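{- Let $p\ge 2$ and let $F_n$, $V_i$ be the constellation generating functions defined in the context. For every $n\ge 0$, $F_n$ equals the sum of the weights of all $p$-excursions of length $np$, where the weight of a $p$-path is the product over its falls of $V_i$, $i$ being the starting height of the fall.
   Context: A planar map is a proper embedding of a connected graph in the sphere, considered up to orientation-preserving homeomorphism. For an integer $p\ge 2$, a $p$-constellation is a planar map whose faces are colored black or white so that adjacent faces have opposite colors, every black face has degree $p$, and every white face has degree a multiple of $p$. Each edge is oriented so that its incident white face lies on its right. Rooted: an edge (root edge) is distinguished; the white root face is the white face incident to it, and the root degree is its degree. Pointed: a vertex is distinguished. In a pointed constellation, a vertex $v$ is of type $j$ if $j$ is the minimal length of an oriented path from $v$ to the pointed vertex; an edge is of type $j\to j'$ if its origin and endpoint have types $j$, $j'$. A constellation has weight $\prod_k x_k^{n_k}$, $n_k$ being its number of white faces of degree $kp$. For $n\ge1$, $F_n$ is the generating function of rooted $p$-constellations of root degree $np$, with no weight for the white root face; $F_0=1$. For $i\ge1$, $V_i$ is $1$ plus the generating function of pointed rooted $p$-constellations whose root edge is of type $j\to j-1$ with $j\le i$. A $p$-path is a lattice path in $\mathbb Z\times\mathbb N$ with steps rises $(1,p-1)$ and falls $(1,-1)$; a $p$-excursion of length $np$ is a $p$-path from $(0,0)$ to $(np,0)$. A fall from $(j,i)$ to $(j+1,i-1)$ has starting height $i$. -}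

module Defs where

-- Encoding of planar p-constellations by permutations ("hypermap" encoding).
-- A labelled constellation with N edges is a pair (β , ω) of permutations of
-- the edge set Fin N:
--   * ω e : the edge following e along the boundary of its white face
--           (boundary traversed in the edge direction, white face on the right),
--   * β e : the edge following e along the boundary of its black face
--           (traversed in the edge direction, black face on the left).
-- Hence origin (ω e) = origin (β e) = end e.  Vertices are the orbits of the
-- permutation ρ = β ∘ ω⁻¹ acting on edges via their origin (ρ sends the
-- out-edge ω e to the out-edge β e at the same vertex).
-- Faces: black faces = β-orbits, white faces = ω-orbits (degree = orbit size).
-- Connected  <=>  ⟨β , ω⟩ acts transitively.
-- Planar (sphere)  <=>  Euler:  #V - #E + #F = 2.
-- Isomorphism classes (orientation-preserving homeomorphism) = simultaneous
-- conjugacy classes.  A rooted (resp. rooted pointed) constellation has no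
-- non-trivial automorphism, so fixing the root edge to be the edge 0 each
-- isomorphism class has exactly (N-1)! labelled representatives; hence
-- (number of classes) = (number of labelled objects with root 0) / (N-1)!.

open import Data.Nat as ℕ using (ℕ; zero; suc; _+_; _*_; _∸_; _≡ᵇ_; _≤ᵇ_; _!)
open import Data.Nat.ListAction using (sum)
open import Data.Bool.ListAction using (all; any)
open import Data.Nat.Properties using (_!≢0)
open import Data.Fin as F using (Fin; zero; suc; toℕ)
open import Data.Vec as V using (Vec; []; _∷_; lookup)
open import Data.List as L using (List; []; _∷_)
open import Data.Bool using (Bool; true; false; _∧_; _∨_; not; if_then_else_)
open import Data.Maybe using (Maybe; just; nothing)
open import Data.Integer using (+_)
open import Data.Rational as Q using (ℚ; 0ℚ; 1ℚ)

_==_ : ∀ {N} → Fin N → Fin N → Bool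
a == b = toℕ a ≡ᵇ toℕ b

allE : ∀ {N} → (Fin N → Bool) → Bool
allE {N} P = all P (L.allFin N)

anyE : ∀ {N} → (Fin N → Bool) → Bool
anyE {N} P = any P (L.allFin N)

countE : ∀ {N} → (Fin N → Bool) → ℕ
countE {N} P = L.length (L.filter (λ e → P e Data.Bool.≟ true) (L.allFin N))
  where import Data.Bool

iter : ∀ {A : Set} → (A → A) → ℕ → A → A
iter f zero    x = x
iter f (suc k) x = f (iter f k x)

firstWhere : (ℕ → Bool) → List ℕ → ℕ
firstWhere P []       = 0
firstWhere P (k ∷ ks) = if P k then k else firstWhere P ks

allVec : (N n : ℕ) → List (Vec (Fin N) n)
allVec N zero    = [] ∷ []
allVec N (suc n) = L.concatMap (λ a → L.map (a ∷_) (allVec N n)) (L.allFin N)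

allBools : ℕ → List (List Bool)
allBools zero    = [] ∷ []
allBools (suc n) = L.concatMap (λ b → L.map (b ∷_) (allBools n)) (true ∷ false ∷ [])

sumℚ : List ℚ → ℚ
sumℚ = L.foldr Q._+_ 0ℚ

module _ {N : ℕ} where

  Map : Set
  Map = Fin N → Fin N

  isBij : Map → Bool
  isBij f = allE λ a → allE λ b → if f a == f b then a == b else true

  inv : Map → Map
  inv f e = L.foldr (λ e' acc → if f e' == e then e' else acc) e (L.allFin N)

  orbitSize : Map → Fin N → ℕ
  orbitSize f e = firstWhere (λ k → iter f k e == e) (L.map suc (L.upTo N))

  sameOrbit : Map → Fin N → Fin N → Bool
  sameOrbit f e e' = any (λ k → iter f k e == e') (L.upTo N)

  isRep : Map → Fin N → Bool
  isRep f e = allE λ e' → if sameOrbit f e e' then toℕ e ≤ᵇ toℕ e' else true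

  nOrbits : Map → ℕ
  nOrbits f = countE (isRep f)

  reach : Map → Map → ℕ → Fin N → Fin N → Bool
  reach f g zero    a b = a == b
  reach f g (suc k) a b = reach f g k a b ∨
                          anyE (λ c → reach f g k a c ∧ (f c == b ∨ g c == b))

  transitive : Map → Map → Bool
  transitive f g = allE λ a → allE λ b → reach f g N a b

  vertexPerm : Map → Map → Map
  vertexPerm β ω e = β (inv ω e)

  isConstellation : ℕ → Map → Map → Bool
  isConstellation p β ω =
    isBij β ∧ isBij ω
    ∧ allE (λ e → orbitSize β e ≡ᵇ p)                 -- black faces of degree p
    ∧ allE (λ e → any (λ k → orbitSize ω e ≡ᵇ k * p) (L.upTo (suc N)))  -- white degrees ∈ pℕ
    ∧ transitive β ω                                  -- connected
    ∧ (nOrbits (vertexPerm β ω) + nOrbits β + nOrbits ω ≡ᵇ N + 2)  -- planar (Euler)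

  notExcluded : Map → Maybe (Fin N) → Fin N → Bool
  notExcluded ω nothing  e = true
  notExcluded ω (just r) e = not (sameOrbit ω r e)

  -- weight profile: entry k-1 (k = 1..K) = number of white faces of degree k·p,
  -- optionally excluding the white face containing edge r
  profile : (K p : ℕ) → Map → Maybe (Fin N) → Vec ℕ K
  profile K p ω ex = V.tabulate λ i → countE λ e →
      isRep ω e ∧ (orbitSize ω e ≡ᵇ suc (toℕ i) * p) ∧ notEx e
    where
      notEx : Fin N → Bool
      notEx e = notExcluded ω ex e

  -- Pointed constellation with pointed vertex = the vertex (ρ-orbit) of edge v.
  -- reachIn k e : the origin of e reaches the pointed vertex by an oriented path
  -- of length ≤ k.  (An edge f leaves origin(e) iff f is ρ-equivalent to e, and
  -- end f = origin (ω f).)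
  reachIn : Map → Map → Fin N → ℕ → Fin N → Bool
  reachIn β ω v zero    e = sameOrbit (vertexPerm β ω) e v
  reachIn β ω v (suc k) e = reachIn β ω v k e ∨
    anyE (λ f → sameOrbit (vertexPerm β ω) e f ∧ reachIn β ω v k (ω f))

  typeOrigin : Map → Map → Fin N → Fin N → ℕ
  typeOrigin β ω v e = firstWhere (λ k → reachIn β ω v k e) (L.upTo (suc N))

  typeEnd : Map → Map → Fin N → Fin N → ℕ
  typeEnd β ω v e = typeOrigin β ω v (ω e)

-- monomials ∏_{k ≤ K} x_k^{m_k} as exponent vectors; series = coefficient maps

isZero : ∀ {K} → Vec ℕ K → Bool
isZero v = all (λ x → x ≡ᵇ 0) (V.toList v)

eqVec : ∀ {K} → Vec ℕ K → Vec ℕ K → Bool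
eqVec [] [] = true
eqVec (x ∷ xs) (y ∷ ys) = (x ≡ᵇ y) ∧ eqVec xs ys

wsum : ∀ {K} → Vec ℕ K → ℕ
wsum {K} m = sum (L.map (λ i → suc (toℕ i) * lookup m i) (L.allFin K))

below : ∀ {K} → Vec ℕ K → List (Vec ℕ K)
below [] = [] ∷ []
below (x ∷ xs) = L.concatMap (λ a → L.map (a ∷_) (below xs)) (L.upTo (suc x))

Series : ℕ → Set
Series K = Vec ℕ K → ℚ

oneS : ∀ {K} → Series K
oneS m = if isZero m then 1ℚ else 0ℚ

mulS : ∀ {K} → Series K → Series K → Series K
mulS A B m = sumℚ (L.map (λ a → A a Q.* B (V.zipWith _∸_ m a)) (below m))

prodS : ∀ {K} → List (Series K) → Series K
prodS = L.foldr mulS oneS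

-- labelled rooted constellations with N = suc M edges, root edge 0,
-- root degree n·p, and non-root white-face profile m
countF : (p n : ℕ) → ∀ {K} → Vec ℕ K → (M : ℕ) → ℕ
countF p n {K} m M = L.length (L.filter (λ b → b Data.Bool.≟ true)
  (L.concatMap (λ β → L.map (λ ω →
       isConstellation p (lookup β) (lookup ω)
     ∧ (orbitSize (lookup ω) zero ≡ᵇ n * p)
     ∧ eqVec (profile K p (lookup ω) (just zero)) m)
     (allVec (suc M) (suc M))) (allVec (suc M) (suc M))))
  where import Data.Bool

classesF : (p n : ℕ) → ∀ {K} → Vec ℕ K → ℕ → ℚ
classesF p n m zero    = 0ℚ
classesF p n m (suc M) = ((+ countF p n m M) Q./ (M !)) {{M !≢0}}

Fcoef : (p n : ℕ) → ∀ {K} → Series K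
Fcoef p zero    m = oneS m
Fcoef p (suc n) m = classesF p (suc n) m (p * (suc n + wsum m))

-- labelled pointed rooted constellations with suc M edges, root edge 0,
-- pointed vertex = canonical (minimal) representative v of a ρ-orbit,
-- white-face profile m (all white faces), root edge of type j → j-1 with j ≤ i
countV : (p i : ℕ) → ∀ {K} → Vec ℕ K → (M : ℕ) → ℕ
countV p i {K} m M = L.length (L.filter (λ b → b Data.Bool.≟ true)
  (L.concatMap (λ β → L.concatMap (λ ω → L.map (λ v →
       isConstellation p (lookup β) (lookup ω)
     ∧ isRep (vertexPerm (lookup β) (lookup ω)) v
     ∧ eqVec (profile K p (lookup ω) nothing) m
     ∧ (typeOrigin (lookup β) (lookup ω) v zero ≡ᵇ suc (typeEnd (lookup β) (lookup ω) v zero))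
     ∧ (typeOrigin (lookup β) (lookup ω) v zero ≤ᵇ i))
     (L.allFin (suc M)))
     (allVec (suc M) (suc M))) (allVec (suc M) (suc M))))
  where import Data.Bool

classesV : (p i : ℕ) → ∀ {K} → Vec ℕ K → ℕ → ℚ
classesV p i m zero    = 0ℚ
classesV p i m (suc M) = ((+ countV p i m M) Q./ (M !)) {{M !≢0}}

Vcoef : (p i : ℕ) → ∀ {K} → Series K
Vcoef p i m = if isZero m then 1ℚ else classesV p i m (p * wsum m)

-- p-paths: true = rise (1, p-1), false = fall (1, -1).
-- fallHeights p h s : starting from height h, follow s staying in ℕ and
-- ending at height 0; returns the list of starting heights of the falls.

fallHeights : ℕ → ℕ → List Bool → Maybe (List ℕ)
fallHeights p zero    []            = just []
fallHeights p (suc h) []            = nothing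
fallHeights p h       (true ∷ s)    = fallHeights p (h + (p ∸ 1)) s
fallHeights p zero    (false ∷ s)   = nothing
fallHeights p (suc h) (false ∷ s) with fallHeights p h s
... | nothing = nothing
... | just hs = just (suc h ∷ hs)

excursionSum : (p n : ℕ) → ∀ {K} → Series K
excursionSum p n m = sumℚ (L.map term (allBools (n * p)))
  where
    term : List Bool → ℚ
    term s with fallHeights p 0 s
    ... | nothing = 0ℚ
    ... | just hs = prodS (L.map (λ i → Vcoef p i) hs) m

{-# OPTIONS --safe #-}
module Submission where

-- Label every edge by the type of its origin.  An edge is then a fall or a rise, each black
-- face has exactly one rise, and being at distance ℓ from the pointed vertex becomes a local
-- condition: exactly one vertex (the sink) has no outgoing fall.  Let κ be the first-return
-- permutation of the vertex rotation on falls and π = κ ∘ ω the contour.  Cutting each vertex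
-- into pieces with a single outgoing fall leaves β unchanged and turns ω into π, so the genus
-- inequality z(α) + z(β) + z(αβ) ≤ N + 2c forces π to be a single cycle.  Conversely β is
-- recovered from the closed path of labels along π as a unique cactus (matching every rise
-- with the following falls).  Hence constellations correspond to plane trees (κ , ω , ℓ), and
-- relabelling along π shows that there are (N-1)! labelled objects per tree with π the
-- standard rotation.  In such a tree the corner of each fall of height i of the root face
-- either is bare or carries a tree counted by V_i, again by the genus inequality; the root
-- face itself is a p-excursion.

open import Defs
open import Data.Bool using (Bool; true; false; _∧_; _∨_; not; if_then_else_)
import Data.Bool as 𝔹
import Data.Bool.Properties as Boolₚ
open import Data.Bool.ListAction using (all; any)
open import Data.Empty using (⊥; ⊥-elim)
open import Data.Fin as Fin using (Fin; zero; suc; toℕ; fromℕ<)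
import Data.Fin.Properties as Finₚ
import Data.Integer as ℤ
import Data.Integer.Properties as ℤₚ
open import Data.List as L using (List; []; _∷_; _++_)
open import Data.List.Membership.Propositional using (_∈_)
import Data.List.Membership.Propositional.Properties as Memₚ
import Data.List.Properties as Lₚ
open import Data.List.Relation.Unary.All as All using ([]; _∷_)
open import Data.List.Relation.Unary.AllPairs using ([]; _∷_)
open import Data.List.Relation.Unary.Any using (here; there)
open import Data.List.Relation.Unary.Unique.Propositional using (Unique)
import Data.List.Relation.Unary.Unique.Propositional.Properties as Uniqueₚ
open import Data.Maybe using (Maybe; just; nothing)
open import Data.Nat as ℕ using (ℕ; zero; suc; _+_; _*_; _∸_; _≤_; _<_; z≤n; s≤s; NonZero; _!)
open import Data.Nat.DivMod as DM using (_%_; _/_; m%n<n; m≡m%n+[m/n]*n)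
open import Data.Nat.Divisibility using (_∣_; divides; ∣-antisym; ∣-trans; ∣⇒≤; ∣m+n∣m⇒∣n; n∣m*n; >⇒∤; m%n≡0⇒n∣m)
open import Data.Nat.ListAction using (sum)
import Data.Nat.Properties as ℕₚ
open import Data.Nat.Solver using (module +-*-Solver)
open import Data.Product using (Σ; ∃; _×_; _,_; proj₁; proj₂)
open import Data.Rational as ℚ using (ℚ; toℚᵘ)
import Data.Rational.Properties as ℚₚ
open import Data.Rational.Unnormalised as ℚᵘ using (mkℚᵘ; *≡*)
import Data.Rational.Unnormalised.Properties as ℚᵘₚ
open import Data.Sum using (_⊎_; inj₁; inj₂)
open import Data.Sum.Properties using (inj₁-injective; inj₂-injective)
open import Data.Unit using (⊤; tt)
open import Data.Vec as V using (Vec; []; _∷_; lookup)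
import Data.Vec.Properties as Vₚ
open import Function using (_∘_; id)
open import Relation.Binary.Definitions using (tri<; tri≈; tri>)
open import Relation.Binary.PropositionalEquality
open import Relation.Nullary using (¬_; Dec; yes; no)
open import Relation.Nullary.Decidable using (map′; _×-dec_; ¬?)

-- Iterates and orbits

-- That a type drops by one or rises by `q = p - 1` along an edge is not local: distances to the
-- pointed vertex must satisfy a congruence modulo `p`. Planarity provides it. All face degrees are
-- multiples of `p`, so the `p`-fold cover that counts steps modulo `p` would violate the genus
-- inequality if two of its sheets were joined. The inequality is the only topological input; it is
-- stated with any `c` points that meet all components, so components are never counted. The bound
-- `j ≤ i` in `V_i` is absorbed by a shift: the root label is set to `i`, and the pointed vertex
-- then has label `i - j`, which has to be a natural number. A weight vector of length `K` does not
-- see faces of degree above `K p`. The prescribed number of edges excludes them, and when a tree is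
-- cut in two this has to be recovered for each piece from two bounds whose sum is tight. All
-- counting is by bijections between finite sets, in natural numbers. Each labelled count is `M !`
-- times a number of trees, so the division by `M !` is exact.

iter-+ : ∀ {X : Set} (f : X → X) a b x → iter f (a + b) x ≡ iter f a (iter f b x)
iter-+ f zero    b x = refl
iter-+ f (suc a) b x = cong f (iter-+ f a b x)

iter-comm : ∀ {X : Set} (f : X → X) k x → iter f k (f x) ≡ f (iter f k x)
iter-comm f zero    x = refl
iter-comm f (suc k) x = cong f (iter-comm f k x)

iter-* : ∀ {X : Set} (f : X → X) q x → iter f q x ≡ x → ∀ k → iter f (k * q) x ≡ x
iter-* f q x e zero    = refl
iter-* f q x e (suc k) =
  trans (iter-+ f q (k * q) x) (trans (cong (iter f q) (iter-* f q x e k)) e)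

iter-cong : ∀ {X : Set} {f g : X → X} → (∀ x → f x ≡ g x) → ∀ k x → iter f k x ≡ iter g k x
iter-cong h zero    x = refl
iter-cong {f = f} h (suc k) x = trans (cong f (iter-cong h k x)) (h _)

iter-map : ∀ {X Y : Set} {f : X → X} {g : Y → Y} (φ : X → Y) → (∀ x → φ (f x) ≡ g (φ x)) →
  ∀ k x → φ (iter f k x) ≡ iter g k (φ x)
iter-map φ h zero    x = refl
iter-map {g = g} φ h (suc k) x = trans (h _) (cong g (iter-map φ h k x))

record Perm (X : Set) : Set where
  no-eta-equality
  constructor mkPerm
  field
    to from : X → X
    to∘from : ∀ x → to (from x) ≡ x
    from∘to : ∀ x → from (to x) ≡ x

  injective : ∀ {x y} → to x ≡ to y → x ≡ y
  injective {x} {y} e = trans (sym (from∘to x)) (trans (cong from e) (from∘to y))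

  iter-injective : ∀ k {x y} → iter to k x ≡ iter to k y → x ≡ y
  iter-injective zero    e = e
  iter-injective (suc k) e = iter-injective k (injective e)

open Perm public using (to; from; to∘from; from∘to)

infixr 9 _∙_
_∙_ : ∀ {X} → Perm X → Perm X → Perm X
to      (f ∙ g) x = to f (to g x)
from    (f ∙ g) x = from g (from f x)
to∘from (f ∙ g) x = trans (cong (to f) (to∘from g _)) (to∘from f x)
from∘to (f ∙ g) x = trans (cong (from g) (from∘to f _)) (from∘to g x)

_⁻¹ : ∀ {X} → Perm X → Perm X
f ⁻¹ = mkPerm (from f) (to f) (from∘to f) (to∘from f)

-- Only forward iterates are used; for a permutation of a finite set the relation is symmetric all
-- the same (`orb-sym`), and witnesses stay natural numbers.
Orb : ∀ {X : Set} → (X → X) → X → X → Set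
Orb f x y = ∃ λ k → iter f k x ≡ y

orb-refl : ∀ {X : Set} {f : X → X} {x} → Orb f x x
orb-refl = 0 , refl

orb-reflexive : ∀ {X : Set} {f : X → X} {x y} → x ≡ y → Orb f x y
orb-reflexive e = 0 , e

orb-step : ∀ {X : Set} {f : X → X} {x} → Orb f x (f x)
orb-step = 1 , refl

orb-trans : ∀ {X : Set} {f : X → X} {x y z} → Orb f x y → Orb f y z → Orb f x z
orb-trans {f = f} {x} (a , refl) (b , refl) = b + a , iter-+ f b a x

orb-cong : ∀ {X : Set} {f g : X → X} → (∀ x → f x ≡ g x) → ∀ {x y} → Orb f x y → Orb g x y
orb-cong h {x} (k , e) = k , trans (sym (iter-cong h k x)) e

orb-map : ∀ {X Y : Set} {f : X → X} {g : Y → Y} (φ : X → Y) → (∀ x → φ (f x) ≡ g (φ x)) →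
  ∀ {x y} → Orb f x y → Orb g (φ x) (φ y)
orb-map φ h {x} (k , refl) = k , sym (iter-map φ h k x)

orb-induct : ∀ {X : Set} {f : X → X} (R : X → X → Set) → (∀ x → R x x) →
  (∀ {x y} → R (f x) y → R x y) → ∀ {x y} → Orb f x y → R x y
orb-induct {f = f} R r s (k , e) = go k e
  where
  go : ∀ k {x y} → iter f k x ≡ y → R x y
  go zero    refl = r _
  go (suc k) {x} e = s (go k (trans (iter-comm f k x) e))

orb-fixed : ∀ {X : Set} {f : X → X} {x y} → f x ≡ x → Orb f x y → x ≡ y
orb-fixed {f = f} {x} e (k , refl) = sym (go k)
  where
  go : ∀ k → iter f k x ≡ x
  go zero    = refl
  go (suc k) = trans (cong f (go k)) e

-- Counting classes: P is the set being counted, R the equivalence relation on it.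

record Count {X : Set} (P : X → Set) (R : X → X → Set) (n : ℕ) : Set where
  no-eta-equality
  field
    rep   : Fin n → X
    repP  : ∀ i → P (rep i)
    sep   : ∀ i j → R (rep i) (rep j) → i ≡ j
    cover : ∀ x → P x → ∃ λ i → R x (rep i)

open Count public

Size : {X : Set} → (X → Set) → ℕ → Set
Size P n = Count P _≡_ n

All⊤ : {X : Set} → X → Set
All⊤ _ = ⊤

Card : Set → ℕ → Set
Card X n = Size {X} All⊤ n

record IsEq {X : Set} (R : X → X → Set) : Set where
  field
    rfl : ∀ {x} → R x x
    sm  : ∀ {x y} → R x y → R y x
    tr  : ∀ {x y z} → R x y → R y z → R x z

≡-isEq : ∀ {X : Set} → IsEq {X} _≡_
≡-isEq = record { rfl = refl ; sm = sym ; tr = trans }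

-- Pigeonhole: the index of the covering class is injective on the family.
family-≤ : ∀ {X : Set} {P : X → Set} {R n k} → IsEq R → Count P R n →
  (g : Fin k → X) → (∀ i → P (g i)) → (∀ i j → R (g i) (g j) → i ≡ j) → k ≤ n
family-≤ {R = R} E c g gP gs = Finₚ.injective⇒≤ {f = λ i → proj₁ (cover c (g i) (gP i))} λ {i} {j} e →
  gs i j (tr (proj₂ (cover c (g i) (gP i)))
    (sm (subst (λ z → R (g j) (rep c z)) (sym e) (proj₂ (cover c (g j) (gP j))))))
  where open IsEq E using (sm; tr)

count-≤ : ∀ {X Y : Set} {P : X → Set} {Q : Y → Set} {R S n m} → IsEq S →
  Count P R n → Count Q S m →
  (φ : ∀ x → P x → Y) → (∀ x px → Q (φ x px)) →
  (∀ {x x'} px px' → S (φ x px) (φ x' px') → R x x') → n ≤ m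
count-≤ E c d φ φQ φS = family-≤ E d (λ i → φ (rep c i) (repP c i)) (λ i → φQ _ _)
  λ i j s → sep c i j (φS _ _ s)

count-unique : ∀ {X : Set} {P : X → Set} {R n m} → IsEq R → Count P R n → Count P R m → n ≡ m
count-unique E c d = ℕₚ.≤-antisym
  (count-≤ E c d (λ x _ → x) (λ _ p → p) (λ _ _ r → r))
  (count-≤ E d c (λ x _ → x) (λ _ p → p) (λ _ _ r → r))

size-rel-≤ : ∀ {X Y : Set} {P : X → Set} {Q : Y → Set} {n m} → Size P n → Size Q m →
  (Rel : X → Y → Set) → (∀ x → P x → ∃ λ y → Q y × Rel x y) →
  (∀ {x x' y} → P x → P x' → Rel x y → Rel x' y → x ≡ x') → n ≤ m
size-rel-≤ c d Rel tot inj = count-≤ ≡-isEq c d (λ x px → proj₁ (tot x px))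
  (λ x px → proj₁ (proj₂ (tot x px)))
  λ {x} {x'} px px' e → inj px px' (proj₂ (proj₂ (tot x px)))
    (subst (Rel x') (sym e) (proj₂ (proj₂ (tot x' px'))))

-- A bijection is given as a relation, total and injective in both directions, because each side is
-- produced by an existence proof rather than by a formula.
size-rel-≡ : ∀ {X Y : Set} {P : X → Set} {Q : Y → Set} {n m} → Size P n → Size Q m →
  (Rel : X → Y → Set) → (∀ x → P x → ∃ λ y → Q y × Rel x y) → (∀ y → Q y → ∃ λ x → P x × Rel x y) →
  (∀ {x x' y} → P x → P x' → Rel x y → Rel x' y → x ≡ x') →
  (∀ {x y y'} → Q y → Q y' → Rel x y → Rel x y' → y ≡ y') → n ≡ m
size-rel-≡ c d Rel tot tot' inj inj' = ℕₚ.≤-antisym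
  (size-rel-≤ c d Rel tot inj) (size-rel-≤ d c (λ y x → Rel x y) tot' inj')

count-map : ∀ {X Y : Set} {P : X → Set} {Q : Y → Set} {R S n} → Count P R n →
  (φ : X → Y) → (∀ x → P x → Q (φ x)) → (∀ {x x'} → P x → P x' → S (φ x) (φ x') → R x x') →
  (∀ y → Q y → ∃ λ x → P x × (∀ {x'} → P x' → R x x' → S y (φ x'))) → Count Q S n
count-map c φ φP φS φc = record
  { rep = φ ∘ rep c ; repP = λ i → φP _ (repP c i) ; sep = λ i j s → sep c i j (φS (repP c i) (repP c j) s)
  ; cover = λ y qy → let (x , px , h) = φc y qy ; (i , r) = cover c x px in i , h (repP c i) r }

count-mapP : ∀ {X Y : Set} {P : X → Set} {Q : Y → Set} {R S n} → Count P R n →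
  (φ : ∀ x → P x → Y) → (∀ x px → Q (φ x px)) → (∀ {x x'} px px' → S (φ x px) (φ x' px') → R x x') →
  (∀ y → Q y → ∃ λ x → P x × (∀ {x'} px' → R x x' → S y (φ x' px'))) → Count Q S n
count-mapP c φ φP φS φc = record
  { rep = λ i → φ (rep c i) (repP c i) ; repP = λ i → φP _ (repP c i) ; sep = λ i j s → sep c i j (φS (repP c i) (repP c j) s)
  ; cover = λ y qy → let (x , px , h) = φc y qy ; (i , r) = cover c x px in i , h (repP c i) r }

count-≗ : ∀ {X : Set} {P Q : X → Set} {R S n} → Count P R n →
  (∀ x → P x → Q x) → (∀ x → Q x → P x) → (∀ {x y} → R x y → S x y) → (∀ {x y} → S x y → R x y) →
  Count Q S n
count-≗ c f g h k = count-map c id f (λ _ _ → k) (λ y q → y , g y q , λ _ → h)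

count-⊎ : ∀ {X : Set} {P Q : X → Set} {R n m} → IsEq R → Count P R n → Count Q R m →
  (∀ {x y} → P x → Q y → ¬ R x y) → Count (λ x → P x ⊎ Q x) R (n + m)
count-⊎ {X} {P} {Q} {R} {n} {m} E c d dis = record
  { rep = λ i → rp (Fin.splitAt n i) ; repP = λ i → rpP (Fin.splitAt n i)
  ; sep = λ i j r → trans (sym (Finₚ.join-splitAt n m i))
      (trans (cong (Fin.join n m) (sp (Fin.splitAt n i) (Fin.splitAt n j) r)) (Finₚ.join-splitAt n m j))
  ; cover = cv }
  where
  open IsEq E using (sm)
  rp : Fin n ⊎ Fin m → X
  rp (inj₁ i) = rep c i
  rp (inj₂ j) = rep d j
  rpP : ∀ i → P (rp i) ⊎ Q (rp i)
  rpP (inj₁ i) = inj₁ (repP c i)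
  rpP (inj₂ j) = inj₂ (repP d j)
  sp : ∀ i j → R (rp i) (rp j) → i ≡ j
  sp (inj₁ i) (inj₁ j) r = cong inj₁ (sep c i j r)
  sp (inj₁ i) (inj₂ j) r = ⊥-elim (dis (repP c i) (repP d j) r)
  sp (inj₂ i) (inj₁ j) r = ⊥-elim (dis (repP c j) (repP d i) (sm r))
  sp (inj₂ i) (inj₂ j) r = cong inj₂ (sep d i j r)
  to-i : ∀ {x} s → R x (rp s) → R x (rp (Fin.splitAt n (Fin.join n m s)))
  to-i {x} s r = subst (λ z → R x (rp z)) (sym (Finₚ.splitAt-join n m s)) r
  cv : ∀ x → P x ⊎ Q x → ∃ λ i → R x (rp (Fin.splitAt n i))
  cv x (inj₁ px) = let (i , r) = cover c x px in Fin.join n m (inj₁ i) , to-i (inj₁ i) r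
  cv x (inj₂ qx) = let (i , r) = cover d x qx in Fin.join n m (inj₂ i) , to-i (inj₂ i) r

count-one : ∀ {X : Set} {P : X → Set} {R} (x : X) → P x → (∀ y → P y → R y x) → Count P R 1
count-one x px h = record
  { rep = λ _ → x ; repP = λ _ → px ; sep = λ { zero zero _ → refl } ; cover = λ y py → zero , h y py }

fin-card : ∀ n → Card (Fin n) n
fin-card n = record { rep = id ; repP = λ _ → tt ; sep = λ _ _ e → e ; cover = λ x _ → x , refl }

-- Leave out the class of `y`. If `R'` relates two of the remaining representatives, then either `R`
-- relates them or both lie in the class of `x`; so they stay distinct for `R'`.
join-≤ : ∀ {X : Set} {P : X → Set} {R R' : X → X → Set} {n n'} → IsEq R → IsEq R' →
  Count P R n → Count P R' n' → ∀ {x y} → P y →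
  (∀ {a b} → R' a b → R a b ⊎ ((R a x ⊎ R a y) × (R b x ⊎ R b y))) → n ≤ suc n'
join-≤ {n = zero} E E' c c' Py h = z≤n
join-≤ {R = R} {n = suc n} E E' c c' {x} {y} Py h = s≤s (family-≤ E' c'
    (λ i → rep c (Fin.punchIn i₁ i)) (λ i → repP c _) λ i j r → Finₚ.punchIn-injective i₁ i j (key i j (h r)))
  where
  open IsEq E using (sm; tr)
  i₁ = proj₁ (cover c y Py)
  noty : ∀ i → ¬ R (rep c (Fin.punchIn i₁ i)) y
  noty i r = Finₚ.punchInᵢ≢i i₁ i (sep c _ _ (tr r (proj₂ (cover c y Py))))
  key : ∀ i j → _ → Fin.punchIn i₁ i ≡ Fin.punchIn i₁ j
  key i j (inj₁ r) = sep c _ _ r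
  key i j (inj₂ (inj₁ a , inj₁ b)) = sep c _ _ (tr a (sm b))
  key i j (inj₂ (inj₂ a , _)) = ⊥-elim (noty i a)
  key i j (inj₂ (_ , inj₂ b)) = ⊥-elim (noty j b)

-- Replace the representative of the common `R`-class of `x` and `y` by `x` and add `y` as a new
-- one: the enlarged family is separated by `R'`.
join-< : ∀ {X : Set} {P : X → Set} {R R' : X → X → Set} {n n'} → IsEq R → IsEq R' →
  Count P R n → Count P R' n' → ∀ {x y} → P x → P y → ¬ R' x y → R x y →
  (∀ {a b} → R' a b → R a b) → suc n ≤ n'
join-< {X = X} {P} {R} {R'} {n = n} E E' c c' {x} {y} Px Py nxy rxy h = family-≤ E' c' g gP gs
  where
  open IsEq
  i₀ = proj₁ (cover c x Px)
  g' : Fin n → X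
  g' i with i Finₚ.≟ i₀
  ... | yes _ = x
  ... | no  _ = rep c i
  g : Fin (suc n) → X
  g zero    = y
  g (suc i) = g' i
  gP : ∀ i → P (g i)
  gP zero = Py
  gP (suc i) with i Finₚ.≟ i₀
  ... | yes _ = Px
  ... | no  _ = repP c i
  g'R : ∀ i → R (g' i) (rep c i)
  g'R i with i Finₚ.≟ i₀
  ... | yes refl = proj₂ (cover c x Px)
  ... | no  _ = rfl E
  noy : ∀ i → ¬ R' (g' i) y
  noy i r with i Finₚ.≟ i₀
  ... | yes _ = nxy r
  ... | no ne = ne (sep c _ _ (tr E (h r) (tr E (sm E rxy) (proj₂ (cover c x Px)))))
  gs : ∀ i j → R' (g i) (g j) → i ≡ j
  gs zero zero r = refl
  gs zero (suc j) r = ⊥-elim (noy j (sm E' r))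
  gs (suc i) zero r = ⊥-elim (noy i r)
  gs (suc i) (suc j) r = cong suc (sep c _ _ (tr E (sm E (g'R i)) (tr E (h r) (g'R j))))

-- Least witnesses, periods and orbits on finite sets

least : (P : ℕ → Set) → (∀ k → Dec (P k)) → ∀ {k} → P k → ∃ λ j → P j × j ≤ k × (∀ i → i < j → ¬ P i)
least P P? {zero} p = 0 , p , z≤n , λ _ ()
least P P? {suc k} p with P? 0
... | yes p0 = 0 , p0 , z≤n , λ _ ()
... | no ¬p0 with least (P ∘ suc) (P? ∘ suc) p
... | j , pj , j≤k , m = suc j , pj , s≤s j≤k , λ { zero _ → ¬p0 ; (suc i) (s≤s q) → m i q }

-- Minimality is expressed by divisibility of all return times: uniqueness becomes antisymmetry of
-- divisibility, and a face degree divisible by `p` makes every closed walk along the face divisible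
-- by `p`.
record Per {X : Set} (f : X → X) (x : X) (q : ℕ) : Set where
  constructor mkPer
  field
    per-pos : 0 < q
    per-closes : iter f q x ≡ x
    per-div : ∀ j → iter f j x ≡ x → q ∣ j

open Per public

per-unique : ∀ {X : Set} {f : X → X} {x q r} → Per f x q → Per f x r → q ≡ r
per-unique p p' = ∣-antisym (per-div p _ (per-closes p')) (per-div p' _ (per-closes p))

iter-% : ∀ {X : Set} (f : X → X) → ∀ x d → iter f (suc d) x ≡ x → ∀ k → iter f k x ≡ iter f (k % suc d) x
iter-% f x d e k = trans (cong (λ z → iter f z x) (m≡m%n+[m/n]*n k (suc d)))
  (trans (iter-+ f (k % suc d) (k / suc d * suc d) x)
         (cong (iter f (k % suc d)) (iter-* f (suc d) x e (k / suc d))))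

module Finite {X : Set} {n : ℕ} (card : Card X n) where

  idx : X → Fin n
  idx x = proj₁ (cover card x tt)

  enum : Fin n → X
  enum = rep card

  enum-idx : ∀ x → x ≡ enum (idx x)
  enum-idx x = proj₂ (cover card x tt)

  idx-injective : ∀ {x y} → idx x ≡ idx y → x ≡ y
  idx-injective {x} {y} e = trans (enum-idx x) (trans (cong enum e) (sym (enum-idx y)))

  _≟_ : (x y : X) → Dec (x ≡ y)
  x ≟ y = map′ idx-injective (cong idx) (idx x Finₚ.≟ idx y)

  -- Among the first `n + 1` iterates two coincide; injectivity cancels their common initial part.
  returns-injective : (f : X → X) → (∀ {x y} → f x ≡ f y → x ≡ y) →
    ∀ x → ∃ λ d → iter f (suc d) x ≡ x × suc d ≤ n
  returns-injective f inj x with Finₚ.pigeonhole (ℕₚ.n<1+n n) (λ i → idx (iter f (toℕ i) x))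
  ... | i , j , i<j , e = d , iter-inj (toℕ i) eq , le
    where
    iter-inj : ∀ k {x y} → iter f k x ≡ iter f k y → x ≡ y
    iter-inj zero    e = e
    iter-inj (suc k) e = iter-inj k (inj e)
    d : ℕ
    d = toℕ j ∸ suc (toℕ i)
    lem : toℕ i + suc d ≡ toℕ j
    lem = trans (ℕₚ.+-suc _ d) (ℕₚ.m+[n∸m]≡n i<j)
    eq : iter f (toℕ i) (iter f (suc d) x) ≡ iter f (toℕ i) x
    eq = trans (sym (iter-+ f (toℕ i) (suc d) x))
      (trans (cong (λ k → iter f k x) lem) (sym (idx-injective e)))
    le : suc d ≤ n
    le = ℕₚ.≤-trans (subst (suc d ≤_) lem (ℕₚ.m≤n+m (suc d) (toℕ i))) (ℕ.s≤s⁻¹ (Finₚ.toℕ<n j))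

  returns : (f : Perm X) → ∀ x → ∃ λ d → iter (to f) (suc d) x ≡ x × suc d ≤ n
  returns f = returns-injective (to f) (Perm.injective f)

  -- The inverse image of `x` is the iterate one step before the orbit comes back to `x`.
  fromInjective : (f : X → X) → (∀ {x y} → f x ≡ f y → x ≡ y) → Perm X
  to      (fromInjective f inj) = f
  from    (fromInjective f inj) x = iter f (proj₁ (returns-injective f inj x)) x
  to∘from (fromInjective f inj) x = proj₁ (proj₂ (returns-injective f inj x))
  from∘to (fromInjective f inj) x = inj (proj₁ (proj₂ (returns-injective f inj (f x))))

  period : (f : Perm X) → ∀ x → ∃ λ q → Per (to f) x q × q ≤ n
  period f x with returns f x
  ... | d , e , d≤n with least (λ k → iter (to f) (suc k) x ≡ x) (λ k → _ ≟ _) e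
  ... | j , ej , j≤d , mn = suc j , mkPer (s≤s z≤n) ej dv , ℕₚ.≤-trans (s≤s j≤d) d≤n
    where
    dv : ∀ k → iter (to f) k x ≡ x → suc j ∣ k
    -- A return time with nonzero remainder would give a return earlier than the least one.
    dv k ek with k % suc j in r
    ... | zero = divides (k / suc j) (trans (m≡m%n+[m/n]*n k (suc j)) (cong (_+ k / suc j * suc j) r))
    ... | suc i = ⊥-elim (mn i (ℕ.s≤s⁻¹ (subst (_< suc j) r (m%n<n k (suc j))))
       (trans (cong (λ z → iter (to f) z x) (sym r)) (trans (sym (iter-% (to f) x j ej k)) ek)))

  orb-bound : (f : Perm X) → ∀ {x y} → Orb (to f) x y → ∃ λ k → k < n × iter (to f) k x ≡ y
  orb-bound f {x} (k , e) with returns f x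
  ... | d , ed , d≤n = k % suc d , ℕₚ.<-≤-trans (m%n<n k (suc d)) d≤n , trans (sym (iter-% (to f) x d ed k)) e

  orb-sym : (f : Perm X) → ∀ {x y} → Orb (to f) x y → Orb (to f) y x
  orb-sym f {x} (k , refl) with returns f x
  ... | d , ed , _ = (k * suc d) ∸ k , (begin
      iter (to f) (k * suc d ∸ k) (iter (to f) k x) ≡⟨ sym (iter-+ (to f) (k * suc d ∸ k) k x) ⟩
      iter (to f) (k * suc d ∸ k + k) x ≡⟨ cong (λ z → iter (to f) z x) (ℕₚ.m∸n+n≡m (ℕₚ.m≤m*n k (suc d))) ⟩
      iter (to f) (k * suc d) x ≡⟨ iter-* (to f) (suc d) x ed k ⟩
      x ∎)
    where open ≡-Reasoning

  orb-isEq : (f : Perm X) → IsEq (Orb (to f))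
  orb-isEq f = record { rfl = orb-refl ; sm = orb-sym f ; tr = orb-trans }

  orb? : (f : Perm X) → ∀ x y → Dec (Orb (to f) x y)
  orb? f x y = map′ (λ (k , e) → toℕ k , e)
    (λ o → let (k , k<n , e) = orb-bound f o in
       fromℕ< k<n , trans (cong (λ z → iter (to f) z x) (Finₚ.toℕ-fromℕ< k<n)) e)
    (Finₚ.any? (λ k → iter (to f) (toℕ k) x ≟ y))

  abstract
    -- Greedy choice in index order: an element opens a new class when it is related to none of the
    -- representatives chosen so far.
    count-exists : {P : X → Set} {R : X → X → Set} → IsEq R → (∀ x → Dec (P x)) → (∀ x y → Dec (R x y)) →
      ∃ λ c → Count P R c
    count-exists {P} {R} E P? R? with go n ℕₚ.≤-refl
      where
      open IsEq E using (rfl; sm)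
      Upto : ℕ → X → Set
      Upto k x = toℕ (idx x) < k × P x
      weaken : ∀ {k x} → Upto k x → Upto (suc k) x
      weaken (l , px) = ℕₚ.m<n⇒m<1+n l , px
      go : ∀ k → k ≤ n → ∃ λ c → Count (Upto k) R c
      go zero _ = 0 , record { rep = λ () ; repP = λ () ; sep = λ () ; cover = λ { _ (() , _) } }
      go (suc k) k<n with go k (ℕₚ.<⇒≤ k<n)
      ... | c , C = add (P? x₀)
        where
        x₀ : X
        x₀ = enum (fromℕ< k<n)
        last : ∀ {x} → Upto (suc k) x → Upto k x ⊎ x ≡ x₀
        last {x} (lt , px) with ℕₚ.m≤n⇒m<n∨m≡n (ℕ.s≤s⁻¹ lt)
        ... | inj₁ l = inj₁ (l , px)
        ... | inj₂ refl = inj₂ (trans (enum-idx x) (sym (cong enum (Finₚ.fromℕ<-toℕ (idx x) k<n))))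
        idx₀ : toℕ (idx x₀) < suc k
        idx₀ = s≤s (ℕₚ.≤-reflexive (trans (cong toℕ (sym (sep card _ _ (enum-idx x₀)))) (Finₚ.toℕ-fromℕ< k<n)))
        old : (P x₀ → ∃ λ i → R x₀ (rep C i)) → ∃ λ c → Count (Upto (suc k)) R c
        old h = c , record { rep = rep C ; repP = λ j → weaken (repP C j) ; sep = sep C ; cover = cv }
          where
          cv : ∀ x → Upto (suc k) x → ∃ λ i → R x (rep C i)
          cv x u with last u
          ... | inj₁ l = cover C x l
          ... | inj₂ refl = h (proj₂ u)
        add : Dec (P x₀) → ∃ λ c → Count (Upto (suc k)) R c
        add (no ¬p) = old (λ p → ⊥-elim (¬p p))
        add (yes p) with Finₚ.any? (λ i → R? x₀ (rep C i))
        ... | yes r = old (λ _ → r)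
        ... | no ¬r = suc c , record { rep = rp ; repP = rpP ; sep = sp ; cover = cv }
          where
          rp : Fin (suc c) → X
          rp zero = x₀
          rp (suc i) = rep C i
          rpP : ∀ i → Upto (suc k) (rp i)
          rpP zero = idx₀ , p
          rpP (suc i) = weaken (repP C i)
          sp : ∀ i j → R (rp i) (rp j) → i ≡ j
          sp zero zero _ = refl
          sp zero (suc j) r = ⊥-elim (¬r (j , r))
          sp (suc i) zero r = ⊥-elim (¬r (i , sm r))
          sp (suc i) (suc j) r = cong suc (sep C i j r)
          cv : ∀ x → Upto (suc k) x → ∃ λ i → R x (rp i)
          cv x u with last u
          ... | inj₁ l = let (i , r) = cover C x l in suc i , r
          ... | inj₂ refl = zero , rfl
    ... | c , C = c , count-≗ C (λ _ → proj₂) (λ x px → Finₚ.toℕ<n (idx x) , px) id id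

  size-exists : {P : X → Set} → (∀ x → Dec (P x)) → ∃ λ c → Size P c
  size-exists P? = count-exists ≡-isEq P? _≟_

  orbits : (f : Perm X) → ∃ λ c → Count {X} All⊤ (Orb (to f)) c
  orbits f = count-exists (orb-isEq f) (λ _ → yes tt) (orb? f)

  orbits-in : (f : Perm X) {P : X → Set} → (∀ x → Dec (P x)) → ∃ λ c → Count P (Orb (to f)) c
  orbits-in f P? = count-exists (orb-isEq f) P? (orb? f)

-- Connectivity and the genus inequality

data Conn {X : Set} (f g : X → X) : X → X → Set where
  done  : ∀ {x} → Conn f g x x
  via₁  : ∀ {x y} → Conn f g (f x) y → Conn f g x y
  via₂  : ∀ {x y} → Conn f g (g x) y → Conn f g x y

conn-trans : ∀ {X : Set} {f g : X → X} {x y z} → Conn f g x y → Conn f g y z → Conn f g x z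
conn-trans done d = d
conn-trans (via₁ c) d = via₁ (conn-trans c d)
conn-trans (via₂ c) d = via₂ (conn-trans c d)

conn-orb₁ : ∀ {X : Set} {f g : X → X} {x y} → Orb f x y → Conn f g x y
conn-orb₁ = orb-induct (Conn _ _) (λ _ → done) via₁

conn-orb₂ : ∀ {X : Set} {f g : X → X} {x y} → Orb g x y → Conn f g x y
conn-orb₂ = orb-induct (Conn _ _) (λ _ → done) via₂

conn-map : ∀ {X Y : Set} {f g : X → X} {f' g' : Y → Y} (φ : X → Y) →
  (∀ x → Conn f' g' (φ x) (φ (f x))) → (∀ x → Conn f' g' (φ x) (φ (g x))) →
  ∀ {x y} → Conn f g x y → Conn f' g' (φ x) (φ y)
conn-map φ hf hg done = done
conn-map φ hf hg (via₁ c) = conn-trans (hf _) (conn-map φ hf hg c)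
conn-map φ hf hg (via₂ c) = conn-trans (hg _) (conn-map φ hf hg c)

-- The equation `f = f' ∘ (x y)`, written pointwise.
record Swapped {X : Set} (f f' : X → X) (x y : X) : Set where
  constructor mkSwapped
  field
    sw-x : f x ≡ f' y
    sw-y : f y ≡ f' x
    sw-else : ∀ z → z ≢ x → z ≢ y → f z ≡ f' z

open Swapped

swapped-sym : ∀ {X : Set} {f f' : X → X} {x y} → Swapped f f' x y → Swapped f' f x y
swapped-sym s = mkSwapped (sym (sw-y s)) (sym (sw-x s)) (λ z a b → sym (sw-else s z a b))

module FinitePerm {X : Set} {n : ℕ} (card : Card X n) where
  open Finite card using (idx; enum; enum-idx; _≟_; returns; orb-sym; orb-isEq; orb?; orbits)

  conn-sym : (α β : Perm X) → ∀ {x y} → Conn (to α) (to β) x y → Conn (to α) (to β) y x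
  conn-sym α β done = done
  conn-sym α β (via₁ c) = conn-trans (conn-sym α β c) (conn-orb₁ (orb-sym α orb-step))
  conn-sym α β (via₂ c) = conn-trans (conn-sym α β c) (conn-orb₂ (orb-sym β orb-step))

  transp : X → X → X → X
  transp x y z with z ≟ x
  ... | yes _ = y
  ... | no  _ with z ≟ y
  ... | yes _ = x
  ... | no  _ = z

  transp-x : ∀ x y → transp x y x ≡ y
  transp-x x y with x ≟ x
  ... | yes _ = refl
  ... | no ne = ⊥-elim (ne refl)

  transp-y : ∀ x y → transp x y y ≡ x
  transp-y x y with y ≟ x
  ... | yes e = e
  ... | no _ with y ≟ y
  ... | yes _ = refl
  ... | no ne = ⊥-elim (ne refl)

  transp-else : ∀ x y z → z ≢ x → z ≢ y → transp x y z ≡ z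
  transp-else x y z a b with z ≟ x
  ... | yes e = ⊥-elim (a e)
  ... | no _ with z ≟ y
  ... | yes e = ⊥-elim (b e)
  ... | no _ = refl

  transp² : ∀ x y z → transp x y (transp x y z) ≡ z
  transp² x y z with z ≟ x
  ... | yes refl = transp-y x y
  ... | no a with z ≟ y
  ... | yes refl = transp-x x y
  ... | no b = transp-else x y z a b

  transposition : X → X → Perm X
  transposition x y = mkPerm (transp x y) (transp x y) (transp² x y) (transp² x y)

  swapped-transp : (f : X → X) → ∀ x y → Swapped (f ∘ transp x y) f x y
  swapped-transp f x y = mkSwapped (cong f (transp-x x y)) (cong f (transp-y x y))
    (λ z a b → cong f (transp-else x y z a b))

  -- γ agrees with γ' off {x , y}, and follows the γ'-orbit of y from x until it closes up.
  orb-merge : (γ γ' : Perm X) → ∀ {x y} → Swapped (to γ) (to γ') x y → ¬ Orb (to γ') x y → Orb (to γ) x y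
  orb-merge γ γ' {x} {y} s nxy with returns γ' y
  ... | d' , ed' , _ with least (λ k → iter (to γ') (suc k) y ≡ y) (λ k → _ ≟ _) {d'} ed'
  ... | d , ed , _ , mn = suc d , trans (go d ℕₚ.≤-refl) ed
    where
    go : ∀ k → k ≤ d → iter (to γ) (suc k) x ≡ iter (to γ') (suc k) y
    go zero _ = sw-x s
    go (suc k) k<d = trans (cong (to γ) (go k (ℕₚ.<⇒≤ k<d)))
      (sw-else s _ (λ e → nxy (orb-sym γ' (suc k , e))) (mn k k<d))

  swapped-⊆ : (γ γ' : Perm X) → ∀ {x y} → Swapped (to γ) (to γ') x y → Orb (to γ) x y →
    ∀ {a b} → Orb (to γ') a b → Orb (to γ) a b
  swapped-⊆ γ γ' {x} {y} s oxy = orb-induct (Orb (to γ)) (λ _ → orb-refl) (λ o → orb-trans (st _) o)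
    where
    st : ∀ z → Orb (to γ) z (to γ' z)
    st z with z ≟ x
    ... | yes refl = orb-trans oxy (1 , sw-y s)
    ... | no a with z ≟ y
    ... | yes refl = orb-trans (orb-sym γ oxy) (1 , sw-x s)
    ... | no b = 1 , sw-else s z a b

  -- A walk along `γ'` is a walk along `γ` until it meets `x` or `y`.
  swapped-half : (γ γ' : Perm X) → ∀ {x y} → Swapped (to γ) (to γ') x y →
    ∀ {a b} → Orb (to γ') a b → Orb (to γ) a b ⊎ (Orb (to γ) a x ⊎ Orb (to γ) a y)
  swapped-half γ γ' {x} {y} s = orb-induct R (λ _ → inj₁ orb-refl) st
    where
    R : X → X → Set
    R a b = Orb (to γ) a b ⊎ (Orb (to γ) a x ⊎ Orb (to γ) a y)
    st : ∀ {z b} → R (to γ' z) b → R z b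
    st {z} r with z ≟ x
    ... | yes refl = inj₂ (inj₁ orb-refl)
    ... | no a with z ≟ y
    ... | yes refl = inj₂ (inj₂ orb-refl)
    ... | no b with r
    ... | inj₁ o = inj₁ (orb-trans (1 , sw-else s z a b) o)
    ... | inj₂ (inj₁ o) = inj₂ (inj₁ (orb-trans (1 , sw-else s z a b) o))
    ... | inj₂ (inj₂ o) = inj₂ (inj₂ (orb-trans (1 , sw-else s z a b) o))

  swapped-join : (γ γ' : Perm X) → ∀ {x y} → Swapped (to γ) (to γ') x y → ∀ {a b} → Orb (to γ') a b →
    Orb (to γ) a b ⊎ ((Orb (to γ) a x ⊎ Orb (to γ) a y) × (Orb (to γ) b x ⊎ Orb (to γ) b y))
  swapped-join γ γ' s o with swapped-half γ γ' s o | swapped-half γ γ' s (orb-sym γ' o)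
  ... | inj₁ r | _ = inj₁ r
  ... | inj₂ _ | inj₁ r = inj₁ (orb-sym γ r)
  ... | inj₂ r | inj₂ r' = inj₂ (r , r')

  swapped-≤ : (γ γ' : Perm X) → ∀ {x y g g'} → Swapped (to γ) (to γ') x y →
    Count {X} All⊤ (Orb (to γ)) g → Count {X} All⊤ (Orb (to γ')) g' → g ≤ suc g'
  swapped-≤ γ γ' {y = y} s c c' = join-≤ (orb-isEq γ) (orb-isEq γ') c c' {y = y} tt (swapped-join γ γ' s)

  swapped-< : (γ γ' : Perm X) → ∀ {x y g g'} → Swapped (to γ) (to γ') x y → ¬ Orb (to γ') x y →
    Count {X} All⊤ (Orb (to γ)) g → Count {X} All⊤ (Orb (to γ')) g' → suc g ≤ g'
  swapped-< γ γ' s nxy c c' = join-< (orb-isEq γ) (orb-isEq γ') c c' tt tt nxy (orb-merge γ γ' s nxy)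
    (swapped-⊆ γ γ' s (orb-merge γ γ' s nxy))

  swapped-≡ : (γ γ' : Perm X) → ∀ {x y g g'} → Swapped (to γ) (to γ') x y → ¬ Orb (to γ') x y →
    Count {X} All⊤ (Orb (to γ)) g → Count {X} All⊤ (Orb (to γ')) g' → g' ≡ suc g
  swapped-≡ γ γ' s nxy c c' = ℕₚ.≤-antisym (swapped-≤ γ' γ (swapped-sym s) c' c) (swapped-< γ γ' s nxy c c')

  -- The number of components is at most `c`; the genus inequality uses `c` in its place.
  Covers : (f g : X → X) {c : ℕ} → (Fin c → X) → Set
  Covers f g h = ∀ z → ∃ λ i → Conn f g z (h i)

  module _ (α β β' : Perm X) {x y : X} (s : Swapped (to β) (to β') x y) where

    conn-split : ∀ {z w} → Conn (to α) (to β) z w →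
      Conn (to α) (to β') z w ⊎ (Conn (to α) (to β') z x ⊎ Conn (to α) (to β') z y)
    conn-split done = inj₁ done
    conn-split (via₁ c) with conn-split c
    ... | inj₁ d = inj₁ (via₁ d)
    ... | inj₂ (inj₁ d) = inj₂ (inj₁ (via₁ d))
    ... | inj₂ (inj₂ d) = inj₂ (inj₂ (via₁ d))
    conn-split {z} {w} (via₂ c) with z ≟ x
    ... | yes refl = inj₂ (inj₁ done)
    ... | no a with z ≟ y
    ... | yes refl = inj₂ (inj₂ done)
    ... | no b with conn-split c
    ... | inj₁ d = inj₁ (via₂ (subst (λ v → Conn (to α) (to β') v w) (sw-else s z a b) d))
    ... | inj₂ (inj₁ d) = inj₂ (inj₁ (via₂ (subst (λ v → Conn (to α) (to β') v x) (sw-else s z a b) d)))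
    ... | inj₂ (inj₂ d) = inj₂ (inj₂ (via₂ (subst (λ v → Conn (to α) (to β') v y) (sw-else s z a b) d)))

    conn-same : Conn (to α) (to β') x y → ∀ {z w} → Conn (to α) (to β) z w → Conn (to α) (to β') z w
    conn-same cxy = conn-map id (λ _ → via₁ done) st
      where
      st : ∀ z → Conn (to α) (to β') z (to β z)
      st z with z ≟ x
      ... | yes refl = conn-trans cxy (subst (Conn (to α) (to β') y) (sym (sw-x s)) (via₂ done))
      ... | no a with z ≟ y
      ... | yes refl = conn-trans (conn-sym α β' cxy) (subst (Conn (to α) (to β') x) (sym (sw-y s)) (via₂ done))
      ... | no b = subst (Conn (to α) (to β') z) (sym (sw-else s z a b)) (via₂ done)

    -- Undoing the swap detaches at most one component: `x` takes over from the point that covered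
    -- it, and `y` is added.
    covers-split : ∀ {c} (h : Fin c → X) → Covers (to α) (to β) h →
      ∃ λ (h' : Fin (suc c) → X) → Covers (to α) (to β') h'
    covers-split {c} h cov = h' , cov'
      where
      i₀ = proj₁ (cov x)
      h₀ : Fin c → X
      h₀ i with i Finₚ.≟ i₀
      ... | yes _ = x
      ... | no  _ = h i
      h' : Fin (suc c) → X
      h' zero = y
      h' (suc i) = h₀ i
      h₀x : h₀ i₀ ≡ x
      h₀x with i₀ Finₚ.≟ i₀
      ... | yes _ = refl
      ... | no ne = ⊥-elim (ne refl)
      tox : ∀ {z} → Conn (to α) (to β') z x → ∃ λ i → Conn (to α) (to β') z (h' i)
      tox c = suc i₀ , subst (Conn (to α) (to β') _) (sym h₀x) c
      hi : ∀ i → ∃ λ j → Conn (to α) (to β') (h i) (h' j)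
      hi i with i Finₚ.≟ i₀ in eq
      ... | no ne = suc i , subst (Conn (to α) (to β') (h i)) (sym lem) done
        where
        lem : h₀ i ≡ h i
        lem rewrite eq = refl
      ... | yes refl with conn-split (conn-sym α β (proj₂ (cov x)))
      ... | inj₁ d = tox d
      ... | inj₂ (inj₁ d) = tox d
      ... | inj₂ (inj₂ d) = zero , d
      cov' : Covers (to α) (to β') h'
      cov' z with cov z
      ... | i , c with conn-split c
      ... | inj₁ d = let (j , e) = hi i in j , conn-trans d e
      ... | inj₂ (inj₁ d) = tox d
      ... | inj₂ (inj₂ d) = zero , d

  -- Induction on the support of β: splitting a fixed point off β by a transposition
  -- changes the number of cycles of α ∙ β by one.
  genus : (α β : Perm X) → ∀ {a b g c} →
    Count {X} All⊤ (Orb (to α)) a → Count {X} All⊤ (Orb (to β)) b → Count {X} All⊤ (Orb (to (α ∙ β))) g →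
    (h : Fin c → X) → Covers (to α) (to β) h → a + b + g ≤ n + (c + c)
  genus α β {a} ca cb cg h cov = go n β (λ i n≤i → ⊥-elim (ℕₚ.<⇒≱ (Finₚ.toℕ<n i) n≤i)) cb cg h cov
    where
    Fixes : ℕ → Perm X → Set
    Fixes k β = ∀ i → k ≤ toℕ i → to β (enum i) ≡ enum i
    go : ∀ k (β : Perm X) → Fixes k β → ∀ {b g c} → Count {X} All⊤ (Orb (to β)) b →
      Count {X} All⊤ (Orb (to (α ∙ β))) g →
      (h : Fin c → X) → Covers (to α) (to β) h → a + b + g ≤ n + (c + c)
    -- Here `β` is the identity, so every component is a single cycle of `α` and of `α ∙ β`; both
    -- have at most `c` cycles.
    go zero β fx {b} {g} {c} cb cg h cov = begin
        a + b + g ≡⟨ cong (_+ g) (ℕₚ.+-comm a b) ⟩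
        b + a + g ≡⟨ ℕₚ.+-assoc b _ g ⟩
        b + (a + g) ≤⟨ ℕₚ.+-mono-≤ (family-≤ ≡-isEq card (rep cb) (λ _ → tt) (λ i j e → sep cb i j (orb-reflexive e)))
             (ℕₚ.+-mono-≤ (bound α ca (λ _ → refl)) (bound (α ∙ β) cg (λ z → cong (to α) (β-id z)))) ⟩
        n + (c + c) ∎
      where
      open ℕₚ.≤-Reasoning
      β-id : ∀ z → to β z ≡ z
      β-id z = trans (cong (to β) (enum-idx z)) (trans (fx (idx z) z≤n) (sym (enum-idx z)))
      bound : (γ : Perm X) → ∀ {d} → Count {X} All⊤ (Orb (to γ)) d → (∀ z → to γ z ≡ to α z) → d ≤ c
      bound γ cd γα = Finₚ.injective⇒≤ {f = λ i → proj₁ (cov (rep cd i))} λ {i} {j} e →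
          sep cd i j (orb-trans (proj (proj₂ (cov (rep cd i))))
            (orb-sym γ (subst (λ v → Orb (to γ) (rep cd j) (h v)) (sym e) (proj (proj₂ (cov (rep cd j)))))))
        where
        proj : ∀ {z w} → Conn (to α) (to β) z w → Orb (to γ) z w
        proj done = orb-refl
        proj (via₁ c) = orb-trans (1 , γα _) (proj c)
        proj {z} {w} (via₂ c) = subst (λ v → Orb (to γ) v w) (β-id z) (proj c)
    go (suc k) β fx {b} {g} {c} cb cg h cov with k ℕₚ.<? n
    ... | no k≮n = go k β (λ i k≤i → ⊥-elim (k≮n (ℕₚ.≤-<-trans k≤i (Finₚ.toℕ<n i)))) cb cg h cov
    ... | yes k<n = next (to β x ≟ x)
      where
      i₀ = fromℕ< k<n
      x = enum i₀
      -- With `y` the preimage of `x`, the product `β ∙ (x y)` fixes `x` and detaches it from its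
      -- cycle.
      y = from β x
      β' = β ∙ transposition x y
      s : Swapped (to β) (to β') x y
      s = swapped-sym (swapped-transp (to β) x y)
      s' : Swapped (to (α ∙ β)) (to (α ∙ β')) x y
      s' = swapped-sym (swapped-transp (to (α ∙ β)) x y)
      fx' : to β x ≢ x → Fixes k β'
      fx' ne i k≤i with ℕₚ.m≤n⇒m<n∨m≡n k≤i
      ... | inj₂ refl = subst (λ v → to β' v ≡ v) (cong enum (Finₚ.fromℕ<-toℕ i k<n))
              (trans (cong (to β) (transp-x x y)) (to∘from β x))
      ... | inj₁ k<i = trans (cong (to β) (transp-else x y (enum i) n1 n2)) (fx i k<i)
        where
        n1 : enum i ≢ x
        n1 e with sep card i i₀ e
        ... | refl = ℕₚ.<-irrefl (sym (Finₚ.toℕ-fromℕ< k<n)) k<i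
        n2 : enum i ≢ y
        n2 e = ne (trans (cong (to β) lem) (trans (fx i k<i) (sym lem)))
          where
          lem : x ≡ enum i
          lem = trans (sym (to∘from β x)) (trans (cong (to β) (sym e)) (fx i k<i))
      fixed : to β x ≡ x → Fixes k β
      fixed e i k≤i with ℕₚ.m≤n⇒m<n∨m≡n k≤i
      ... | inj₂ refl = subst (λ v → to β v ≡ v) (cong enum (Finₚ.fromℕ<-toℕ i k<n)) e
      ... | inj₁ k<i = fx i k<i
      split-off : to β x ≢ x → ¬ Orb (to β') x y
      split-off ne o = ne (trans (cong (to β) (orb-fixed
        (trans (cong (to β) (transp-x x y)) (to∘from β x)) o)) (to∘from β x))
      x→y : Orb (to (α ∙ β')) x y → Conn (to α) (to β') x y
      x→y = orb-induct (Conn (to α) (to β')) (λ _ → done) (λ c → via₂ (via₁ c))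
      -- When `x` and `y` lie on one cycle of `α ∙ β'`, the gain from `b` to `b'` pays for
      -- `g ≤ suc g'`, and the same points still cover.
      joined : to β x ≢ x → ∀ {b' g'} → Count {X} All⊤ (Orb (to β')) b' → Count {X} All⊤ (Orb (to (α ∙ β'))) g' →
        Orb (to (α ∙ β')) x y → a + b + g ≤ n + (c + c)
      joined ne {b'} {g'} cb' cg' o = begin
          a + b + g ≤⟨ ℕₚ.+-monoʳ-≤ (a + b) (swapped-≤ (α ∙ β) (α ∙ β') s' cg cg') ⟩
          a + b + suc g' ≡⟨ trans (ℕₚ.+-suc (a + b) g') (cong (_+ g') (sym (ℕₚ.+-suc a b))) ⟩
          a + suc b + g' ≤⟨ ℕₚ.+-monoˡ-≤ g' (ℕₚ.+-monoʳ-≤ a (swapped-< β β' s (split-off ne) cb cb')) ⟩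
          a + b' + g' ≤⟨ go k β' (fx' ne) cb' cg' h (λ z → let (i , d) = cov z in i , conn-same α β β' s (x→y o) d) ⟩
          n + (c + c) ∎
        where open ℕₚ.≤-Reasoning
      -- Otherwise both `b'` and `g'` gain one, which pays for one more covering point, as that
      -- point counts twice.
      apart : to β x ≢ x → ∀ {b' g'} → Count {X} All⊤ (Orb (to β')) b' → Count {X} All⊤ (Orb (to (α ∙ β'))) g' →
        ¬ Orb (to (α ∙ β')) x y → (∃ λ (h' : Fin (suc c) → X) → Covers (to α) (to β') h') → a + b + g ≤ n + (c + c)
      apart ne {b'} {g'} cb' cg' no-o (h' , cov') = ℕₚ.+-cancelʳ-≤ 2 _ _ (begin
          a + b + g + 2 ≡⟨ solve 3 (λ a b g → a :+ b :+ g :+ con 2 := a :+ (con 1 :+ b) :+ (con 1 :+ g)) refl a b g ⟩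
          a + suc b + suc g ≤⟨ ℕₚ.+-mono-≤ (ℕₚ.+-monoʳ-≤ a (swapped-< β β' s (split-off ne) cb cb')) (swapped-< (α ∙ β) (α ∙ β') s' no-o cg cg') ⟩
          a + b' + g' ≤⟨ go k β' (fx' ne) cb' cg' h' cov' ⟩
          n + (suc c + suc c) ≡⟨ solve 2 (λ n c → n :+ ((con 1 :+ c) :+ (con 1 :+ c)) := n :+ (c :+ c) :+ con 2) refl n c ⟩
          n + (c + c) + 2 ∎)
        where
        open ℕₚ.≤-Reasoning
        open +-*-Solver
      choose : to β x ≢ x → Dec (Orb (to (α ∙ β')) x y) → a + b + g ≤ n + (c + c)
      choose ne (yes o) = joined ne (proj₂ (orbits β')) (proj₂ (orbits (α ∙ β'))) o
      choose ne (no ¬o) = apart ne (proj₂ (orbits β')) (proj₂ (orbits (α ∙ β'))) ¬o (covers-split α β β' s h cov)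
      next : Dec (to β x ≡ x) → a + b + g ≤ n + (c + c)
      next (yes e) = go k β (fixed e) cb cg h cov
      next (no ne) = choose ne (orb? (α ∙ β') x y)

-- Cutting a rotation: first-return permutations and sinks

module Contours {X : Set} {n : ℕ} (card : Card X n) (F : X → Set) (F? : ∀ x → Dec (F x)) where
  open Finite card using (idx; enum; enum-idx; _≟_; returns; fromInjective; orb-sym; orb-isEq; orb?)

  -- ρ′ is obtained from ρ = ρ′ ∙ κ by cutting every orbit of ρ into pieces with at most
  -- one element of F; κ is then the first-return permutation of ρ on F.
  record Contour (ρ ρ′ κ : Perm X) : Set where
    field
      compose : ∀ x → to ρ x ≡ to ρ′ (to κ x)
      fixes   : ∀ x → ¬ F x → to κ x ≡ x
      one     : ∀ {x y} → F x → F y → Orb (to ρ′) x y → x ≡ y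

  F-in? : (ρ : Perm X) → ∀ x → Dec (∃ λ y → F y × Orb (to ρ) x y)
  F-in? ρ x = map′ (λ (i , fi , o) → enum i , fi , o)
      (λ (y , fy , o) → idx y , subst F (enum-idx y) fy , subst (Orb (to ρ) x) (enum-idx y) o)
      (Finₚ.any? λ i → F? (enum i) ×-dec orb? ρ x (enum i))

  -- Exactly one orbit avoids `F`. When `F` is the set of falls and `ρ` the vertex rotation, this
  -- orbit is the pointed vertex.
  record OneSink (ρ : Perm X) : Set where
    field
      sink   : X
      noF    : ∀ {y} → Orb (to ρ) sink y → ¬ F y
      others : ∀ x → (∃ λ y → F y × Orb (to ρ) x y) ⊎ Orb (to ρ) x sink

  open Contour
  open OneSink

  module _ {ρ ρ′ κ : Perm X} (C : Contour ρ ρ′ κ) where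

    κ-F : ∀ {x} → F x → F (to κ x)
    κ-F {x} fx with F? (to κ x)
    ... | yes f = f
    ... | no ¬f = ⊥-elim (¬f (subst F (sym (Perm.injective κ (fixes C _ ¬f))) fx))

    ρ-off : ∀ {x} → ¬ F x → to ρ x ≡ to ρ′ x
    ρ-off {x} ¬f = trans (compose C x) (cong (to ρ′) (fixes C x ¬f))

    -- Off `F` the two rotations agree, and `κ e` is the only element of `F` on its `ρ′`-orbit. So
    -- `ρ`, started at `e`, runs through that orbit and closes it at `κ e`.
    first-return : ∀ {e} → F e → ∃ λ d → iter (to ρ) (suc d) e ≡ to κ e ×
      (∀ i → i < d → ¬ F (iter (to ρ) (suc i) e))
    first-return {e} fe with returns ρ′ (to κ e)
    ... | d' , ed' , _ with least (λ k → iter (to ρ′) (suc k) (to κ e) ≡ to κ e) (λ k → _ ≟ _) {d'} ed'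
    ... | d , ed , _ , mn = d , trans (go d ℕₚ.≤-refl) ed , λ i i<d f → nof i i<d (subst F (go i (ℕₚ.<⇒≤ i<d)) f)
      where
      nof : ∀ i → i < d → ¬ F (iter (to ρ′) (suc i) (to κ e))
      nof i i<d f = mn i i<d (sym (one C (κ-F fe) f (suc i , refl)))
      go : ∀ i → i ≤ d → iter (to ρ) (suc i) e ≡ iter (to ρ′) (suc i) (to κ e)
      go zero _ = compose C e
      go (suc i) i<d = trans (cong (to ρ) (go i (ℕₚ.<⇒≤ i<d))) (ρ-off (nof i i<d))

    κ⊆ρ : ∀ {x y} → Orb (to κ) x y → Orb (to ρ) x y
    κ⊆ρ = orb-induct (Orb (to ρ)) (λ _ → orb-refl) (λ o → orb-trans (st _) o)
      where
      st : ∀ x → Orb (to ρ) x (to κ x)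
      st x with F? x
      ... | yes f = let (d , e , _) = first-return f in suc d , e
      ... | no ¬f = orb-reflexive (sym (fixes C x ¬f))

    ρ′⊆ρ : ∀ {x y} → Orb (to ρ′) x y → Orb (to ρ) x y
    ρ′⊆ρ = orb-induct (Orb (to ρ)) (λ _ → orb-refl) (λ o → orb-trans (st _) o)
      where
      st : ∀ x → Orb (to ρ) x (to ρ′ x)
      st x = orb-trans (orb-sym ρ (κ⊆ρ (1 , to∘from κ x))) (1 , trans (compose C _) (cong (to ρ′) (to∘from κ x)))

    -- Invariant along the `ρ`-walk: the current point lies on the `ρ′`-orbit of some `h` in `F`
    -- that `κ` reaches from `f`.
    ρ⊆κ : ∀ {f g} → F f → F g → Orb (to ρ) f g → Orb (to κ) f g
    ρ⊆κ {f} ff fg (k , refl) with go k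
      where
      go : ∀ k → ∃ λ h → F h × Orb (to κ) f h × Orb (to ρ′) h (iter (to ρ) k f)
      go zero = f , ff , orb-refl , orb-refl
      go (suc k) with go k | F? (iter (to ρ) k f)
      ... | h , fh , o , o' | no ¬f = h , fh , o , orb-trans o' (1 , sym (ρ-off ¬f))
      ... | h , fh , o , o' | yes fz = to κ z , κ-F fz ,
              subst (λ v → Orb (to κ) f (to κ v)) (one C fh fz o') (orb-trans o orb-step) ,
              (1 , sym (compose C z))
        where z = iter (to ρ) k f
    ... | h , fh , o , o' = subst (Orb (to κ) f) (one C fh fg o') o

    ρ⊆ρ′ : ∀ {x} → (∀ {y} → Orb (to ρ′) x y → ¬ F y) → ∀ {y} → Orb (to ρ) x y → Orb (to ρ′) x y
    ρ⊆ρ′ {x} no-f (k , refl) = go k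
      where
      go : ∀ k → Orb (to ρ′) x (iter (to ρ) k x)
      go zero = orb-refl
      go (suc k) = orb-trans (go k) (1 , sym (ρ-off (no-f (go k))))

    -- The rotations differ only on `F`, so an orbit that avoids `F` is the same for both.
    sink→′ : OneSink ρ → OneSink ρ′
    sink   (sink→′ S) = sink S
    noF    (sink→′ S) o = noF S (ρ′⊆ρ o)
    others (sink→′ S) x with F-in? ρ′ x
    ... | yes a = inj₁ a
    ... | no ¬a with others S x
    ... | inj₂ o = inj₂ (ρ⊆ρ′ (λ o f → ¬a (_ , f , o)) o)
    ... | inj₁ (y , fy , o) = inj₁ (y , fy , ρ⊆ρ′ (λ o f → ¬a (_ , f , o)) o)

    sink←′ : OneSink ρ′ → OneSink ρ
    sink   (sink←′ S) = sink S
    noF    (sink←′ S) o = noF S (ρ⊆ρ′ (noF S) o)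
    others (sink←′ S) x with others S x
    ... | inj₁ (y , fy , o) = inj₁ (y , fy , ρ′⊆ρ o)
    ... | inj₂ o = inj₂ (ρ′⊆ρ o)

    count-F-in : ∀ {k} → Size F k → Count (λ x → ∃ λ y → F y × Orb (to ρ′) x y) (Orb (to ρ′)) k
    count-F-in c = count-map c id (λ x fx → x , fx , orb-refl) (one C)
      (λ y (f , ff , o) → f , ff , λ { _ refl → o })

    count-ρ′ : OneSink ρ′ → ∀ {k} → Size F k → Count {X} All⊤ (Orb (to ρ′)) (k + 1)
    count-ρ′ S c = count-≗ (count-⊎ (orb-isEq ρ′) (count-F-in c)
        (count-one {P = λ x → Orb (to ρ′) x (sink S)} (sink S) orb-refl (λ _ o → o))
        (λ (f , ff , o) o' r → noF S (orb-trans (orb-sym ρ′ o') (orb-trans (orb-sym ρ′ r) o)) ff))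
      (λ _ _ → tt) (λ x _ → others S x) id id

    -- The `ρ`-orbits that meet `F` correspond to the cycles of `κ` on `F`; the sink is the extra
    -- one.
    count-ρ : OneSink ρ → ∀ {a} → Count F (Orb (to κ)) a → Count {X} All⊤ (Orb (to ρ)) (a + 1)
    count-ρ S c = count-≗ (count-⊎ (orb-isEq ρ)
        (count-map {Q = λ x → ∃ λ y → F y × Orb (to ρ) x y} {S = Orb (to ρ)} c id
          (λ x fx → x , fx , orb-refl) ρ⊆κ (λ y (f , ff , o) → f , ff , λ _ r → orb-trans o (κ⊆ρ r)))
        (count-one {P = λ x → Orb (to ρ) x (sink S)} (sink S) orb-refl (λ _ o → o))
        (λ (f , ff , o) o' r → noF S (orb-trans (orb-sym ρ o') (orb-trans (orb-sym ρ r) o)) ff))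
      (λ _ _ → tt) (λ x _ → others S x) id id

  count-fixed : (κ : Perm X) → (∀ x → ¬ F x → to κ x ≡ x) → ∀ {a r} → Count F (Orb (to κ)) a →
    Size (λ x → ¬ F x) r → Count {X} All⊤ (Orb (to κ)) (a + r)
  count-fixed κ fx c d = count-≗ (count-⊎ (orb-isEq κ) c
      (count-map {Q = λ x → ¬ F x} {S = Orb (to κ)} d id (λ _ p → p) (λ ¬f _ o → orb-fixed (fx _ ¬f) o)
        (λ y ¬f → y , ¬f , λ { _ refl → orb-refl }))
      (λ {x} {y} fx' ¬fy r → ¬fy (subst F (sym (orb-fixed (fx y ¬fy) (orb-sym κ r))) fx')))
    (λ _ _ → tt) (λ x _ → dec x) id id
    where
    dec : ∀ x → F x ⊎ ¬ F x
    dec x with F? x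
    ... | yes f = inj₁ f
    ... | no ¬f = inj₂ ¬f

  -- Both are the first return to `F` along the same rotation.
  contour-unique : ∀ {ρ₁ ρ₂ ρ₁′ ρ₂′ κ₁ κ₂ : Perm X} → (∀ x → to ρ₁ x ≡ to ρ₂ x) →
    Contour ρ₁ ρ₁′ κ₁ → Contour ρ₂ ρ₂′ κ₂ → ∀ x → to κ₁ x ≡ to κ₂ x
  contour-unique {ρ₁} {ρ₂} {κ₁ = κ₁} {κ₂} eq C₁ C₂ x = go (F? x)
    where
    first : F x → (∃ λ d → iter (to ρ₁) (suc d) x ≡ to κ₁ x × (∀ i → i < d → ¬ F (iter (to ρ₁) (suc i) x))) →
      (∃ λ d → iter (to ρ₂) (suc d) x ≡ to κ₂ x × (∀ i → i < d → ¬ F (iter (to ρ₂) (suc i) x))) → to κ₁ x ≡ to κ₂ x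
    first f (d , e , m) (d' , e' , m') with ℕₚ.<-cmp d d'
    ... | tri< d<d' _ _ = ⊥-elim (m' d d<d' (subst F (trans (sym e) (iter-cong eq (suc d) x)) (κ-F C₁ f)))
    ... | tri≈ _ refl _ = trans (sym e) (trans (iter-cong eq (suc d) x) e')
    ... | tri> _ _ d'<d = ⊥-elim (m d' d'<d (subst F (trans (sym e') (sym (iter-cong eq (suc d') x))) (κ-F C₂ f)))
    go : Dec (F x) → to κ₁ x ≡ to κ₂ x
    go (no ¬f) = trans (fixes C₁ x ¬f) (sym (fixes C₂ x ¬f))
    go (yes f) = first f (first-return C₁ f) (first-return C₂ f)

  module FirstReturn (ρ : Perm X) where

    hit : ∀ {e} → F e → ∃ λ d → F (iter (to ρ) (suc d) e) × (∀ i → i < d → ¬ F (iter (to ρ) (suc i) e))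
    hit {e} fe with returns ρ e
    ... | d' , ed' , _ with least (λ k → F (iter (to ρ) (suc k) e)) (λ k → F? _) {d'} (subst F (sym ed') fe)
    ... | d , fd , _ , mn = d , fd , mn

    next : ∀ x → Dec (F x) → X
    next x (yes f) = iter (to ρ) (suc (proj₁ (hit f))) x
    next x (no _)  = x

    next-inj : ∀ {x y} (dx : Dec (F x)) (dy : Dec (F y)) → next x dx ≡ next y dy → x ≡ y
    next-inj {x} {y} (yes f) (yes g) e = go (hit f) (hit g) e
      where
      -- If the return from `x` is the shorter one, `x` itself lies strictly inside the return from
      -- `y`, which avoids `F`.
      aux : ∀ {x y d d'} → F x → (∀ i → i < d' → ¬ F (iter (to ρ) (suc i) y)) → d < d' →
        iter (to ρ) (suc d) x ≡ iter (to ρ) (suc d') y → ⊥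
      aux {x} {y} {d} {d'} fx m d<d' e = m i i<d' (subst F lem fx)
        where
        i = d' ∸ suc d
        eqn : suc d + suc i ≡ suc d'
        eqn = trans (ℕₚ.+-suc (suc d) i) (cong suc (ℕₚ.m+[n∸m]≡n d<d'))
        i<d' : i < d'
        i<d' = subst (suc i ≤_) (ℕₚ.m+[n∸m]≡n d<d') (s≤s (ℕₚ.m≤n+m i d))
        lem : x ≡ iter (to ρ) (suc i) y
        lem = Perm.iter-injective ρ (suc d) (trans e (trans (cong (λ k → iter (to ρ) k y) (sym eqn)) (iter-+ (to ρ) (suc d) (suc i) y)))
      go : (a : ∃ λ d → F (iter (to ρ) (suc d) x) × (∀ i → i < d → ¬ F (iter (to ρ) (suc i) x)))
           (b : ∃ λ d → F (iter (to ρ) (suc d) y) × (∀ i → i < d → ¬ F (iter (to ρ) (suc i) y))) →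
           iter (to ρ) (suc (proj₁ a)) x ≡ iter (to ρ) (suc (proj₁ b)) y → x ≡ y
      go (d , _ , m) (d' , _ , m') e with ℕₚ.<-cmp d d'
      ... | tri< l _ _ = ⊥-elim (aux f m' l e)
      ... | tri≈ _ refl _ = Perm.iter-injective ρ (suc d) e
      ... | tri> _ _ l = ⊥-elim (aux g m l (sym e))
    next-inj (yes f) (no ¬g) e = ⊥-elim (¬g (subst F e (proj₁ (proj₂ (hit f)))))
    next-inj (no ¬f) (yes g) e = ⊥-elim (¬f (subst F (sym e) (proj₁ (proj₂ (hit g)))))
    next-inj (no _)  (no _)  e = e

    κ : Perm X
    κ = fromInjective (λ x → next x (F? x)) (λ {x} {y} → next-inj (F? x) (F? y))

    κ-fixes : ∀ x → ¬ F x → to κ x ≡ x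
    κ-fixes x ¬f with F? x
    ... | yes f = ⊥-elim (¬f f)
    ... | no _ = refl

    κ-hit : ∀ x → F x → ∃ λ d → to κ x ≡ iter (to ρ) (suc d) x × (∀ i → i < d → ¬ F (iter (to ρ) (suc i) x))
    κ-hit x f with F? x
    ... | yes f' = proj₁ (hit f') , refl , proj₂ (proj₂ (hit f'))
    ... | no ¬f = ⊥-elim (¬f f)

    contour : Contour ρ (ρ ∙ κ ⁻¹) κ
    compose contour x = cong (to ρ) (sym (from∘to κ x))
    fixes contour = κ-fixes
    -- The `ρ′`-orbit of `g` is the stretch of `ρ` after `e = κ⁻¹ g` up to `g`, which meets `F` only
    -- at its end.
    one contour {g} {y} fg fy (j , refl) with κ-hit e fe
      where
      e = from κ g
      fe : F e
      fe with F? e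
      ... | yes f = f
      ... | no ¬f = ⊥-elim (¬f (subst F (trans (sym (to∘from κ g)) (κ-fixes e ¬f)) fg))
    ... | d , eq , m = key (j % suc d) (m%n<n j (suc d)) (iter-% (to ρ′) g d (trans (go d ℕₚ.≤-refl) (trans (sym eq) (to∘from κ g))) j)
      where
      e = from κ g
      ρ′ = ρ ∙ κ ⁻¹
      go : ∀ i → i ≤ d → iter (to ρ′) (suc i) g ≡ iter (to ρ) (suc i) e
      go zero _ = refl
      go (suc i) i<d = trans (cong (to ρ′) (go i (ℕₚ.<⇒≤ i<d))) (cong (to ρ) lem)
        where
        lem : from κ (iter (to ρ) (suc i) e) ≡ iter (to ρ) (suc i) e
        lem = trans (cong (from κ) (sym (κ-fixes _ (m i i<d)))) (from∘to κ _)
      key : ∀ i → i < suc d → iter (to ρ′) j g ≡ iter (to ρ′) i g → g ≡ iter (to ρ′) j g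
      key zero _ e = sym e
      key (suc i) (s≤s i<d) e = ⊥-elim (m i i<d (subst F (trans e (go i (ℕₚ.<⇒≤ i<d))) fy))

-- Edge labels: falls, rises, black faces and plane trees

module Labels {X : Set} {n : ℕ} (card : Card X n) (q : ℕ) (1≤q : 1 ≤ q)
  (ℓ end : X → ℕ) (step : ∀ x → ℓ x ≡ suc (end x) ⊎ end x ≡ ℓ x + q) where
  open Finite card using (orb-sym; orb-isEq; size-exists; orbits; orbits-in)
  open FinitePerm card using (genus)

  p : ℕ
  p = suc q

  Fall : X → Set
  Fall x = ℓ x ≡ suc (end x)

  Fall? : ∀ x → Dec (Fall x)
  Fall? x = ℓ x ℕₚ.≟ suc (end x)

  rise-end : ∀ {x} → ¬ Fall x → end x ≡ ℓ x + q
  rise-end {x} ¬f with step x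
  ... | inj₁ f = ⊥-elim (¬f f)
  ... | inj₂ r = r

  rise-up : ∀ {x} → ¬ Fall x → ℓ x < end x
  rise-up {x} ¬f = subst (ℓ x <_) (sym (rise-end ¬f))
    (subst (_≤ ℓ x + q) (ℕₚ.+-comm (ℓ x) 1) (ℕₚ.+-monoʳ-≤ (ℓ x) 1≤q))

  up-rise : ∀ {x} → ℓ x ≤ end x → ¬ Fall x
  up-rise {x} l f = ℕₚ.1+n≰n (subst (_≤ end x) f l)

  open Contours card Fall Fall?
    using (Contour; OneSink; κ⊆ρ; ρ′⊆ρ; sink→′; count-ρ′; count-ρ; count-fixed; module FirstReturn)
  open Contour
  open OneSink

  -- Having `end` as a separate function lets `β`, `ω` and the contour be treated alike: they send
  -- an edge to different edges with the same label.
  Follows : (X → X) → Set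
  Follows f = ∀ x → ℓ (f x) ≡ end x

  module Path {f : X → X} (fol : Follows f) where

    path-≥ : ∀ j x → ℓ x ≤ ℓ (iter f j x) + j
    path-≥ zero x = ℕₚ.≤-reflexive (sym (ℕₚ.+-identityʳ _))
    path-≥ (suc j) x = ℕₚ.≤-trans (path-≥ j x) (ℕₚ.≤-trans (ℕₚ.+-monoˡ-≤ j one-step) (ℕₚ.≤-reflexive (sym (ℕₚ.+-suc _ j))))
      where
      y = iter f j x
      one-step : ℓ y ≤ suc (ℓ (f y))
      one-step with step y
      ... | inj₁ e = ℕₚ.≤-reflexive (trans e (cong suc (sym (fol y))))
      ... | inj₂ e = ℕₚ.m≤n⇒m≤1+n (subst (ℓ y ≤_) (sym (trans (fol y) e)) (ℕₚ.m≤m+n _ q))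

    -- Every step lowers the label by one modulo `p`, a rise too, since it adds `p - 1`.
    path-mod : ∀ j x → ∃ λ u → ℓ (iter f j x) + j ≡ ℓ x + u * p
    path-mod zero x = 0 , refl
    path-mod (suc j) x with path-mod j x | step (iter f j x)
    ... | u , e | inj₁ d = u , trans (ℕₚ.+-suc _ j) (trans (cong (λ z → suc z + j) (fol _)) (trans (cong (_+ j) (sym d)) e))
    ... | u , e | inj₂ d = suc u , (begin
        ℓ (f y) + suc j ≡⟨ cong (_+ suc j) (trans (fol y) d) ⟩
        ℓ y + q + suc j ≡⟨ s1 (ℓ y) q j ⟩
        (ℓ y + j) + suc q ≡⟨ cong (_+ suc q) e ⟩
        (ℓ x + u * p) + suc q ≡⟨ s2 (ℓ x) (u * p) q ⟩
        ℓ x + suc u * p ∎)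
      where
      open ≡-Reasoning
      open +-*-Solver
      y = iter f j x
      s1 : ∀ a q j → a + q + suc j ≡ (a + j) + suc q
      s1 = solve 3 (λ a q j → a :+ q :+ (con 1 :+ j) := (a :+ j) :+ (con 1 :+ q)) refl
      s2 : ∀ a u q → a + u + suc q ≡ a + (suc q + u)
      s2 = solve 3 (λ a u q → a :+ u :+ (con 1 :+ q) := a :+ ((con 1 :+ q) :+ u)) refl

    closed-length : ∀ {j x} → iter f j x ≡ x → p ∣ j
    closed-length {j} {x} e with path-mod j x
    ... | u , h = divides u (ℕₚ.+-cancelˡ-≡ (ℓ x) _ _ (trans (cong (λ z → ℓ z + j) (sym e)) h))

  module Black (β : Perm X) (fol : Follows (to β)) (cyc : ∀ x → iter (to β) p x ≡ x) where
    open Path fol using (path-≥)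

    -- Two rises on one black face would climb `2 q` in all, while only `p - 2` other edges are
    -- there to come down, by at most one each.
    after-rise : ∀ {R} → ¬ Fall R → ∀ j → suc j < p → Fall (iter (to β) (suc j) R)
    after-rise {R} rR j j<p with Fall? (iter (to β) (suc j) R)
    ... | yes f = f
    ... | no r = ⊥-elim (ℕₚ.1+n≰n (ℕₚ.≤-trans (ℕₚ.≤-reflexive (trans (sym (ℕₚ.+-suc r' j)) rq)) (ℕₚ.≤-trans (ℕₚ.m≤m+n q q) final)))
      where
      x = iter (to β) (suc j) R
      r' = p ∸ suc (suc j)
      rq : r' + suc j ≡ q
      rq = ℕₚ.suc-injective (trans (sym (ℕₚ.+-suc r' (suc j))) (ℕₚ.m∸n+n≡m j<p))
      h1 : ℓ R + q ≤ ℓ x + j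
      h1 = subst₂ _≤_ (trans (fol R) (rise-end rR)) (cong (λ z → ℓ z + j) (iter-comm (to β) j R)) (path-≥ j (to β R))
      back : iter (to β) r' (to β x) ≡ R
      back = trans (sym (iter-+ (to β) r' (suc (suc j)) R)) (trans (cong (λ k → iter (to β) k R) (ℕₚ.m∸n+n≡m j<p)) (cyc R))
      h2 : ℓ x + q ≤ ℓ R + r'
      h2 = subst₂ _≤_ (trans (fol x) (rise-end r)) (cong (λ z → ℓ z + r') back) (path-≥ r' (to β x))
      open +-*-Solver
      final : q + q ≤ r' + j
      final = ℕₚ.+-cancelˡ-≤ (ℓ R + ℓ x) _ _ (subst₂ _≤_
        (solve 3 (λ a b q → (a :+ q) :+ (b :+ q) := a :+ b :+ (q :+ q)) refl (ℓ R) (ℓ x) q)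
        (solve 4 (λ a b r j → (b :+ j) :+ (a :+ r) := a :+ b :+ (r :+ j)) refl (ℓ R) (ℓ x) r' j)
        (ℕₚ.+-mono-≤ h1 h2))

    -- Without a rise the label would have dropped by `p` after one turn around the face.
    has-rise : ∀ x → ∃ λ R → ¬ Fall R × Orb (to β) x R
    has-rise x with go p
      where
      go : ∀ j → (∃ λ R → ¬ Fall R × Orb (to β) x R) ⊎ (ℓ (iter (to β) j x) + j ≡ ℓ x)
      go zero = inj₂ (ℕₚ.+-identityʳ _)
      go (suc j) with go j
      ... | inj₁ a = inj₁ a
      ... | inj₂ e with Fall? (iter (to β) j x)
      ... | no ¬f = inj₁ (_ , ¬f , j , refl)
      ... | yes f = inj₂ (trans (ℕₚ.+-suc _ j) (trans (cong (λ z → suc z + j) (fol _)) (trans (cong (_+ j) (sym f)) e)))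
    ... | inj₁ a = a
    ... | inj₂ e = ⊥-elim (ℕₚ.m≢1+m+n (ℓ x) (trans (sym e) (trans (cong (λ z → ℓ z + p) (cyc x)) (ℕₚ.+-suc _ q))))

    reduce : ∀ {x y} → Orb (to β) x y → ∃ λ j → j < p × iter (to β) j x ≡ y
    reduce {x} (k , refl) = k % p , m%n<n k p , sym (iter-% (to β) x q (cyc x) k)

    one-rise : ∀ {R R'} → ¬ Fall R → ¬ Fall R' → Orb (to β) R R' → R ≡ R'
    one-rise r r' o with reduce o
    ... | zero , _ , e = e
    ... | suc j , j<p , e = ⊥-elim (r' (subst Fall e (after-rise r j j<p)))

    count-β : ∀ {r} → Size (λ x → ¬ Fall x) r → Count {X} All⊤ (Orb (to β)) r
    count-β c = count-map c id (λ _ _ → tt) one-rise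
      (λ y _ → let (R , rR , o) = has-rise y in R , rR , λ { _ refl → o })

  sizes : ∀ {k r} → Size Fall k → Size (λ x → ¬ Fall x) r → k + r ≡ n
  sizes c d = count-unique ≡-isEq (count-≗ (count-⊎ ≡-isEq c d (λ { f ¬f refl → ¬f f })) (λ _ _ → tt)
      (λ x _ → dec x) id id) card
    where
    dec : ∀ x → Fall x ⊎ ¬ Fall x
    dec x with Fall? x
    ... | yes f = inj₁ f
    ... | no ¬f = inj₂ ¬f

  -- A factorisation of an `n`-cycle whose two factors have `n + 1` cycles in total is a bicoloured
  -- plane tree with `n` edges. The cycles of `κ` and of `ω` are its vertices; those of `ω` are
  -- still the white faces of the constellation.
  record Tree (κ ω : Perm X) : Set where
    field
      ω-follows : Follows (to ω)
      κ-label   : ∀ x → ℓ (to κ x) ≡ ℓ x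
      κ-fixes   : ∀ x → ¬ Fall x → to κ x ≡ x
      single    : ∀ x y → Orb (to (κ ∙ ω)) x y
      tree-euler : ∀ {a b} → Count {X} All⊤ (Orb (to κ)) a → Count {X} All⊤ (Orb (to ω)) b → a + b ≡ n + 1

  -- A pointed constellation in local form: label rules in place of distances, the sink in place of
  -- the pointed vertex.
  record Good (β ω : Perm X) : Set where
    field
      β-follows : Follows (to β)
      ω-follows : Follows (to ω)
      cyc       : ∀ x → iter (to β) p x ≡ x
      one-sink  : OneSink (β ∙ ω ⁻¹)
      euler     : ∀ {a b c} → Count {X} All⊤ (Orb (to (β ∙ ω ⁻¹))) a → Count {X} All⊤ (Orb (to β)) b →
                  Count {X} All⊤ (Orb (to ω)) c → a + b + c ≡ n + 2

  record Linked (β ω κ : Perm X) : Set where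
    constructor mkLinked
    field contour : Contour (β ∙ ω ⁻¹) (β ∙ (κ ∙ ω) ⁻¹) κ
  open Linked public

  module EulerTransfer {β ω κ} (L : Linked β ω κ) (S : OneSink (β ∙ ω ⁻¹))
      (β-follows : Follows (to β)) (cyc : ∀ x → iter (to β) p x ≡ x) where

    -- Vertices are the `κ`-cycles on falls and the sink. Black faces correspond to rises, and each
    -- rise is a fixed point of `κ`. Hence the Euler counts of the constellation and of the tree
    -- differ by one.
    transfer : ∀ {a b v c d} → Count {X} All⊤ (Orb (to κ)) a → Count {X} All⊤ (Orb (to ω)) b →
      Count {X} All⊤ (Orb (to (β ∙ ω ⁻¹))) v → Count {X} All⊤ (Orb (to β)) c →
      Count {X} All⊤ (Orb (to ω)) d → v + c + d ≡ (a + b) + 1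
    transfer {a} {b} {v} {c} {d} cκ cω cρ cβ cω' =
        go (proj₂ (orbits-in κ Fall?)) (proj₂ (size-exists (λ x → ¬? (Fall? x))))
      where
      open ≡-Reasoning
      open +-*-Solver
      go : ∀ {a' r} → Count Fall (Orb (to κ)) a' → Size (λ x → ¬ Fall x) r → v + c + d ≡ (a + b) + 1
      go {a'} {r} af nr = begin
        v + c + d ≡⟨ cong₂ _+_ (cong₂ _+_ (count-unique (orb-isEq (β ∙ ω ⁻¹)) cρ (count-ρ (contour L) S af))
              (count-unique (orb-isEq β) cβ (Black.count-β β β-follows cyc nr)))
              (count-unique (orb-isEq ω) cω' cω) ⟩
        (a' + 1) + r + b ≡⟨ solve 3 (λ a r b → (a :+ con 1) :+ r :+ b := (a :+ r :+ b) :+ con 1) refl a' r b ⟩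
        (a' + r + b) + 1 ≡⟨ cong (λ z → z + b + 1) (count-unique (orb-isEq κ) (count-fixed κ (fixes (contour L)) af nr) cκ) ⟩
        (a + b) + 1 ∎

  abstract
    linked-exists : ∀ β ω → ∃ λ κ → Linked β ω κ
    linked-exists β ω = κ , mkLinked (record { compose = compose C ; fixes = fixes C ; one = one C })
      where open FirstReturn (β ∙ ω ⁻¹) using (κ) renaming (contour to C)

  module GoodToTree {β ω κ} (G : Good β ω) (linked : Linked β ω κ) where
    open Good G using (β-follows; ω-follows; cyc; one-sink; euler)
    ρ = β ∙ ω ⁻¹
    π = κ ∙ ω
    ρ′ = β ∙ π ⁻¹

    ρ-label : ∀ x → ℓ (to ρ x) ≡ ℓ x
    ρ-label x = trans (β-follows _) (trans (sym (ω-follows _)) (cong ℓ (to∘from ω x)))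

    ρ-label* : ∀ {x y} → Orb (to ρ) x y → ℓ x ≡ ℓ y
    ρ-label* = orb-induct (λ x y → ℓ x ≡ ℓ y) (λ _ → refl) (λ e → trans (sym (ρ-label _)) e)

    κ-label : ∀ x → ℓ (to κ x) ≡ ℓ x
    κ-label x = sym (ρ-label* (κ⊆ρ (contour linked) orb-step))

    π-follows : Follows (to π)
    π-follows x = trans (κ-label _) (ω-follows x)

    -- Induction on the label: turn to the fall of the cut vertex and follow `π` along it, which
    -- arrives one lower.
    to-sink : (S′ : OneSink ρ′) → ∀ m x → ℓ x ≤ m → Conn (to ρ′) (to π) x (sink S′)
    to-sink S′ m x le = go (others S′ x)
      where
      go : (∃ λ y → Fall y × Orb (to ρ′) x y) ⊎ Orb (to ρ′) x (sink S′) → Conn (to ρ′) (to π) x (sink S′)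
      go (inj₂ o) = conn-orb₁ o
      go (inj₁ (f , ff , o)) = conn-trans (conn-orb₁ o) (via₂ (rec m lt))
        where
        lt : ℓ (to π f) < m
        lt = ℕₚ.≤-trans (ℕₚ.≤-reflexive (trans (cong suc (π-follows f)) (trans (sym ff) (sym (ρ-label* (ρ′⊆ρ (contour linked) o)))))) le
        rec : ∀ m → ℓ (to π f) < m → Conn (to ρ′) (to π) (to π f) (sink S′)
        rec (suc m) (s≤s l) = to-sink S′ m (to π f) l

    -- There are `k + 1` cut vertices and `r` black faces with `k + r = n`; for one component the
    -- bound `n + 2` leaves room for a single cycle of `π`.
    π-orbits : OneSink ρ′ → ∀ {k r z} → Size Fall k → Size (λ x → ¬ Fall x) r → Count {X} All⊤ (Orb (to π)) z → z ≤ 1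
    π-orbits S′ {k} {r} {z} cf cr cπ = ℕₚ.+-cancelˡ-≤ (n + 1) _ _ (subst₂ _≤_
        (trans (solve 3 (λ k z r → (k :+ con 1) :+ z :+ r := (k :+ r :+ con 1) :+ z) refl k z r)
            (cong (λ m → m + 1 + z) (sizes cf cr))) (sym (ℕₚ.+-assoc n 1 1)) g)
      where
      open +-*-Solver
      cβ : Count {X} All⊤ (Orb (to (ρ′ ∙ π))) r
      cβ = count-≗ (Black.count-β β β-follows cyc cr) (λ _ p → p) (λ _ p → p)
         (orb-cong (λ x → sym (cong (to β) (from∘to π x)))) (orb-cong (λ x → cong (to β) (from∘to π x)))
      g : (k + 1) + z + r ≤ n + (1 + 1)
      g = genus ρ′ π (count-ρ′ (contour linked) S′ cf) cπ cβ (λ (_ : Fin 1) → sink S′) (λ x → zero , to-sink S′ (ℓ x) x ℕₚ.≤-refl)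

    π-single : ∀ x y → Orb (to π) x y
    π-single x y = go (proj₂ (orbits π)) (π-orbits (sink→′ (contour linked) one-sink) (proj₂ (size-exists Fall?)) (proj₂ (size-exists (λ x → ¬? (Fall? x)))) (proj₂ (orbits π)))
      where
      same : ∀ {z} (i j : Fin z) → z ≤ 1 → i ≡ j
      same {suc zero} zero zero _ = refl
      same {suc (suc z)} _ _ (s≤s ())
      go : ∀ {z} → Count {X} All⊤ (Orb (to π)) z → z ≤ 1 → Orb (to π) x y
      go c z≤1 = orb-trans (proj₂ (cover c x tt)) (orb-sym π (subst (λ i → Orb (to π) y (rep c i))
        (same _ _ z≤1) (proj₂ (cover c y tt))))

    tree : Tree κ ω
    tree = record
      { ω-follows = ω-follows ; κ-label = κ-label ; κ-fixes = fixes (contour linked) ; single = π-single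
      ; tree-euler = λ {a} {b} ca cb → ℕₚ.+-cancelʳ-≡ 1 _ _ (trans
          (sym (EulerTransfer.transfer {β} {ω} {κ} linked one-sink β-follows cyc ca cb (proj₂ (orbits ρ)) (proj₂ (orbits β)) cb))
          (trans (euler (proj₂ (orbits ρ)) (proj₂ (orbits β)) cb) (sym (ℕₚ.+-assoc n 1 1)))) }

-- Cacti: black faces recovered from the contour

module Cactus {X : Set} {n : ℕ} (card : Card X n) (q : ℕ) (1≤q : 1 ≤ q)
  (ℓ end : X → ℕ) (step : ∀ x → ℓ x ≡ suc (end x) ⊎ end x ≡ ℓ x + q)
  (π : Perm X) (fol : ∀ x → ℓ (to π x) ≡ end x) (single : ∀ x y → Orb (to π) x y) where
  open Finite card using (idx; enum; enum-idx; fromInjective; orb-sym; orb-isEq; orb?; size-exists; orbits)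
  open FinitePerm card using (genus)
  open Labels card q 1≤q ℓ end step
    using (p; Fall; Fall?; rise-end; rise-up; up-rise; Follows; module Black; sizes)
  open Contours card Fall Fall? using (Contour; F-in?; OneSink; count-F-in)
  open Contour
  open OneSink

  fall-π : ∀ {f} → Fall f → ℓ f ≡ suc (ℓ (to π f))
  fall-π {f} ff = trans ff (cong suc (sym (fol f)))

  rise-π : ∀ {x} → ¬ Fall x → ℓ (to π x) ≡ ℓ x + q
  rise-π {x} r = trans (fol x) (rise-end r)

  -- T x f : f is the first fall from the height of x met from x on;
  -- Chain i x y : y is the first place i levels below x.
  data T : X → X → Set
  data Chain : ℕ → X → X → Set

  data T where
    here : ∀ {f} → Fall f → T f f
    over : ∀ {x y f} → ¬ Fall x → Chain q (to π x) y → T y f → T x f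

  data Chain where
    nil  : ∀ {x} → Chain 0 x x
    cons : ∀ {i x f y} → T x f → Chain i (to π f) y → Chain (suc i) x y

  T-fall : ∀ {x f} → T x f → Fall f
  T-fall (here f) = f
  T-fall (over _ _ t) = T-fall t

  private
    shift : ∀ (k j : ℕ) x → suc j ≤ k → iter (to π) (k ∸ suc j) (to π (iter (to π) j x)) ≡ iter (to π) k x
    shift k j x le = trans (sym (iter-+ (to π) (k ∸ suc j) (suc j) x)) (cong (λ m → iter (to π) m x) (ℕₚ.m∸n+n≡m le))

  Found : ℕ → X → Set
  Found k x = ∃ λ f → T x f × ℓ f ≡ ℓ x × (∃ λ j → suc j ≤ k × f ≡ iter (to π) j x)

  -- Labels descend by at most one at a time, so a path that ends below its starting height leaves
  -- that height by a fall. The path has `k` steps; `m` is there for the recursion.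
  findT : ∀ m k → k ≤ m → ∀ x → ℓ (iter (to π) k x) < ℓ x → Found k x
  findC : ∀ m k → k ≤ m → ∀ i x → ℓ (iter (to π) k x) + i < ℓ x →
    ∃ λ y → Chain i x y × ℓ y + i ≡ ℓ x × (∃ λ j → j ≤ k × y ≡ iter (to π) j x)

  findT m zero le x lt = ⊥-elim (ℕₚ.<-irrefl refl lt)
  findT (suc m) (suc k) (s≤s le) x lt with Fall? x
  ... | yes f = x , here f , refl , 0 , s≤s z≤n , refl
  -- A rise is crossed by a chain of `q` levels back down to the height of `x`, and the search
  -- resumes there.
  ... | no r with findC m k le q (to π x) hyp
    where
    hyp : ℓ (iter (to π) k (to π x)) + q < ℓ (to π x)
    hyp = subst₂ _<_ (cong (λ z → ℓ z + q) (sym (iter-comm (to π) k x))) (sym (rise-π r)) (ℕₚ.+-monoˡ-< q lt)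
  ... | y , ch , ℓy , j , j≤k , yeq with findT m (k ∸ j) (ℕₚ.≤-trans (ℕₚ.m∸n≤m k j) le) y hyp
    where
    y' : y ≡ iter (to π) (suc j) x
    y' = trans yeq (iter-comm (to π) j x)
    ℓyx : ℓ y ≡ ℓ x
    ℓyx = ℕₚ.+-cancelʳ-≡ q _ _ (trans ℓy (rise-π r))
    hyp : ℓ (iter (to π) (k ∸ j) y) < ℓ y
    hyp = subst₂ _<_ (cong ℓ (trans (sym (shift (suc k) j x (s≤s j≤k))) (cong (iter (to π) (k ∸ j)) (sym y')))) (sym ℓyx) lt
  ... | f , t , ℓf , j' , j'≤ , feq = f , over r ch t , trans ℓf (ℕₚ.+-cancelʳ-≡ q _ _ (trans ℓy (rise-π r))) ,
        j' + suc j , s≤s (subst (_≤ k) (sym (ℕₚ.+-suc j' j)) (ℕₚ.≤-trans (ℕₚ.+-monoˡ-≤ j j'≤) (ℕₚ.≤-reflexive (ℕₚ.m∸n+n≡m j≤k)))) ,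
        trans feq (trans (cong (iter (to π) j') (trans yeq (iter-comm (to π) j x))) (sym (iter-+ (to π) j' (suc j) x)))

  findC m k le zero x lt = x , nil , ℕₚ.+-identityʳ _ , 0 , z≤n , refl
  findC m k le (suc i) x lt with findT m k le x (ℕₚ.≤-<-trans (ℕₚ.m≤m+n _ _) lt)
  ... | f , t , ℓf , j , j<k , feq with findC m (k ∸ suc j) (ℕₚ.≤-trans (ℕₚ.m∸n≤m k (suc j)) le) i (to π f) hyp
    where
    hyp : ℓ (iter (to π) (k ∸ suc j) (to π f)) + i < ℓ (to π f)
    hyp = ℕ.s≤s⁻¹ (subst₂ _≤_ (cong suc (trans (ℕₚ.+-suc _ i) (cong (λ z → suc (ℓ z + i)) (sym (trans (cong (λ z → iter (to π) (k ∸ suc j) (to π z)) feq) (shift k j x j<k))))))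
        (trans (sym ℓf) (fall-π (T-fall t))) lt)
  ... | y , ch , ℓy , j' , j'≤ , yeq = y , cons t ch ,
       trans (ℕₚ.+-suc _ i) (trans (cong suc ℓy) (trans (sym (fall-π (T-fall t))) ℓf)) ,
       j' + suc j , ℕₚ.≤-trans (ℕₚ.+-monoˡ-≤ (suc j) j'≤) (ℕₚ.≤-reflexive (ℕₚ.m∸n+n≡m j<k)) ,
       trans yeq (trans (cong (λ z → iter (to π) j' (to π z)) feq) (sym (iter-+ (to π) j' (suc j) x)))

  record IsCactus (β : Perm X) : Set where
    field
      β-follows : Follows (to β)
      cyc : ∀ x → iter (to β) p x ≡ x
      one-fall : ∀ {x y} → Fall x → Fall y → Orb (to (β ∙ π ⁻¹)) x y → x ≡ y

  module CactusUnique {β : Perm X} (C : IsCactus β) where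
    open IsCactus C using (β-follows; cyc; one-fall)
    open Black β β-follows cyc using (after-rise)
    ρ′ = β ∙ π ⁻¹

    turn : ∀ d → Orb (to ρ′) (to π d) (to β d)
    turn d = 1 , cong (to β) (from∘to π d)

    next-fall : ∀ {d f} → Fall (to β d) → Fall f → Orb (to ρ′) (to π d) f → to β d ≡ f
    next-fall {d} fb ff o = one-fall fb ff (orb-trans (orb-sym ρ′ (turn d)) o)

    -- `T` and `Chain` speak of `π` alone, `ρ′` involves `β`. A chain down from a rise `R` has to
    -- visit the falls of the `β`-cycle of `R` in order: each of its falls lies on the cut vertex of
    -- the next `β`-edge, and a cut vertex has only one fall.
    T-orb : ∀ {x f} → T x f → Orb (to ρ′) x f
    chain-end : ∀ {R} → ¬ Fall R → ∀ i j {x y} → i + j ≡ q → x ≡ to π (iter (to β) j R) → Chain i x y →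
      y ≡ to π (iter (to β) q R)

    T-orb (here _) = orb-refl
    -- The chain ends at `π (β^q x)`, whose cut vertex also contains `β^p x = x`.
    T-orb {x} {f} (over {y = y} r ch t) = orb-trans (orb-sym ρ′ (orb-trans
        (subst (λ z → Orb (to ρ′) z _) (sym (chain-end r q 0 (ℕₚ.+-identityʳ q) refl ch)) (turn _))
        (orb-reflexive (cyc x)))) (T-orb t)
    chain-end r zero j refl eq nil = eq
    chain-end {R} r (suc i) j {x} {y} ij eq (cons {f = f} t ch) = chain-end r i (suc j) (trans (ℕₚ.+-suc i j) ij)
      (cong (to π) (sym (next-fall (after-rise r j (s≤s (subst (suc j ≤_) ij (s≤s (ℕₚ.m≤n+m j i))))) (T-fall t)
        (subst (λ z → Orb (to ρ′) z f) eq (T-orb t))))) ch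

    -- Every value of `β` that is a fall is thereby described by `π` alone, which is what uniqueness
    -- rests on.
    T-next : ∀ d → Fall (to β d) → T (to π d) (to β d)
    T-next d fb with single (to π d) (to π (to β d))
    ... | k , e with findT k k ℕₚ.≤-refl (to π d) (subst₂ _<_ (cong ℓ (sym e)) lab (ℕₚ.n<1+n _))
      where
      lab : suc (ℓ (to π (to β d))) ≡ ℓ (to π d)
      lab = trans (sym (fall-π fb)) (trans (β-follows d) (sym (fol d)))
    ... | f , t , _ = subst (T (to π d)) (sym (next-fall fb (T-fall t) (T-orb t))) t

  -- The cycles are compared from a rise on: the falls agree because `T` does not depend on `β`, and
  -- the `p`-th step closes both at the rise.
  cactus-unique : ∀ {β₁ β₂} → IsCactus β₁ → IsCactus β₂ → ∀ x → to β₁ x ≡ to β₂ x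
  cactus-unique {β₁} {β₂} C₁ C₂ x with B₁.has-rise x
    where module B₁ = Black β₁ (IsCactus.β-follows C₁) (IsCactus.cyc C₁) using (after-rise; has-rise)
  ... | R , r , o with Black.reduce β₁ (IsCactus.β-follows C₁) (IsCactus.cyc C₁) (orb-sym β₁ o)
  ... | j , j<p , refl = trans (agree (suc j) j<p) (cong (to β₂) (sym (agree j (ℕₚ.<⇒≤ j<p))))
    where
    module B₁ = Black β₁ (IsCactus.β-follows C₁) (IsCactus.cyc C₁) using (after-rise; has-rise)
    module B₂ = Black β₂ (IsCactus.β-follows C₂) (IsCactus.cyc C₂) using (after-rise)
    agree : ∀ j → j ≤ p → iter (to β₁) j R ≡ iter (to β₂) j R
    agree zero _ = refl
    agree (suc j) j<p with ℕₚ.m≤n⇒m<n∨m≡n j<p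
    ... | inj₂ refl = trans (IsCactus.cyc C₁ R) (sym (IsCactus.cyc C₂ R))
    ... | inj₁ sj<p = sym (trans (cong (to β₂) (sym (agree j (ℕₚ.<⇒≤ j<p)))) (CactusUnique.next-fall C₂
          (subst (λ z → Fall (to β₂ z)) (sym (agree j (ℕₚ.<⇒≤ j<p))) (B₂.after-rise r j sj<p))
          (B₁.after-rise r j sj<p)
          (CactusUnique.T-orb C₂ (CactusUnique.T-next C₁ _ (B₁.after-rise r j sj<p)))))

  -- Existence: every fall f is assigned to the last rise R before f starting below f, and β
  -- runs from R through the falls assigned to it in decreasing order of height.

  data Hit : X → X → Set where
    h0 : ∀ {f} → Hit f f
    hs : ∀ {x f} → ℓ f ≤ ℓ x → Hit (to π x) f → Hit x f

  hit-≤ : ∀ {x f} → Hit x f → ℓ f ≤ ℓ x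
  hit-≤ h0 = ℕₚ.≤-refl
  hit-≤ (hs l _) = l

  hit-concat : ∀ {a x y} → Hit a x → ℓ y ≤ ℓ x → Hit (to π x) y → Hit a y
  hit-concat h0 l h = hs l h
  hit-concat (hs l' h') l h = hs (ℕₚ.≤-trans l l') (hit-concat h' l h)

  below-fall : ∀ {f} → Fall f → ¬ (ℓ f ≤ ℓ (to π f))
  below-fall {f} ff l = ℕₚ.1+n≰n (subst (_≤ ℓ (to π f)) (fall-π ff) l)

  -- After the first of two falls of one height the path is below that height, so the second cannot
  -- be hit.
  hit-unique : ∀ {x f g} → Fall f → Fall g → ℓ f ≡ ℓ g → Hit x f → Hit x g → f ≡ g
  hit-unique ff fg e h0 h0 = refl
  hit-unique {x} ff fg e h0 (hs _ h) = ⊥-elim (below-fall ff (subst (_≤ ℓ (to π x)) (sym e) (hit-≤ h)))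
  hit-unique {x} ff fg e (hs _ h) h0 = ⊥-elim (below-fall fg (subst (_≤ ℓ (to π x)) e (hit-≤ h)))
  hit-unique ff fg e (hs _ h) (hs _ h') = hit-unique ff fg e h h'

  -- Advance while the next label is at least `h`; where this stops there is a fall from height
  -- exactly `h`.
  descend : ∀ k x h → h ≤ ℓ x → ℓ (iter (to π) k x) < h → ∃ λ f → Fall f × ℓ f ≡ h × Hit x f
  descend zero x h le lt = ⊥-elim (ℕₚ.<⇒≱ lt le)
  descend (suc k) x h le lt with h ℕₚ.≤? ℓ (to π x)
  ... | yes le' = let (f , ff , e , hit) = descend k (to π x) h le' (subst (λ z → ℓ z < h) (sym (iter-comm (to π) k x)) lt)
                  in f , ff , e , hs (subst (_≤ ℓ x) (sym e) le) hit
  ... | no nle = x , ff , ℕₚ.≤-antisym (subst (_≤ h) (sym (fall-π ff)) (ℕₚ.≰⇒> nle)) le , h0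
    where
    ff : Fall x
    ff with Fall? x
    ... | yes f = f
    ... | no r = ⊥-elim (nle (ℕₚ.≤-trans le (subst (ℓ x ≤_) (sym (rise-π r)) (ℕₚ.m≤m+n _ q))))

  hit-index : ∀ {x f} → Hit x f → ∃ λ k → iter (to π) k x ≡ f × (∀ i → i ≤ k → ℓ f ≤ ℓ (iter (to π) i x))
  hit-index h0 = 0 , refl , λ { zero _ → ℕₚ.≤-refl }
  hit-index {x} {f} (hs l h) with hit-index h
  ... | k , e , b = suc k , trans (sym (iter-comm (to π) k x)) e ,
        λ { zero _ → l ; (suc i) (s≤s i≤k) → subst (λ z → ℓ f ≤ ℓ z) (iter-comm (to π) i x) (b i i≤k) }

  Owns : X → X → Set
  Owns R f = Fall f × ℓ R < ℓ f × Hit (to π R) f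

  -- `R` would lie on the stretch from `π R'` to `f`, where no label is below that of `f`.
  earlier : ∀ {R R' f k k'} → k < k' → iter (to π) k (to π R) ≡ f → iter (to π) k' (to π R') ≡ f →
    (∀ i → i ≤ k' → ℓ f ≤ ℓ (iter (to π) i (to π R'))) → ℓ R < ℓ f → ⊥
  earlier {R} {R'} {f} {k} {k'} k<k' e e' b' l = ℕₚ.<⇒≱ l (subst (λ z → ℓ f ≤ ℓ z) (sym eq) (b' i (ℕₚ.m∸n≤m k' (suc k))))
    where
    i = k' ∸ suc k
    eq : R ≡ iter (to π) i (to π R')
    eq = Perm.injective π (Perm.iter-injective π k (trans e (trans (sym e') (trans
      (cong (λ m → iter (to π) m (to π R')) (sym (trans (ℕₚ.+-suc k i) (ℕₚ.m+[n∸m]≡n k<k'))))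
      (iter-+ (to π) k (suc i) (to π R'))))))

  owns-unique : ∀ {R R' f} → Owns R f → Owns R' f → R ≡ R'
  owns-unique {R} {R'} {f} (_ , l , h) (_ , l' , h') with hit-index h | hit-index h'
  ... | k , e , b | k' , e' , b' with ℕₚ.<-cmp k k'
  ... | tri≈ _ refl _ = Perm.injective π (Perm.iter-injective π k (trans e (sym e')))
  ... | tri< k<k' _ _ = ⊥-elim (earlier k<k' e e' b' l)
  ... | tri> _ _ k'<k = ⊥-elim (earlier k'<k e' e b l')

  -- Scan forward and remember the last place below `f`; `search` starts the scan anew whenever the
  -- path dips below the height of `f` again.
  owner-from : ∀ k x {f} → Fall f → iter (to π) k x ≡ f → ℓ x < ℓ f → ∃ λ R → Owns R f
  owner-from zero x ff refl lt = ⊥-elim (ℕₚ.<-irrefl refl lt)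
  owner-from (suc k) x {f} ff e lt with ℓ (to π x) ℕₚ.<? ℓ f
  ... | yes l = owner-from k (to π x) ff (trans (iter-comm (to π) k x) e) l
  ... | no nl with search k (to π x) (trans (iter-comm (to π) k x) e) (ℕₚ.≮⇒≥ nl)
    where
    search : ∀ k y → iter (to π) k y ≡ f → ℓ f ≤ ℓ y → Hit y f ⊎ (∃ λ R → Owns R f)
    search zero y refl le = inj₁ h0
    search (suc k) y e le with ℓ f ℕₚ.≤? ℓ (to π y)
    ... | yes l with search k (to π y) (trans (iter-comm (to π) k y) e) l
    ... | inj₁ h = inj₁ (hs le h)
    ... | inj₂ r = inj₂ r
    search (suc k) y e le | no nl = inj₂ (owner-from k (to π y) ff (trans (iter-comm (to π) k y) e) (ℕₚ.≰⇒> nl))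
  ... | inj₁ h = x , ff , lt , h
  ... | inj₂ r = r

  Own : X → X → Set
  Own x R = ¬ Fall R × (x ≡ R ⊎ Owns R x)

  own : ∀ x → ∃ (Own x)
  own x with Fall? x
  ... | no r = x , r , inj₁ refl
  ... | yes f with single (to π x) x
  ... | k , e with owner-from k (to π x) f e (subst (ℓ (to π x) <_) (sym (fall-π f)) (ℕₚ.n<1+n _))
  ... | R , o@(_ , l , h) = R , up-rise (ℕₚ.<⇒≤ (ℕₚ.<-≤-trans l (subst (ℓ x ≤_) (fol R) (hit-≤ h)))) , inj₂ o

  own-unique : ∀ {x R R'} → Own x R → Own x R' → R ≡ R'
  own-unique (_ , inj₁ refl) (_ , inj₁ refl) = refl
  own-unique (r , inj₁ refl) (_ , inj₂ (f , _)) = ⊥-elim (r f)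
  own-unique (_ , inj₂ (f , _)) (r , inj₁ refl) = ⊥-elim (r f)
  own-unique (_ , inj₂ o) (_ , inj₂ o') = owns-unique o o'

  -- `R` is the rise that owns `x`. Back at the height of `R` the polygon closes; above it, the
  -- polygon continues with the fall from height `end x` visible after `x`.
  Next : X → X → X → Set
  Next R x y = (end x ≡ ℓ R × y ≡ R) ⊎ (ℓ R < end x × Fall y × ℓ y ≡ end x × Hit (to π x) y)

  own-end : ∀ {x R} → Own x R → ℓ R ≤ end x
  own-end (r , inj₁ refl) = ℕₚ.<⇒≤ (rise-up r)
  own-end {R = R} (_ , inj₂ (f , l , _)) = ℕ.s≤s⁻¹ (subst (ℓ R <_) f l)

  next : ∀ x R → Own x R → ∃ (Next R x)
  next x R o with ℕₚ.m≤n⇒m<n∨m≡n (own-end o)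
  ... | inj₂ e = R , inj₁ (sym e , refl)
  ... | inj₁ l with single (to π x) R
  ... | k , e with descend k (to π x) (end x) (ℕₚ.≤-reflexive (sym (fol x))) (subst (λ z → ℓ z < end x) (sym e) l)
  ... | y , fy , ey , h = y , inj₂ (l , fy , ey , h)

  next-own : ∀ {x y R} → Own x R → Next R x y → Own y R
  next-own (r , _) (inj₁ (_ , refl)) = r , inj₁ refl
  next-own {R = R} (r , inj₁ refl) (inj₂ (l , fy , e , h)) = r , inj₂ (fy , subst (ℓ R <_) (sym e) l , h)
  next-own {R = R} (r , inj₂ (f , l' , h')) (inj₂ (l , fy , e , h)) = r , inj₂ (fy , subst (ℓ R <_) (sym e) l ,
    hit-concat h' (subst₂ _≤_ (sym e) (sym f) (ℕₚ.n≤1+n _)) h)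

  next-label : ∀ {x y R} → Next R x y → ℓ y ≡ end x
  next-label (inj₁ (e , refl)) = sym e
  next-label (inj₂ (_ , _ , e , _)) = e

  -- Two owned falls of one height coincide by `hit-unique`, and the rise ends higher than every
  -- fall it owns, since these are hit from `π R`.
  own-inj : ∀ {x x' R} → Own x R → Own x' R → end x ≡ end x' → x ≡ x'
  own-inj (_ , inj₁ refl) (_ , inj₁ refl) e = refl
  own-inj {R = R} (_ , inj₁ refl) (_ , inj₂ (f , _ , h)) e =
    ⊥-elim (ℕₚ.1+n≰n (subst₂ _≤_ (trans f (cong suc (sym e))) (fol R) (hit-≤ h)))
  own-inj {R = R} (_ , inj₂ (f , _ , h)) (_ , inj₁ refl) e =
    ⊥-elim (ℕₚ.1+n≰n (subst₂ _≤_ (trans f (cong suc e)) (fol R) (hit-≤ h)))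
  own-inj (_ , inj₂ (f , _ , h)) (_ , inj₂ (f' , _ , h')) e = hit-unique f f' (trans f (trans (cong suc e) (sym f'))) h h'

  βf : X → X
  βf x = proj₁ (next x (proj₁ (own x)) (proj₂ (own x)))

  βf-spec : ∀ x → Next (proj₁ (own x)) x (βf x)
  βf-spec x = proj₂ (next x (proj₁ (own x)) (proj₂ (own x)))

  βf-next : ∀ {x R} → Own x R → Next R x (βf x)
  βf-next {x} o = subst (λ r → Next r x (βf x)) (own-unique (proj₂ (own x)) o) (βf-spec x)

  βf-own : ∀ {x R} → Own x R → Own (βf x) R
  βf-own o = next-own o (βf-next o)

  βf-label : ∀ x → ℓ (βf x) ≡ end x
  βf-label x = next-label (βf-spec x)

  βf-inj : ∀ {x x'} → βf x ≡ βf x' → x ≡ x'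
  βf-inj {x} {x'} e = own-inj (proj₂ (own x)) (subst (Own x') (sym R≡) (proj₂ (own x')))
      (trans (sym (βf-label x)) (trans (cong ℓ e) (βf-label x')))
    where
    R≡ : proj₁ (own x) ≡ proj₁ (own x')
    R≡ = own-unique (βf-own (proj₂ (own x))) (subst (λ z → Own z _) (sym e) (βf-own (proj₂ (own x'))))

  β : Perm X
  β = fromInjective βf βf-inj

  βf-last : ∀ {x R} → Own x R → end x ≡ ℓ R → βf x ≡ R
  βf-last o e with βf-next o
  ... | inj₁ (_ , r) = r
  ... | inj₂ (l , _) = ⊥-elim (ℕₚ.<-irrefl (sym e) l)

  βf-more : ∀ {x R} → Own x R → ℓ R < end x → Fall (βf x)
  βf-more o l with βf-next o
  ... | inj₁ (e , _) = ⊥-elim (ℕₚ.<-irrefl (sym e) l)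
  ... | inj₂ (_ , f , _) = f

  -- The ends come down from `ℓ R + q` one at a time, so `q` falls are met before the closing step.
  cyc-rise : ∀ {R} → ¬ Fall R → iter βf p R ≡ R
  cyc-rise {R} r = βf-last (proj₁ (go q ℕₚ.≤-refl)) (ℕₚ.+-cancelʳ-≡ q _ _ (proj₂ (go q ℕₚ.≤-refl)))
    where
    Inv : X → ℕ → Set
    Inv y j = Own y R × end y + j ≡ ℓ R + q
    advance : ∀ {y j} → j < q → Inv y j → Inv (βf y) (suc j)
    advance {y} {j} j<q (o , e) = βf-own o , trans (ℕₚ.+-suc _ j) (trans (cong (_+ j) (trans (sym (βf-more o l)) (βf-label y))) e)
      where
      l : ℓ R < end y
      l = ℕₚ.+-cancelʳ-< j _ _ (ℕₚ.<-≤-trans (ℕₚ.+-monoʳ-< (ℓ R) j<q) (ℕₚ.≤-reflexive (sym e)))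
    go : ∀ j → j ≤ q → Inv (iter βf j R) j
    go zero _ = (r , inj₁ refl) , trans (ℕₚ.+-identityʳ _) (rise-end r)
    go (suc j) j<q = advance j<q (go j (ℕₚ.<⇒≤ j<q))

  orb-rise : ∀ m {x R} → Own x R → end x ≡ ℓ R + m → Orb βf x R
  orb-rise zero o e = 1 , βf-last o (trans e (ℕₚ.+-identityʳ _))
  orb-rise (suc m) {x} {R} o e = orb-trans orb-step (orb-rise m (βf-own o)
      (ℕₚ.suc-injective (trans (sym (βf-more o l)) (trans (βf-label x) (trans e (ℕₚ.+-suc _ m))))))
    where
    l : ℓ R < end x
    l = subst (ℓ R <_) (sym (trans e (ℕₚ.+-suc _ m))) (s≤s (ℕₚ.m≤m+n _ m))

  β-cyc : ∀ x → iter βf p x ≡ x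
  β-cyc x = go (own x)
    where
    open ≡-Reasoning
    go : ∃ (Own x) → iter βf p x ≡ x
    go (R , o) = back (orb-rise (end x ∸ ℓ R) o (sym (ℕₚ.m+[n∸m]≡n (own-end o))))
      where
      back : Orb βf x R → iter βf p x ≡ x
      back (s , e) = Perm.iter-injective β s (begin
        iter βf s (iter βf p x) ≡⟨ sym (iter-+ βf s p x) ⟩
        iter βf (s + p) x ≡⟨ cong (λ k → iter βf k x) (ℕₚ.+-comm s p) ⟩
        iter βf (p + s) x ≡⟨ iter-+ βf p s x ⟩
        iter βf p (iter βf s x) ≡⟨ cong (iter βf p) e ⟩
        iter βf p R ≡⟨ cyc-rise (proj₁ o) ⟩
        R ≡⟨ sym e ⟩
        iter βf s x ∎)

  -- The fall at the height of `x` that is visible from `x`. It does not change along the cut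
  -- rotation, so two falls of one cut vertex are equal.
  V : X → X → Set
  V x f = Hit x f × ℓ f ≡ ℓ x

  V-next : ∀ {d y R f} → Fall f → Own d R → Next R d y → V (to π d) f → V y f
  V-next {d} ff o (inj₂ (_ , fg , eg , hg)) (h , e) = subst (λ z → V z _) (hit-unique ff fg (trans e (trans (fol d) (sym eg))) h hg) (h0 , refl)
  V-next _ (r , inj₁ refl) (inj₁ (eR , _)) _ = ⊥-elim (ℕₚ.<-irrefl (sym eR) (rise-up r))
  V-next {d} {R = R} {f} ff (r , inj₂ (fd , l , hd)) (inj₁ (eR , refl)) (h , e) =
      hs (ℕₚ.≤-reflexive ℓf) (hit-concat hd (subst (_≤ ℓ d) (sym ℓf) (ℕₚ.<⇒≤ l)) h) , ℓf
    where
    ℓf : ℓ f ≡ ℓ R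
    ℓf = trans e (trans (fol d) eR)

  V-step : ∀ {x f} → Fall f → V x f → V (to (β ∙ π ⁻¹) x) f
  V-step {x} {f} ff v = V-next ff (proj₂ (own (from π x))) (βf-spec (from π x)) (subst (λ z → V z f) (sym (to∘from π x)) v)

  V-fall : ∀ {x f} → Fall x → V x f → x ≡ f
  V-fall fx (h0 , _) = refl
  V-fall {x} fx (hs _ h , e) = ⊥-elim (below-fall fx (subst (_≤ ℓ (to π x)) e (hit-≤ h)))

  cactus : IsCactus β
  IsCactus.β-follows cactus = βf-label
  IsCactus.cyc cactus = β-cyc
  IsCactus.one-fall cactus {x} {y} fx fy (k , refl) with go k
    where
    go : ∀ k → V (iter (to (β ∙ π ⁻¹)) k x) x
    go zero = h0 , refl
    go (suc k) = V-step fx (go k)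
  ... | v = sym (V-fall fy v)

  lowest : X → ∃ λ v → ∀ x → ℓ v ≤ ℓ x
  lowest r with least (λ h → ∃ λ i → ℓ (enum i) ≡ h) (λ h → Finₚ.any? (λ i → ℓ (enum i) ℕₚ.≟ h)) {ℓ r} (idx r , cong ℓ (sym (enum-idx r)))
  ... | h , (i , refl) , _ , mn = enum i , λ x → ℕₚ.≮⇒≥ (λ l → mn (ℓ x) l (idx x , cong ℓ (sym (enum-idx x))))

  -- A vertex of lowest label has no fall. A second cut vertex without a fall would make at least
  -- `k + 2` of them, one more than the genus inequality allows when `π` is a single cycle.
  one-sink : X → ∀ {β₁} → IsCactus β₁ → OneSink (β₁ ∙ π ⁻¹)
  one-sink r {β₁} C = record { sink = v ; noF = λ o → v-noF o ; others = oth }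
    where
    open IsCactus C using (β-follows; cyc; one-fall)
    v = proj₁ (lowest r)
    ρ′ = β₁ ∙ π ⁻¹
    ρ′-label : ∀ {x y} → Orb (to ρ′) x y → ℓ x ≡ ℓ y
    ρ′-label = orb-induct (λ x y → ℓ x ≡ ℓ y) (λ _ → refl)
      (λ {x} e → trans (sym (trans (β-follows _) (trans (sym (fol _)) (cong ℓ (to∘from π x))))) e)
    v-noF : ∀ {y} → Orb (to ρ′) v y → ¬ Fall y
    v-noF {y} o f = below-fall f (subst (_≤ ℓ (to π y)) (ρ′-label o) (proj₂ (lowest r) (to π y)))
    K : Contour ρ′ ρ′ (mkPerm id id (λ _ → refl) (λ _ → refl))
    K = record { compose = λ _ → refl ; fixes = λ _ _ → refl ; one = one-fall }
    HasFall : X → Set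
    HasFall x = ∃ λ y → Fall y × Orb (to ρ′) x y
    module _ (x : X) (¬a : ¬ HasFall x) (¬o : ¬ Orb (to ρ′) x v) {k s c : ℕ} (fs : Size Fall k) (rs : Size (λ x → ¬ Fall x) s)
        (cρ : Count {X} All⊤ (Orb (to ρ′)) c) where
      one-part : Count (λ y → HasFall y ⊎ Orb (to ρ′) y v) (Orb (to ρ′)) (k + 1)
      one-part = count-⊎ (orb-isEq ρ′) (count-F-in K fs) (count-one {P = λ x → Orb (to ρ′) x v} v orb-refl (λ _ o → o))
        (λ (f , ff , o) o' s → v-noF (orb-trans (orb-sym ρ′ o') (orb-trans (orb-sym ρ′ s) o)) ff)
      clash : ∀ {y z} → HasFall y ⊎ Orb (to ρ′) y v → Orb (to ρ′) z x → ¬ Orb (to ρ′) y z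
      clash (inj₁ (f , ff , o)) o' s = ¬a (f , ff , orb-trans (orb-sym ρ′ o') (orb-trans (orb-sym ρ′ s) o))
      clash (inj₂ o) o' s = ¬o (orb-trans (orb-sym ρ′ o') (orb-trans (orb-sym ρ′ s) o))
      two : Count (λ y → (HasFall y ⊎ Orb (to ρ′) y v) ⊎ Orb (to ρ′) y x) (Orb (to ρ′)) (k + 1 + 1)
      two = count-⊎ (orb-isEq ρ′) one-part (count-one {P = λ y → Orb (to ρ′) y x} x orb-refl (λ _ o → o)) clash
      lower : k + 1 + 1 ≤ c
      lower = family-≤ (orb-isEq ρ′) cρ (rep two) (λ _ → tt) (sep two)
      cβ : Count {X} All⊤ (Orb (to (ρ′ ∙ π))) s
      cβ = count-≗ (Black.count-β β₁ β-follows cyc rs) (λ _ p → p) (λ _ p → p)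
         (orb-cong (λ x → sym (cong (to β₁) (from∘to π x)))) (orb-cong (λ x → cong (to β₁) (from∘to π x)))
      upper : c + 1 + s ≤ n + (1 + 1)
      upper = genus ρ′ π cρ (count-one r tt (λ y _ → single y r)) cβ (λ (_ : Fin 1) → r) (λ x → zero , conn-orb₂ (single x r))
      open +-*-Solver
      absurd : ⊥
      absurd = ℕₚ.1+n≰n (ℕₚ.+-cancelˡ-≤ (n + 1) 2 1 (ℕₚ.≤-trans (ℕₚ.≤-reflexive (sym arith)) (ℕₚ.≤-trans
          (ℕₚ.+-monoˡ-≤ s (ℕₚ.+-monoˡ-≤ 1 lower)) (ℕₚ.≤-trans upper (ℕₚ.≤-reflexive (sym (ℕₚ.+-assoc n 1 1)))))))
        where
        arith : k + 1 + 1 + 1 + s ≡ (n + 1) + 2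
        arith = trans (solve 2 (λ k r → k :+ con 1 :+ con 1 :+ con 1 :+ r := (k :+ r :+ con 1) :+ con 2) refl k s)
           (cong (λ m → m + 1 + 2) (sizes fs rs))
    oth : ∀ x → HasFall x ⊎ Orb (to ρ′) x v
    oth x = go (F-in? ρ′ x) (orb? ρ′ x v)
      where
      go : Dec (HasFall x) → Dec (Orb (to ρ′) x v) → HasFall x ⊎ Orb (to ρ′) x v
      go (yes a) _ = inj₁ a
      go (no _) (yes o) = inj₂ o
      go (no ¬a) (no ¬o) = ⊥-elim (absurd x ¬a ¬o (proj₂ (size-exists Fall?)) (proj₂ (size-exists (λ x → ¬? (Fall? x)))) (proj₂ (orbits ρ′)))

-- From labelled trees back to good pairs

module TreeToGood {X : Set} {n : ℕ} (card : Card X n) (q : ℕ) (1≤q : 1 ≤ q)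
  (ℓ end : X → ℕ) (step : ∀ x → ℓ x ≡ suc (end x) ⊎ end x ≡ ℓ x + q) where
  open Finite card using (orbits)
  open Labels card q 1≤q ℓ end step
    using (Fall; Fall?; Tree; Good; Linked; mkLinked; contour; module EulerTransfer)
  open Contours card Fall Fall? using (Contour; OneSink; sink←′)
  open Contour

  module _ {κ ω : Perm X} (T : Tree κ ω) where
    open Tree T using (ω-follows; κ-label; κ-fixes; single; tree-euler)
    π-follows : ∀ x → ℓ (to κ (to ω x)) ≡ end x
    π-follows x = trans (κ-label _) (ω-follows x)
    open Cactus card q 1≤q ℓ end step (κ ∙ ω) π-follows single using (T; IsCactus; β; cactus; one-sink)

    tree→good : X → ∃ λ β → Good β ω × Linked β ω κ
    tree→good r = go cactus
      where
      go : ∀ {β} → IsCactus β → ∃ λ β → Good β ω × Linked β ω κ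
      go {β} C = β , record
          { β-follows = β-follows ; ω-follows = ω-follows ; cyc = cyc ; one-sink = S
          ; euler = λ ca cb cc → trans (EulerTransfer.transfer {β} {ω} {κ} L S β-follows cyc (proj₂ (orbits κ)) cc ca cb cc)
              (trans (cong (_+ 1) (tree-euler (proj₂ (orbits κ)) cc)) (ℕₚ.+-assoc n 1 1)) } , L
        where
        open IsCactus C using (β-follows; cyc; one-fall)
        L : Linked β ω κ
        L = mkLinked (record { compose = λ x → cong (λ z → to β (from ω z)) (sym (from∘to κ x)) ; fixes = κ-fixes ; one = one-fall })
        S : OneSink (β ∙ ω ⁻¹)
        S = sink←′ (contour L) (one-sink r C)

-- Meaning of the Boolean tests

∧-true : ∀ {a b} → a ∧ b ≡ true → a ≡ true × b ≡ true
∧-true {true} {true} _ = refl , refl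

∧-intro : ∀ {a b} → a ≡ true → b ≡ true → a ∧ b ≡ true
∧-intro refl refl = refl

∨-true : ∀ {a b} → a ∨ b ≡ true → a ≡ true ⊎ b ≡ true
∨-true {true} _ = inj₁ refl
∨-true {false} e = inj₂ e

∨-introˡ : ∀ {a b} → a ≡ true → a ∨ b ≡ true
∨-introˡ refl = refl

∨-introʳ : ∀ {a b} → b ≡ true → a ∨ b ≡ true
∨-introʳ {true} _ = refl
∨-introʳ {false} e = e

if-elim : ∀ {c d} → (if c then d else true) ≡ true → c ≡ true → d ≡ true
if-elim e refl = e

if-intro : ∀ {c d} → (c ≡ true → d ≡ true) → (if c then d else true) ≡ true
if-intro {true} h = h refl
if-intro {false} h = refl

T⇒ : ∀ {b} → 𝔹.T b → b ≡ true
T⇒ {true} _ = refl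

⇒T : ∀ {b} → b ≡ true → 𝔹.T b
⇒T refl = tt

≢true : ∀ {b} → b ≢ true → b ≡ false
≢true {true} h = ⊥-elim (h refl)
≢true {false} _ = refl

not-true : ∀ {b} → not b ≡ true → b ≢ true
not-true {true} ()
not-true {false} _ ()

not-intro : ∀ {b} → b ≢ true → not b ≡ true
not-intro {true} h = ⊥-elim (h refl)
not-intro {false} _ = refl

≡ᵇ-elim : ∀ {m n} → (m ℕ.≡ᵇ n) ≡ true → m ≡ n
≡ᵇ-elim {m} {n} e = ℕₚ.≡ᵇ⇒≡ m n (⇒T e)

≡ᵇ-intro : ∀ {m n} → m ≡ n → (m ℕ.≡ᵇ n) ≡ true
≡ᵇ-intro {m} {n} e = T⇒ (ℕₚ.≡⇒≡ᵇ m n e)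

≤ᵇ-elim : ∀ {m n} → (m ℕ.≤ᵇ n) ≡ true → m ≤ n
≤ᵇ-elim {m} {n} e = ℕₚ.≤ᵇ⇒≤ m n (⇒T e)

≤ᵇ-intro : ∀ {m n} → m ≤ n → (m ℕ.≤ᵇ n) ≡ true
≤ᵇ-intro e = T⇒ (ℕₚ.≤⇒≤ᵇ e)

==-elim : ∀ {N} {a b : Fin N} → (a == b) ≡ true → a ≡ b
==-elim e = Finₚ.toℕ-injective (≡ᵇ-elim e)

==-intro : ∀ {N} {a b : Fin N} → a ≡ b → (a == b) ≡ true
==-intro e = ≡ᵇ-intro (cong toℕ e)

==-refl : ∀ {N} (a : Fin N) → (a == a) ≡ true
==-refl a = ==-intro {a = a} refl

all-tab : ∀ {A : Set} {N} (P : A → Bool) (f : Fin N → A) → all P (L.tabulate f) ≡ true → ∀ i → P (f i) ≡ true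
all-tab {N = suc N} P f e zero = proj₁ (∧-true e)
all-tab {N = suc N} P f e (suc i) = all-tab P (f ∘ suc) (proj₂ (∧-true e)) i

tab-all : ∀ {A : Set} {N} (P : A → Bool) (f : Fin N → A) → (∀ i → P (f i) ≡ true) → all P (L.tabulate f) ≡ true
tab-all {N = zero} P f h = refl
tab-all {N = suc N} P f h = ∧-intro (h zero) (tab-all P (f ∘ suc) (h ∘ suc))

any-tab : ∀ {A : Set} {N} (P : A → Bool) (f : Fin N → A) → any P (L.tabulate f) ≡ true → ∃ λ i → P (f i) ≡ true
any-tab {N = suc N} P f e with ∨-true {P (f zero)} e
... | inj₁ h = zero , h
... | inj₂ h = let (i , r) = any-tab P (f ∘ suc) h in suc i , r

tab-any : ∀ {A : Set} {N} (P : A → Bool) (f : Fin N → A) i → P (f i) ≡ true → any P (L.tabulate f) ≡ true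
tab-any P f zero h = ∨-introˡ h
tab-any P f (suc i) h = ∨-introʳ {P (f zero)} (tab-any P (f ∘ suc) i h)

allE-elim : ∀ {N} {P : Fin N → Bool} → allE P ≡ true → ∀ i → P i ≡ true
allE-elim {P = P} e = all-tab P id e

allE-intro : ∀ {N} {P : Fin N → Bool} → (∀ i → P i ≡ true) → allE P ≡ true
allE-intro {P = P} = tab-all P id

anyE-elim : ∀ {N} {P : Fin N → Bool} → anyE P ≡ true → ∃ λ i → P i ≡ true
anyE-elim {P = P} = any-tab P id

anyE-intro : ∀ {N} {P : Fin N → Bool} i → P i ≡ true → anyE P ≡ true
anyE-intro {P = P} = tab-any P id

any-apply-elim : ∀ (P : ℕ → Bool) (f : ℕ → ℕ) n → any P (L.applyUpTo f n) ≡ true → ∃ λ k → k < n × P (f k) ≡ true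
any-apply-elim P f (suc n) e with ∨-true {P (f 0)} e
... | inj₁ h = 0 , s≤s z≤n , h
... | inj₂ h = let (k , l , r) = any-apply-elim P (f ∘ suc) n h in suc k , s≤s l , r

any-apply-intro : ∀ (P : ℕ → Bool) (f : ℕ → ℕ) {n k} → k < n → P (f k) ≡ true → any P (L.applyUpTo f n) ≡ true
any-apply-intro P f {suc n} {zero} _ h = ∨-introˡ h
any-apply-intro P f {suc n} {suc k} (s≤s l) h = ∨-introʳ {P (f 0)} (any-apply-intro P (f ∘ suc) l h)

firstWhere-apply : ∀ (P : ℕ → Bool) (f : ℕ → ℕ) n {k} → k < n → P (f k) ≡ true →
  ∃ λ j → firstWhere P (L.applyUpTo f n) ≡ f j × P (f j) ≡ true × (∀ i → i < j → P (f i) ≡ false) × j ≤ k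
firstWhere-apply P f (suc n) {k} l h with P (f 0) in e
... | true = 0 , refl , e , (λ _ ()) , z≤n
... | false with k
... | zero = ⊥-elim (case (trans (sym e) h))
  where
  case : false ≡ true → ⊥
  case ()
... | suc k with firstWhere-apply P (f ∘ suc) n (ℕ.s≤s⁻¹ l) h
... | j , eq , pj , m , le = suc j , eq , pj , (λ { zero _ → e ; (suc i) (s≤s q) → m i q }) , s≤s le

count-filter : ∀ {A : Set} (P : A → Bool) → List A → ℕ
count-filter P xs = L.length (L.filter (λ e → P e Boolₚ.≟ true) xs)

size-tab : ∀ {A : Set} {N} (P : A → Bool) (f : Fin N → A) → (∀ {i j} → f i ≡ f j → i ≡ j) →
  Size (λ a → (∃ λ i → f i ≡ a) × P a ≡ true) (count-filter P (L.tabulate f))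
size-tab {A} {zero} P f inj = record { rep = λ () ; repP = λ () ; sep = λ () ; cover = λ { _ ((() , _) , _) } }
size-tab {A} {suc N} P f inj with P (f zero) in e
... | false = count-≗ (size-tab P (f ∘ suc) (λ q → Finₚ.suc-injective (inj q)))
    (λ { _ ((i , q) , r) → (suc i , q) , r })
    (λ { _ ((zero , refl) , r) → ⊥-elim (case (trans (sym e) r)) ; _ ((suc i , q) , r) → (i , q) , r }) id id
  where
  case : false ≡ true → ⊥
  case ()
... | true = count-≗ (count-⊎ ≡-isEq (count-one {P = λ a → a ≡ f zero} (f zero) refl (λ _ q → q))
      (size-tab P (f ∘ suc) (λ q → Finₚ.suc-injective (inj q)))
      (λ { refl ((i , q) , _) refl → case (inj q) }))
    (λ { _ (inj₁ refl) → (zero , refl) , e ; _ (inj₂ ((i , q) , r)) → (suc i , q) , r })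
    (λ { _ ((zero , refl) , r) → inj₁ refl ; _ ((suc i , q) , r) → inj₂ ((i , q) , r) }) id id
  where
  case : ∀ {i : Fin N} → suc i ≡ zero → ⊥
  case ()

countE-size : ∀ {N} (P : Fin N → Bool) → Size (λ e → P e ≡ true) (countE P)
countE-size P = count-≗ (size-tab P id id) (λ _ → proj₂) (λ x h → (x , refl) , h) id id

-- The Boolean tests of Defs on Fin N, for a function f that agrees with a permutation φ.

fin-perm : ∀ {N} (f : Fin N → Fin N) → (∀ {x y} → f x ≡ f y → x ≡ y) → Perm (Fin N)
fin-perm {N} = Finite.fromInjective (fin-card N)

isBij-elim : ∀ {N} {f : Fin N → Fin N} → isBij f ≡ true → ∀ {x y} → f x ≡ f y → x ≡ y
isBij-elim e {x} {y} q = ==-elim (if-elim (allE-elim (allE-elim e x) y) (==-intro q))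

isBij-intro : ∀ {N} {f : Fin N → Fin N} → (∀ {x y} → f x ≡ f y → x ≡ y) → isBij f ≡ true
isBij-intro {f = f} h = allE-intro λ x → allE-intro λ y →
  if-intro λ q → ==-intro {a = x} {y} (h (==-elim {a = f x} {f y} q))

-- A preimage exists, so the default value of the fold in `inv` is never reached.
inv-spec : ∀ {N} (φ : Perm (Fin N)) e → inv (to φ) e ≡ from φ e
inv-spec {N} φ e = Perm.injective φ (trans (go id (from φ e , to∘from φ e)) (sym (to∘from φ e)))
  where
  f = to φ
  go : ∀ {n} (g : Fin n → Fin N) → (∃ λ i → f (g i) ≡ e) →
    f (L.foldr (λ e' acc → if f e' == e then e' else acc) e (L.tabulate g)) ≡ e
  go {suc n} g (i , q) with f (g zero) == e in b
  ... | true = ==-elim b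
  go {suc n} g (zero , q) | false = ⊥-elim (case (trans (sym b) (==-intro q)))
    where
    case : false ≡ true → ⊥
    case ()
  go {suc n} g (suc i , q) | false = go (g ∘ suc) (i , q)

module Reflect {N : ℕ} (f : Fin N → Fin N) (φ : Perm (Fin N)) (f≗ : ∀ x → f x ≡ to φ x) where
  open Finite (fin-card N) using (returns; period; orb-bound; orb-sym; orb?)

  f-inj : ∀ {x y} → f x ≡ f y → x ≡ y
  f-inj {x} {y} e = Perm.injective φ (trans (sym (f≗ x)) (trans e (f≗ y)))

  φf : Perm (Fin N)
  φf = fin-perm f f-inj

  sameOrbit-elim : ∀ {x y} → sameOrbit f x y ≡ true → Orb f x y
  sameOrbit-elim {x} {y} e = let (k , _ , h) = any-apply-elim (λ k → iter f k x == y) id N e in k , ==-elim h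

  sameOrbit-intro : ∀ {x y} → Orb f x y → sameOrbit f x y ≡ true
  sameOrbit-intro {x} {y} o = let (k , k<N , h) = orb-bound φf o in
    any-apply-intro (λ k → iter f k x == y) id k<N (==-intro h)

  -- `firstWhere` answers 0 when nothing is found; a return within `N` steps makes its value
  -- meaningful.
  orbitSize-per : ∀ x → Per f x (orbitSize f x)
  orbitSize-per x with returns φf x
  ... | d , ed , d<N with firstWhere-apply (λ k → iter f k x == x) suc N d<N (==-intro ed)
  ... | j , eq , pj , mn , _ = subst (Per f x) (sym (trans (cong (firstWhere _) (Lₚ.map-upTo suc N)) eq)) (go (period φf x))
    where
    go : (∃ λ q → Per f x q × q ≤ N) → Per f x (suc j)
    go (zero , mkPer () _ _ , _)
    go (suc q , pp , _) = subst (Per f x) (cong suc (ℕₚ.≤-antisym q≤j j≤q)) pp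
      where
      q≤j : q ≤ j
      q≤j = ℕ.s≤s⁻¹ (∣⇒≤ (per-div pp (suc j) (==-elim pj)))
      j≤q : j ≤ q
      j≤q = ℕₚ.≮⇒≥ λ l → case (trans (sym (mn q l)) (==-intro (per-closes pp)))
        where
        case : false ≡ true → ⊥
        case ()

  isRep-elim : ∀ {x y} → isRep f x ≡ true → Orb f x y → toℕ x ≤ toℕ y
  isRep-elim {x} {y} e o = ≤ᵇ-elim (if-elim (allE-elim e y) (sameOrbit-intro o))

  isRep-intro : ∀ {x} → (∀ y → Orb f x y → toℕ x ≤ toℕ y) → isRep f x ≡ true
  isRep-intro h = allE-intro λ y → if-intro λ s → ≤ᵇ-intro (h y (sameOrbit-elim s))

  min-rep : ∀ x → ∃ λ y → Orb f x y × isRep f y ≡ true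
  min-rep x with least (λ k → ∃ λ y → toℕ y ≡ k × Orb f x y)
      (λ k → Finₚ.any? λ y → (toℕ y ℕₚ.≟ k) ×-dec orb? φf x y) {toℕ x} (x , refl , orb-refl)
  ... | _ , (y , refl , o) , _ , mn = y , o , isRep-intro λ z o' → ℕₚ.≮⇒≥ λ l → mn (toℕ z) l (z , refl , orb-trans o o')

  rep-unique : ∀ {x y} → isRep f x ≡ true → isRep f y ≡ true → Orb f x y → x ≡ y
  rep-unique a b o = Finₚ.toℕ-injective (ℕₚ.≤-antisym (isRep-elim a o) (isRep-elim b (orb-sym φf o)))

  reps-count : (P : Fin N → Bool) → (∀ {x y} → Orb f x y → P x ≡ true → P y ≡ true) →
    ∀ {c} → Size (λ e → isRep f e ∧ P e ≡ true) c → Count (λ e → P e ≡ true) (Orb f) c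
  reps-count P resp s = count-map s id (λ x h → proj₂ (∧-true h))
    (λ hx hy o → rep-unique (proj₁ (∧-true hx)) (proj₁ (∧-true hy)) o)
    (λ y py → let (z , o , r) = min-rep y in z , ∧-intro r (resp o py) , λ { _ refl → o })

  nOrbits-count : Count {Fin N} All⊤ (Orb f) (nOrbits f)
  nOrbits-count = count-map (countE-size (isRep f)) id (λ _ _ → tt) rep-unique
    (λ y _ → let (z , o , r) = min-rep y in z , r , λ { _ refl → o })

-- Saturation, shared by `reach` and `reachIn`. If `b` first appears at level `k₀`, going back
-- yields a point of each exact level up to `k₀`; these points are distinct, so `k₀ < N` and `N`
-- rounds suffice.
levels : ∀ {N} (r : ℕ → Fin N → Bool) →
  (∀ {k b} → r (suc k) b ≡ true → r k b ≡ true ⊎ ∃ λ c → r k c ≡ true × (∀ j → r j c ≡ true → r (suc j) b ≡ true)) →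
  (∀ {k b} → r k b ≡ true → r (suc k) b ≡ true) →
  ∀ {k b} → r k b ≡ true → r N b ≡ true
levels {N} r back mono {k} {b} h with least (λ k → r k b ≡ true) (λ k → r k b Boolₚ.≟ true) {k} h
... | k₀ , h₀ , _ , mn = mono* k₀ (ℕₚ.<⇒≤ k₀<N) h₀
  where
  mono* : ∀ k {N b} → k ≤ N → r k b ≡ true → r N b ≡ true
  mono* k {N} l h with ℕₚ.m≤n⇒m<n∨m≡n l
  ... | inj₂ refl = h
  mono* k {suc N} l h | inj₁ (s≤s l') = mono (mono* k l' h)
  Exact : ℕ → Fin N → Set
  Exact j x = r j x ≡ true × (∀ i → i < j → ¬ r i x ≡ true)
  down : ∀ {j x} → Exact (suc j) x → ∃ (Exact j)
  down {j} {x} (e , m) with back e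
  ... | inj₁ q = ⊥-elim (m j ℕₚ.≤-refl q)
  ... | inj₂ (c , rc , f) = c , rc , λ i l q → m (suc i) (s≤s l) (f i q)
  chain : ∀ d j → d + j ≡ k₀ → ∃ (Exact j)
  chain zero j refl = b , h₀ , mn
  chain (suc d) j e = down (proj₂ (chain d (suc j) (trans (ℕₚ.+-suc d j) e)))
  at : (i : Fin (suc k₀)) → ∃ (Exact (toℕ i))
  at i = chain (k₀ ∸ toℕ i) (toℕ i) (ℕₚ.m∸n+n≡m (ℕ.s≤s⁻¹ (Finₚ.toℕ<n i)))
  exact-unique : ∀ {j j' x} → Exact j x → Exact j' x → j ≡ j'
  exact-unique {j} {j'} (a , m) (a' , m') with ℕₚ.<-cmp j j'
  ... | tri< l _ _ = ⊥-elim (m' j l a)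
  ... | tri≈ _ e _ = e
  ... | tri> _ _ l = ⊥-elim (m j' l a')
  k₀<N : k₀ < N
  k₀<N = Finₚ.injective⇒≤ {f = λ i → proj₁ (at i)} λ {i} {j} e →
    Finₚ.toℕ-injective (exact-unique (proj₂ (at i)) (subst (Exact (toℕ j)) (sym e) (proj₂ (at j))))

reach-conn : ∀ {N} (f g : Fin N → Fin N) k {a b} → reach f g k a b ≡ true → Conn f g a b
reach-conn f g zero e = subst (Conn f g _) (==-elim e) done
reach-conn f g (suc k) {a} {b} e with ∨-true {reach f g k a b} e
... | inj₁ h = reach-conn f g k h
... | inj₂ h with anyE-elim h
... | c , hc with ∧-true {reach f g k a c} hc
... | h₁ , h₂ with ∨-true {f c == b} h₂
... | inj₁ q = conn-trans (reach-conn f g k h₁) (via₁ (subst (Conn f g _) (==-elim q) done))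
... | inj₂ q = conn-trans (reach-conn f g k h₁) (via₂ (subst (Conn f g _) (==-elim q) done))

conn-reach : ∀ {N} (f g : Fin N → Fin N) {a b} → Conn f g a b → reach f g N a b ≡ true
conn-reach {N} f g {a} {b} c = levels (λ k b → reach f g k a b) (λ {k} → back {k}) (λ h → ∨-introˡ h) {proj₁ (go 0 (==-refl a) c)} (proj₂ (go 0 (==-refl a) c))
  where
  snoc : ∀ k {x y} → reach f g k a x ≡ true → (f x == y ∨ g x == y) ≡ true → reach f g (suc k) a y ≡ true
  snoc k {x} {y} h s = ∨-introʳ {reach f g k a y} (anyE-intro x (∧-intro h s))
  go : ∀ k {x} → reach f g k a x ≡ true → Conn f g x b → ∃ λ k → reach f g k a b ≡ true
  go k h done = k , h
  go k {x} h (via₁ c) = go (suc k) (snoc k h (∨-introˡ (==-refl (f x)))) c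
  go k {x} h (via₂ c) = go (suc k) (snoc k h (∨-introʳ {f x == g x} (==-refl (g x)))) c
  back : ∀ {k b} → reach f g (suc k) a b ≡ true →
    reach f g k a b ≡ true ⊎ ∃ λ c → reach f g k a c ≡ true × (∀ j → reach f g j a c ≡ true → reach f g (suc j) a b ≡ true)
  back {k} {b} e with ∨-true {reach f g k a b} e
  ... | inj₁ h = inj₁ h
  ... | inj₂ h with anyE-elim h
  ... | c , hc with ∧-true {reach f g k a c} hc
  ... | h₁ , h₂ = inj₂ (c , h₁ , λ j q → snoc j q h₂)

-- The standard cycle, to which contours are relabelled; it also shifts the sheets of the `p`-fold
-- cover.
rot : ∀ {M} → Fin (suc M) → Fin (suc M)
rot {M} x = fromℕ< (m%n<n (suc (toℕ x)) (suc M))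

suc-% : ∀ a n .{{_ : NonZero n}} → suc (a % n) % n ≡ suc a % n
suc-% a n = trans (DM.%-distribˡ-+ 1 (a % n) n)
  (trans (cong (λ z → (1 % n + z) % n) (DM.m%n%n≡m%n a n)) (sym (DM.%-distribˡ-+ 1 a n)))

toℕ-iter-rot : ∀ {M} k (x : Fin (suc M)) → toℕ (iter rot k x) ≡ (k + toℕ x) % suc M
toℕ-iter-rot {M} zero x = sym (DM.m<n⇒m%n≡m (Finₚ.toℕ<n x))
toℕ-iter-rot {M} (suc k) x = trans (Finₚ.toℕ-fromℕ< _)
  (trans (cong (λ z → suc z % suc M) (toℕ-iter-rot k x)) (suc-% (k + toℕ x) (suc M)))

iter-rot-full : ∀ {M} (x : Fin (suc M)) → iter rot (suc M) x ≡ x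
iter-rot-full {M} x = Finₚ.toℕ-injective (trans (toℕ-iter-rot (suc M) x)
  (trans (cong (_% suc M) (ℕₚ.+-comm (suc M) (toℕ x))) (trans (DM.[m+n]%n≡m%n (toℕ x) (suc M)) (DM.m<n⇒m%n≡m (Finₚ.toℕ<n x)))))

rotation : ∀ M → Perm (Fin (suc M))
rotation M = mkPerm rot (iter rot M) iter-rot-full (λ x → trans (iter-comm rot M x) (iter-rot-full x))

iter-rot-zero : ∀ {M} (x : Fin (suc M)) → iter rot (toℕ x) zero ≡ x
iter-rot-zero {M} x = Finₚ.toℕ-injective (trans (toℕ-iter-rot (toℕ x) zero)
  (trans (cong (_% suc M) (ℕₚ.+-identityʳ (toℕ x))) (DM.m<n⇒m%n≡m (Finₚ.toℕ<n x))))

count-× : ∀ {X Y : Set} {P : X → Set} {Q : Y → Set} {R S a b} → Count P R a → Count Q S b →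
  Count {X × Y} (λ (x , y) → P x × Q y) (λ (x , y) (x' , y') → R x x' × S y y') (a * b)
count-× {X} {Y} {P} {Q} {R} {S} {a} {b} c d = record
  { rep = λ i → rep c (proj₁ (Fin.remQuot {a} b i)) , rep d (proj₂ (Fin.remQuot {a} b i))
  ; repP = λ i → repP c _ , repP d _
  ; sep = λ i j (r , s) → trans (sym (Finₚ.combine-remQuot {a} b i)) (trans
      (cong₂ Fin.combine (sep c _ _ r) (sep d _ _ s)) (Finₚ.combine-remQuot {a} b j))
  ; cover = λ (x , y) (px , qy) → let (i , r) = cover c x px ; (j , s) = cover d y qy in
      Fin.combine i j , subst (λ z → R x (rep c (proj₁ z)) × S y (rep d (proj₂ z))) (sym (Finₚ.remQuot-combine i j)) (r , s) }

size-× : ∀ {X Y : Set} {P : X → Set} {Q : Y → Set} {a b} → Size P a → Size Q b →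
  Size {X × Y} (λ (x , y) → P x × Q y) (a * b)
size-× c d = count-≗ (count-× c d) (λ _ p → p) (λ _ p → p) (λ (a , b) → cong₂ _,_ a b) (λ e → cong proj₁ e , cong proj₂ e)

card-× : ∀ {X Y : Set} {a b} → Card X a → Card Y b → Card (X × Y) (a * b)
card-× c d = count-≗ (size-× c d) (λ _ _ → tt) (λ _ _ → tt , tt) id id

-- In a planar connected pair ρ , ω the p-fold cover splits: every closed walk has a number
-- of ω-steps divisible by p.

module Cover {N : ℕ} (q : ℕ) (ρ ω β : Perm (Fin N)) (ρω : ∀ x → to ρ (to ω x) ≡ to β x)
  (ω-div : ∀ {k x} → iter (to ω) k x ≡ x → suc q ∣ k) (β-div : ∀ {k x} → iter (to β) k x ≡ x → suc q ∣ k)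
  (euler : ∀ {a b c} → Count {Fin N} All⊤ (Orb (to ρ)) a → Count {Fin N} All⊤ (Orb (to ω)) b →
     Count {Fin N} All⊤ (Orb (to β)) c → a + b + c ≡ N + 2)
  (v : Fin N) (conn : ∀ x → Conn (to ρ) (to ω) x v) where

  p : ℕ
  p = suc q

  -- The second component counts oriented edges modulo `p`: `ω` and `β` shift it by one, turning
  -- around a vertex leaves it alone.
  Y : Set
  Y = Fin N × Fin p

  cardY : Card Y (N * p)
  cardY = card-× (fin-card N) (fin-card p)

  module Y = Finite cardY using (orb-isEq; orbits)
  module YP = FinitePerm cardY using (conn-sym; Covers; genus)
  open Finite (fin-card N) using (orbits)

  _⊗_ : Perm (Fin N) → Perm (Fin p) → Perm Y
  f ⊗ g = mkPerm (λ (x , c) → to f x , to g c) (λ (x , c) → from f x , from g c)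
    (λ (x , c) → cong₂ _,_ (to∘from f x) (to∘from g c)) (λ (x , c) → cong₂ _,_ (from∘to f x) (from∘to g c))

  idP : Perm (Fin p)
  idP = mkPerm id id (λ _ → refl) (λ _ → refl)

  iter-⊗ : ∀ f g k x c → iter (to (f ⊗ g)) k (x , c) ≡ (iter (to f) k x , iter (to g) k c)
  iter-⊗ f g zero x c = refl
  iter-⊗ f g (suc k) x c = cong (to (f ⊗ g)) (iter-⊗ f g k x c)

  -- A cycle of `f` whose length shifts no sheet lifts to `p` disjoint cycles.
  lift-≤ : ∀ f g → (∀ {k x} c → iter (to f) k x ≡ x → iter (to g) k c ≡ c) → ∀ {a b} →
    Count {Fin N} All⊤ (Orb (to f)) a → Count {Y} All⊤ (Orb (to (f ⊗ g))) b → a * p ≤ b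
  lift-≤ f g h {a} ca cb = family-≤ (Y.orb-isEq (f ⊗ g)) cb (rep d) (λ _ → tt) sp
    where
    d = count-× ca (fin-card p)
    sp : ∀ i j → Orb (to (f ⊗ g)) (rep d i) (rep d j) → i ≡ j
    sp i j (k , e) = sep d i j (o , sym (trans (sym (cong proj₂ e')) (h {k} {x} _ ek)))
      where
      x = proj₁ (rep d i)
      e' : (iter (to f) k x , iter (to g) k (proj₂ (rep d i))) ≡ rep d j
      e' = trans (sym (iter-⊗ f g k _ _)) e
      o : Orb (to f) x (proj₁ (rep d j))
      o = k , cong proj₁ e'
      ek : iter (to f) k x ≡ x
      ek = trans (cong proj₁ e') (cong (rep ca) (sym (sep ca _ _ o)))

  rot-div : ∀ {k} → p ∣ k → ∀ (c : Fin p) → iter rot k c ≡ c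
  rot-div (divides m refl) c = iter-* rot p c (iter-rot-full c) m

  ρ̃ = ρ ⊗ idP
  ω̃ = ω ⊗ rotation q
  β̃ = β ⊗ rotation q

  iter-id : ∀ k (c : Fin p) → iter id k c ≡ c
  iter-id zero c = refl
  iter-id (suc k) c = iter-id k c

  lift-conn : ∀ {x y} → Conn (to ρ) (to ω) x y → ∀ c → ∃ λ d → Conn (to ρ̃) (to ω̃) (x , c) (y , d)
  lift-conn done c = c , done
  lift-conn (via₁ w) c = let (d , z) = lift-conn w c in d , via₁ z
  lift-conn (via₂ w) c = let (d , z) = lift-conn w (rot c) in d , via₂ z

  -- If two sheets over `v` were joined, `q` points would cover all components. But the cover has at
  -- least `p (N + 2)` cycles, more than the permitted `N p + 2 q`.
  split : ∀ {a b} → Conn (to ρ̃) (to ω̃) (v , a) (v , b) → a ≡ b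
  split {a} {b} cab with a Finₚ.≟ b
  ... | yes e = e
  ... | no ne = ⊥-elim (go (proj₂ (orbits ρ)) (proj₂ (orbits ω)) (proj₂ (orbits β)) (proj₂ (Y.orbits ρ̃)) (proj₂ (Y.orbits ω̃)) (proj₂ (Y.orbits β̃)))
    where
    h : Fin q → Y
    h i = v , Fin.punchIn a i
    cov : YP.Covers (to ρ̃) (to ω̃) h
    cov (x , c) with lift-conn (conn x) c
    ... | d , w with a Finₚ.≟ d
    ... | no ne' = Fin.punchOut ne' , subst (λ z → Conn _ _ (x , c) (v , z)) (sym (Finₚ.punchIn-punchOut ne')) w
    ... | yes refl = Fin.punchOut ne , subst (λ z → Conn _ _ (x , c) (v , z)) (sym (Finₚ.punchIn-punchOut ne)) (conn-trans w cab)
    go : ∀ {a b c a' b' c'} → Count {Fin N} All⊤ (Orb (to ρ)) a → Count {Fin N} All⊤ (Orb (to ω)) b →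
      Count {Fin N} All⊤ (Orb (to β)) c → Count {Y} All⊤ (Orb (to ρ̃)) a' → Count {Y} All⊤ (Orb (to ω̃)) b' →
      Count {Y} All⊤ (Orb (to β̃)) c' → ⊥
    go {a} {b} {c} {a'} {b'} {c'} ca cb cc ca' cb' cc' = ℕₚ.1+n≰n (ℕₚ.≤-trans (ℕₚ.n≤1+n (suc (q + q))) (ℕₚ.+-cancelˡ-≤ (N * p) _ _ (begin
        N * p + suc (suc (q + q)) ≡⟨ solve 2 (λ n q → n :* (con 1 :+ q) :+ (con 2 :+ (q :+ q)) := (n :+ con 2) :* (con 1 :+ q)) refl N q ⟩
        (N + 2) * p ≡⟨ cong (_* p) (sym (euler ca cb cc)) ⟩
        (a + b + c) * p ≡⟨ trans (ℕₚ.*-distribʳ-+ p (a + b) c) (cong (_+ c * p) (ℕₚ.*-distribʳ-+ p a b)) ⟩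
        a * p + b * p + c * p ≤⟨ ℕₚ.+-mono-≤ (ℕₚ.+-mono-≤ (lift-≤ ρ idP (λ {k} c _ → iter-id k c) ca ca') (lift-≤ ω (rotation q) (λ {k} {x} c e → rot-div (ω-div {k} {x} e) c) cb cb'))
            (lift-≤ β (rotation q) (λ {k} {x} c e → rot-div (β-div {k} {x} e) c) cc cc') ⟩
        a' + b' + c' ≤⟨ YP.genus ρ̃ ω̃ ca' cb' (count-≗ cc' (λ _ p → p) (λ _ p → p) (orb-cong (λ (x , c) → cong (_, rot c) (sym (ρω x)))) (orb-cong (λ (x , c) → cong (_, rot c) (ρω x)))) h cov ⟩
        N * p + (q + q) ∎)))
      where
      open ℕₚ.≤-Reasoning
      open +-*-Solver

%-cong-div : ∀ a d n .{{_ : NonZero n}} → a % n ≡ (a + d) % n → n ∣ d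
%-cong-div a d n e = ∣m+n∣m⇒∣n {n} {(a / n) * n} {d} (divides ((a + d) / n) (ℕₚ.+-cancelˡ-≡ (a % n) _ _ (begin
    a % n + ((a / n) * n + d) ≡⟨ sym (ℕₚ.+-assoc (a % n) _ d) ⟩
    (a % n + (a / n) * n) + d ≡⟨ cong (_+ d) (sym (m≡m%n+[m/n]*n a n)) ⟩
    a + d ≡⟨ m≡m%n+[m/n]*n (a + d) n ⟩
    (a + d) % n + ((a + d) / n) * n ≡⟨ cong (_+ ((a + d) / n) * n) (sym e) ⟩
    a % n + ((a + d) / n) * n ∎))) (n∣m*n (a / n))
  where open ≡-Reasoning

-- Distances to the pointed vertex as labels

module Dist {N : ℕ} (q : ℕ) (1≤q : 1 ≤ q) where
  open Finite (fin-card N) using (period; orb-sym; orb-isEq)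
  open FinitePerm (fin-card N) using (conn-sym)

  p : ℕ
  p = suc q

  record IsLab (β ω : Fin N → Fin N) (ℓ : Fin N → ℕ) : Set where
    field
      β-inj : ∀ {x y} → β x ≡ β y → x ≡ y
      ω-inj : ∀ {x y} → ω x ≡ ω y → x ≡ y
      step  : ∀ x → ℓ x ≡ suc (ℓ (ω x)) ⊎ ℓ (ω x) ≡ ℓ x + q
      good  : Labels.Good (fin-card N) q 1≤q ℓ (ℓ ∘ ω) step (fin-perm β β-inj) (fin-perm ω ω-inj)

  module Walks (β ω : Fin N → Fin N) (β-inj : ∀ {x y} → β x ≡ β y → x ≡ y)
      (ω-inj : ∀ {x y} → ω x ≡ ω y → x ≡ y) where
    βP = fin-perm β β-inj
    ωP = fin-perm ω ω-inj
    ρ = βP ∙ ωP ⁻¹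

    vp≗ : ∀ x → vertexPerm β ω x ≡ to ρ x
    vp≗ x = cong β (inv-spec ωP x)

    module Rρ = Reflect (vertexPerm β ω) ρ vp≗
      using (sameOrbit-elim; sameOrbit-intro; min-rep; rep-unique; nOrbits-count)
    module Rβ = Reflect β βP (λ _ → refl) using (orbitSize-per; nOrbits-count)
    module Rω = Reflect ω ωP (λ _ → refl) using (orbitSize-per; nOrbits-count)

    same-elim : ∀ {x y} → sameOrbit (vertexPerm β ω) x y ≡ true → Orb (to ρ) x y
    same-elim e = orb-cong vp≗ (Rρ.sameOrbit-elim e)

    same-intro : ∀ {x y} → Orb (to ρ) x y → sameOrbit (vertexPerm β ω) x y ≡ true
    same-intro o = Rρ.sameOrbit-intro (orb-cong (λ x → sym (vp≗ x)) o)

    ρω : ∀ x → to ρ (ω x) ≡ β x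
    ρω x = cong β (from∘to ωP x)

    count-ρ : Count {Fin N} All⊤ (Orb (to ρ)) (nOrbits (vertexPerm β ω))
    count-ρ = count-≗ Rρ.nOrbits-count (λ _ p → p) (λ _ p → p) (orb-cong vp≗) (orb-cong (λ x → sym (vp≗ x)))

    module To (v : Fin N) where

      record RI (k : ℕ) (e : Fin N) : Set where
        constructor mkRI
        field isRI : reachIn β ω v k e ≡ true
      open RI

      ri-zero : ∀ {e} → Orb (to ρ) e v → RI 0 e
      ri-zero o = mkRI (same-intro o)

      ri-zero⁻ : ∀ {e} → RI 0 e → Orb (to ρ) e v
      ri-zero⁻ (mkRI h) = same-elim h

      ri-mono : ∀ {k e} → RI k e → RI (suc k) e
      ri-mono (mkRI h) = mkRI (∨-introˡ h)

      ri-step : ∀ {k e f} → Orb (to ρ) e f → RI k (ω f) → RI (suc k) e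
      ri-step {k} {e} {f} o (mkRI h) = mkRI (∨-introʳ {reachIn β ω v k e} (anyE-intro f (∧-intro (same-intro o) h)))

      ri-back : ∀ {k e} → RI (suc k) e → RI k e ⊎ ∃ λ f → Orb (to ρ) e f × RI k (ω f)
      ri-back {k} {e} (mkRI h) with ∨-true {reachIn β ω v k e} h
      ... | inj₁ a = inj₁ (mkRI a)
      ... | inj₂ a = let (f , b) = anyE-elim a ; (o , r) = ∧-true b in inj₂ (f , same-elim o , mkRI r)

      ri-resp : ∀ k {a b} → Orb (to ρ) a b → RI k a → RI k b
      ri-resp zero o h = ri-zero (orb-trans (orb-sym ρ o) (ri-zero⁻ h))
      ri-resp (suc k) o h with ri-back h
      ... | inj₁ a = ri-mono (ri-resp k o a)
      ... | inj₂ (f , o' , r) = ri-step (orb-trans (orb-sym ρ o) o') r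

      ri-bound : ∀ {k e} → RI k e → RI N e
      ri-bound {k} {e} (mkRI h) = mkRI (levels (reachIn β ω v) (λ {k} {b} → back {k} {b}) (λ {k} {e} h → isRI (ri-mono {k} {e} (mkRI h))) {k} {e} h)
        where
        back : ∀ {k b} → reachIn β ω v (suc k) b ≡ true → reachIn β ω v k b ≡ true ⊎
          ∃ λ c → reachIn β ω v k c ≡ true × (∀ j → reachIn β ω v j c ≡ true → reachIn β ω v (suc j) b ≡ true)
        back {k} {b} h with ri-back {k} {b} (mkRI h)
        ... | inj₁ (mkRI a) = inj₁ a
        ... | inj₂ (f , o , mkRI r) = inj₂ (ω f , r , λ j q → isRI (ri-step {j} o (mkRI q)))

      ri-conn : ∀ {e} → Conn β ω e v → ∃ λ k → RI k e
      ri-conn done = 0 , ri-zero orb-refl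
      -- `β x` and `ω x` leave the same vertex, so a step along `β` is traded for one along `ω`.
      ri-conn (via₁ {x} c) = let (k , h) = ri-conn c in suc k , ri-step orb-refl (ri-resp k (orb-sym ρ (1 , ρω x)) h)
      ri-conn (via₂ c) = let (k , h) = ri-conn c in suc k , ri-step orb-refl h

      abstract
        t : Fin N → ℕ
        t = typeOrigin β ω v

        t-def : ∀ e → t e ≡ typeOrigin β ω v e
        t-def e = refl

        t-spec : ∀ {k e} → RI k e → RI (t e) e × (∀ j → RI j e → t e ≤ j)
        t-spec {k} {e} h with firstWhere-apply (λ k → reachIn β ω v k e) id (suc N) (ℕₚ.n<1+n N) (isRI (ri-bound h))
        ... | j , eq , pj , mn , _ = subst (λ z → RI z e) (sym eq) (mkRI pj) ,
              λ { i (mkRI hi) → subst (_≤ i) (sym eq) (ℕₚ.≮⇒≥ (λ l → case (trans (sym (mn i l)) hi))) }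
          where
          case : false ≡ true → ⊥
          case ()

  module FromConstellation (β ω : Fin N → Fin N) (isC : isConstellation p β ω ≡ true) where
    private
      c₁ = ∧-true {isBij β} isC
      c₂ = ∧-true {isBij ω} (proj₂ c₁)
      c₃ = ∧-true {allE (λ e → orbitSize β e ℕ.≡ᵇ p)} (proj₂ c₂)
      c₄ = ∧-true {allE (λ e → any (λ k → orbitSize ω e ℕ.≡ᵇ k * p) (L.upTo (suc N)))} (proj₂ c₃)
      c₅ = ∧-true {transitive β ω} (proj₂ c₄)

    β-inj : ∀ {x y} → β x ≡ β y → x ≡ y
    β-inj = isBij-elim (proj₁ c₁)
    ω-inj : ∀ {x y} → ω x ≡ ω y → x ≡ y
    ω-inj = isBij-elim (proj₁ c₂)

    open Walks β ω β-inj ω-inj using (βP; ωP; ρ; module Rβ; module Rω; ρω; count-ρ; module To)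

    β-per : ∀ x → Per β x p
    β-per x = subst (Per β x) (≡ᵇ-elim (allE-elim (proj₁ c₃) x)) (Rβ.orbitSize-per x)

    size-div : ∀ x → p ∣ orbitSize ω x
    size-div x = go (any-apply-elim (λ k → orbitSize ω x ℕ.≡ᵇ k * p) id (suc N)
        (allE-elim {P = λ e → any (λ k → orbitSize ω e ℕ.≡ᵇ k * p) (L.upTo (suc N))} (proj₁ c₄) x))
      where
      go : (∃ λ k → k < suc N × (orbitSize ω x ℕ.≡ᵇ k * p) ≡ true) → p ∣ orbitSize ω x
      go (j , _ , h) = divides j (≡ᵇ-elim h)

    ω-div : ∀ {k x} → iter ω k x ≡ x → p ∣ k
    ω-div {k} {x} e = ∣-trans (size-div x) (per-div (Rω.orbitSize-per x) k e)

    conn : ∀ x y → Conn β ω x y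
    conn x y = reach-conn β ω N (allE-elim (allE-elim (proj₁ c₅) x) y)

    euler : ∀ {a b c} → Count {Fin N} All⊤ (Orb (to ρ)) a → Count {Fin N} All⊤ (Orb β) b →
                  Count {Fin N} All⊤ (Orb ω) c → a + b + c ≡ N + 2
    euler ca cb cc = trans (cong₂ _+_ (cong₂ _+_ (count-unique (orb-isEq ρ) ca count-ρ) (count-unique (orb-isEq βP) cb Rβ.nOrbits-count))
      (count-unique (orb-isEq ωP) cc Rω.nOrbits-count)) (≡ᵇ-elim (proj₂ c₅))

    euler′ : ∀ {a b c} → Count {Fin N} All⊤ (Orb (to ρ)) a → Count {Fin N} All⊤ (Orb ω) b →
                  Count {Fin N} All⊤ (Orb β) c → a + b + c ≡ N + 2
    euler′ {a} {b} {c} ca cb cc = trans (solve 3 (λ a b c → a :+ b :+ c := a :+ c :+ b) refl a b c) (euler ca cc cb)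
      where open +-*-Solver

    module _ (v : Fin N) where
      open To v using (RI; ri-zero; ri-zero⁻; ri-step; ri-back; ri-resp; ri-conn; t; t-spec)

      reachable : ∀ e → ∃ λ k → RI k e
      reachable e = ri-conn (conn e v)

      t-reach : ∀ e → RI (t e) e
      t-reach e = proj₁ (t-spec (proj₂ (reachable e)))

      t-min : ∀ e j → RI j e → t e ≤ j
      t-min e = proj₂ (t-spec (proj₂ (reachable e)))

      t-self : t v ≡ 0
      t-self = ℕₚ.n≤0⇒n≡0 (t-min v 0 (ri-zero orb-refl))

      t-ρ : ∀ {x y} → Orb (to ρ) x y → t x ≡ t y
      t-ρ {x} {y} o = ℕₚ.≤-antisym (t-min x (t y) (ri-resp (t y) (orb-sym ρ o) (t-reach y))) (t-min y (t x) (ri-resp (t x) o (t-reach x)))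

      t-step : ∀ e → t e ≤ suc (t (ω e))
      t-step e = t-min e (suc (t (ω e))) (ri-step orb-refl (t-reach (ω e)))

      t-β : ∀ e → t (β e) ≡ t (ω e)
      t-β e = sym (t-ρ (1 , ρω e))

      -- The other `q` edges of the black face of `e` lead from its end back to its origin.
      t-up : ∀ e → t (ω e) ≤ t e + q
      t-up e = subst (λ z → t (ω e) ≤ z + q) (cong t (trans (iter-comm β q e) (per-closes (β-per e))))
        (subst (_≤ t (iter β q (β e)) + q) (t-β e) (go q (β e)))
        where
        go : ∀ j x → t x ≤ t (iter β j x) + j
        go zero x = ℕₚ.≤-reflexive (sym (ℕₚ.+-identityʳ _))
        go (suc j) x = ℕₚ.≤-trans (go j x) (ℕₚ.≤-trans (ℕₚ.+-monoˡ-≤ j (ℕₚ.≤-trans (t-step y) (ℕₚ.≤-reflexive (cong suc (sym (t-β y))))))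
              (ℕₚ.≤-reflexive (sym (ℕₚ.+-suc _ j))))
          where y = iter β j x

      conn′ : ∀ x → Conn (to ρ) ω x v
      conn′ x = conn-map id (λ x → via₂ (via₁ (subst (λ z → Conn (to ρ) ω z (β x)) (sym (ρω x)) done))) (λ _ → via₂ done) (conn x v)

      module C = Cover q ρ ωP βP ρω (λ {k} {x} → ω-div {k} {x}) (λ {k} {x} e → per-div (β-per x) k e)
        euler′ v conn′ using (module YP; ρ̃; ω̃; split)

      lift-ρ : ∀ {x y} c → Orb (to ρ) x y → Conn (to C.ρ̃) (to C.ω̃) (x , c) (y , c)
      lift-ρ c = orb-induct (λ x y → Conn (to C.ρ̃) (to C.ω̃) (x , c) (y , c)) (λ _ → done) via₁

      -- A shortest path, lifted to the cover, ends on the sheet shifted by its length.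
      walk : ∀ k {e} c → RI k e → (∀ j → RI j e → k ≤ j) → Conn (to C.ρ̃) (to C.ω̃) (e , c) (v , iter rot k c)
      walk zero c h m = lift-ρ c (ri-zero⁻ h)
      walk (suc k) {e} c h m with ri-back h
      ... | inj₁ a = ⊥-elim (ℕₚ.1+n≰n (m k a))
      ... | inj₂ (f , o , r) = conn-trans (lift-ρ c o) (via₂ (subst (λ z → Conn _ _ (ω f , rot c) (v , z)) (iter-comm rot k c)
             (walk k (rot c) r (λ j rj → ℕ.s≤s⁻¹ (m (suc j) (ri-step o rj))))))

      -- A shortest path from `e`, and the step along `e` followed by a shortest path from `ω e`,
      -- lift to walks from one point that end over `v`. Distinct sheets over `v` are not joined, so
      -- the lengths agree modulo `p`.
      t-mod : ∀ e → t e % p ≡ suc (t (ω e)) % p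
      t-mod e = trans (cong (_% p) (sym (ℕₚ.+-identityʳ (t e)))) (trans (sym (toℕ-iter-rot (t e) zero)) (trans (cong toℕ (C.split
          (conn-trans (C.YP.conn-sym C.ρ̃ C.ω̃ (walk (t e) zero (t-reach e) (t-min e)))
            (via₂ (subst (λ z → Conn _ _ (ω e , rot zero) (v , z)) (iter-comm rot (t (ω e)) zero) (walk (t (ω e)) (rot zero) (t-reach (ω e)) (t-min (ω e))))))))
          (trans (toℕ-iter-rot (suc (t (ω e))) zero) (cong (_% p) (ℕₚ.+-identityʳ (suc (t (ω e))))))))

      -- The difference `suc (t (ω e)) - t e` lies between 0 and `p` and is a multiple of `p`.
      t-cases : ∀ e → t e ≡ suc (t (ω e)) ⊎ t (ω e) ≡ t e + q
      t-cases e = go (suc (t (ω e)) ∸ t e) (sym (ℕₚ.m+[n∸m]≡n (t-step e)))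
        where
        go : ∀ d → suc (t (ω e)) ≡ t e + d → t e ≡ suc (t (ω e)) ⊎ t (ω e) ≡ t e + q
        go zero eq = inj₁ (sym (trans eq (ℕₚ.+-identityʳ _)))
        go (suc d) eq = inj₂ (ℕₚ.suc-injective (trans eq (trans (cong (t e +_) (cong suc d≡q)) (ℕₚ.+-suc _ q))))
          where
          d≤q : d ≤ q
          d≤q = ℕₚ.+-cancelˡ-≤ (t e) _ _ (subst (_≤ t e + q) (ℕₚ.suc-injective (trans eq (ℕₚ.+-suc _ d))) (t-up e))
          q≤d : q ≤ d
          q≤d = ℕ.s≤s⁻¹ (∣⇒≤ (%-cong-div (t e) (suc d) p (trans (t-mod e) (cong (_% p) eq))))
          d≡q : d ≡ q
          d≡q = ℕₚ.≤-antisym d≤q q≤d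

      module _ (s : ℕ) where

        -- The shift `s` is 0 for `F_n`; for `V_i` it lifts the root edge to label `i`.
        ℓ : Fin N → ℕ
        ℓ e = s + t e

        lab-step : ∀ x → ℓ x ≡ suc (ℓ (ω x)) ⊎ ℓ (ω x) ≡ ℓ x + q
        lab-step x = go (t-cases x)
          where
          go : t x ≡ suc (t (ω x)) ⊎ t (ω x) ≡ t x + q → ℓ x ≡ suc (ℓ (ω x)) ⊎ ℓ (ω x) ≡ ℓ x + q
          go (inj₁ e) = inj₁ (trans (cong (s +_) e) (ℕₚ.+-suc s _))
          go (inj₂ e) = inj₂ (trans (cong (s +_) e) (sym (ℕₚ.+-assoc s _ q)))

        open Labels (fin-card N) q 1≤q ℓ (ℓ ∘ ω) lab-step using (Fall; Fall?; Good)
        open Contours (fin-card N) Fall Fall? using (OneSink)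

        one-sink : OneSink ρ
        one-sink = record { sink = v ; noF = nf ; others = oth }
          where
          nf : ∀ {y} → Orb (to ρ) v y → ¬ Fall y
          nf {y} o f = ℕₚ.1+n≰n (ℕₚ.≤-trans (s≤s (ℕₚ.m≤m+n s (t (ω y)))) (ℕₚ.≤-reflexive (trans (sym f) (trans (cong (s +_) (trans (sym (t-ρ o)) t-self)) (ℕₚ.+-identityʳ s)))))
          oth : ∀ x → (∃ λ y → Fall y × Orb (to ρ) x y) ⊎ Orb (to ρ) x v
          oth x = go (t x) refl
            where
            go : ∀ k → t x ≡ k → (∃ λ y → Fall y × Orb (to ρ) x y) ⊎ Orb (to ρ) x v
            go zero e = inj₂ (ri-zero⁻ (subst (λ k → RI k x) e (t-reach x)))
            go (suc k) e with ri-back (subst (λ k → RI k x) e (t-reach x))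
            ... | inj₁ a = ⊥-elim (ℕₚ.1+n≰n (subst (_≤ k) e (t-min x k a)))
            -- `f` is the first edge of a shortest path, hence a fall.
            ... | inj₂ (f , o , r) = inj₁ (f , trans (cong (s +_) tf) (ℕₚ.+-suc s _) , o)
              where
              tf : t f ≡ suc (t (ω f))
              tf = ℕₚ.≤-antisym (t-step f) (ℕₚ.≤-trans (s≤s (t-min (ω f) k r)) (ℕₚ.≤-reflexive (trans (sym e) (t-ρ o))))

        lab : IsLab β ω ℓ
        lab = record { β-inj = β-inj ; ω-inj = ω-inj ; step = lab-step ; good = record
          { β-follows = λ x → cong (s +_) (t-β x) ; ω-follows = λ x → refl ; cyc = λ x → per-closes (β-per x)
          ; one-sink = one-sink ; euler = euler } }

  module FromLab {β ω : Fin N → Fin N} {ℓ : Fin N → ℕ} (lab : IsLab β ω ℓ) where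
    open IsLab lab using (β-inj; ω-inj; step; good)
    open Walks β ω β-inj ω-inj using (βP; ωP; ρ; module Rβ; module Rω; count-ρ; module To)
    open Labels (fin-card N) q 1≤q ℓ (ℓ ∘ ω) step using (Fall; Fall?; Good; module Path)
    open Contours (fin-card N) Fall Fall? using (OneSink)
    open Good good using (β-follows; ω-follows; cyc; one-sink; euler)
    open OneSink one-sink using (sink; others)

    ρ-label : ∀ {x y} → Orb (to ρ) x y → ℓ x ≡ ℓ y
    ρ-label = orb-induct (λ x y → ℓ x ≡ ℓ y) (λ _ → refl)
      (λ {x} e → trans (sym (trans (β-follows _) (cong ℓ (to∘from ωP x)))) e)

    -- From any vertex, following falls goes down until the sink is reached.
    low : ∀ m x → ℓ x ≤ m → ℓ sink ≤ ℓ x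
    low m x le with others x
    ... | inj₂ o = ℕₚ.≤-reflexive (sym (ρ-label o))
    low zero x le | inj₁ (f , ff , o) = ⊥-elim (ℕₚ.<⇒≱ (s≤s z≤n) (subst (_≤ 0) (trans (ρ-label o) ff) le))
    low (suc m) x le | inj₁ (f , ff , o) = ℕₚ.≤-trans (low m (ω f) (ℕ.s≤s⁻¹ (subst (_≤ suc m) (trans (ρ-label o) ff) le)))
      (ℕₚ.≤-trans (ℕₚ.n≤1+n _) (ℕₚ.≤-reflexive (sym (trans (ρ-label o) ff))))

    lowest-sink : ∀ {x} → ℓ x ≡ ℓ sink → Orb (to ρ) x sink
    lowest-sink {x} e with others x
    ... | inj₂ o = o
    ... | inj₁ (f , ff , o) = ⊥-elim (ℕₚ.1+n≰n (ℕₚ.≤-trans (ℕₚ.≤-reflexive (trans (sym ff) (trans (sym (ρ-label o)) e))) (low _ (ω f) ℕₚ.≤-refl)))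

    ρ⊆ : ∀ {x y} → Orb (to ρ) x y → Conn β ω x y
    ρ⊆ = orb-induct (Conn β ω) (λ _ → done) (λ {x} c → conn-trans (conn-orb₂ (orb-sym ωP (1 , to∘from ωP x))) (via₁ c))

    to-sink : ∀ m x → ℓ x ≤ m → Conn β ω x sink
    to-sink m x le with others x
    ... | inj₂ o = ρ⊆ o
    to-sink zero x le | inj₁ (f , ff , o) = ⊥-elim (ℕₚ.<⇒≱ (s≤s z≤n) (subst (_≤ 0) (trans (ρ-label o) ff) le))
    to-sink (suc m) x le | inj₁ (f , ff , o) = conn-trans (ρ⊆ o) (via₂ (to-sink m (ω f) (ℕ.s≤s⁻¹ (subst (_≤ suc m) (trans (ρ-label o) ff) le))))

    constellation : isConstellation p β ω ≡ true
    constellation = ∧-intro (isBij-intro β-inj) (∧-intro (isBij-intro ω-inj) (∧-intro black (∧-intro white (∧-intro trs eul))))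
      where
      black : allE (λ e → orbitSize β e ℕ.≡ᵇ p) ≡ true
      -- `p` steps close the face by `cyc`, and a closed label path has length divisible by `p`; so
      -- the degree is exactly `p`.
      black = allE-intro λ e → ≡ᵇ-intro (per-unique (Rβ.orbitSize-per e)
        (mkPer (s≤s z≤n) (cyc e) (λ j h → Path.closed-length β-follows h)))
      white : allE (λ e → any (λ k → orbitSize ω e ℕ.≡ᵇ k * p) (L.upTo (suc N))) ≡ true
      white = allE-intro λ e → go e (Path.closed-length ω-follows (per-closes (Rω.orbitSize-per e)))
        where
        go : ∀ e → p ∣ orbitSize ω e → any (λ k → orbitSize ω e ℕ.≡ᵇ k * p) (L.upTo (suc N)) ≡ true
        go e (divides k r) = any-apply-intro (λ k → orbitSize ω e ℕ.≡ᵇ k * p) id (s≤s k≤N) (≡ᵇ-intro r)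
          where
          k≤N : k ≤ N
          k≤N = ℕₚ.≤-trans (ℕₚ.m≤m*n k p) (ℕₚ.≤-trans (ℕₚ.≤-reflexive (sym r))
            (subst (_≤ N) (per-unique (proj₁ (proj₂ (period ωP e))) (Rω.orbitSize-per e)) (proj₂ (proj₂ (period ωP e)))))
      trs : transitive β ω ≡ true
      trs = allE-intro λ a → allE-intro λ b → conn-reach β ω (conn-trans (to-sink _ a ℕₚ.≤-refl) (conn-sym βP ωP (to-sink _ b ℕₚ.≤-refl)))
      eul : (nOrbits (vertexPerm β ω) + nOrbits β + nOrbits ω ℕ.≡ᵇ N + 2) ≡ true
      eul = ≡ᵇ-intro (euler count-ρ Rβ.nOrbits-count Rω.nOrbits-count)

    module _ (v : Fin N) (ov : Orb (to ρ) v sink) where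
      open To v using (RI; ri-zero; ri-zero⁻; ri-step; ri-back; t; t-def; t-spec)

      ri-≤ : ∀ k {e} → RI k e → ℓ e ≤ ℓ v + k
      ri-≤ zero h = ℕₚ.≤-reflexive (trans (ρ-label (ri-zero⁻ h)) (sym (ℕₚ.+-identityʳ _)))
      ri-≤ (suc k) {e} h with ri-back h
      ... | inj₁ a = ℕₚ.≤-trans (ri-≤ k a) (ℕₚ.+-monoʳ-≤ (ℓ v) (ℕₚ.n≤1+n k))
      ... | inj₂ (f , o , r) = ℕₚ.≤-trans (ℕₚ.≤-reflexive (ρ-label o)) (ℕₚ.≤-trans (one-step f)
              (ℕₚ.≤-trans (s≤s (ri-≤ k r)) (ℕₚ.≤-reflexive (sym (ℕₚ.+-suc _ k)))))
        where
        one-step : ∀ f → ℓ f ≤ suc (ℓ (ω f))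
        one-step f with step f
        ... | inj₁ e = ℕₚ.≤-reflexive e
        ... | inj₂ e = ℕₚ.m≤n⇒m≤1+n (subst (ℓ f ≤_) (sym e) (ℕₚ.m≤m+n _ q))

      -- Every vertex other than the sink has an outgoing fall, so a path made of falls attains the
      -- lower bound of `ri-≤`.
      ≡-ri : ∀ k {e} → ℓ e ≡ ℓ v + k → RI k e
      ≡-ri zero {e} h = ri-zero (orb-trans (lowest-sink (trans h (trans (ℕₚ.+-identityʳ _) (ρ-label ov)))) (orb-sym ρ ov))
      ≡-ri (suc k) {e} h with others e
      ... | inj₂ o = ⊥-elim (ℕₚ.m≢1+m+n (ℓ v) (trans (ρ-label ov) (trans (sym (ρ-label o)) (trans h (ℕₚ.+-suc _ k)))))
      ... | inj₁ (f , ff , o) = ri-step o (≡-ri k (ℕₚ.suc-injective (trans (sym ff) (trans (sym (ρ-label o)) (trans h (ℕₚ.+-suc _ k))))))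

      ℓ-type : ∀ e → ℓ e ≡ ℓ v + typeOrigin β ω v e
      ℓ-type e = trans (ℕₚ.≤-antisym (ri-≤ (t e) (proj₁ ts)) (subst (ℓ v + t e ≤_) (sym (proj₂ ex)) (ℕₚ.+-monoʳ-≤ (ℓ v) (proj₂ ts _ ri)))) (cong (ℓ v +_) (t-def e))
        where
        ex : ∃ λ k → ℓ e ≡ ℓ v + k
        ex = ℓ e ∸ ℓ v , sym (ℕₚ.m+[n∸m]≡n (subst (_≤ ℓ e) (sym (ρ-label ov)) (low _ e ℕₚ.≤-refl)))
        ri : RI (proj₁ ex) e
        ri = ≡-ri (proj₁ ex) (proj₂ ex)
        ts = t-spec ri

-- Bijections, factorials and numberings of cycles

size-transport : ∀ {X Y : Set} {P : X → Set} {Q : Y → Set} {n} → Size P n →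
  (Rel : X → Y → Set) → (∀ x → P x → ∃ λ y → Q y × Rel x y) → (∀ y → Q y → ∃ λ x → P x × Rel x y) →
  (∀ {x x' y} → P x → P x' → Rel x y → Rel x' y → x ≡ x') →
  (∀ {x y y'} → Q y → Q y' → Rel x y → Rel x y' → y ≡ y') → Size Q n
size-transport {Y = Y} {P} {Q} {n} c Rel tot tot' inj inj' = record
  { rep = λ i → proj₁ (img i) ; repP = λ i → proj₁ (proj₂ (img i))
  ; sep = λ i j e → sep c i j (inj (repP c i) (repP c j) (subst (Rel (rep c i)) e (proj₂ (proj₂ (img i)))) (proj₂ (proj₂ (img j))))
  ; cover = cv }
  where
  img : ∀ i → ∃ λ y → Q y × Rel (rep c i) y
  img i = tot (rep c i) (repP c i)
  cv : ∀ y → Q y → ∃ λ i → y ≡ proj₁ (img i)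
  cv y qy with tot' y qy
  ... | x , px , r with cover c x px
  ... | i , refl = i , inj' qy (proj₁ (proj₂ (img i))) r (proj₂ (proj₂ (img i)))

-- If P fibres over S × QT with S of size s, then QT has a size t, read off over one point of S.
size-split : ∀ {X S Y : Set} {P : X → Set} {QS : S → Set} {QT : Y → Set} {n s} →
  Size P n → Size QS s → (∀ a b → Dec (a ≡ b)) → (s₀ : S) → QS s₀ → (Rel : X → S × Y → Set) →
  (∀ x → P x → ∃ λ (a , y) → (QS a × QT y) × Rel x (a , y)) →
  (∀ a y → QS a → QT y → ∃ λ x → P x × Rel x (a , y)) →
  (∀ {x x' y} → P x → P x' → Rel x y → Rel x' y → x ≡ x') →
  (∀ {x a y a' y'} → QS a → QT y → QS a' → QT y' → Rel x (a , y) → Rel x (a' , y') → (a , y) ≡ (a' , y')) →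
  ∃ λ t → Size QT t × n ≡ s * t
size-split {X} {S} {Y} {P} {QS} {QT} {n} {s} cP cS _≟_ s₀ q₀ Rel tot tot' inj inj' = t , cT ,
    size-rel-≡ cP (size-× cS cT) Rel tot (λ (a , y) (qa , qy) → tot' a y qa qy) inj
      (λ (qa , qy) (qa' , qy') → inj' qa qy qa' qy')
  where
  img : ∀ i → ∃ λ (a , y) → (QS a × QT y) × Rel (rep cP i) (a , y)
  img i = tot (rep cP i) (repP cP i)
  -- The fibre over `s₀` is counted among the indices of `P`, where membership is decidable.
  ex = Finite.size-exists (fin-card n) (λ i → proj₁ (proj₁ (img i)) ≟ s₀)
  t = proj₁ ex
  cT : Size QT t
  cT = size-transport (proj₂ ex) (λ i y → Rel (rep cP i) (s₀ , y))
    (λ i e → let ((a , y) , (qa , qy) , r) = img i in y , qy , subst (λ z → Rel (rep cP i) (z , y)) e r)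
    (λ y qy → let (x , px , r) = tot' s₀ y q₀ qy ; (i , e) = cover cP x px ; r' = subst (λ z → Rel z (s₀ , y)) e r in
       i , cong proj₁ (inj' (proj₁ (proj₁ (proj₂ (img i)))) (proj₂ (proj₁ (proj₂ (img i)))) q₀ qy (proj₂ (proj₂ (img i))) r') , r')
    (λ {i} {j} _ _ r r' → sep cP i j (inj (repP cP i) (repP cP j) r r'))
    (λ qy qy' r r' → cong proj₂ (inj' q₀ qy q₀ qy' r r'))

vec-ext : ∀ {A : Set} {n} {u v : Vec A n} → (∀ i → lookup u i ≡ lookup v i) → u ≡ v
vec-ext {u = u} {v} h = trans (sym (Vₚ.tabulate∘lookup u)) (trans (Vₚ.tabulate-cong h) (Vₚ.tabulate∘lookup v))

abstract
  tab : ∀ {A : Set} {n} → (Fin n → A) → Vec A n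
  tab = V.tabulate

  look-tab : ∀ {A : Set} {n} (f : Fin n → A) i → lookup (tab f) i ≡ f i
  look-tab = Vₚ.lookup∘tabulate

IsPermV : ∀ {N} → Vec (Fin N) N → Set
IsPermV {N} σ = ∀ x y → lookup σ x ≡ lookup σ y → x ≡ y

Perm₀V : ∀ {M} → Vec (Fin (suc M)) (suc M) → Set
Perm₀V σ = IsPermV σ × lookup σ zero ≡ zero

private
  -- A permutation of `suc n` points splits into its value at `zero` and a permutation of the
  -- remaining points, renumbered by `punchIn a`.
  Extends : ∀ {n} → Vec (Fin (suc n)) (suc n) → Fin (suc n) × Vec (Fin n) n → Set
  Extends σ (a , τ) = lookup σ zero ≡ a × (∀ x → lookup σ (suc x) ≡ Fin.punchIn a (lookup τ x))

  restrict : ∀ {n} (σ : Vec (Fin (suc n)) (suc n)) → IsPermV σ → ∃ λ τ → IsPermV τ × Extends σ (lookup σ zero , τ)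
  restrict {n} σ h = τ , hτ , refl , ext
    where
    ne : ∀ x → lookup σ zero ≢ lookup σ (suc x)
    ne x e with h zero (suc x) e
    ... | ()
    τ = V.tabulate (λ x → Fin.punchOut (ne x))
    ext : ∀ x → lookup σ (suc x) ≡ Fin.punchIn (lookup σ zero) (lookup τ x)
    ext x = sym (trans (cong (Fin.punchIn (lookup σ zero)) (Vₚ.lookup∘tabulate _ x)) (Finₚ.punchIn-punchOut (ne x)))
    hτ : IsPermV τ
    hτ x y e = Finₚ.suc-injective (h (suc x) (suc y) (trans (ext x) (trans (cong (Fin.punchIn _) e) (sym (ext y)))))

  extend : ∀ {n} a (τ : Vec (Fin n) n) → IsPermV τ → ∃ λ σ → IsPermV σ × Extends σ (a , τ)
  extend a τ h = σ , hσ , refl , ext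
    where
    σ = a ∷ V.map (Fin.punchIn a) τ
    ext : ∀ x → lookup σ (suc x) ≡ Fin.punchIn a (lookup τ x)
    ext x = Vₚ.lookup-map x (Fin.punchIn a) τ
    hσ : IsPermV σ
    hσ zero zero e = refl
    hσ zero (suc y) e = ⊥-elim (Finₚ.punchInᵢ≢i a _ (sym (trans e (ext y))))
    hσ (suc x) zero e = ⊥-elim (Finₚ.punchInᵢ≢i a _ (trans (sym (ext x)) e))
    hσ (suc x) (suc y) e = cong suc (h x y (Finₚ.punchIn-injective a _ _ (trans (sym (ext x)) (trans e (ext y)))))

  extends-inj : ∀ {n} {σ σ' : Vec (Fin (suc n)) (suc n)} {y} → Extends σ y → Extends σ' y → σ ≡ σ'
  extends-inj (e , h) (e' , h') = vec-ext λ { zero → trans e (sym e') ; (suc x) → trans (h x) (sym (h' x)) }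

  extends-inj' : ∀ {n} {σ : Vec (Fin (suc n)) (suc n)} {y y'} → Extends σ y → Extends σ y' → y ≡ y'
  extends-inj' {y = a , τ} {_ , τ'} (refl , h) (refl , h') =
    cong (a ,_) (vec-ext λ x → Finₚ.punchIn-injective a _ _ (trans (sym (h x)) (h' x)))

perm-size : ∀ n → Size (IsPermV {n}) (n !)
perm-size zero = count-one [] (λ ()) (λ { [] _ → refl })
perm-size (suc n) = size-transport (size-× (fin-card (suc n)) (perm-size n)) (λ y σ → Extends σ y)
  (λ (a , τ) (_ , h) → extend a τ h) (λ σ h → let (τ , hτ , e) = restrict σ h in (_ , τ) , (tt , hτ) , e)
  (λ {x} {x'} {y} _ _ → extends-inj' {σ = y} {x} {x'}) (λ {x} {y} {y'} _ _ → extends-inj {σ = y} {y'} {x})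

perm₀-size : ∀ M → Size (Perm₀V {M}) (M !)
perm₀-size M = size-transport (perm-size M) (λ τ σ → Extends σ (zero , τ))
  (λ τ h → let (σ , hσ , e) = extend zero τ h in σ , (hσ , proj₁ e) , e)
  (λ σ (h , z) → let (τ , hτ , e) = restrict σ h in τ , hτ , subst (λ a → Extends σ (a , τ)) z e)
  (λ {x} {x'} {y} _ _ e e' → cong proj₂ (extends-inj' {σ = y} {zero , x} {zero , x'} e e'))
  (λ {x} {y} {y'} _ _ → extends-inj {σ = y} {y'} {zero , x})

module CycleLabel {X : Set} {M : ℕ} (π : Perm X) (r : X) (cycle-per : Per (to π) r (suc M)) where

  N = suc M

  σ : Fin N → X
  σ j = iter (to π) (toℕ j) r

  σ-lt : ∀ {i j : Fin N} → toℕ i < toℕ j → σ i ≢ σ j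
  σ-lt {i} {j} l e = >⇒∤ lt (per-div cycle-per (toℕ j ∸ toℕ i) (sym (Perm.iter-injective π (toℕ i)
      (trans e (trans (cong (λ z → iter (to π) z r) (sym (ℕₚ.m+[n∸m]≡n (ℕₚ.<⇒≤ l)))) (iter-+ (to π) (toℕ i) (toℕ j ∸ toℕ i) r))))))
    where
    instance
      nz : NonZero (toℕ j ∸ toℕ i)
      nz = ℕ.>-nonZero (ℕₚ.m<n⇒0<n∸m l)
    lt : toℕ j ∸ toℕ i < N
    lt = ℕₚ.≤-<-trans (ℕₚ.m∸n≤m (toℕ j) (toℕ i)) (Finₚ.toℕ<n j)

  σ-inj : ∀ {i j} → σ i ≡ σ j → i ≡ j
  σ-inj {i} {j} e with ℕₚ.<-cmp (toℕ i) (toℕ j)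
  ... | tri< l _ _ = ⊥-elim (σ-lt {i} {j} l e)
  ... | tri≈ _ q _ = Finₚ.toℕ-injective q
  ... | tri> _ _ l = ⊥-elim (σ-lt {j} {i} l (sym e))

  σ-% : ∀ k (lt : k % N < N) → σ (fromℕ< lt) ≡ iter (to π) k r
  σ-% k lt = trans (cong (λ z → iter (to π) z r) (Finₚ.toℕ-fromℕ< lt)) (sym (iter-% (to π) r M (per-closes cycle-per) k))

  σ⁻¹ : ∀ {x} → Orb (to π) r x → Fin N
  σ⁻¹ (k , _) = fromℕ< (m%n<n k N)

  σ-σ⁻¹ : ∀ {x} (o : Orb (to π) r x) → σ (σ⁻¹ o) ≡ x
  σ-σ⁻¹ (k , e) = trans (σ-% k (m%n<n k N)) e

  σ-rot : ∀ j → to π (σ j) ≡ σ (rot j)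
  σ-rot j = sym (σ-% (suc (toℕ j)) (m%n<n (suc (toℕ j)) N))

single-per : ∀ {X : Set} {M : ℕ} (card : Card X (suc M)) (π : Perm X) (single : ∀ x y → Orb (to π) x y) (r : X) →
  Per (to π) r (suc M)
single-per {X} {M} card π single r = go (period π r)
  where
  open Finite card using (enum; period)
  N = suc M
  go : (∃ λ k → Per (to π) r k × k ≤ N) → Per (to π) r N
  go (zero , mkPer () _ _ , _)
  go (suc k , pk , k≤N) = subst (Per (to π) r) (ℕₚ.≤-antisym k≤N N≤k) pk
    where
    h : Fin N → ℕ
    h i = proj₁ (single r (enum i))
    g : Fin N → Fin (suc k)
    g i = fromℕ< (m%n<n (h i) (suc k))
    at : ∀ i → iter (to π) (toℕ (g i)) r ≡ enum i
    at i = trans (cong (λ z → iter (to π) z r) (Finₚ.toℕ-fromℕ< (m%n<n (h i) (suc k)))) (trans (sym (iter-% (to π) r k (per-closes pk) (h i))) (proj₂ (single r (enum i))))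
    N≤k : N ≤ suc k
    N≤k = Finₚ.injective⇒≤ {f = g} λ {i} {j} e → sep card i j (trans (sym (at i)) (trans (cong (λ z → iter (to π) (toℕ z) r) e) (at j)))

module SingleCycle {X : Set} {M : ℕ} (card : Card X (suc M)) (π : Perm X)
  (single : ∀ x y → Orb (to π) x y) (r : X) where
  private module C = CycleLabel π r (single-per card π single r) using (σ; σ-inj; σ⁻¹; σ-σ⁻¹; σ-rot)
  open C public using (σ; σ-inj; σ-rot)

  σ⁻¹ : X → Fin (suc M)
  σ⁻¹ x = C.σ⁻¹ (single r x)

  σ-σ⁻¹ : ∀ x → σ (σ⁻¹ x) ≡ x
  σ-σ⁻¹ x = C.σ-σ⁻¹ (single r x)

-- A numbering that turns `f` into `rot` is determined by where it sends `zero`.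
rot-labelling : ∀ {X : Set} {M} (f : X → X) (σ : Fin (suc M) → X) → (∀ j → f (σ j) ≡ σ (rot j)) →
  ∀ j → σ j ≡ iter f (toℕ j) (σ zero)
rot-labelling f σ h j = trans (cong σ (sym (iter-rot-zero j))) (iter-map σ (λ x → sym (h x)) (toℕ j) zero)

perm-from-cong : ∀ {X : Set} (f g : Perm X) → (∀ x → to f x ≡ to g x) → ∀ x → from f x ≡ from g x
perm-from-cong f g h x = Perm.injective f (trans (to∘from f x) (trans (sym (to∘from g x)) (sym (h _))))

module Iso {X Y : Set} (φ : Y → X) (φ⁻¹ : X → Y) (φφ⁻¹ : ∀ x → φ (φ⁻¹ x) ≡ x) (φ-inj : ∀ {y y'} → φ y ≡ φ y' → y ≡ y') where

  orb-back : ∀ {f : X → X} {g : Y → Y} → (∀ y → φ (g y) ≡ f (φ y)) → ∀ {y y'} → Orb f (φ y) (φ y') → Orb g y y'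
  orb-back h {y} (k , e) = k , φ-inj (trans (iter-map φ h k y) e)

  count-push : ∀ {f : X → X} {g : Y → Y} {P : Y → Set} {Q : X → Set} {n} → (∀ y → φ (g y) ≡ f (φ y)) →
    (∀ y → P y → Q (φ y)) → (∀ y → Q (φ y) → P y) → Count P (Orb g) n → Count Q (Orb f) n
  count-push {f} {g} {P} {Q} h pq qp c = count-map {P = P} {Q} {Orb g} {Orb f} c φ pq (λ _ _ → orb-back h)
    (λ x qx → φ⁻¹ x , qp _ (subst Q (sym (φφ⁻¹ x)) qx) , λ {y'} _ o → subst (λ z → Orb f z (φ y')) (φφ⁻¹ x) (orb-map φ h o))

  count-pull : ∀ {f : X → X} {g : Y → Y} {P : Y → Set} {Q : X → Set} {n} → (∀ y → φ (g y) ≡ f (φ y)) →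
    (∀ y → P y → Q (φ y)) → (∀ y → Q (φ y) → P y) → Count Q (Orb f) n → Count P (Orb g) n
  count-pull {f} {g} {P} {Q} h pq qp c = count-map {P = Q} {P} {Orb f} {Orb g} c φ⁻¹ (λ x qx → qp _ (subst Q (sym (φφ⁻¹ x)) qx))
    (λ {x} {x'} _ _ o → subst₂ (Orb f) (φφ⁻¹ x) (φφ⁻¹ x') (orb-map φ h o))
    (λ y py → φ y , pq y py , λ {x'} _ o → orb-back h (subst (Orb f (φ y)) (sym (φφ⁻¹ x')) o))

  per-push : ∀ {f : X → X} {g : Y → Y} {y q} → (∀ y → φ (g y) ≡ f (φ y)) → Per g y q → Per f (φ y) q
  per-push {f} {g} {y} {q} h (mkPer a b c) = mkPer a (trans (sym (iter-map {g = f} φ h q y)) (cong φ b))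
    (λ j e → c j (φ-inj (trans (iter-map {g = f} φ h j y) e)))

  per-pull : ∀ {f : X → X} {g : Y → Y} {y q} → (∀ y → φ (g y) ≡ f (φ y)) → Per f (φ y) q → Per g y q
  per-pull {f} {g} {y} {q} h (mkPer a b c) = mkPer a (φ-inj (trans (iter-map {g = f} φ h q y) b))
    (λ j e → c j (trans (sym (iter-map {g = f} φ h j y)) (cong φ e)))

-- Relabelling along the contour

module Trees (q : ℕ) (1≤q : 1 ≤ q) where

  record IsTree {N : ℕ} (κ ω : Fin N → Fin N) (ℓ : Fin N → ℕ) : Set where
    field
      κ-inj : ∀ {x y} → κ x ≡ κ y → x ≡ y
      ω-inj : ∀ {x y} → ω x ≡ ω y → x ≡ y
      step  : ∀ x → ℓ x ≡ suc (ℓ (ω x)) ⊎ ℓ (ω x) ≡ ℓ x + q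
      tree  : Labels.Tree (fin-card N) q 1≤q ℓ (ℓ ∘ ω) step (fin-perm κ κ-inj) (fin-perm ω ω-inj)

  module Pull {X Y : Set} {N : ℕ} (cX : Card X N) (cY : Card Y N) (σ : Y → X) (σ⁻¹ : X → Y)
      (σσ⁻¹ : ∀ x → σ (σ⁻¹ x) ≡ x) (σ-inj : ∀ {y y'} → σ y ≡ σ y' → y ≡ y')
      {ℓ end : X → ℕ} (step : ∀ x → ℓ x ≡ suc (end x) ⊎ end x ≡ ℓ x + q)
      {ℓ' end' : Y → ℕ} (step' : ∀ x → ℓ' x ≡ suc (end' x) ⊎ end' x ≡ ℓ' x + q)
      (ℓσ : ∀ y → ℓ' y ≡ ℓ (σ y)) (endσ : ∀ y → end' y ≡ end (σ y))
      {κ ω : Perm X} {κ' ω' : Perm Y} (κσ : ∀ y → σ (to κ' y) ≡ to κ (σ y)) (ωσ : ∀ y → σ (to ω' y) ≡ to ω (σ y)) where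
    open Iso σ σ⁻¹ σσ⁻¹ σ-inj using (orb-back; count-push)
    module LX = Labels cX q 1≤q ℓ end step using (Tree)
    module LY = Labels cY q 1≤q ℓ' end' step' using (Tree)

    pull : LX.Tree κ ω → LY.Tree κ' ω'
    pull T = record
      { ω-follows = λ y → trans (ℓσ _) (trans (cong ℓ (ωσ y)) (trans (ω-follows (σ y)) (sym (endσ y))))
      ; κ-label = λ y → trans (ℓσ _) (trans (cong ℓ (κσ y)) (trans (κ-label (σ y)) (sym (ℓσ y))))
      ; κ-fixes = λ y ¬f → σ-inj (trans (κσ y) (κ-fixes (σ y) (λ f → ¬f (trans (ℓσ y) (trans f (cong suc (sym (endσ y))))))))
      ; single = λ y y' → orb-back (λ y → trans (κσ _) (cong (to κ) (ωσ y))) (single (σ y) (σ y'))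
      ; tree-euler = λ ca cb → tree-euler (count-push κσ (λ _ p → p) (λ _ p → p) ca) (count-push ωσ (λ _ p → p) (λ _ p → p) cb) }
      where open LX.Tree T using (ω-follows; κ-label; κ-fixes; single; tree-euler)

module Relabel (q : ℕ) (1≤q : 1 ≤ q) {M : ℕ} where
  N : ℕ
  N = suc M

  open Dist {N} q 1≤q using (IsLab)
  open Trees q 1≤q using (IsTree; module Pull)

  module _ {ℓ end : Fin N → ℕ} {step : ∀ x → ℓ x ≡ suc (end x) ⊎ end x ≡ ℓ x + q} where
    open Labels (fin-card N) q 1≤q ℓ end step using (p; Fall; Fall?; Good; Linked; mkLinked)
    open Contours (fin-card N) Fall Fall? using (Contour; OneSink)

    good-cong : ∀ {β β' ω} → (∀ x → to β x ≡ to β' x) → Good β ω → Good β' ω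
    good-cong {β} {β'} {ω} h G = record
      { β-follows = λ x → trans (cong ℓ (sym (h x))) (β-follows x) ; ω-follows = ω-follows
      ; cyc = λ x → trans (sym (iter-cong h p x)) (cyc x)
      ; one-sink = record { sink = sink ; noF = λ o → noF (orb-cong hρ⁻ o) ; others = oth }
      ; euler = λ ca cb cc → euler (count-≗ ca (λ _ p → p) (λ _ p → p) (orb-cong hρ⁻) (orb-cong hρ))
          (count-≗ cb (λ _ p → p) (λ _ p → p) (orb-cong (λ x → sym (h x))) (orb-cong h)) cc }
      where
      open Good G using (β-follows; ω-follows; cyc; one-sink; euler)
      open OneSink one-sink using (sink; noF; others)
      hρ : ∀ x → to (β ∙ ω ⁻¹) x ≡ to (β' ∙ ω ⁻¹) x
      hρ x = h _
      hρ⁻ : ∀ x → to (β' ∙ ω ⁻¹) x ≡ to (β ∙ ω ⁻¹) x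
      hρ⁻ x = sym (h _)
      oth : ∀ x → (∃ λ y → Fall y × Orb (to (β' ∙ ω ⁻¹)) x y) ⊎ Orb (to (β' ∙ ω ⁻¹)) x sink
      oth x with others x
      ... | inj₁ (y , f , o) = inj₁ (y , f , orb-cong hρ o)
      ... | inj₂ o = inj₂ (orb-cong hρ o)

    linked-cong : ∀ {β β' ω κ} → (∀ x → to β x ≡ to β' x) → Linked β ω κ → Linked β' ω κ
    linked-cong {β} {β'} {ω} {κ} h (mkLinked C) = mkLinked (record
      { compose = λ x → trans (sym (h _)) (trans (Contour.compose C x) (h _)) ; fixes = Contour.fixes C
      ; one = λ fx fy o → Contour.one C fx fy (orb-cong (λ x → sym (h _)) o) })

  lab-cong : ∀ {β ω ℓ ℓ'} → (∀ x → ℓ x ≡ ℓ' x) → IsLab β ω ℓ → IsLab β ω ℓ'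
  lab-cong {β} {ω} {ℓ} {ℓ'} h L = record { β-inj = β-inj ; ω-inj = ω-inj ; step = step' ; good = record
      { β-follows = λ x → trans (sym (h _)) (trans (β-follows x) (h _)) ; ω-follows = λ _ → refl ; cyc = cyc
      ; one-sink = record { sink = sink ; noF = λ {y} o f → noF o (trans (h y) (trans f (cong suc (sym (h _))))) ; others = oth }
      ; euler = euler } }
    where
    open IsLab L using (β-inj; ω-inj; step; good)
    open Labels.Good good using (β-follows; ω-follows; cyc; one-sink; euler)
    open Contours.OneSink one-sink using (sink; noF; others)
    step' : ∀ x → ℓ' x ≡ suc (ℓ' (ω x)) ⊎ ℓ' (ω x) ≡ ℓ' x + q
    step' x with step x
    ... | inj₁ e = inj₁ (trans (sym (h x)) (trans e (cong suc (h _))))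
    ... | inj₂ e = inj₂ (trans (sym (h _)) (trans e (cong (_+ q) (h x))))
    ρ = fin-perm β β-inj ∙ fin-perm ω ω-inj ⁻¹
    oth : ∀ x → (∃ λ y → ℓ' y ≡ suc (ℓ' (ω y)) × Orb (to ρ) x y) ⊎ Orb (to ρ) x sink
    oth x with others x
    ... | inj₁ (y , f , o) = inj₁ (y , trans (sym (h y)) (trans f (cong suc (h _))) , o)
    ... | inj₂ o = inj₂ o

  Perms : Set
  Perms = Vec (Fin N) N

  TreeData : Set
  TreeData = Perms × Perms × Vec ℕ N

  -- With the contour normalised to `rot` and the root at `zero`, each rooted tree has one
  -- representative.
  IsStdTree : TreeData → Set
  IsStdTree (κ , ω , ℓ) = IsTree (lookup κ) (lookup ω) (lookup ℓ) × (∀ x → lookup κ (lookup ω x) ≡ rot x)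

  LinkedLab : ∀ {β ω : Fin N → Fin N} {ℓ : Fin N → ℕ} → IsLab β ω ℓ → Perm (Fin N) → Set
  LinkedLab {β} {ω} {ℓ} L κ = Labels.Linked (fin-card N) q 1≤q ℓ (ℓ ∘ ω) step (fin-perm β β-inj) (fin-perm ω ω-inj) κ
    where open IsLab L using (β-inj; ω-inj; step)

  linked-lab : ∀ {β ω : Fin N → Fin N} {ℓ : Fin N → ℕ} (ω-inj : ∀ {x y} → ω x ≡ ω y → x ≡ y)
    (step : ∀ x → ℓ x ≡ suc (ℓ (ω x)) ⊎ ℓ (ω x) ≡ ℓ x + q) (β₀ : Perm (Fin N)) → (∀ x → to β₀ x ≡ β x) → ∀ {κ} →
    Labels.Good (fin-card N) q 1≤q ℓ (ℓ ∘ ω) step β₀ (fin-perm ω ω-inj) →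
    Labels.Linked (fin-card N) q 1≤q ℓ (ℓ ∘ ω) step β₀ (fin-perm ω ω-inj) κ →
    ∃ λ (L : IsLab β ω ℓ) → LinkedLab L κ
  linked-lab {β} {ω} {ℓ} ω-inj step β₀ h {κ} G l = lab , linked-cong {ℓ} {ℓ ∘ ω} {step} {β₀} {fin-perm β β-inj} {fin-perm ω ω-inj} {κ} h l
    where
    β-inj : ∀ {x y} → β x ≡ β y → x ≡ y
    β-inj {x} {y} e = Perm.injective β₀ (trans (h x) (trans e (sym (h y))))
    lab : IsLab β ω ℓ
    lab = record { β-inj = β-inj ; ω-inj = ω-inj ; step = step ; good = good-cong {ℓ} {ℓ ∘ ω} {step} {β₀} {fin-perm β β-inj} {fin-perm ω ω-inj} h G }

  -- `σ` numbers the edges of the labelled object along its contour, and the barred data are the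
  -- same tree in this numbering. The factor `M !` in the counts is the number of permutations `σ`
  -- that fix `zero`.
  record Core (β ω : Perms) (ℓ : Vec ℕ N) (y : Perms × TreeData) : Set where
    constructor mkCore
    σ = proj₁ y
    κ̄ = proj₁ (proj₂ y)
    ω̄ = proj₁ (proj₂ (proj₂ y))
    ℓ̄ = proj₂ (proj₂ (proj₂ y))
    field
      lab : IsLab (lookup β) (lookup ω) (lookup ℓ)
    open IsLab lab public
    βP = fin-perm (lookup β) β-inj
    ωP = fin-perm (lookup ω) ω-inj
    field
      κ : Perm (Fin N)
      linked : LinkedLab lab κ
      κσ : ∀ x → lookup σ (lookup κ̄ x) ≡ to κ (lookup σ x)
      ωσ : ∀ x → lookup σ (lookup ω̄ x) ≡ lookup ω (lookup σ x)
      ℓσ : ∀ x → lookup ℓ̄ x ≡ lookup ℓ (lookup σ x)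

  surjective : ∀ {σ : Perms} → IsPermV σ → ∀ x → ∃ λ y → lookup σ y ≡ x
  surjective {σ} h x = from P x , to∘from P x
    where P = fin-perm (lookup σ) (h _ _)

  record StdOf {X : Set} (ℓ : X → ℕ) (κ ω : X → X) (r : X) : Set where
    field
      κ̄ ω̄ : Perms
      ℓ̄ : Vec ℕ N
      isStd : IsStdTree (κ̄ , ω̄ , ℓ̄)
      σ : Fin N → X
      σ⁻¹ : X → Fin N
      σ-zero : σ zero ≡ r
      σ-inj : ∀ {x y} → σ x ≡ σ y → x ≡ y
      σσ⁻¹ : ∀ x → σ (σ⁻¹ x) ≡ x
      κσ : ∀ x → σ (lookup κ̄ x) ≡ κ (σ x)
      ωσ : ∀ x → σ (lookup ω̄ x) ≡ ω (σ x)
      ℓσ : ∀ x → lookup ℓ̄ x ≡ ℓ (σ x)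

  std-tree : ∀ {X : Set} (cX : Card X N) (ℓ end : X → ℕ) (step : ∀ x → ℓ x ≡ suc (end x) ⊎ end x ≡ ℓ x + q) (κ ω : Perm X) →
    Labels.Tree cX q 1≤q ℓ end step κ ω → (r : X) → StdOf ℓ (to κ) (to ω) r
  std-tree {X} cX ℓ end step κ ω T r = record
    { κ̄ = κ̄ ; ω̄ = ω̄ ; ℓ̄ = ℓ̄ ; isStd = tr , rotates ; σ = S.σ ; σ⁻¹ = S.σ⁻¹ ; σ-zero = refl ; σ-inj = S.σ-inj
    ; σσ⁻¹ = S.σ-σ⁻¹ ; κσ = κS ; ωσ = ωS ; ℓσ = ℓS }
    where
    open Labels cX q 1≤q ℓ end step using (Tree)
    module S = SingleCycle cX (κ ∙ ω) (Tree.single T) r using (σ; σ-inj; σ-rot; σ⁻¹; σ-σ⁻¹)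
    κ̄ ω̄ : Perms
    κ̄ = tab (λ x → S.σ⁻¹ (to κ (S.σ x)))
    ω̄ = tab (λ x → S.σ⁻¹ (to ω (S.σ x)))
    ℓ̄ : Vec ℕ N
    ℓ̄ = tab (λ x → ℓ (S.σ x))
    κS : ∀ x → S.σ (lookup κ̄ x) ≡ to κ (S.σ x)
    κS x = trans (cong S.σ (look-tab _ x)) (S.σ-σ⁻¹ _)
    ωS : ∀ x → S.σ (lookup ω̄ x) ≡ to ω (S.σ x)
    ωS x = trans (cong S.σ (look-tab _ x)) (S.σ-σ⁻¹ _)
    ℓS : ∀ x → lookup ℓ̄ x ≡ ℓ (S.σ x)
    ℓS x = look-tab _ x
    κ̄-inj : ∀ {x y} → lookup κ̄ x ≡ lookup κ̄ y → x ≡ y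
    κ̄-inj {x} {y} e = S.σ-inj (Perm.injective κ (trans (sym (κS x)) (trans (cong S.σ e) (κS y))))
    ω̄-inj : ∀ {x y} → lookup ω̄ x ≡ lookup ω̄ y → x ≡ y
    ω̄-inj {x} {y} e = S.σ-inj (Perm.injective ω (trans (sym (ωS x)) (trans (cong S.σ e) (ωS y))))
    endS : ∀ x → lookup ℓ̄ (lookup ω̄ x) ≡ end (S.σ x)
    endS x = trans (ℓS (lookup ω̄ x)) (trans (cong ℓ (ωS x)) (Tree.ω-follows T (S.σ x)))
    step̄ : ∀ x → lookup ℓ̄ x ≡ suc (lookup ℓ̄ (lookup ω̄ x)) ⊎ lookup ℓ̄ (lookup ω̄ x) ≡ lookup ℓ̄ x + q
    step̄ x with step (S.σ x)
    ... | inj₁ e = inj₁ (trans (ℓS x) (trans e (cong suc (sym (endS x)))))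
    ... | inj₂ e = inj₂ (trans (endS x) (trans e (cong (_+ q) (sym (ℓS x)))))
    tr : IsTree (lookup κ̄) (lookup ω̄) (lookup ℓ̄)
    tr = record { κ-inj = κ̄-inj ; ω-inj = ω̄-inj ; step = step̄
      ; tree = Pull.pull cX (fin-card N) S.σ S.σ⁻¹ S.σ-σ⁻¹ S.σ-inj step step̄ ℓS endS {κ} {ω} {fin-perm (lookup κ̄) κ̄-inj} {fin-perm (lookup ω̄) ω̄-inj} κS ωS T }
    rotates : ∀ x → lookup κ̄ (lookup ω̄ x) ≡ rot x
    rotates x = S.σ-inj (trans (κS (lookup ω̄ x)) (trans (cong (to κ) (ωS x)) (S.σ-rot x)))

  core-tot : ∀ β ω ℓ → IsLab (lookup β) (lookup ω) (lookup ℓ) →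
    ∃ λ ((σ , τ) : Perms × TreeData) → (Perm₀V σ × IsStdTree τ) × Core β ω ℓ (σ , τ)
  core-tot β ω ℓ L = go (linked-exists βP ωP)
    where
    open IsLab L using (β-inj; ω-inj; step; good)
    open Labels (fin-card N) q 1≤q (lookup ℓ) (lookup ℓ ∘ lookup ω) step
      using (Linked; linked-exists; module GoodToTree)
    βP = fin-perm (lookup β) β-inj
    ωP = fin-perm (lookup ω) ω-inj
    go : (∃ λ κ → Linked βP ωP κ) →
      ∃ λ ((σ , τ) : Perms × TreeData) → (Perm₀V σ × IsStdTree τ) × Core β ω ℓ (σ , τ)
    go (κ , linked) = fin (std-tree (fin-card N) (lookup ℓ) (lookup ℓ ∘ lookup ω) step κ ωP (GoodToTree.tree {βP} {ωP} {κ} good linked) zero)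
      where
      fin : StdOf (lookup ℓ) (to κ) (lookup ω) zero →
        ∃ λ ((σ , τ) : Perms × TreeData) → (Perm₀V σ × IsStdTree τ) × Core β ω ℓ (σ , τ)
      fin S = (σv , S.κ̄ , S.ω̄ , S.ℓ̄) ,
          (((λ x y e → S.σ-inj (trans (sym (look x)) (trans e (look y)))) , trans (look zero) S.σ-zero) , S.isStd) ,
          mkCore L κ linked (λ x → trans (look (lookup S.κ̄ x)) (trans (S.κσ x) (cong (to κ) (sym (look x)))))
            (λ x → trans (look (lookup S.ω̄ x)) (trans (S.ωσ x) (cong (lookup ω) (sym (look x)))))
            (λ x → trans (S.ℓσ x) (cong (lookup ℓ) (sym (look x))))
        where
        module S = StdOf S using (κ̄; ω̄; ℓ̄; isStd; σ; σ-zero; σ-inj; κσ; ωσ; ℓσ)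
        σv : Perms
        σv = tab S.σ
        look : ∀ x → lookup σv x ≡ S.σ x
        look = look-tab S.σ

  -- The tree is first carried over to the edge names given by `σ`; only then is `β` rebuilt as a
  -- cactus.
  push : ∀ σ (P : Perm (Fin N)) → (∀ x → to P x ≡ lookup σ x) → ∀ ((κ̄ , ω̄ , ℓ̄) : TreeData) →
    IsTree (lookup κ̄) (lookup ω̄) (lookup ℓ̄) → ∃ λ β → ∃ λ ω → ∃ λ ℓ → Core β ω ℓ (σ , κ̄ , ω̄ , ℓ̄)
  push σ P Pσ (κ̄ , ω̄ , ℓ̄) tr = go (TreeToGood.tree→good (fin-card N) q 1≤q (lookup ℓ) (lookup ℓ ∘ lookup ω) step T zero)
    where
    module R = IsTree tr using (κ-inj; ω-inj; step; tree)
    P⁻ : ∀ x → from P (lookup σ x) ≡ x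
    P⁻ x = trans (cong (from P) (sym (Pσ x))) (from∘to P x)
    ω : Perms
    ω = tab (λ x → to P (lookup ω̄ (from P x)))
    ℓ : Vec ℕ N
    ℓ = tab (λ x → lookup ℓ̄ (from P x))
    κf : Fin N → Fin N
    κf x = to P (lookup κ̄ (from P x))
    ωS : ∀ x → from P (lookup ω x) ≡ lookup ω̄ (from P x)
    ωS x = trans (cong (from P) (look-tab _ x)) (from∘to P _)
    κS : ∀ x → from P (κf x) ≡ lookup κ̄ (from P x)
    κS x = from∘to P _
    ℓS : ∀ x → lookup ℓ x ≡ lookup ℓ̄ (from P x)
    ℓS x = look-tab _ x
    ω-inj : ∀ {x y} → lookup ω x ≡ lookup ω y → x ≡ y
    ω-inj {x} {y} e = Perm.injective (P ⁻¹) (R.ω-inj (trans (sym (ωS x)) (trans (cong (from P) e) (ωS y))))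
    κ-inj : ∀ {x y} → κf x ≡ κf y → x ≡ y
    κ-inj {x} {y} e = Perm.injective (P ⁻¹) (R.κ-inj (trans (sym (κS x)) (trans (cong (from P) e) (κS y))))
    endS : ∀ x → lookup ℓ (lookup ω x) ≡ lookup ℓ̄ (lookup ω̄ (from P x))
    endS x = trans (ℓS (lookup ω x)) (cong (lookup ℓ̄) (ωS x))
    step : ∀ x → lookup ℓ x ≡ suc (lookup ℓ (lookup ω x)) ⊎ lookup ℓ (lookup ω x) ≡ lookup ℓ x + q
    step x with R.step (from P x)
    ... | inj₁ e = inj₁ (trans (ℓS x) (trans e (cong suc (sym (endS x)))))
    ... | inj₂ e = inj₂ (trans (endS x) (trans e (cong (_+ q) (sym (ℓS x)))))
    ωP = fin-perm (lookup ω) ω-inj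
    κ = fin-perm κf κ-inj
    open Labels (fin-card N) q 1≤q (lookup ℓ) (lookup ℓ ∘ lookup ω) step using (Tree; Good; Linked)
    T : Tree κ ωP
    T = Pull.pull (fin-card N) (fin-card N) (from P) (to P) (from∘to P) (Perm.injective (P ⁻¹)) R.step step ℓS endS
        {fin-perm (lookup κ̄) R.κ-inj} {fin-perm (lookup ω̄) R.ω-inj} {κ} {ωP} κS ωS R.tree
    go : (∃ λ β → Good β ωP × Linked β ωP κ) → ∃ λ β → ∃ λ ω → ∃ λ ℓ → Core β ω ℓ (σ , κ̄ , ω̄ , ℓ̄)
    go (β , G , L) = βv , ω , ℓ , mkCore (proj₁ ll) κ (proj₂ ll)
         (λ x → trans (sym (Pσ _)) (cong (λ z → to P (lookup κ̄ z)) (sym (P⁻ x))))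
         (λ x → sym (trans (look-tab _ (lookup σ x)) (trans (cong (λ z → to P (lookup ω̄ z)) (P⁻ x)) (Pσ _))))
         (λ x → sym (trans (ℓS (lookup σ x)) (cong (lookup ℓ̄) (P⁻ x))))
      where
      βv : Perms
      βv = tab (to β)
      ll : ∃ λ (L : IsLab (lookup βv) (lookup ω) (lookup ℓ)) → LinkedLab L κ
      ll = linked-lab ω-inj step β (λ x → sym (look-tab (to β) x)) {κ} G L

  core-tot' : ∀ σ τ → Perm₀V σ → IsStdTree τ → ∃ λ β → ∃ λ ω → ∃ λ ℓ → Core β ω ℓ (σ , τ)
  core-tot' σ τ (σ-perm , _) (tr , _) = push σ (fin-perm (lookup σ) (σ-perm _ _)) (λ _ → refl) τ tr

  -- Contour and labels are shared, so both permutations are cacti of the same closed path.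
  core-β : ∀ {β β' ω ℓ y} (C : Core β ω ℓ y) (C' : Core β' ω ℓ y) → (∀ x → to (Core.κ C) x ≡ to (Core.κ C') x) → β ≡ β'
  core-β {β} {β'} {ω} {ℓ} C C' κ≗ = vec-ext (cactus-unique {C.βP} {C'.βP}
      (record { β-follows = β-follows C.good ; cyc = cyc C.good ; one-fall = Contours.Contour.one (Labels.Linked.contour C.linked) })
      (record { β-follows = β-follows C'.good ; cyc = cyc C'.good
        ; one-fall = λ fx fy o → Contours.Contour.one (Labels.Linked.contour C'.linked) fx fy (orb-cong (λ x → cong (lookup β') (perm-from-cong (C.κ ∙ C.ωP) (C'.κ ∙ C'.ωP) (λ z → κ≗ _) x)) o) }))
    where
    module C = Core C using (σ; step; good; βP; ωP; κ; linked; κσ; ωσ; ℓσ)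
    module C' = Core C' using (good; βP; ωP; κ; linked; κσ; ωσ; ℓσ)
    open Labels.Good using (β-follows; cyc)
    open Labels (fin-card N) q 1≤q (lookup ℓ) (lookup ℓ ∘ lookup ω) C.step using (Tree; module GoodToTree)
    T : Tree C.κ C.ωP
    T = GoodToTree.tree {C.βP} {C.ωP} {C.κ} C.good C.linked
    open Cactus (fin-card N) q 1≤q (lookup ℓ) (lookup ℓ ∘ lookup ω) C.step (C.κ ∙ C.ωP)
      (λ x → trans (Tree.κ-label T _) (Tree.ω-follows T x)) (Tree.single T) using (cactus-unique)

  core-inj : ∀ {β ω ℓ β' ω' ℓ' σ τ} → IsPermV σ → Core β ω ℓ (σ , τ) → Core β' ω' ℓ' (σ , τ) →
    (β ≡ β' × ω ≡ ω' × ℓ ≡ ℓ')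
  core-inj {β} {ω} {ℓ} {β'} {ω'} {ℓ'} {σ} {κ̄ , ω̄ , ℓ̄} σ-perm C C' = fin ω≡ ℓ≡ C C'
    where
    at : ∀ {A : Set} {f g : Fin N → A} → (∀ x → f (lookup σ x) ≡ g (lookup σ x)) → ∀ x → f x ≡ g x
    at {f = f} {g} h x = let (y , e) = surjective {σ} σ-perm x in subst (λ z → f z ≡ g z) e (h y)
    ω≡ : ω ≡ ω'
    ω≡ = vec-ext (at (λ x → trans (sym (Core.ωσ C x)) (Core.ωσ C' x)))
    ℓ≡ : ℓ ≡ ℓ'
    ℓ≡ = vec-ext (at (λ x → trans (sym (Core.ℓσ C x)) (Core.ℓσ C' x)))
    fin : ω ≡ ω' → ℓ ≡ ℓ' → Core β ω ℓ (σ , κ̄ , ω̄ , ℓ̄) → Core β' ω' ℓ' (σ , κ̄ , ω̄ , ℓ̄) → (β ≡ β' × ω ≡ ω' × ℓ ≡ ℓ')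
    fin refl refl C C' = core-β C C' (at (λ x → trans (sym (Core.κσ C x)) (Core.κσ C' x))) , refl , refl

  -- `κ` is recovered as a first return, which fixes the contour; numbering the contour from the
  -- root then leaves no choice for `σ`.
  core-inj' : ∀ {β ω ℓ σ τ σ' τ'} → Perm₀V σ → IsStdTree τ → Perm₀V σ' → IsStdTree τ' →
    Core β ω ℓ (σ , τ) → Core β ω ℓ (σ' , τ') → (σ , τ) ≡ (σ' , τ')
  core-inj' {β} {ω} {ℓ} {σ} {κ̄ , ω̄ , ℓ̄} {σ'} {κ̄' , ω̄' , ℓ̄'} (σp , σ0) (_ , rt) (σp' , σ0') (_ , rt') C C' = fin σ≡ C C'
    where
    module C = Core C using (σ; step; good; βP; ωP; κ; linked; κσ; ωσ; ℓσ)
    module C' = Core C' using (good; βP; ωP; κ; linked; κσ; ωσ; ℓσ)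
    κ≗ : ∀ x → to C.κ x ≡ to C'.κ x
    κ≗ = Contours.contour-unique (fin-card N) _ _ (λ x → cong (lookup β) (perm-from-cong C.ωP C'.ωP (λ _ → refl) x)) (Labels.Linked.contour C.linked) (Labels.Linked.contour C'.linked)
    lab₁ : ∀ j → to C.κ (lookup ω (lookup σ j)) ≡ lookup σ (rot j)
    lab₁ j = trans (cong (to C.κ) (sym (C.ωσ j))) (trans (sym (C.κσ _)) (cong (lookup σ) (rt j)))
    lab₂ : ∀ j → to C'.κ (lookup ω (lookup σ' j)) ≡ lookup σ' (rot j)
    lab₂ j = trans (cong (to C'.κ) (sym (C'.ωσ j))) (trans (sym (C'.κσ _)) (cong (lookup σ') (rt' j)))
    σ≡ : σ ≡ σ'
    σ≡ = vec-ext λ j → trans (rot-labelling (λ x → to C.κ (lookup ω x)) (lookup σ) lab₁ j)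
       (trans (iter-cong (λ x → κ≗ _) (toℕ j) _) (trans (cong (iter _ (toℕ j)) (trans σ0 (sym σ0')))
          (sym (rot-labelling (λ x → to C'.κ (lookup ω x)) (lookup σ') lab₂ j))))
    fin : σ ≡ σ' → Core β ω ℓ (σ , κ̄ , ω̄ , ℓ̄) → Core β ω ℓ (σ' , κ̄' , ω̄' , ℓ̄') → (σ , κ̄ , ω̄ , ℓ̄) ≡ (σ' , κ̄' , ω̄' , ℓ̄')
    fin refl _ _ = cong (σ ,_) (cong₂ _,_ (vec-ext λ x → σp _ _ (trans (C.κσ x) (trans (κ≗ _) (sym (C'.κσ x)))))
      (cong₂ _,_ (vec-ext λ x → σp _ _ (trans (C.ωσ x) (sym (C'.ωσ x)))) (vec-ext λ x → trans (C.ℓσ x) (sym (C'.ℓσ x)))))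

-- Sizes of sets enumerated by lists

trues : List Bool → ℕ
trues bs = L.length (L.filter (λ b → b Boolₚ.≟ true) bs)

trues-++ : ∀ as bs → trues (as ++ bs) ≡ trues as + trues bs
trues-++ as bs = trans (cong L.length (Lₚ.filter-++ (λ b → b Boolₚ.≟ true) as bs)) (Lₚ.length-++ (L.filter (λ b → b Boolₚ.≟ true) as))

size-cons : ∀ {A Y : Set} {Q : A → Y → Set} {x xs n m} → Unique (x ∷ xs) → Size (Q x) n →
  Size {A × Y} (λ (a , y) → a ∈ xs × Q a y) m → Size {A × Y} (λ (a , y) → a ∈ (x ∷ xs) × Q a y) (n + m)
size-cons {A} {Y} {Q} {x} {xs} (x∉ ∷ _) c d = count-≗ (count-⊎ ≡-isEq
    (count-map {Q = λ (a , y) → a ≡ x × Q a y} {S = _≡_} c (x ,_) (λ y q → refl , q) (λ { _ _ refl → refl })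
      (λ { (_ , y) (refl , q) → y , q , λ { _ refl → refl } }))
    d (λ { (refl , _) (i , _) refl → All.lookup x∉ i refl }))
  (λ { _ (inj₁ (refl , q)) → here refl , q ; _ (inj₂ (i , q)) → there i , q })
  (λ { _ (here refl , q) → inj₁ (refl , q) ; _ (there i , q) → inj₂ (i , q) }) id id

size-nil : ∀ {A Y : Set} {Q : A → Y → Set} → Size {A × Y} (λ (a , y) → a ∈ [] × Q a y) 0
size-nil = record { rep = λ () ; repP = λ () ; sep = λ () ; cover = λ { _ (() , _) } }

size-sum : ∀ {A Y : Set} {Q : A → Y → Set} {h : A → ℕ} (xs : List A) → Unique xs → (∀ a → a ∈ xs → Size (Q a) (h a)) →
  Size {A × Y} (λ (a , y) → a ∈ xs × Q a y) (sum (L.map h xs))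
size-sum [] u s = size-nil
size-sum (x ∷ xs) u@(_ ∷ u') s = size-cons u (s x (here refl)) (size-sum xs u' (λ a i → s a (there i)))

size-concatMap : ∀ {A Y : Set} {Q : A → Y → Set} (g : A → List Bool) (xs : List A) → Unique xs →
  (∀ a → Size (Q a) (trues (g a))) → Size {A × Y} (λ (a , y) → a ∈ xs × Q a y) (trues (L.concatMap g xs))
size-concatMap g [] u s = size-nil
size-concatMap {A} {Y} {Q} g (x ∷ xs) u@(_ ∷ u') s = subst (Size _) (sym (trues-++ (g x) (L.concatMap g xs)))
  (size-cons {Q = Q} u (s x) (size-concatMap g xs u' s))

size-map : ∀ {A : Set} (b : A → Bool) (xs : List A) → Unique xs → Size (λ a → a ∈ xs × b a ≡ true) (trues (L.map b xs))
size-map b [] u = record { rep = λ () ; repP = λ () ; sep = λ () ; cover = λ { _ (() , _) } }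
size-map b (x ∷ xs) (x∉ ∷ u) with b x in e
... | false = count-≗ (size-map b xs u) (λ _ (i , q) → there i , q)
      (λ { _ (here refl , q) → ⊥-elim (case (trans (sym e) q)) ; _ (there i , q) → i , q }) id id
  where
  case : false ≡ true → ⊥
  case ()
... | true = count-≗ (count-⊎ ≡-isEq (count-one {P = λ a → a ≡ x} x refl (λ _ q → q)) (size-map b xs u)
      (λ { refl (i , _) refl → All.lookup x∉ i refl }))
    (λ { _ (inj₁ refl) → here refl , e ; _ (inj₂ (i , q)) → there i , q })
    (λ { _ (here refl , q) → inj₁ refl ; _ (there i , q) → inj₂ (i , q) }) id id

concatMap-product : ∀ {A B C : Set} (f : A → B → C) xs ys → L.concatMap (λ a → L.map (f a) ys) xs ≡ L.cartesianProductWith f xs ys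
concatMap-product f [] ys = refl
concatMap-product f (x ∷ xs) ys = cong (L.map (f x) ys ++_) (concatMap-product f xs ys)

allFin-unique : ∀ N → Unique (L.allFin N)
allFin-unique N = Uniqueₚ.tabulate⁺ id

allVec-unique : ∀ N n → Unique (allVec N n)
allVec-unique N zero = All.[] ∷ []
allVec-unique N (suc n) = subst Unique (sym (concatMap-product _∷_ (L.allFin N) (allVec N n)))
  (Uniqueₚ.cartesianProductWith⁺ _∷_ Vₚ.∷-injective (allFin-unique N) (allVec-unique N n))

allVec-complete : ∀ {N n} (v : Vec (Fin N) n) → v ∈ allVec N n
allVec-complete [] = here refl
allVec-complete {N} {suc n} (a ∷ v) = subst (a ∷ v ∈_) (sym (concatMap-product _∷_ (L.allFin N) (allVec N n)))
  (Memₚ.∈-cartesianProductWith⁺ _∷_ (Memₚ.∈-allFin a) (allVec-complete v))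

-- Weight profiles of white faces

per-orb : ∀ {X : Set} (φ : Perm X) {x y k} → Orb (to φ) x y → Per (to φ) x k → Per (to φ) y k
per-orb φ {x} {y} {k} (j , refl) (mkPer a b c) = mkPer a (trans (swap k) (cong (iter (to φ) j) b))
    (λ i e → c i (Perm.iter-injective φ j (trans (sym (swap i)) e)))
  where
  swap : ∀ i → iter (to φ) i (iter (to φ) j x) ≡ iter (to φ) j (iter (to φ) i x)
  swap i = trans (sym (iter-+ (to φ) i j x)) (trans (cong (λ z → iter (to φ) z x) (ℕₚ.+-comm i j)) (iter-+ (to φ) j i x))

-- Counts orbits instead of their least elements, as `profile` does, so that it can be moved along
-- any bijection.
WProf : ∀ {X : Set} (p : ℕ) (f : X → X) (Ex : X → Set) {K : ℕ} (m : Vec ℕ K) → Set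
WProf p f Ex m = ∀ i → Count (λ e → Per f e (suc (toℕ i) * p) × ¬ Ex e) (Orb f) (lookup m i)

Excluded : ∀ {N} → (Fin N → Fin N) → Maybe (Fin N) → Fin N → Set
Excluded ω nothing  e = ⊥
Excluded ω (just r) e = Orb ω r e

eqVec-elim : ∀ {K} (u v : Vec ℕ K) → eqVec u v ≡ true → u ≡ v
eqVec-elim [] [] _ = refl
eqVec-elim (x ∷ u) (y ∷ v) e = cong₂ _∷_ (≡ᵇ-elim (proj₁ (∧-true e))) (eqVec-elim u v (proj₂ (∧-true {x ℕ.≡ᵇ y} e)))

eqVec-refl : ∀ {K} (u : Vec ℕ K) → eqVec u u ≡ true
eqVec-refl [] = refl
eqVec-refl (x ∷ u) = ∧-intro (≡ᵇ-intro {x} refl) (eqVec-refl u)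

module Profiles {N : ℕ} (p : ℕ) (φ : Perm (Fin N)) (ex : Maybe (Fin N)) where
  open Finite (fin-card N) using (orb-sym; orb-isEq)
  ω = to φ
  open Reflect ω φ (λ _ → refl) using (sameOrbit-elim; sameOrbit-intro; orbitSize-per; reps-count)

  test : ℕ → Fin N → Bool
  test k e = (orbitSize ω e ℕ.≡ᵇ k) ∧ notExcluded ω ex e

  notEx-elim : ∀ ex e → notExcluded ω ex e ≡ true → ¬ Excluded ω ex e
  notEx-elim nothing e _ ()
  notEx-elim (just r) e h o = not-true h (sameOrbit-intro o)

  notEx-intro : ∀ ex e → ¬ Excluded ω ex e → notExcluded ω ex e ≡ true
  notEx-intro nothing e _ = refl
  notEx-intro (just r) e h = not-intro (λ s → h (sameOrbit-elim s))

  test-elim : ∀ k e → test k e ≡ true → Per ω e k × ¬ Excluded ω ex e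
  test-elim k e h = subst (Per ω e) (≡ᵇ-elim (proj₁ (∧-true h))) (orbitSize-per e) ,
    notEx-elim ex e (proj₂ (∧-true {orbitSize ω e ℕ.≡ᵇ k} h))

  test-intro : ∀ k e → Per ω e k × ¬ Excluded ω ex e → test k e ≡ true
  test-intro k e (a , b) = ∧-intro (≡ᵇ-intro (per-unique (orbitSize-per e) a)) (notEx-intro ex e b)

  ex-resp : ∀ ex {x y} → Orb ω x y → Excluded ω ex y → Excluded ω ex x
  ex-resp nothing o ()
  ex-resp (just r) o h = orb-trans h (orb-sym φ o)

  entry : ∀ k → Count (λ e → Per ω e k × ¬ Excluded ω ex e) (Orb ω) (countE (λ e → isRep ω e ∧ test k e))
  entry k = count-≗ (reps-count (test k)
      (λ {x} {y} o h → let (a , b) = test-elim k x h in test-intro k y (per-orb φ o a , λ z → b (ex-resp ex o z)))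
      (countE-size (λ e → isRep ω e ∧ test k e)))
    (test-elim k) (test-intro k) id id

  profile-count : ∀ {K} (i : Fin K) → Count (λ e → Per ω e (suc (toℕ i) * p) × ¬ Excluded ω ex e) (Orb ω) (lookup (profile K p ω ex) i)
  profile-count {K} i = subst (Count _ (Orb ω)) (sym (Vₚ.lookup∘tabulate _ i)) (entry (suc (toℕ i) * p))

  profile-elim : ∀ {K} (m : Vec ℕ K) → eqVec (profile K p ω ex) m ≡ true → WProf p ω (Excluded ω ex) m
  profile-elim {K} m e i = subst (λ v → Count _ (Orb ω) (lookup v i)) (eqVec-elim (profile K p ω ex) m e) (profile-count i)

  profile-intro : ∀ {K} (m : Vec ℕ K) → WProf p ω (Excluded ω ex) m → eqVec (profile K p ω ex) m ≡ true
  profile-intro {K} m w = subst (λ v → eqVec (profile K p ω ex) v ≡ true)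
    (vec-ext (λ i → count-unique (orb-isEq φ) (profile-count i) (w i))) (eqVec-refl (profile K p ω ex))

wprof-pull : ∀ {X Y : Set} {p K} {m : Vec ℕ K} (φ : Y → X) (φ⁻¹ : X → Y) (φφ⁻¹ : ∀ x → φ (φ⁻¹ x) ≡ x)
  (φ-inj : ∀ {y y'} → φ y ≡ φ y' → y ≡ y') {f : X → X} {g : Y → Y} → (∀ y → φ (g y) ≡ f (φ y)) →
  {Ex : X → Set} {Ey : Y → Set} → (∀ y → Ex (φ y) → Ey y) → (∀ y → Ey y → Ex (φ y)) → WProf p f Ex m → WProf p g Ey m
wprof-pull φ φ⁻¹ φφ⁻¹ φ-inj h a b w i = count-pull h
    (λ y (r , n) → per-push h r , λ e → n (a y e)) (λ y (r , n) → per-pull h r , λ e → n (b y e)) (w i)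
  where open Iso φ φ⁻¹ φφ⁻¹ φ-inj using (count-pull; per-push; per-pull)

wprof-push : ∀ {X Y : Set} {p K} {m : Vec ℕ K} (φ : Y → X) (φ⁻¹ : X → Y) (φφ⁻¹ : ∀ x → φ (φ⁻¹ x) ≡ x)
  (φ-inj : ∀ {y y'} → φ y ≡ φ y' → y ≡ y') {f : X → X} {g : Y → Y} → (∀ y → φ (g y) ≡ f (φ y)) →
  {Ex : X → Set} {Ey : Y → Set} → (∀ y → Ex (φ y) → Ey y) → (∀ y → Ey y → Ex (φ y)) → WProf p g Ey m → WProf p f Ex m
wprof-push φ φ⁻¹ φφ⁻¹ φ-inj h a b w i = count-push h
    (λ y (r , n) → per-push h r , λ e → n (a y e)) (λ y (r , n) → per-pull h r , λ e → n (b y e)) (w i)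
  where open Iso φ φ⁻¹ φφ⁻¹ φ-inj using (count-push; per-push; per-pull)

-- Labelled constellations as `M !` copies of the trees

module LabelledCounts (q : ℕ) (1≤q : 1 ≤ q) {M : ℕ} {K : ℕ} (m : Vec ℕ K) where
  p : ℕ
  p = suc q

  open Relabel q 1≤q {M}
    using (N; lab-cong; Perms; TreeData; IsStdTree; Core; core-tot; core-tot'; core-inj; core-inj')
  open Dist {N} q 1≤q using (IsLab; module FromConstellation; module FromLab; module Walks)
  open Finite (fin-card N) using (orb-sym)

  vec-≟ : (a b : Perms) → Dec (a ≡ b)
  vec-≟ = Vₚ.≡-dec Finₚ._≟_

  idV : Perms
  idV = V.allFin N

  idV-perm : Perm₀V idV
  idV-perm = (λ x y e → trans (sym (Vₚ.lookup-allFin x)) (trans e (Vₚ.lookup-allFin y))) , refl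

  -- A root label 0 puts the pointed vertex at the origin of the root edge, so a rooted
  -- constellation is pointed without a choice.
  TreeF : (n : ℕ) → TreeData → Set
  TreeF n τ@(κ , ω , ℓ) = IsStdTree τ × lookup ℓ zero ≡ 0 × Per (lookup ω) zero (n * p) ×
    WProf p (lookup ω) (Orb (lookup ω) zero) m

  -- The root label is exactly `i`, whatever the type `j` of the root edge. The pointed vertex has
  -- label `i - j`, and since labels are natural numbers this encodes `j ≤ i`.
  TreeV : (i : ℕ) → TreeData → Set
  TreeV i τ@(κ , ω , ℓ) = IsStdTree τ × lookup ℓ zero ≡ i × lookup ℓ zero ≡ suc (lookup ℓ (lookup ω zero)) ×
    WProf p (lookup ω) (λ _ → ⊥) m

  module CoreFacts {β ω ℓ σ κ̄ ω̄ ℓ̄} (σ-perm : Perm₀V σ) (C : Core β ω ℓ (σ , κ̄ , ω̄ , ℓ̄)) where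
    open Core C using (lab; ωP; ωσ; ℓσ) public
    P = fin-perm (lookup σ) (proj₁ σ-perm _ _)
    σ-inj : ∀ {x y} → lookup σ x ≡ lookup σ y → x ≡ y
    σ-inj = proj₁ σ-perm _ _
    open Iso (lookup σ) (from P) (to∘from P) σ-inj using (orb-back; per-push; per-pull)

    root-label : lookup ℓ̄ zero ≡ lookup ℓ zero
    root-label = trans (ℓσ zero) (cong (lookup ℓ) (proj₂ σ-perm))

    root-next : lookup ℓ̄ (lookup ω̄ zero) ≡ lookup ℓ (lookup ω zero)
    root-next = trans (ℓσ _) (cong (lookup ℓ) (trans (ωσ zero) (cong (lookup ω) (proj₂ σ-perm))))

    root-per : ∀ {k} → Per (lookup ω) zero k → Per (lookup ω̄) zero k
    root-per h = per-pull ωσ (subst (λ z → Per (lookup ω) z _) (sym (proj₂ σ-perm)) h)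

    root-per⁻ : ∀ {k} → Per (lookup ω̄) zero k → Per (lookup ω) zero k
    root-per⁻ h = subst (λ z → Per (lookup ω) z _) (proj₂ σ-perm) (per-push ωσ h)

    ex→ : ∀ y → Orb (lookup ω) zero (lookup σ y) → Orb (lookup ω̄) zero y
    ex→ y o = orb-back ωσ (subst (λ z → Orb (lookup ω) z (lookup σ y)) (sym (proj₂ σ-perm)) o)

    ex← : ∀ y → Orb (lookup ω̄) zero y → Orb (lookup ω) zero (lookup σ y)
    ex← y o = subst (λ z → Orb (lookup ω) z (lookup σ y)) (proj₂ σ-perm) (orb-map (lookup σ) ωσ o)

    profF : WProf p (lookup ω) (Orb (lookup ω) zero) m → WProf p (lookup ω̄) (Orb (lookup ω̄) zero) m
    profF = wprof-pull {p = p} {m = m} (lookup σ) (from P) (to∘from P) σ-inj ωσ ex→ ex←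

    profF⁻ : WProf p (lookup ω̄) (Orb (lookup ω̄) zero) m → WProf p (lookup ω) (Orb (lookup ω) zero) m
    profF⁻ = wprof-push {p = p} {m = m} (lookup σ) (from P) (to∘from P) σ-inj ωσ ex→ ex←

    profV : WProf p (lookup ω) (λ _ → ⊥) m → WProf p (lookup ω̄) (λ _ → ⊥) m
    profV = wprof-pull {p = p} {m = m} (lookup σ) (from P) (to∘from P) σ-inj ωσ (λ _ e → e) (λ _ e → e)

    profV⁻ : WProf p (lookup ω̄) (λ _ → ⊥) m → WProf p (lookup ω) (λ _ → ⊥) m
    profV⁻ = wprof-push {p = p} {m = m} (lookup σ) (from P) (to∘from P) σ-inj ωσ (λ _ e → e) (λ _ e → e)

  -- Rooted constellations pointed at the origin of the root

  testF : (n : ℕ) → Perms → Perms → Bool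
  testF n β ω = isConstellation p (lookup β) (lookup ω) ∧ (orbitSize (lookup ω) zero ℕ.≡ᵇ n * p)
     ∧ eqVec (profile K p (lookup ω) (just zero)) m

  LabF : (n : ℕ) → Perms × Perms → Set
  LabF n (β , ω) = testF n β ω ≡ true

  labF-size : ∀ n → Size (LabF n) (countF p n m M)
  labF-size n = count-≗ (size-concatMap {Q = λ β ω → ω ∈ allVec N N × testF n β ω ≡ true} (λ β → L.map (testF n β) (allVec N N)) (allVec N N) (allVec-unique N N)
      (λ β → size-map (testF n β) (allVec N N) (allVec-unique N N)))
    (λ _ (_ , _ , h) → h) (λ (β , ω) h → allVec-complete β , allVec-complete ω , h) id id

  RelF : Perms × Perms → Perms × TreeData → Set
  RelF (β , ω) (σ , τ) = Perm₀V σ × ∃ λ ℓ → lookup ℓ zero ≡ 0 × Core β ω ℓ (σ , τ)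

  -- Label 0 is minimal, so the root leaves the sink and labels are distances to its origin. In
  -- particular `ℓ` is determined by `β` and `ω`.
  typed : ∀ {β ω ℓ} (L : IsLab (lookup β) (lookup ω) (lookup ℓ)) → lookup ℓ zero ≡ 0 →
    ∀ e → lookup ℓ e ≡ typeOrigin (lookup β) (lookup ω) zero e
  typed {β} {ω} {ℓ} L z e = trans (FromLab.ℓ-type L zero (FromLab.lowest-sink L
      (trans z (sym (ℕₚ.n≤0⇒n≡0 (ℕₚ.≤-trans (FromLab.low L _ zero ℕₚ.≤-refl) (ℕₚ.≤-reflexive z))))))  e) (cong (_+ typeOrigin (lookup β) (lookup ω) zero e) z)

  totF : ∀ n x → LabF n x → ∃ λ (σ , τ) → (Perm₀V σ × TreeF n τ) × RelF x (σ , τ)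
  totF n (β , ω) h = go (core-tot β ω ℓ L)
    where
    isC = proj₁ (∧-true {isConstellation p (lookup β) (lookup ω)} h)
    h₂ = ∧-true {orbitSize (lookup ω) zero ℕ.≡ᵇ n * p} (proj₂ (∧-true {isConstellation p (lookup β) (lookup ω)} h))
    module FC = FromConstellation (lookup β) (lookup ω) isC using (β-inj; ω-inj; t-self; t-ρ; ℓ; lab)
    ℓ : Vec ℕ N
    ℓ = tab (FC.ℓ zero 0)
    L : IsLab (lookup β) (lookup ω) (lookup ℓ)
    L = lab-cong (λ x → sym (look-tab (FC.ℓ zero 0) x)) (FC.lab zero 0)
    ωP = fin-perm (lookup ω) (IsLab.ω-inj L)
    z : lookup ℓ zero ≡ 0
    z = trans (look-tab _ zero) (FC.t-self zero)
    go : (∃ λ ((σ , τ) : Perms × TreeData) → (Perm₀V σ × IsStdTree τ) × Core β ω ℓ (σ , τ)) →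
      ∃ λ (σ , τ) → (Perm₀V σ × TreeF n τ) × RelF (β , ω) (σ , τ)
    go ((σ , τ) , (sp , std) , C) = (σ , τ) , (sp , std , trans root-label z ,
        root-per (subst (Per (lookup ω) zero) (≡ᵇ-elim (proj₁ h₂)) (Reflect.orbitSize-per (lookup ω) ωP (λ _ → refl) zero)) ,
        profF (Profiles.profile-elim p ωP (just zero) m (proj₂ h₂))) , sp , ℓ , z , C
      where open CoreFacts {β} {ω} {ℓ} sp C using (root-label; root-per; profF)

  totF' : ∀ n σ τ → Perm₀V σ → TreeF n τ → ∃ λ x → LabF n x × RelF x (σ , τ)
  totF' n σ τ sp (std , z , pr , wp) = go (core-tot' σ τ sp std)
    where
    go : (∃ λ β → ∃ λ ω → ∃ λ ℓ → Core β ω ℓ (σ , τ)) → ∃ λ x → LabF n x × RelF x (σ , τ)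
    go (β , ω , ℓ , C) = (β , ω) , ∧-intro (FromLab.constellation lab) (∧-intro
        (≡ᵇ-intro (per-unique (Reflect.orbitSize-per (lookup ω) ωP (λ _ → refl) zero) (root-per⁻ pr)))
        (Profiles.profile-intro p ωP (just zero) m (profF⁻ wp))) , sp , ℓ , trans (sym root-label) z , C
      where open CoreFacts {β} {ω} {ℓ} sp C using (lab; ωP; root-label; root-per⁻; profF⁻)

  -- A labelled constellation is the same as a numbering that fixes the root together with a
  -- standard tree.
  countF-trees : ∀ n → ∃ λ t → Size (TreeF n) t × countF p n m M ≡ M ! * t
  countF-trees n = size-split (labF-size n) (perm₀-size M) vec-≟ idV idV-perm RelF (totF n) (totF' n) inj inj'
    where
    inj : ∀ {x x' y} → LabF n x → LabF n x' → RelF x y → RelF x' y → x ≡ x'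
    inj {β , ω} {β' , ω'} {σ , τ} _ _ (sp , ℓ , _ , C) (_ , ℓ' , _ , C') =
      let (a , b , _) = core-inj {β} {ω} {ℓ} {β'} {ω'} {ℓ'} {σ} {τ} (proj₁ sp) C C' in cong₂ _,_ a b
    inj' : ∀ {x a y a' y'} → Perm₀V a → TreeF n y → Perm₀V a' → TreeF n y' → RelF x (a , y) → RelF x (a' , y') → (a , y) ≡ (a' , y')
    inj' {β , ω} {a} {y} {a'} {y'} sp (std , _) sp' (std' , _) (_ , ℓ , z , C) (_ , ℓ' , z' , C') =
        fin (vec-ext (λ e → trans (typed {β} {ω} {ℓ} (Core.lab C) z e) (sym (typed {β} {ω} {ℓ'} (Core.lab C') z' e)))) C C'
      where
      fin : ∀ {ℓ ℓ'} → ℓ ≡ ℓ' → Core β ω ℓ (a , y) → Core β ω ℓ' (a' , y') → (a , y) ≡ (a' , y')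
      fin {ℓ} refl C C' = core-inj' {β} {ω} {ℓ} {a} {y} {a'} {y'} sp std sp' std' C C'

  testV : (i : ℕ) → Perms → Perms → Fin N → Bool
  testV i β ω v = isConstellation p (lookup β) (lookup ω) ∧ isRep (vertexPerm (lookup β) (lookup ω)) v
     ∧ eqVec (profile K p (lookup ω) nothing) m
     ∧ (typeOrigin (lookup β) (lookup ω) v zero ℕ.≡ᵇ suc (typeEnd (lookup β) (lookup ω) v zero))
     ∧ (typeOrigin (lookup β) (lookup ω) v zero ℕ.≤ᵇ i)

  LabV : (i : ℕ) → Perms × Perms × Fin N → Set
  LabV i (β , ω , v) = testV i β ω v ≡ true

  labV-size : ∀ i → Size (LabV i) (countV p i m M)
  labV-size i = count-≗ (size-concatMap {Q = λ β (ω , v) → ω ∈ allVec N N × v ∈ L.allFin N × testV i β ω v ≡ true}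
      (λ β → L.concatMap (λ ω → L.map (testV i β ω) (L.allFin N)) (allVec N N)) (allVec N N) (allVec-unique N N)
      (λ β → size-concatMap {Q = λ ω v → v ∈ L.allFin N × testV i β ω v ≡ true} (λ ω → L.map (testV i β ω) (L.allFin N)) (allVec N N) (allVec-unique N N)
        (λ ω → size-map (testV i β ω) (L.allFin N) (allFin-unique N))))
    (λ _ (_ , _ , _ , h) → h) (λ (β , ω , v) h → allVec-complete β , allVec-complete ω , Memₚ.∈-allFin v , h) id id

  -- Ties `v` to the sink without reference to a particular proof that the labelling is good.
  NoFall : Perms → Perms → Vec ℕ N → Fin N → Set
  NoFall β ω ℓ v = ∀ f → Orb (vertexPerm (lookup β) (lookup ω)) v f → lookup ℓ f ≢ suc (lookup ℓ (lookup ω f))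

  RelV : ℕ → Perms × Perms × Fin N → Perms × TreeData → Set
  RelV i (β , ω , v) (σ , τ) = Perm₀V σ × ∃ λ ℓ → lookup ℓ zero ≡ i × NoFall β ω ℓ v × Core β ω ℓ (σ , τ)

  module Sinks {β ω ℓ} (L : IsLab (lookup β) (lookup ω) (lookup ℓ)) where
    open IsLab L using (β-inj; ω-inj; good)
    open Walks (lookup β) (lookup ω) β-inj ω-inj public
    open Contours.OneSink (Labels.Good.one-sink good) using (sink; noF; others)

    to-sink : ∀ {v} → NoFall β ω ℓ v → Orb (to ρ) v sink
    to-sink {v} nf with others v
    ... | inj₂ o = o
    ... | inj₁ (f , ff , o) = ⊥-elim (nf f (orb-cong (λ x → sym (vp≗ x)) o) ff)

    from-sink : ∀ {v} → Orb (to ρ) sink v → NoFall β ω ℓ v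
    from-sink o f o' = noF (orb-trans o (orb-cong vp≗ o'))

    typedV : ∀ {v} → NoFall β ω ℓ v → ∀ e → lookup ℓ e ≡ lookup ℓ v + typeOrigin (lookup β) (lookup ω) v e
    typedV {v} nf = FromLab.ℓ-type L v (to-sink {v} nf)

    sink-rep : ∃ λ v → isRep (vertexPerm (lookup β) (lookup ω)) v ≡ true × NoFall β ω ℓ v
    sink-rep = let (v , o , r) = Rρ.min-rep sink in v , r , from-sink (orb-cong vp≗ o)

    rep-unique : ∀ {v v'} → isRep (vertexPerm (lookup β) (lookup ω)) v ≡ true → isRep (vertexPerm (lookup β) (lookup ω)) v' ≡ true →
      NoFall β ω ℓ v → NoFall β ω ℓ v' → v ≡ v'
    rep-unique {v} {v'} r r' n n' = Rρ.rep-unique {v} {v'} r r' (orb-cong (λ x → sym (vp≗ x)) (orb-trans (to-sink {v} n) (orb-sym ρ (to-sink {v'} n'))))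

  totV : ∀ i x → LabV i x → ∃ λ (σ , τ) → (Perm₀V σ × TreeV i τ) × RelV i x (σ , τ)
  totV i (β , ω , v) h = go (core-tot β ω ℓ L)
    where
    h₁ = ∧-true {isConstellation p (lookup β) (lookup ω)} h
    h₂ = ∧-true {isRep (vertexPerm (lookup β) (lookup ω)) v} (proj₂ h₁)
    h₃ = ∧-true {eqVec (profile K p (lookup ω) nothing) m} (proj₂ h₂)
    h₄ = ∧-true {typeOrigin (lookup β) (lookup ω) v zero ℕ.≡ᵇ suc (typeEnd (lookup β) (lookup ω) v zero)} (proj₂ h₃)
    module FC = FromConstellation (lookup β) (lookup ω) (proj₁ h₁) using (β-inj; ω-inj; t-self; t-ρ; ℓ; lab)
    module W = Walks (lookup β) (lookup ω) FC.β-inj FC.ω-inj using (vp≗; module To)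
    t = W.To.t v
    t-def = W.To.t-def v
    t-fall : t zero ≡ suc (t (lookup ω zero))
    t-fall = trans (t-def zero) (trans (≡ᵇ-elim (proj₁ h₄)) (cong suc (sym (t-def (lookup ω zero)))))
    t≤i : t zero ≤ i
    t≤i = subst (_≤ i) (sym (t-def zero)) (≤ᵇ-elim (proj₂ h₄))
    -- The truncated subtraction is exact because `t zero ≤ i`.
    s = i ∸ t zero
    ℓ : Vec ℕ N
    ℓ = tab (FC.ℓ v s)
    ℓ-look : ∀ x → lookup ℓ x ≡ s + t x
    ℓ-look = look-tab (FC.ℓ v s)
    L : IsLab (lookup β) (lookup ω) (lookup ℓ)
    L = lab-cong (λ x → sym (look-tab (FC.ℓ v s) x)) (FC.lab v s)
    ωP = fin-perm (lookup ω) (IsLab.ω-inj L)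
    z : lookup ℓ zero ≡ i
    z = trans (ℓ-look zero) (ℕₚ.m∸n+n≡m t≤i)
    fall : lookup ℓ zero ≡ suc (lookup ℓ (lookup ω zero))
    fall = trans (ℓ-look zero) (trans (cong (s +_) t-fall) (trans (ℕₚ.+-suc s _) (cong suc (sym (ℓ-look (lookup ω zero))))))
    nf : NoFall β ω ℓ v
    nf f o e = ℕₚ.1+n≰n (ℕₚ.≤-trans (s≤s (ℕₚ.m≤m+n s (t (lookup ω f)))) (ℕₚ.≤-reflexive (trans (cong suc (sym (ℓ-look (lookup ω f))))
       (trans (sym e) (trans (ℓ-look f) (trans (cong (s +_) (trans (sym (FC.t-ρ v (orb-cong W.vp≗ o))) (FC.t-self v))) (ℕₚ.+-identityʳ s)))))))
    go : (∃ λ ((σ , τ) : Perms × TreeData) → (Perm₀V σ × IsStdTree τ) × Core β ω ℓ (σ , τ)) →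
      ∃ λ (σ , τ) → (Perm₀V σ × TreeV i τ) × RelV i (β , ω , v) (σ , τ)
    go ((σ , τ) , (sp , std) , C) = (σ , τ) , (sp , std , trans root-label z ,
        trans root-label (trans fall (cong suc (sym root-next))) ,
        profV (Profiles.profile-elim p ωP nothing m (proj₁ h₃))) , sp , ℓ , z , nf , C
      where open CoreFacts {β} {ω} {ℓ} sp C using (root-label; root-next; profV)

  totV' : ∀ i σ τ → Perm₀V σ → TreeV i τ → ∃ λ x → LabV i x × RelV i x (σ , τ)
  totV' i σ τ sp (std , z , fl , wp) = go (core-tot' σ τ sp std)
    where
    go : (∃ λ β → ∃ λ ω → ∃ λ ℓ → Core β ω ℓ (σ , τ)) → ∃ λ x → LabV i x × RelV i x (σ , τ)
    go (β , ω , ℓ , C) = (β , ω , v) , ∧-intro (FromLab.constellation lab) (∧-intro isR (∧-intro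
        (Profiles.profile-intro p ωP nothing m (profV⁻ wp))
        (∧-intro (≡ᵇ-intro t-fall) (≤ᵇ-intro t≤i)))) , sp , ℓ , ℓ0 , nf , C
      where
      open CoreFacts {β} {ω} {ℓ} sp C using (lab; ωP; root-label; root-next; profV⁻)
      module S = Sinks {β} {ω} {ℓ} lab using (typedV; sink-rep)
      v = proj₁ S.sink-rep
      isR = proj₁ (proj₂ S.sink-rep)
      nf : NoFall β ω ℓ v
      nf = proj₂ (proj₂ S.sink-rep)
      ty : ∀ e → lookup ℓ e ≡ lookup ℓ v + typeOrigin (lookup β) (lookup ω) v e
      ty = S.typedV {v} nf
      ℓ0 : lookup ℓ zero ≡ i
      ℓ0 = trans (sym root-label) z
      t-fall : typeOrigin (lookup β) (lookup ω) v zero ≡ suc (typeEnd (lookup β) (lookup ω) v zero)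
      t-fall = ℕₚ.+-cancelˡ-≡ (lookup ℓ v) _ _ (trans (sym (ty zero)) (trans (sym root-label) (trans fl (trans (cong suc (trans root-next (ty (lookup ω zero)))) (sym (ℕₚ.+-suc (lookup ℓ v) _))))))
      t≤i : typeOrigin (lookup β) (lookup ω) v zero ≤ i
      t≤i = subst (typeOrigin (lookup β) (lookup ω) v zero ≤_) (trans (sym (ty zero)) ℓ0) (ℕₚ.m≤n+m _ (lookup ℓ v))

  -- As for `F`, with the pointed vertex recovered as the sink; `isRep` selects one representative
  -- edge of it.
  countV-trees : ∀ i → ∃ λ t → Size (TreeV i) t × countV p i m M ≡ M ! * t
  countV-trees i = size-split (labV-size i) (perm₀-size M) vec-≟ idV idV-perm (RelV i) (totV i) (totV' i) inj inj'
    where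
    reps : ∀ {β ω v} → LabV i (β , ω , v) → isRep (vertexPerm (lookup β) (lookup ω)) v ≡ true
    reps {β} {ω} {v} h = proj₁ (∧-true {isRep (vertexPerm (lookup β) (lookup ω)) v} (proj₂ (∧-true {isConstellation p (lookup β) (lookup ω)} h)))
    inj : ∀ {x x' y} → LabV i x → LabV i x' → RelV i x y → RelV i x' y → x ≡ x'
    inj {β , ω , v} {β' , ω' , v'} {σ , τ} h h' (sp , ℓ , _ , nf , C) (_ , ℓ' , _ , nf' , C') =
        fin (core-inj {β} {ω} {ℓ} {β'} {ω'} {ℓ'} {σ} {τ} (proj₁ sp) C C') h' nf'
      where
      fin : (β ≡ β' × ω ≡ ω' × ℓ ≡ ℓ') → LabV i (β' , ω' , v') → NoFall β' ω' ℓ' v' → (β , ω , v) ≡ (β' , ω' , v')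
      fin (refl , refl , refl) h' nf' = cong (λ z → β , ω , z) (Sinks.rep-unique {β} {ω} {ℓ} (Core.lab C) {v} {v'} (reps {β} {ω} {v} h) (reps {β} {ω} {v'} h') nf nf')
    inj' : ∀ {x a y a' y'} → Perm₀V a → TreeV i y → Perm₀V a' → TreeV i y' → RelV i x (a , y) → RelV i x (a' , y') → (a , y) ≡ (a' , y')
    inj' {β , ω , v} {a} {y} {a'} {y'} sp (std , _) sp' (std' , _) (_ , ℓ , z , nf , C) (_ , ℓ' , z' , nf' , C') =
        fin (vec-ext (λ e → trans (ty e) (trans (cong (_+ typeOrigin (lookup β) (lookup ω) v e) ℓv) (sym (ty' e))))) C C'
      where
      ty = Sinks.typedV {β} {ω} {ℓ} (Core.lab C) {v} nf
      ty' = Sinks.typedV {β} {ω} {ℓ'} (Core.lab C') {v} nf'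
      ℓv : lookup ℓ v ≡ lookup ℓ' v
      ℓv = ℕₚ.+-cancelʳ-≡ (typeOrigin (lookup β) (lookup ω) v zero) _ _ (trans (sym (ty zero)) (trans z (trans (sym z') (ty' zero))))
      fin : ∀ {ℓ ℓ'} → ℓ ≡ ℓ' → Core β ω ℓ (a , y) → Core β ω ℓ' (a' , y') → (a , y) ≡ (a' , y')
      fin {ℓ} refl C C' = core-inj' {β} {ω} {ℓ} {a} {y} {a'} {y'} sp std sp' std' C C'

-- Face degrees and the number of edges

orbit-size : ∀ {X : Set} (φ : Perm X) {P : X → Set} {c k} → Count P (Orb (to φ)) c →
  (∀ {x} → P x → Per (to φ) x (suc k)) → (∀ {x y} → Orb (to φ) x y → P x → P y) → Size P (c * suc k)
orbit-size {X} φ {P} {c} {k} C per closed = record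
  { rep = rp ; repP = λ i → closed (toℕ (proj₂ (Fin.remQuot {c} (suc k) i)) , refl) (repP C _)
  ; sep = λ i j e → trans (sym (Finₚ.combine-remQuot {c} (suc k) i)) (trans (sp _ _ _ _ e) (Finₚ.combine-remQuot {c} (suc k) j))
  ; cover = λ x px → cv x px (cover C x px) }
  where
  at : Fin c → Fin (suc k) → X
  at a b = iter (to φ) (toℕ b) (rep C a)
  rp : Fin (c * suc k) → X
  rp i = at (proj₁ (Fin.remQuot {c} (suc k) i)) (proj₂ (Fin.remQuot {c} (suc k) i))
  back : ∀ a → ∀ j → Orb (to φ) (iter (to φ) j (rep C a)) (rep C a)
  back a j = k * j , trans (sym (iter-+ (to φ) (k * j) j (rep C a))) (trans (cong (λ z → iter (to φ) z (rep C a)) (trans (ℕₚ.+-comm (k * j) j) (ℕₚ.*-comm (suc k) j)))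
     (iter-* (to φ) (suc k) (rep C a) (per-closes (per (repP C a))) j))
  sp : ∀ a b a' b' → at a b ≡ at a' b' → Fin.combine a b ≡ Fin.combine a' b'
  sp a b a' b' e with sep C a a' (orb-trans (toℕ b , refl) (subst (λ z → Orb (to φ) z (rep C a')) (sym e) (back a' (toℕ b'))))
  ... | refl = cong (Fin.combine a) (CycleLabel.σ-inj φ (rep C a) (per (repP C a)) e)
  cv : ∀ x → P x → (∃ λ a → Orb (to φ) x (rep C a)) → ∃ λ i → x ≡ rp i
  cv x px (a , j , e) = Fin.combine a b , sym (trans (cong (λ z → at (proj₁ z) (proj₂ z)) (Finₚ.remQuot-combine a b)) (CycleLabel.σ-σ⁻¹ φ (rep C a) (per (repP C a)) o))
    where
    o : Orb (to φ) (rep C a) x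
    o = subst (λ z → Orb (to φ) z x) e (k * j , trans (sym (iter-+ (to φ) (k * j) j x)) (trans (cong (λ z → iter (to φ) z x) (trans (ℕₚ.+-comm (k * j) j) (ℕₚ.*-comm (suc k) j)))
      (iter-* (to φ) (suc k) x (per-closes (per px)) j)))
    b = CycleLabel.σ⁻¹ φ (rep C a) (per (repP C a)) o

orbit-of-size : ∀ {X : Set} (φ : Perm X) {r k} → Per (to φ) r (suc k) → Size (Orb (to φ) r) (suc k)
orbit-of-size φ {r} {k} pr = record
  { rep = σ ; repP = λ i → toℕ i , refl ; sep = λ i j → σ-inj ; cover = λ x o → σ⁻¹ o , sym (σ-σ⁻¹ o) }
  where open CycleLabel φ r pr using (σ; σ-inj; σ⁻¹; σ-σ⁻¹)

sum-cong : ∀ {A : Set} {f g : A → ℕ} (xs : List A) → (∀ x → f x ≡ g x) → sum (L.map f xs) ≡ sum (L.map g xs)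
sum-cong [] h = refl
sum-cong (x ∷ xs) h = cong₂ _+_ (h x) (sum-cong xs h)

sum-* : ∀ {A : Set} (c : ℕ) (f : A → ℕ) (xs : List A) → sum (L.map (λ x → c * f x) xs) ≡ c * sum (L.map f xs)
sum-* c f [] = sym (ℕₚ.*-zeroʳ c)
sum-* c f (x ∷ xs) = trans (cong (c * f x +_) (sum-* c f xs)) (sym (ℕₚ.*-distribˡ-+ c (f x) _))

sum-+ : ∀ {A : Set} (f g : A → ℕ) (xs : List A) → sum (L.map (λ x → f x + g x) xs) ≡ sum (L.map f xs) + sum (L.map g xs)
sum-+ f g [] = refl
sum-+ f g (x ∷ xs) = trans (cong (f x + g x +_) (sum-+ f g xs)) (solve 4 (λ a b c d → (a :+ b) :+ (c :+ d) := (a :+ c) :+ (b :+ d)) refl (f x) (g x) _ _)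
  where open +-*-Solver

wsum-+ : ∀ {K} (m a b : Vec ℕ K) → (∀ i → lookup m i ≡ lookup a i + lookup b i) → wsum m ≡ wsum a + wsum b
wsum-+ {K} m a b h = trans (sum-cong (L.allFin K) (λ i → trans (cong (suc (toℕ i) *_) (h i)) (ℕₚ.*-distribˡ-+ (suc (toℕ i)) (lookup a i) (lookup b i))))
  (sum-+ (λ i → suc (toℕ i) * lookup a i) (λ i → suc (toℕ i) * lookup b i) (L.allFin K))

-- Disjoint faces occupy disjoint sets of edges. It is only an inequality, since faces of degree
-- above `K p` do not show in `m`; equality is forced later by the total number of edges.
profile-bound : ∀ {X : Set} {N} (card : Card X N) (φ : Perm X) {Ex : X → Set} {e q K} (m : Vec ℕ K) →
  Size Ex e → (∀ {x y} → Orb (to φ) x y → Ex y → Ex x) → WProf (suc q) (to φ) Ex m → e + suc q * wsum m ≤ N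
profile-bound {X} {N} card φ {Ex} {e} {q} {K} m ce resp w = subst (λ z → e + z ≤ N) total
    (count-≤ ≡-isEq (count-⊎ {P = P₁} {Q = P₂} ≡-isEq c₁ c₂ (λ { {inj₁ x} _ () refl })) card
      (λ { (inj₁ x) _ → x ; (inj₂ (i , x)) _ → x }) (λ _ _ → tt) inj)
  where
  p = suc q
  Q : Fin K → X → Set
  Q i x = Per (to φ) x (suc (toℕ i) * p) × ¬ Ex x
  P₁ P₂ : X ⊎ (Fin K × X) → Set
  P₁ (inj₁ x) = Ex x
  P₁ (inj₂ _) = ⊥
  P₂ (inj₁ x) = ⊥
  P₂ (inj₂ (i , x)) = i ∈ L.allFin K × Q i x
  c₁ : Size P₁ e
  c₁ = count-map ce inj₁ (λ _ h → h) (λ { _ _ refl → refl }) (λ { (inj₁ x) h → x , h , λ { _ refl → refl } })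
  c₂ : Size P₂ (sum (L.map (λ i → lookup m i * (suc (toℕ i) * p)) (L.allFin K)))
  c₂ = count-map (size-sum {Q = Q} (L.allFin K) (allFin-unique K) (λ i _ → orbit-size φ (w i) proj₁
        (λ o (a , b) → per-orb φ o a , λ z → b (resp o z)))) inj₂ (λ _ h → h) (λ { _ _ refl → refl })
      (λ { (inj₂ y) h → y , h , λ { _ refl → refl } })
  inj : ∀ {x x'} (px : P₁ x ⊎ P₂ x) (px' : P₁ x' ⊎ P₂ x') → _ → x ≡ x'
  inj {inj₁ x} {inj₁ x'} _ _ refl = refl
  inj {inj₁ x} {inj₂ (i , x')} (inj₁ ex) (inj₂ (_ , _ , n)) refl = ⊥-elim (n ex)
  inj {inj₂ (i , x)} {inj₁ x'} (inj₂ (_ , _ , n)) (inj₁ ex) refl = ⊥-elim (n ex)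
  inj {inj₂ (i , x)} {inj₂ (j , x')} (inj₂ (_ , a , _)) (inj₂ (_ , b , _)) refl =
    cong (λ z → inj₂ (z , x)) (Finₚ.toℕ-injective (ℕₚ.suc-injective (ℕₚ.*-cancelʳ-≡ _ _ p (per-unique a b))))
  total : sum (L.map (λ i → lookup m i * (suc (toℕ i) * p)) (L.allFin K)) ≡ p * wsum m
  total = trans (sum-cong (L.allFin K) (λ i → solve 3 (λ a b c → a :* (b :* c) := c :* (b :* a)) refl (lookup m i) (suc (toℕ i)) p))
    (sum-* p (λ i → suc (toℕ i) * lookup m i) (L.allFin K))
    where open +-*-Solver

-- Restricting a pair to a closed part

module Piece {N : ℕ} (κ ω : Perm (Fin N)) (r : Fin N) {M₁ : ℕ} (per : Per (to (κ ∙ ω)) r (suc M₁))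
    (κ-closed : ∀ z → Orb (to (κ ∙ ω)) r z → Orb (to (κ ∙ ω)) r (to κ z))
    (ω-closed : ∀ z → Orb (to (κ ∙ ω)) r z → Orb (to (κ ∙ ω)) r (to ω z)) where
  π = κ ∙ ω
  N₁ = suc M₁
  module F₁ = Finite (fin-card N₁) using (orb-sym; orbits)
  open CycleLabel π r per public using (σ; σ-inj; σ⁻¹; σ-σ⁻¹; σ-rot)

  Cls : Fin N → Set
  Cls = Orb (to π) r

  σ-cls : ∀ j → Cls (σ j)
  σ-cls j = toℕ j , refl

  κ̄ ω̄ : Vec (Fin N₁) N₁
  κ̄ = tab (λ j → σ⁻¹ (κ-closed (σ j) (σ-cls j)))
  ω̄ = tab (λ j → σ⁻¹ (ω-closed (σ j) (σ-cls j)))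

  κσ : ∀ j → σ (lookup κ̄ j) ≡ to κ (σ j)
  κσ j = trans (cong σ (look-tab _ j)) (σ-σ⁻¹ (κ-closed (σ j) (σ-cls j)))

  ωσ : ∀ j → σ (lookup ω̄ j) ≡ to ω (σ j)
  ωσ j = trans (cong σ (look-tab _ j)) (σ-σ⁻¹ (ω-closed (σ j) (σ-cls j)))

  κ̄-inj : ∀ {x y} → lookup κ̄ x ≡ lookup κ̄ y → x ≡ y
  κ̄-inj {x} {y} e = σ-inj (Perm.injective κ (trans (sym (κσ x)) (trans (cong σ e) (κσ y))))

  ω̄-inj : ∀ {x y} → lookup ω̄ x ≡ lookup ω̄ y → x ≡ y
  ω̄-inj {x} {y} e = σ-inj (Perm.injective ω (trans (sym (ωσ x)) (trans (cong σ e) (ωσ y))))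

  rotates : ∀ x → lookup κ̄ (lookup ω̄ x) ≡ rot x
  rotates x = σ-inj (trans (κσ _) (trans (cong (to κ) (ωσ x)) (σ-rot x)))

  module _ {f : Perm (Fin N)} {f̄ : Fin N₁ → Fin N₁} (h : ∀ j → σ (f̄ j) ≡ to f (σ j)) where

    orb-up : ∀ {i j} → Orb f̄ i j → Orb (to f) (σ i) (σ j)
    orb-up = orb-map σ h

    orb-down : ∀ {i j} → Orb (to f) (σ i) (σ j) → Orb f̄ i j
    orb-down {i} (k , e) = k , σ-inj (trans (iter-map σ h k i) e)

    per-up : ∀ {j k} → Per f̄ j k → Per (to f) (σ j) k
    per-up {j} {k} (mkPer a b c) = mkPer a (trans (sym (iter-map {g = to f} σ h k j)) (cong σ b))
      (λ i e → c i (σ-inj (trans (iter-map {g = to f} σ h i j) e)))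

    per-down : ∀ {j k} → Per (to f) (σ j) k → Per f̄ j k
    per-down {j} {k} (mkPer a b c) = mkPer a (σ-inj (trans (iter-map {g = to f} σ h k j) b))
      (λ i e → c i (trans (sym (iter-map {g = to f} σ h i j)) (cong σ e)))

    class-count : ∀ {c} → Count {Fin N₁} All⊤ (Orb f̄) c → Count Cls (Orb (to f)) c
    class-count C = count-map C σ (λ j _ → σ-cls j) (λ _ _ → orb-down)
      (λ z o → σ⁻¹ o , tt , λ {j} _ o' → subst (λ v → Orb (to f) v (σ j)) (σ-σ⁻¹ o) (orb-up o'))

    class-restrict : ∀ {P : Fin N → Set} {P̄ : Fin N₁ → Set} {c} → (∀ j → P (σ j) → P̄ j) → (∀ j → P̄ j → P (σ j)) →
      Count (λ z → Cls z × P z) (Orb (to f)) c → Count P̄ (Orb f̄) c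
    class-restrict {P} {P̄} a b C = count-mapP C (λ z (o , _) → σ⁻¹ o)
      (λ z (o , pz) → a _ (subst P (sym (σ-σ⁻¹ o)) pz))
      (λ (o , _) (o' , _) w → subst₂ (Orb (to f)) (σ-σ⁻¹ o) (σ-σ⁻¹ o') (orb-up w))
      (λ j pj → σ j , (σ-cls j , b j pj) , λ (o , _) w → orb-down (subst (Orb (to f) (σ j)) (sym (σ-σ⁻¹ o)) w))

  κ̄P = fin-perm (lookup κ̄) κ̄-inj
  ω̄P = fin-perm (lookup ω̄) ω̄-inj

  rot-single : ∀ x y → Orb (to (κ̄P ∙ ω̄P)) x y
  rot-single x y = orb-trans (F₁.orb-sym (κ̄P ∙ ω̄P) (fromZero x)) (fromZero y)
    where
    fromZero : ∀ x → Orb (to (κ̄P ∙ ω̄P)) zero x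
    fromZero x = orb-cong (λ z → sym (rotates z)) (toℕ x , iter-rot-zero x)

  -- The genus inequality for a single cycle. Equality comes later, from adding the two pieces of a
  -- cut tree.
  piece-≤ : ∀ {a b} → Count {Fin N₁} All⊤ (Orb (lookup κ̄)) a → Count {Fin N₁} All⊤ (Orb (lookup ω̄)) b → a + b ≤ N₁ + 1
  piece-≤ {a} {b} ca cb = ℕₚ.+-cancelʳ-≤ 1 _ _ (subst (a + b + 1 ≤_) (sym (ℕₚ.+-assoc N₁ 1 1))
    (FinitePerm.genus (fin-card N₁) κ̄P ω̄P ca cb (count-one zero tt (λ y _ → rot-single y zero)) (λ (_ : Fin 1) → zero)
      (λ z → zero , orb-induct (Conn (lookup κ̄) (lookup ω̄)) (λ _ → done) (λ c → via₂ (via₁ c)) (rot-single z zero))))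

-- Gluing a tree at a corner of the root face

module Gluing (q : ℕ) (1≤q : 1 ≤ q) where
  open Trees q 1≤q using (IsTree)

  p : ℕ
  p = suc q

  T : ℕ → Set
  T M = Relabel.TreeData q 1≤q {M}

  Std : ∀ {M} → T M → Set
  Std {M} = Relabel.IsStdTree q 1≤q {M}

  Follow : ∀ {X : Set} (ω : X → X) (ℓ : X → ℕ) → X → List Bool → Set
  Follow ω ℓ x [] = ⊤
  Follow ω ℓ x (true ∷ s)  = ℓ (ω x) ≡ ℓ x + q × Follow ω ℓ (ω x) s
  Follow ω ℓ x (false ∷ s) = ℓ x ≡ suc (ℓ (ω x)) × Follow ω ℓ (ω x) s

  module _ {X Y : Set} {ω : X → X} {ℓ : X → ℕ} {ω' : Y → Y} {ℓ' : Y → ℕ} (φ : Y → X)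
      (ωφ : ∀ y → φ (ω' y) ≡ ω (φ y)) (ℓφ : ∀ y → ℓ' y ≡ ℓ (φ y)) where

    ℓω : ∀ y → ℓ' (ω' y) ≡ ℓ (ω (φ y))
    ℓω y = trans (ℓφ _) (cong ℓ (ωφ y))

    follow-push : ∀ s {y} → Follow ω' ℓ' y s → Follow ω ℓ (φ y) s
    follow-push [] _ = tt
    follow-push (true ∷ s) {y} (e , f) = trans (sym (ℓω y)) (trans e (cong (_+ q) (ℓφ y))) ,
      subst (λ z → Follow ω ℓ z s) (ωφ y) (follow-push s f)
    follow-push (false ∷ s) {y} (e , f) = trans (sym (ℓφ y)) (trans e (cong suc (ℓω y))) ,
      subst (λ z → Follow ω ℓ z s) (ωφ y) (follow-push s f)

    follow-pull : ∀ s {y} → Follow ω ℓ (φ y) s → Follow ω' ℓ' y s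
    follow-pull [] _ = tt
    follow-pull (true ∷ s) {y} (e , f) = trans (ℓω y) (trans e (cong (_+ q) (sym (ℓφ y)))) ,
      follow-pull s (subst (λ z → Follow ω ℓ z s) (sym (ωφ y)) f)
    follow-pull (false ∷ s) {y} (e , f) = trans (ℓφ y) (trans e (cong suc (sym (ℓω y)))) ,
      follow-pull s (subst (λ z → Follow ω ℓ z s) (sym (ωφ y)) f)

  follow-snoc : ∀ {X : Set} {ω : X → X} {ℓ : X → ℕ} w {x b} → Follow ω ℓ x w →
    Follow ω ℓ (iter ω (L.length w) x) (b ∷ []) → Follow ω ℓ x (w ++ b ∷ [])
  follow-snoc [] _ g = g
  follow-snoc {ω = ω} {ℓ} (true ∷ w) {x} {b} (e , f) g = e , follow-snoc w f (subst (λ z → Follow ω ℓ z (b ∷ [])) (sym (iter-comm ω (L.length w) x)) g)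
  follow-snoc {ω = ω} {ℓ} (false ∷ w) {x} {b} (e , f) g = e , follow-snoc w f (subst (λ z → Follow ω ℓ z (b ∷ [])) (sym (iter-comm ω (L.length w) x)) g)

  follow-unsnoc : ∀ {X : Set} {ω : X → X} {ℓ : X → ℕ} w {x b} → Follow ω ℓ x (w ++ b ∷ []) →
    Follow ω ℓ x w × Follow ω ℓ (iter ω (L.length w) x) (b ∷ [])
  follow-unsnoc [] g = tt , g
  follow-unsnoc {ω = ω} {ℓ} (true ∷ w) {x} {b} (e , f) = let (a , c) = follow-unsnoc w f in (e , a) , subst (λ z → Follow ω ℓ z (b ∷ [])) (iter-comm ω (L.length w) x) c
  follow-unsnoc {ω = ω} {ℓ} (false ∷ w) {x} {b} (e , f) = let (a , c) = follow-unsnoc w f in (e , a) , subst (λ z → Follow ω ℓ z (b ∷ [])) (iter-comm ω (L.length w) x) c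

  -- State of a walk around the root face. The word `w` has been read and its corners are bare, that
  -- is, fixed by `κ`; `s` is still to come and its corners may carry trees. The root face is left
  -- out of the profile.
  record TreeW (n : ℕ) {K M : ℕ} (w : List Bool) (h : ℕ) (s : List Bool) (m : Vec ℕ K) (τ : T M) : Set where
    constructor mkW
    κ : Fin (suc M) → Fin (suc M)
    κ = lookup (proj₁ τ)
    ω : Fin (suc M) → Fin (suc M)
    ω = lookup (proj₁ (proj₂ τ))
    ℓ : Fin (suc M) → ℕ
    ℓ = lookup (proj₂ (proj₂ τ))
    x : Fin (suc M)
    x = iter ω (L.length w) zero
    field
      std    : Std τ
      root   : ℓ zero ≡ 0
      rooted : Per ω zero (n * p)
      prof   : WProf p ω (Orb ω zero) m
      fixed  : ∀ i → i < L.length w → κ (iter ω i zero) ≡ iter ω i zero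
      height : ℓ x ≡ h
      did    : Follow ω ℓ zero w
      todo   : Follow ω ℓ x s

  record TreeV {K M : ℕ} (i : ℕ) (m : Vec ℕ K) (τ : T M) : Set where
    constructor mkV
    ω : Fin (suc M) → Fin (suc M)
    ω = lookup (proj₁ (proj₂ τ))
    ℓ : Fin (suc M) → ℕ
    ℓ = lookup (proj₂ (proj₂ τ))
    field
      std  : Std τ
      root : ℓ zero ≡ i
      fall : ℓ zero ≡ suc (ℓ (ω zero))
      prof : WProf p ω (λ _ → ⊥) m

  -- Gluing the root of a tree B onto the corner at g of a tree A

  module Sum {M₁ M₂ : ℕ} (κA ωA : Fin (suc M₁) → Fin (suc M₁)) (ℓA : Fin (suc M₁) → ℕ)
      (κB ωB : Fin (suc M₂) → Fin (suc M₂)) (ℓB : Fin (suc M₂) → ℕ) (g : Fin (suc M₁)) where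

    X : Set
    X = Fin (suc M₁) ⊎ Fin (suc M₂)

    plus : (Fin (suc M₁) → Fin (suc M₁)) → (Fin (suc M₂) → Fin (suc M₂)) → X → X
    plus f h (inj₁ a) = inj₁ (f a)
    plus f h (inj₂ b) = inj₂ (h b)

    swap₁ : ∀ a → Dec (a ≡ g) → X
    swap₁ a (yes _) = inj₂ zero
    swap₁ a (no _)  = inj₁ a

    -- Composing with this transposition inserts `g`, a fixed point of `κA`, into the `κB`-cycle of
    -- the root of `B` and changes nothing else.
    swap : X → X
    swap (inj₁ a) = swap₁ a (a Finₚ.≟ g)
    swap (inj₂ zero) = inj₁ g
    swap (inj₂ (suc b)) = inj₂ (suc b)

    swap-g : swap (inj₁ g) ≡ inj₂ zero
    swap-g with g Finₚ.≟ g
    ... | yes _ = refl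
    ... | no ne = ⊥-elim (ne refl)

    swap-else : ∀ {a} → a ≢ g → swap (inj₁ a) ≡ inj₁ a
    swap-else {a} ne with a Finₚ.≟ g
    ... | yes e = ⊥-elim (ne e)
    ... | no _ = refl

    swap² : ∀ y → swap (swap y) ≡ y
    swap² (inj₁ a) with a Finₚ.≟ g
    ... | yes refl = refl
    ... | no ne = swap-else ne
    swap² (inj₂ zero) = swap-g
    swap² (inj₂ (suc b)) = refl

    κX ωX : X → X
    κX y = plus κA κB (swap y)
    ωX = plus ωA ωB

    ℓX : X → ℕ
    ℓX (inj₁ a) = ℓA a
    ℓX (inj₂ b) = ℓB b

    iter-plus₁ : ∀ {f h} k a → iter (plus f h) k (inj₁ a) ≡ inj₁ (iter f k a)
    iter-plus₁ {f} {h} k a = sym (iter-map {f = f} {g = plus f h} inj₁ (λ _ → refl) k a)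

    iter-plus₂ : ∀ {f h} k b → iter (plus f h) k (inj₂ b) ≡ inj₂ (iter h k b)
    iter-plus₂ {f} {h} k b = sym (iter-map {f = h} {g = plus f h} inj₂ (λ _ → refl) k b)

    cardX : Card X (suc M₁ + suc M₂)
    cardX = count-≗ (count-⊎ {P = λ y → ∃ λ a → y ≡ inj₁ a} {Q = λ y → ∃ λ b → y ≡ inj₂ b} ≡-isEq
        (count-map (fin-card (suc M₁)) inj₁ (λ a _ → a , refl) (λ { _ _ refl → refl }) (λ { _ (a , refl) → a , tt , λ { _ refl → refl } }))
        (count-map (fin-card (suc M₂)) inj₂ (λ a _ → a , refl) (λ { _ _ refl → refl }) (λ { _ (a , refl) → a , tt , λ { _ refl → refl } }))
        (λ { (_ , refl) (_ , refl) () }))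
      (λ _ _ → tt) (λ { (inj₁ a) _ → inj₁ (a , refl) ; (inj₂ b) _ → inj₂ (b , refl) }) id id

    inj₁-orb : ∀ {f h a b} → Orb (plus f h) (inj₁ a) (inj₁ b) → Orb f a b
    inj₁-orb {f} {h} {a} (k , e) = k , inj₁-injective (trans (sym (iter-plus₁ {f} {h} k a)) e)

    inj₂-orb : ∀ {f h a b} → Orb (plus f h) (inj₂ a) (inj₂ b) → Orb h a b
    inj₂-orb {f} {h} {a} (k , e) = k , inj₂-injective (trans (sym (iter-plus₂ {f} {h} k a)) e)

    mixed-orb : ∀ {f h a b} → ¬ Orb (plus f h) (inj₁ a) (inj₂ b)
    mixed-orb {f} {h} {a} (k , e) with trans (sym (iter-plus₁ {f} {h} k a)) e
    ... | ()

    count-plus : ∀ {f h} {P : X → Set} {c d} → IsEq (Orb (plus f h)) → Count (P ∘ inj₁) (Orb f) c → Count (P ∘ inj₂) (Orb h) d →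
      Count P (Orb (plus f h)) (c + d)
    count-plus {f} {h} {P} E C D = count-≗ (count-⊎ {P = λ y → ∃ λ a → y ≡ inj₁ a × P y} {Q = λ y → ∃ λ b → y ≡ inj₂ b × P y} E
        (count-map C inj₁ (λ a pa → a , refl , pa) (λ _ _ → inj₁-orb) (λ { _ (a , refl , pa) → a , pa , λ _ o → orb-map inj₁ (λ _ → refl) o }))
        (count-map D inj₂ (λ a pa → a , refl , pa) (λ _ _ → inj₂-orb) (λ { _ (a , refl , pa) → a , pa , λ _ o → orb-map inj₂ (λ _ → refl) o }))
        (λ { (_ , refl , _) (_ , refl , _) o → mixed-orb o }))
      (λ { _ (inj₁ (_ , _ , p)) → p ; _ (inj₂ (_ , _ , p)) → p })
      (λ { (inj₁ a) p → inj₁ (a , refl , p) ; (inj₂ b) p → inj₂ (b , refl , p) }) id id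

    per₁ : ∀ {f h a k} → Per f a k → Per (plus f h) (inj₁ a) k
    per₁ {f} {h} {x} {k} (mkPer a b c) = mkPer a (trans (iter-plus₁ {f} {h} k x) (cong inj₁ b))
      (λ j e → c j (inj₁-injective (trans (sym (iter-plus₁ {f} {h} j x)) e)))

    per₁⁻ : ∀ {f h a k} → Per (plus f h) (inj₁ a) k → Per f a k
    per₁⁻ {f} {h} {x} {k} (mkPer a b c) = mkPer a (inj₁-injective (trans (sym (iter-plus₁ {f} {h} k x)) b))
      (λ j e → c j (trans (iter-plus₁ {f} {h} j x) (cong inj₁ e)))

    per₂ : ∀ {f h a k} → Per h a k → Per (plus f h) (inj₂ a) k
    per₂ {f} {h} {x} {k} (mkPer a b c) = mkPer a (trans (iter-plus₂ {f} {h} k x) (cong inj₂ b))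
      (λ j e → c j (inj₂-injective (trans (sym (iter-plus₂ {f} {h} j x)) e)))

    per₂⁻ : ∀ {f h a k} → Per (plus f h) (inj₂ a) k → Per h a k
    per₂⁻ {f} {h} {x} {k} (mkPer a b c) = mkPer a (inj₂-injective (trans (sym (iter-plus₂ {f} {h} k x)) b))
      (λ j e → c j (trans (iter-plus₂ {f} {h} j x) (cong inj₂ e)))

    plus-perm : Perm (Fin (suc M₁)) → Perm (Fin (suc M₂)) → Perm X
    to      (plus-perm f h) = plus (to f) (to h)
    from    (plus-perm f h) = plus (from f) (from h)
    to∘from (plus-perm f h) (inj₁ a) = cong inj₁ (to∘from f a)
    to∘from (plus-perm f h) (inj₂ b) = cong inj₂ (to∘from h b)
    from∘to (plus-perm f h) (inj₁ a) = cong inj₁ (from∘to f a)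
    from∘to (plus-perm f h) (inj₂ b) = cong inj₂ (from∘to h b)

    swap-perm : Perm X
    swap-perm = mkPerm swap swap swap² swap²

    plus-prof : ∀ {K} {m a b : Vec ℕ K} → IsEq (Orb ωX) → (∀ i → lookup m i ≡ lookup a i + lookup b i) →
      WProf p ωA (Orb ωA zero) a → WProf p ωB (λ _ → ⊥) b → WProf p ωX (Orb ωX (inj₁ zero)) m
    plus-prof {m = m} E h wa wb i = subst (Count _ (Orb ωX)) (sym (h i)) (count-plus E
      (count-≗ (wa i) (λ _ (a , n) → per₁ a , λ o → n (inj₁-orb o)) (λ _ (a , n) → per₁⁻ a , λ o → n (orb-map inj₁ (λ _ → refl) o)) id id)
      (count-≗ (wb i) (λ _ (a , _) → per₂ a , mixed-orb) (λ _ (a , _) → per₂⁻ a , λ ()) id id))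

    module _ (tA : IsTree κA ωA ℓA) (rA : ∀ x → κA (ωA x) ≡ rot x) (tB : IsTree κB ωB ℓB) (rB : ∀ x → κB (ωB x) ≡ rot x)
        (gg : κA g ≡ g) (g-fall : ℓA g ≡ suc (ℓA (ωA g))) (b-fall : ℓB zero ≡ suc (ℓB (ωB zero))) (gb : ℓA g ≡ ℓB zero) where
      module A = IsTree tA using (κ-inj; ω-inj; step; tree)
      module B = IsTree tB using (κ-inj; ω-inj; step; tree)
      κAP = fin-perm κA A.κ-inj
      ωAP = fin-perm ωA A.ω-inj
      κBP = fin-perm κB B.κ-inj
      ωBP = fin-perm ωB B.ω-inj
      κ′P = plus-perm κAP κBP
      κXP = κ′P ∙ swap-perm
      ωXP = plus-perm ωAP ωBP
      open Finite cardX using (orb-sym; orb-isEq; orbits)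
      open FinitePerm cardX using (orb-merge; swapped-⊆; swapped-≡)

      stepX : ∀ y → ℓX y ≡ suc (ℓX (ωX y)) ⊎ ℓX (ωX y) ≡ ℓX y + q
      stepX (inj₁ a) = A.step a
      stepX (inj₂ b) = B.step b

      open Labels cardX q 1≤q ℓX (ℓX ∘ ωX) stepX using (Tree)

      swapped-κ : Swapped κX (to κ′P) (inj₁ g) (inj₂ zero)
      swapped-κ = mkSwapped (cong (plus κA κB) swap-g) refl el
        where
        el : ∀ y → y ≢ inj₁ g → y ≢ inj₂ zero → κX y ≡ plus κA κB y
        el (inj₁ a) n _ = cong (plus κA κB) (swap-else (λ e → n (cong inj₁ e)))
        el (inj₂ zero) _ n = ⊥-elim (n refl)
        el (inj₂ (suc b)) _ _ = refl

      πX = κXP ∙ ωXP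
      π′ = κ′P ∙ ωXP

      u v : X
      u = from ωXP (inj₁ g)
      v = from ωXP (inj₂ zero)

      -- For the contours the exchange takes place at the preimages under `ω`. These lie on
      -- different contours, so the two contours merge into one.
      swapped-π : Swapped (to πX) (to π′) u v
      swapped-π = mkSwapped
        (trans (cong κX (to∘from ωXP (inj₁ g))) (trans (Swapped.sw-x swapped-κ) (cong (to κ′P) (sym (to∘from ωXP (inj₂ zero))))))
        (trans (cong κX (to∘from ωXP (inj₂ zero))) (trans (Swapped.sw-y swapped-κ) (cong (to κ′P) (sym (to∘from ωXP (inj₁ g))))))
        (λ y n n' → Swapped.sw-else swapped-κ (ωX y)
          (λ e → n (trans (sym (from∘to ωXP y)) (cong (from ωXP) e))) (λ e → n' (trans (sym (from∘to ωXP y)) (cong (from ωXP) e))))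

      π′-plus : ∀ y → to π′ y ≡ plus rot rot y
      π′-plus (inj₁ a) = cong inj₁ (rA a)
      π′-plus (inj₂ b) = cong inj₂ (rB b)

      rot-orb : ∀ {M} (x y : Fin (suc M)) → Orb rot x y
      rot-orb {M} x y = orb-trans (Finite.orb-sym (fin-card (suc M)) (rotation M) (toℕ x , iter-rot-zero x)) (toℕ y , iter-rot-zero y)

      sideA : ∀ a b → Orb (to π′) (inj₁ a) (inj₁ b)
      sideA a b = orb-cong (λ y → sym (π′-plus y)) (orb-map inj₁ (λ _ → refl) (rot-orb a b))

      sideB : ∀ a b → Orb (to π′) (inj₂ a) (inj₂ b)
      sideB a b = orb-cong (λ y → sym (π′-plus y)) (orb-map inj₂ (λ _ → refl) (rot-orb a b))

      not-uv : ¬ Orb (to π′) u v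
      not-uv o = mixed-orb (orb-cong π′-plus o)

      uv : Orb (to πX) u v
      uv = orb-merge πX π′ swapped-π not-uv

      to-u : ∀ y → Orb (to πX) y u
      to-u (inj₁ a) = swapped-⊆ πX π′ swapped-π uv (sideA a _)
      to-u (inj₂ b) = orb-trans (swapped-⊆ πX π′ swapped-π uv (sideB b _)) (orb-sym πX uv)

      counts : ∀ {f h c d e} (fP : Perm (Fin (suc M₁))) (hP : Perm (Fin (suc M₂))) → to fP ≡ f → to hP ≡ h →
        Count {Fin (suc M₁)} All⊤ (Orb f) c → Count {Fin (suc M₂)} All⊤ (Orb h) d → Count {X} All⊤ (Orb (plus f h)) e → e ≡ c + d
      counts fP hP refl refl C D E = count-unique (orb-isEq (plus-perm fP hP)) E (count-plus (orb-isEq (plus-perm fP hP)) C D)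

      treeX : Tree κXP ωXP
      treeX = record
        { ω-follows = λ _ → refl
        ; κ-label = κl
        ; κ-fixes = κf
        ; single = λ y y' → orb-trans (to-u y) (orb-sym πX (to-u y'))
        ; tree-euler = λ ca cb → eul ca cb (proj₂ (orbits κ′P)) (proj₂ (Finite.orbits (fin-card _) κAP)) (proj₂ (Finite.orbits (fin-card _) ωAP))
            (proj₂ (Finite.orbits (fin-card _) κBP)) (proj₂ (Finite.orbits (fin-card _) ωBP)) }
        where
        module TA = Labels.Tree A.tree using (κ-label; κ-fixes; tree-euler)
        module TB = Labels.Tree B.tree using (κ-label; κ-fixes; tree-euler)
        κl : ∀ y → ℓX (κX y) ≡ ℓX y
        κl (inj₁ a) with a Finₚ.≟ g
        ... | yes refl = trans (TB.κ-label zero) (sym gb)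
        ... | no _ = TA.κ-label a
        κl (inj₂ zero) = trans (TA.κ-label g) gb
        κl (inj₂ (suc b)) = TB.κ-label (suc b)
        κf : ∀ y → ¬ (ℓX y ≡ suc (ℓX (ωX y))) → κX y ≡ y
        κf (inj₁ a) nf with a Finₚ.≟ g
        ... | yes refl = ⊥-elim (nf g-fall)
        ... | no _ = cong inj₁ (TA.κ-fixes a nf)
        κf (inj₂ zero) nf = ⊥-elim (nf b-fall)
        κf (inj₂ (suc b)) nf = cong inj₂ (TB.κ-fixes (suc b) nf)
        not-κ : ¬ Orb (to κ′P) (inj₁ g) (inj₂ zero)
        not-κ o = mixed-orb o
        eul : ∀ {a b k a₁ b₁ a₂ b₂} → Count {X} All⊤ (Orb κX) a → Count {X} All⊤ (Orb ωX) b → Count {X} All⊤ (Orb (to κ′P)) k →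
          Count {Fin (suc M₁)} All⊤ (Orb κA) a₁ → Count {Fin (suc M₁)} All⊤ (Orb ωA) b₁ →
          Count {Fin (suc M₂)} All⊤ (Orb κB) a₂ → Count {Fin (suc M₂)} All⊤ (Orb ωB) b₂ → a + b ≡ (suc M₁ + suc M₂) + 1
        -- `κ` loses one cycle: the vertices of `g` and of the root of `B` become one.
        eul {a} {b} {k} {a₁} {b₁} {a₂} {b₂} ca cb ck ca₁ cb₁ ca₂ cb₂ = ℕₚ.suc-injective (begin
            suc a + b ≡⟨ cong₂ _+_ (trans (sym (swapped-≡ κXP κ′P swapped-κ not-κ ca ck)) (counts κAP κBP refl refl ca₁ ca₂ ck)) (counts ωAP ωBP refl refl cb₁ cb₂ cb) ⟩
            (a₁ + a₂) + (b₁ + b₂) ≡⟨ solve 4 (λ a b c d → (a :+ b) :+ (c :+ d) := (a :+ c) :+ (b :+ d)) refl a₁ a₂ b₁ b₂ ⟩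
            (a₁ + b₁) + (a₂ + b₂) ≡⟨ cong₂ _+_ (TA.tree-euler ca₁ cb₁) (TB.tree-euler ca₂ cb₂) ⟩
            (suc M₁ + 1) + (suc M₂ + 1) ≡⟨ solve 2 (λ a b → (a :+ con 1) :+ (b :+ con 1) := con 1 :+ ((a :+ b) :+ con 1)) refl (suc M₁) (suc M₂) ⟩
            suc ((suc M₁ + suc M₂) + 1) ∎)
          where
          open ≡-Reasoning
          open +-*-Solver

rot-per : ∀ {X : Set} {M} (f : X → X) (σ : Fin (suc M) → X) → (∀ {i j} → σ i ≡ σ j → i ≡ j) →
  (∀ j → σ (rot j) ≡ f (σ j)) → Per f (σ zero) (suc M)
rot-per {M = M} f σ inj h = mkPer (s≤s z≤n) (trans (sym (at (suc M))) (cong σ (iter-rot-full zero)))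
    (λ j e → m%n≡0⇒n∣m j (suc M) (trans (sym (trans (toℕ-iter-rot j zero) (cong (_% suc M) (ℕₚ.+-identityʳ j)))) (cong toℕ (inj (trans (at j) e)))))
  where
  at : ∀ k → σ (iter rot k zero) ≡ iter f k (σ zero)
  at k = iter-map σ h k zero

-- A glued tree and its two pieces determine each other

module Glues (q : ℕ) (1≤q : 1 ≤ q) where
  open Trees q 1≤q using (IsTree)
  open Gluing q 1≤q using (p; T; Std; Follow; follow-push; follow-unsnoc; TreeW; TreeV; module Sum)

  record Glue {M M₁ M₂ : ℕ} (τ : T M) (τA : T M₁) (τB : T M₂) (g : Fin (suc M₁)) : Set where
    private
      module S = Sum (lookup (proj₁ τA)) (lookup (proj₁ (proj₂ τA))) (lookup (proj₂ (proj₂ τA)))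
        (lookup (proj₁ τB)) (lookup (proj₁ (proj₂ τB))) (lookup (proj₂ (proj₂ τB))) g using (X; κX; ωX; ℓX)
    field
      σ : S.X → Fin (suc M)
      σ⁻¹ : Fin (suc M) → S.X
      σσ⁻¹ : ∀ z → σ (σ⁻¹ z) ≡ z
      σ-inj : ∀ {x y} → σ x ≡ σ y → x ≡ y
      σ-root : σ (inj₁ zero) ≡ zero
      κσ : ∀ y → σ (S.κX y) ≡ lookup (proj₁ τ) (σ y)
      ωσ : ∀ y → σ (S.ωX y) ≡ lookup (proj₁ (proj₂ τ)) (σ y)
      ℓσ : ∀ y → S.ℓX y ≡ lookup (proj₂ (proj₂ τ)) (σ y)

  module SumOf {M₁ M₂ : ℕ} (τA : T M₁) (τB : T M₂) (g : Fin (suc M₁)) =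
    Sum (lookup (proj₁ τA)) (lookup (proj₁ (proj₂ τA))) (lookup (proj₂ (proj₂ τA)))
        (lookup (proj₁ τB)) (lookup (proj₁ (proj₂ τB))) (lookup (proj₂ (proj₂ τB))) g
      using (X; plus; swap; swap-g; swap-else; swap²; κX; ωX; ℓX; cardX; per₁; plus-prof; κXP; ωXP; stepX; treeX)

  -- The isomorphism is forced along the contour from the root on, because a standard tree has
  -- contour `rot`.
  glue-unique : ∀ {M M₁ M₂} {τ τ' : T M} {τA : T M₁} {τB : T M₂} {g} → Std τ → Std τ' → Glue τ τA τB g → Glue τ' τA τB g → τ ≡ τ'
  glue-unique {M} {M₁} {M₂} {κ , ω , ℓ} {κ' , ω' , ℓ'} {τA} {τB} {g} (_ , rt) (_ , rt') G G' =
      cong₂ _,_ (vec-ext (λ z → by-σ {f = lookup κ} {lookup κ'} (λ y → trans (sym (G.κσ y)) (trans (σ≗ _) (trans (G'.κσ y) (cong (lookup κ') (sym (σ≗ y)))))) z))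
       (cong₂ _,_ (vec-ext (λ z → by-σ {f = lookup ω} {lookup ω'} (λ y → trans (sym (G.ωσ y)) (trans (σ≗ _) (trans (G'.ωσ y) (cong (lookup ω') (sym (σ≗ y)))))) z))
         (vec-ext (λ z → by-σ {f = lookup ℓ} {lookup ℓ'} (λ y → trans (sym (G.ℓσ y)) (trans (G'.ℓσ y) (cong (lookup ℓ') (sym (σ≗ y))))) z)))
    where
    module G = Glue G using (σ; σ⁻¹; σσ⁻¹; σ-inj; σ-root; κσ; ωσ; ℓσ)
    module G' = Glue G' using (σ; σ-root; κσ; ωσ; ℓσ)
    module S = SumOf τA τB g
      using (X; plus; swap; swap-g; swap-else; swap²; κX; ωX; ℓX; cardX; per₁; plus-prof; κXP; ωXP;
        stepX; treeX)
    πX : S.X → S.X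
    πX y = S.κX (S.ωX y)
    at : ∀ k → G.σ (iter πX k (inj₁ zero)) ≡ iter rot k zero
    at k = trans (iter-map G.σ (λ y → trans (G.κσ _) (trans (cong (lookup κ) (G.ωσ y)) (rt _))) k (inj₁ zero)) (cong (iter rot k) G.σ-root)
    at' : ∀ k → G'.σ (iter πX k (inj₁ zero)) ≡ iter rot k zero
    at' k = trans (iter-map G'.σ (λ y → trans (G'.κσ _) (trans (cong (lookup κ') (G'.ωσ y)) (rt' _))) k (inj₁ zero)) (cong (iter rot k) G'.σ-root)
    σ≗ : ∀ y → G.σ y ≡ G'.σ y
    σ≗ y = trans (sym (trans (at' k) (iter-rot-zero (G.σ y)))) (cong G'.σ (sym y≡))
      where
      k = toℕ (G.σ y)
      y≡ : y ≡ iter πX k (inj₁ zero)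
      y≡ = G.σ-inj (sym (trans (at k) (iter-rot-zero (G.σ y))))
    by-σ : ∀ {A : Set} {f h : Fin (suc M) → A} → (∀ y → f (G.σ y) ≡ h (G.σ y)) → ∀ z → f z ≡ h z
    by-σ {f = f} {h} e z = subst (λ v → f v ≡ h v) (G.σσ⁻¹ z) (e (G.σ⁻¹ z))

  module GlueFacts {M M₁ M₂ : ℕ} {τ : T M} {τA : T M₁} {τB : T M₂} {g : Fin (suc M₁)} (stA : Std τA) (stB : Std τB)
      (gg : lookup (proj₁ τA) g ≡ g) (G : Glue τ τA τB g) where
    open Glue G public
    module S = SumOf τA τB g
      using (X; plus; swap; swap-g; swap-else; swap²; κX; ωX; ℓX; cardX; per₁; plus-prof; κXP; ωXP;
        stepX; treeX)
    κ = lookup (proj₁ τ)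
    ω = lookup (proj₁ (proj₂ τ))
    open FinitePerm (fin-card (suc M)) using (transp; transp-x; transp-y; transp-else)
    -- `x` is the corner where `B` is attached and `f` is the root of `B`.
    x = σ (inj₁ g)
    f = σ (inj₂ zero)

    κf : κ f ≡ x
    κf = trans (sym (κσ (inj₂ zero))) (cong (λ a → σ (inj₁ a)) gg)

    κx≢x : κ x ≢ x
    κx≢x e with σ-inj (trans (trans (cong σ (cong (S.plus _ _) (sym S.swap-g))) (κσ (inj₁ g))) e)
    ... | ()

    -- Composing with the transposition again undoes the gluing: the contour falls apart into that
    -- of `A` through `zero` and that of `B` through `f`.
    κ′ π′ : Fin (suc M) → Fin (suc M)
    κ′ z = κ (transp x f z)
    π′ z = κ′ (ω z)

    σ-swap : ∀ y → σ (S.swap y) ≡ transp x f (σ y)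
    σ-swap (inj₂ zero) = sym (transp-y x f)
    σ-swap (inj₂ (suc b)) = sym (transp-else x f _ (λ e → case₁ (σ-inj e)) (λ e → case₂ (σ-inj e)))
      where
      case₁ : inj₂ (suc b) ≡ inj₁ g → ⊥
      case₁ ()
      case₂ : inj₂ (suc b) ≡ inj₂ zero → ⊥
      case₂ ()
    σ-swap (inj₁ a) = go (a Finₚ.≟ g)
      where
      case₂ : inj₁ a ≡ inj₂ zero → ⊥
      case₂ ()
      go : Dec (a ≡ g) → σ (S.swap (inj₁ a)) ≡ transp x f (σ (inj₁ a))
      go (yes refl) = trans (cong σ S.swap-g) (sym (transp-x x f))
      go (no ne) = trans (cong σ (S.swap-else ne)) (sym (transp-else x f _ (λ e → ne (inj₁-injective (σ-inj e))) (λ e → case₂ (σ-inj e))))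

    κ′σ : ∀ y → σ (S.plus (lookup (proj₁ τA)) (lookup (proj₁ τB)) y) ≡ κ′ (σ y)
    κ′σ y = trans (cong (λ v → σ (S.plus _ _ v)) (sym (S.swap² y))) (trans (κσ (S.swap y)) (cong κ (σ-swap y)))

    π′A : ∀ a → σ (inj₁ (rot a)) ≡ π′ (σ (inj₁ a))
    π′A a = trans (cong (λ v → σ (inj₁ v)) (sym (proj₂ stA a))) (trans (κ′σ (inj₁ (lookup (proj₁ (proj₂ τA)) a))) (cong κ′ (ωσ (inj₁ a))))

    π′B : ∀ b → σ (inj₂ (rot b)) ≡ π′ (σ (inj₂ b))
    π′B b = trans (cong (λ v → σ (inj₂ v)) (sym (proj₂ stB b))) (trans (κ′σ (inj₂ (lookup (proj₁ (proj₂ τB)) b))) (cong κ′ (ωσ (inj₂ b))))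

    perA : Per π′ zero (suc M₁)
    perA = subst (λ z → Per π′ z (suc M₁)) σ-root (rot-per π′ (σ ∘ inj₁) (λ e → inj₁-injective (σ-inj e)) π′A)

    perB : Per π′ f (suc M₂)
    perB = rot-per π′ (σ ∘ inj₂) (λ e → inj₂-injective (σ-inj e)) π′B

    labelA : ∀ a → σ (inj₁ a) ≡ iter π′ (toℕ a) zero
    labelA a = trans (rot-labelling π′ (σ ∘ inj₁) (λ j → sym (π′A j)) a) (cong (iter π′ (toℕ a)) σ-root)

    labelB : ∀ b → σ (inj₂ b) ≡ iter π′ (toℕ b) f
    labelB = rot-labelling π′ (σ ∘ inj₂) (λ j → sym (π′B j))

  -- `x` is found `j` steps along the root face and `f` is its preimage under `κ`, so the cut is
  -- visible in `τ`. The lengths of the two contours give the sizes, and numbering along them gives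
  -- the pieces.
  pieces-unique : ∀ {M M₁ M₂ M₁' M₂'} {τ : T M} {τA : T M₁} {τB : T M₂} {τA' : T M₁'} {τB' : T M₂'} {g g'} j →
    g ≡ iter (lookup (proj₁ (proj₂ τA))) j zero → g' ≡ iter (lookup (proj₁ (proj₂ τA'))) j zero →
    (∀ {x y} → lookup (proj₁ τ) x ≡ lookup (proj₁ τ) y → x ≡ y) → Std τA → Std τB → Std τA' → Std τB' →
    lookup (proj₁ τA) g ≡ g → lookup (proj₁ τA') g' ≡ g' →
    Glue τ τA τB g → Glue τ τA' τB' g' → (M₁ , τA) ≡ (M₁' , τA') × (M₂ , τB) ≡ (M₂' , τB')
  pieces-unique {M} {M₁} {M₂} {M₁'} {M₂'} {τ} {τA} {τB} {τA'} {τB'} {g} {g'} j eg eg' κ-inj sA sB sA' sB' gg gg' G G' =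
      goA (per-unique F.perA (per-≗ (F'.perA))) , goB (per-unique F.perB (subst (λ z → Per F.π′ z (suc M₂')) (sym f≡) (per-≗ F'.perB)))
    where
    module F = GlueFacts sA sB gg G
      using (σ; σσ⁻¹; σ-inj; σ-root; κσ; ωσ; ℓσ; module S; κ; ω; x; f; κf; κx≢x; κ′; π′; κ′σ; perA;
        perB; labelA; labelB)
    module F' = GlueFacts sA' sB' gg' G'
      using (σ; σ-root; ωσ; ℓσ; module S; x; f; κf; κ′; π′; κ′σ; perA; perB; labelA; labelB)
    x≡ : F.x ≡ F'.x
    x≡ = trans (lem F.σ F.S.ωX (λ a → refl) F.ωσ F.σ-root eg) (sym (lem F'.σ F'.S.ωX (λ a → refl) F'.ωσ F'.σ-root eg'))
      where
      lem : ∀ {M₁ M₂} {ωA : Fin (suc M₁) → Fin (suc M₁)} {g} (σ : Fin (suc M₁) ⊎ Fin (suc M₂) → Fin (suc M)) (ωX : Fin (suc M₁) ⊎ Fin (suc M₂) → Fin (suc M₁) ⊎ Fin (suc M₂)) →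
        (∀ a → ωX (inj₁ a) ≡ inj₁ (ωA a)) → (∀ y → σ (ωX y) ≡ F.ω (σ y)) → σ (inj₁ zero) ≡ zero → g ≡ iter ωA j zero → σ (inj₁ g) ≡ iter F.ω j zero
      lem {ωA = ωA} σ ωX h hω r refl = trans (iter-map {f = ωA} {g = F.ω} (σ ∘ inj₁) (λ a → trans (cong σ (sym (h a))) (hω (inj₁ a))) j zero) (cong (iter F.ω j) r)
    f≡ : F.f ≡ F'.f
    f≡ = κ-inj (trans F.κf (trans x≡ (sym F'.κf)))
    π≗ : ∀ z → F'.π′ z ≡ F.π′ z
    π≗ z = cong₂ (λ a b → F.κ (FinitePerm.transp (fin-card (suc M)) a b (F.ω z))) (sym x≡) (sym f≡)
    κ≗ : ∀ z → F'.κ′ z ≡ F.κ′ z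
    κ≗ z = cong₂ (λ a b → F.κ (FinitePerm.transp (fin-card (suc M)) a b z)) (sym x≡) (sym f≡)
    per-≗ : ∀ {z k} → Per F'.π′ z k → Per F.π′ z k
    per-≗ {z} {k} (mkPer a b c) = mkPer a (trans (sym (iter-cong π≗ k z)) b) (λ i e → c i (trans (iter-cong π≗ i z) e))
    goA : suc M₁ ≡ suc M₁' → (M₁ , τA) ≡ (M₁' , τA')
    goA refl = cong (M₁ ,_) (cong₂ _,_ (vec-ext (λ a → up (trans (F.κ′σ (inj₁ a)) (trans (cong F.κ′ (same a)) (trans (sym (κ≗ (F'.σ (inj₁ a)))) (sym (F'.κ′σ (inj₁ a))))))))
        (cong₂ _,_ (vec-ext (λ a → up (trans (F.ωσ (inj₁ a)) (trans (cong F.ω (same a)) (sym (F'.ωσ (inj₁ a)))))))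
          (vec-ext (λ a → trans (F.ℓσ (inj₁ a)) (trans (cong (lookup (proj₂ (proj₂ τ))) (same a)) (sym (F'.ℓσ (inj₁ a))))))))
      where
      same : ∀ a → F.σ (inj₁ a) ≡ F'.σ (inj₁ a)
      same a = trans (F.labelA a) (trans (sym (iter-cong π≗ (toℕ a) zero)) (sym (F'.labelA a)))
      up : ∀ {a b} → F.σ (inj₁ a) ≡ F'.σ (inj₁ b) → a ≡ b
      up {a} {b} e = inj₁-injective (F.σ-inj (trans e (sym (same b))))
    goB : suc M₂ ≡ suc M₂' → (M₂ , τB) ≡ (M₂' , τB')
    goB refl = cong (M₂ ,_) (cong₂ _,_ (vec-ext (λ a → up (trans (F.κ′σ (inj₂ a)) (trans (cong F.κ′ (same a)) (trans (sym (κ≗ (F'.σ (inj₂ a)))) (sym (F'.κ′σ (inj₂ a))))))))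
        (cong₂ _,_ (vec-ext (λ a → up (trans (F.ωσ (inj₂ a)) (trans (cong F.ω (same a)) (sym (F'.ωσ (inj₂ a)))))))
          (vec-ext (λ a → trans (F.ℓσ (inj₂ a)) (trans (cong (lookup (proj₂ (proj₂ τ))) (same a)) (sym (F'.ℓσ (inj₂ a))))))))
      where
      same : ∀ a → F.σ (inj₂ a) ≡ F'.σ (inj₂ a)
      same a = trans (F.labelB a) (trans (cong (iter F.π′ (toℕ a)) f≡) (trans (sym (iter-cong π≗ (toℕ a) F'.f)) (sym (F'.labelB a))))
      up : ∀ {a b} → F.σ (inj₂ a) ≡ F'.σ (inj₂ b) → a ≡ b
      up {a} {b} e = inj₂-injective (F.σ-inj (trans e (sym (same b))))

  module Merge {n K M₁ M₂ : ℕ} {w : List Bool} {h : ℕ} {s : List Bool} {a b m : Vec ℕ K} {τA : T M₁} {τB : T M₂}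
      (WA : TreeW n (w ++ false ∷ []) h s a τA) (VB : TreeV (suc h) b τB) (lt : L.length w < n * p)
      (mab : ∀ i → lookup m i ≡ lookup a i + lookup b i) where
    module A = TreeW WA using (κ; ω; ℓ; std; root; rooted; prof; fixed; height; did; todo)
    module B = TreeV VB using (std; root; fall; prof)
    g = iter A.ω (L.length w) zero
    module S = SumOf τA τB g
      using (X; plus; swap; swap-g; swap-else; swap²; κX; ωX; ℓX; cardX; per₁; plus-prof; κXP; ωXP;
        stepX; treeX)
    M = M₁ + suc M₂

    len : L.length (w ++ false ∷ []) ≡ suc (L.length w)
    len = trans (Lₚ.length-++ w) (ℕₚ.+-comm (L.length w) 1)

    gg : A.κ g ≡ g
    gg = A.fixed (L.length w) (ℕₚ.≤-reflexive (sym len))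

    fd = follow-unsnoc w A.did

    g-fall : A.ℓ g ≡ suc (A.ℓ (A.ω g))
    g-fall = proj₁ (proj₂ fd)

    g-height : A.ℓ g ≡ suc h
    g-height = trans g-fall (cong suc (trans (cong (λ k → A.ℓ (iter A.ω k zero)) (sym len)) A.height))

    private
      tX = S.treeX (proj₁ A.std) (proj₂ A.std) (proj₁ B.std) (proj₂ B.std) gg g-fall B.fall (trans g-height (sym B.root))
      κXP = S.κXP (proj₁ A.std) (proj₂ A.std) (proj₁ B.std) (proj₂ B.std) gg g-fall B.fall (trans g-height (sym B.root))
      ωXP = S.ωXP (proj₁ A.std) (proj₂ A.std) (proj₁ B.std) (proj₂ B.std) gg g-fall B.fall (trans g-height (sym B.root))
      stX = S.stepX (proj₁ A.std) (proj₂ A.std) (proj₁ B.std) (proj₂ B.std) gg g-fall B.fall (trans g-height (sym B.root))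

    result : ∃ λ (τ : T M) → TreeW n w (suc h) (false ∷ s) m τ × Glue τ τA τB g
    result = go (Relabel.std-tree q 1≤q {M} S.cardX S.ℓX (S.ℓX ∘ S.ωX) stX κXP ωXP tX (inj₁ zero))
      where
      go : Relabel.StdOf q 1≤q {M} S.ℓX S.κX S.ωX (inj₁ zero) → ∃ λ (τ : T M) → TreeW n w (suc h) (false ∷ s) m τ × Glue τ τA τB g
      go R = (R.κ̄ , R.ω̄ , R.ℓ̄) , record
          { std = R.isStd
          ; root = trans (cong ℓ (sym φ0)) (trans (ℓφ zero) A.root)
          ; rooted = subst (λ z → Per ω z (n * p)) φ0 (I.per-push ωφ′ (S.per₁ A.rooted))
          ; prof = wprof-push {p = p} {m = m} φ R.σ φφ⁻ φ-inj ωφ′ exp exq (S.plus-prof {m = m} {a} {b} (Finite.orb-isEq S.cardX ωXP) mab A.prof B.prof)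
          ; fixed = fx
          ; height = trans (cong ℓ (sym (itω (L.length w)))) (trans (ℓφ g) g-height)
          ; did = subst (λ z → Follow ω ℓ z w) φ0 (follow-push (φ ∘ inj₁) ωφ (λ a → sym (ℓφ a)) w (proj₁ fd))
          ; todo = subst (λ z → Follow ω ℓ z (false ∷ s)) (itω (L.length w)) (follow-push (φ ∘ inj₁) ωφ (λ a → sym (ℓφ a)) (false ∷ s) (g-fall , subst (λ k → Follow A.ω A.ℓ (iter A.ω k zero) s) len A.todo))
          } , record { σ = φ ; σ⁻¹ = R.σ ; σσ⁻¹ = φφ⁻ ; σ-inj = φ-inj ; σ-root = φ0 ; κσ = κφ ; ωσ = ωφ′ ; ℓσ = λ y → sym (ℓφ′ y) }
        where
        module R = Relabel.StdOf R using (κ̄; ω̄; ℓ̄; isStd; σ; σ⁻¹; σ-zero; σ-inj; σσ⁻¹; κσ; ωσ; ℓσ)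
        κ ω : Fin (suc M) → Fin (suc M)
        κ = lookup R.κ̄
        ω = lookup R.ω̄
        ℓ = lookup R.ℓ̄
        φ : S.X → Fin (suc M)
        φ = R.σ⁻¹
        φφ⁻ : ∀ z → φ (R.σ z) ≡ z
        φφ⁻ z = R.σ-inj (R.σσ⁻¹ (R.σ z))
        φ-inj : ∀ {x y} → φ x ≡ φ y → x ≡ y
        φ-inj {x} {y} e = trans (sym (R.σσ⁻¹ x)) (trans (cong R.σ e) (R.σσ⁻¹ y))
        φ0 : φ (inj₁ zero) ≡ zero
        φ0 = R.σ-inj (trans (R.σσ⁻¹ _) (sym R.σ-zero))
        κφ : ∀ y → φ (S.κX y) ≡ κ (φ y)
        κφ y = R.σ-inj (trans (R.σσ⁻¹ _) (sym (trans (R.κσ (φ y)) (cong S.κX (R.σσ⁻¹ y)))))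
        ωφ′ : ∀ y → φ (S.ωX y) ≡ ω (φ y)
        ωφ′ y = R.σ-inj (trans (R.σσ⁻¹ _) (sym (trans (R.ωσ (φ y)) (cong S.ωX (R.σσ⁻¹ y)))))
        ωφ : ∀ a → φ (inj₁ (A.ω a)) ≡ ω (φ (inj₁ a))
        ωφ a = ωφ′ (inj₁ a)
        ℓφ′ : ∀ y → ℓ (φ y) ≡ S.ℓX y
        ℓφ′ y = trans (R.ℓσ (φ y)) (cong S.ℓX (R.σσ⁻¹ y))
        ℓφ : ∀ a → ℓ (φ (inj₁ a)) ≡ A.ℓ a
        ℓφ a = ℓφ′ (inj₁ a)
        module I = Iso φ R.σ φφ⁻ φ-inj using (orb-back; per-push)
        itω : ∀ k → φ (inj₁ (iter A.ω k zero)) ≡ iter ω k zero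
        itω k = trans (iter-map {f = A.ω} {g = ω} (φ ∘ inj₁) ωφ k zero) (cong (iter ω k) φ0)
        exp : ∀ y → Orb ω zero (φ y) → Orb S.ωX (inj₁ zero) y
        exp y o = I.orb-back ωφ′ (subst (λ z → Orb ω z (φ y)) (sym φ0) o)
        exq : ∀ y → Orb S.ωX (inj₁ zero) y → Orb ω zero (φ y)
        exq y o = subst (λ z → Orb ω z (φ y)) φ0 (orb-map φ ωφ′ o)
        -- The root face has `n * p` distinct edges and `w` is shorter, so the corners of `w` differ
        -- from `g`, and the swap does not touch them.
        fx : ∀ i → i < L.length w → κ (iter ω i zero) ≡ iter ω i zero
        fx i l = subst (λ z → κ z ≡ z) (itω i) (trans (sym (κφ _)) (cong φ (trans (cong (S.plus _ _) (S.swap-else ne))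
            (cong inj₁ (A.fixed i (ℕₚ.<-trans l (ℕₚ.≤-reflexive (sym len))))))))
          where
          ne : iter A.ω i zero ≢ g
          ne e = ℕₚ.<⇒≢ l (iter-distinct (ℕₚ.<-trans l lt) lt e)
            where
            iter-distinct : ∀ {i j} → i < n * p → j < n * p → iter A.ω i zero ≡ iter A.ω j zero → i ≡ j
            iter-distinct {i} {j} li lj e = go′ (n * p) refl li lj
              where
              go′ : ∀ k → k ≡ n * p → i < k → j < k → i ≡ j
              go′ (suc k) eq li lj = trans (sym (Finₚ.toℕ-fromℕ< li)) (trans (cong toℕ (CycleLabel.σ-inj (fin-perm A.ω (IsTree.ω-inj (proj₁ A.std))) zero
                 (subst (Per A.ω zero) (sym eq) A.rooted) {fromℕ< li} {fromℕ< lj}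
                 (trans (cong (λ k → iter A.ω k zero) (Finₚ.toℕ-fromℕ< li)) (trans e (cong (λ k → iter A.ω k zero) (sym (Finₚ.toℕ-fromℕ< lj))))))) (Finₚ.toℕ-fromℕ< lj))

per? : ∀ {N} (φ : Perm (Fin N)) x k → Dec (Per (to φ) x k)
per? {N} φ x k = let (k₀ , pk , _) = Finite.period (fin-card N) φ x in
  map′ (λ e → subst (Per (to φ) x) e pk) (λ pk' → per-unique pk pk') (k₀ ℕₚ.≟ k)

-- Cutting a tree at a corner of the root face

module Splits (q : ℕ) (1≤q : 1 ≤ q) where
  open Trees q 1≤q using (IsTree)
  open Gluing q 1≤q using (p; T; Std; Follow; follow-pull; follow-snoc; TreeW; TreeV)
  open Glues q 1≤q using (Glue; module SumOf)

  -- The sizes of the pieces are bounded from below by their visible faces; exact values follow once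
  -- the total is known.
  record SplitOf (n : ℕ) {K M : ℕ} (w : List Bool) (h : ℕ) (s : List Bool) (m : Vec ℕ K) (τ : T M) : Set where
    field
      {M₁ M₂} : ℕ
      τA : T M₁
      τB : T M₂
      a b : Vec ℕ K
      WA : TreeW n (w ++ false ∷ []) h s a τA
      VB : TreeV (suc h) b τB
      mab : ∀ i → lookup m i ≡ lookup a i + lookup b i
      sizes : suc M₁ + suc M₂ ≡ suc M
      boundA : n * p + p * wsum a ≤ suc M₁
      boundB : p * wsum b ≤ suc M₂
      glue : Glue τ τA τB (iter (lookup (proj₁ (proj₂ τA))) (L.length w) zero)

  module PieceTree {N : ℕ} (κ ω : Perm (Fin N)) (r : Fin N) {M₁ : ℕ} (per : Per (to (κ ∙ ω)) r (suc M₁))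
      (κc : ∀ z → Orb (to (κ ∙ ω)) r z → Orb (to (κ ∙ ω)) r (to κ z))
      (ωc : ∀ z → Orb (to (κ ∙ ω)) r z → Orb (to (κ ∙ ω)) r (to ω z)) where
    module P = Piece κ ω r per κc ωc using (σ; σ-inj; κ̄; ω̄; κσ; ωσ; κ̄-inj; ω̄-inj; rotates; rot-single)

    piece-tree : (ℓ : Fin N → ℕ) → (∀ z → ℓ z ≡ suc (ℓ (to ω z)) ⊎ ℓ (to ω z) ≡ ℓ z + q) →
      (∀ z → ℓ (to κ z) ≡ ℓ z) → (∀ z → ¬ (ℓ z ≡ suc (ℓ (to ω z))) → to κ z ≡ z) →
      (∀ {a b} → Count {Fin (suc M₁)} All⊤ (Orb (lookup P.κ̄)) a → Count {Fin (suc M₁)} All⊤ (Orb (lookup P.ω̄)) b → a + b ≡ suc M₁ + 1) →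
      Std {M₁} (P.κ̄ , P.ω̄ , tab (ℓ ∘ P.σ))
    piece-tree ℓ step κl κf eul = record
        { κ-inj = P.κ̄-inj ; ω-inj = P.ω̄-inj ; step = step̄ ; tree = record
          { ω-follows = λ _ → refl
          ; κ-label = λ j → trans (ℓσ _) (trans (cong ℓ (P.κσ j)) (trans (κl (P.σ j)) (sym (ℓσ j))))
          ; κ-fixes = λ j nf → P.σ-inj (trans (P.κσ j) (κf (P.σ j) (λ e → nf (trans (ℓσ j) (trans e (cong suc (sym (ℓω j))))))))
          ; single = P.rot-single
          ; tree-euler = eul } } , P.rotates
      where
      ℓσ : ∀ j → lookup (tab (ℓ ∘ P.σ)) j ≡ ℓ (P.σ j)
      ℓσ = look-tab (ℓ ∘ P.σ)
      ℓω : ∀ j → lookup (tab (ℓ ∘ P.σ)) (lookup P.ω̄ j) ≡ ℓ (to ω (P.σ j))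
      ℓω j = trans (ℓσ _) (cong ℓ (P.ωσ j))
      step̄ : ∀ j → _ ⊎ _
      step̄ j with step (P.σ j)
      ... | inj₁ e = inj₁ (trans (ℓσ j) (trans e (cong suc (sym (ℓω j)))))
      ... | inj₂ e = inj₂ (trans (ℓω j) (trans e (cong (_+ q) (sym (ℓσ j)))))

  -- κ′ is κ with x removed from its cycle, where x ≠ κ x is the next corner of the root face.
  record SplitData (n : ℕ) {K M : ℕ} (w : List Bool) (h : ℕ) (s : List Bool) (m : Vec ℕ K) (τ : T M) : Set where
    field
      κP ωP κ′ : Perm (Fin (suc M))
      ℓ : Fin (suc M) → ℕ
      hκ : ∀ z → to κP z ≡ lookup (proj₁ τ) z
      hω : ∀ z → to ωP z ≡ lookup (proj₁ (proj₂ τ)) z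
      hℓ : ∀ z → ℓ z ≡ lookup (proj₂ (proj₂ τ)) z
      x f : Fin (suc M)
      x≡ : x ≡ iter (to ωP) (L.length w) zero
      κf : to κP f ≡ x
      ne : to κP x ≢ x
      κ′x : to κ′ x ≡ x
      κ′f : to κ′ f ≡ to κP x
      κ′-else : ∀ z → z ≢ x → z ≢ f → to κ′ z ≡ to κP z
      step : ∀ z → ℓ z ≡ suc (ℓ (to ωP z)) ⊎ ℓ (to ωP z) ≡ ℓ z + q
      κ-label : ∀ z → ℓ (to κP z) ≡ ℓ z
      κ-fixes : ∀ z → ¬ (ℓ z ≡ suc (ℓ (to ωP z))) → to κP z ≡ z
      single : ∀ y z → Orb (to (κP ∙ ωP)) y z
      tree-euler : ∀ {a b} → Count {Fin (suc M)} All⊤ (Orb (to κP)) a → Count {Fin (suc M)} All⊤ (Orb (to ωP)) b → a + b ≡ suc M + 1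
      root : ℓ zero ≡ 0
      rooted : Per (to ωP) zero (suc n * p)
      prof : WProf p (to ωP) (Orb (to ωP) zero) m
      fixed : ∀ i → i < L.length w → to κP (iter (to ωP) i zero) ≡ iter (to ωP) i zero
      height : ℓ x ≡ suc h
      did : Follow (to ωP) ℓ zero w
      todo : Follow (to ωP) ℓ x (false ∷ s)

  module SplitPerm {n K M : ℕ} {w : List Bool} {h : ℕ} {s : List Bool} {m : Vec ℕ K} {τ : T M} (D : SplitData n w h s m τ) where
    open SplitData D
      using (κP; ωP; κ′; ℓ; hκ; hω; hℓ; x; f; x≡; κf; ne; κ′x; κ′f; κ′-else; step; κ-label; κ-fixes;
        single; tree-euler; root; rooted; prof; fixed; height; did; todo)
    N = suc M
    open Finite (fin-card N) using (period; orb-sym; orb-isEq; orb?; orbits; orbits-in)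
    open FinitePerm (fin-card N) using (conn-sym; swapped-half; swapped-≡; genus)
    κ = to κP
    ω = to ωP

    x≢f : x ≢ f
    x≢f e = ne (trans (cong κ e) κf)

    π π′ : Perm (Fin N)
    π = κP ∙ ωP
    π′ = κ′ ∙ ωP

    u v : Fin N
    u = from ωP x
    v = from ωP f

    swapped : Swapped (to π′) (to π) u v
    swapped = mkSwapped
      (trans (cong (to κ′) (to∘from ωP x)) (trans κ′x (trans (sym κf) (cong κ (sym (to∘from ωP f))))))
      (trans (cong (to κ′) (to∘from ωP f)) (trans κ′f (cong κ (sym (to∘from ωP x)))))
      (λ z a b → κ′-else (ω z) (λ e → a (trans (sym (from∘to ωP z)) (cong (from ωP) e))) (λ e → b (trans (sym (from∘to ωP z)) (cong (from ωP) e))))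

    -- Taken out of its cycle, `x` becomes a cycle of its own.
    κ′-count : ∀ {c c'} → Count {Fin N} All⊤ (Orb κ) c → Count {Fin N} All⊤ (Orb (to κ′)) c' → c' ≡ suc c
    κ′-count = swapped-≡ κP κ′ (mkSwapped (sym κ′f) (trans κf (sym κ′x)) (λ z a b → sym (κ′-else z a b))) (λ o → x≢f (orb-fixed κ′x o))

    -- With the extra cycle of `κ′` the factors already have `N + 2` cycles, and for a connected
    -- pair this leaves no room for even one cycle of `π′`.
    not-connected : ∀ r → ¬ (∀ z → Conn (to κ′) ω z r)
    not-connected r conn = go (proj₂ (orbits κP)) (proj₂ (orbits κ′)) (proj₂ (orbits ωP)) (proj₂ (orbits π′))
      where
      go : ∀ {a a' b c} → Count {Fin N} All⊤ (Orb κ) a → Count {Fin N} All⊤ (Orb (to κ′)) a' →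
        Count {Fin N} All⊤ (Orb ω) b → Count {Fin N} All⊤ (Orb (to π′)) c → ⊥
      go {a} {a'} {b} {c} ca ca' cb cc = ℕₚ.1+n≰n (ℕₚ.≤-trans pos (ℕₚ.+-cancelˡ-≤ (N + 2) _ _ (subst₂ _≤_ eq (sym (ℕₚ.+-identityʳ (N + 2)))
          (genus κ′ ωP ca' cb cc (λ (_ : Fin 1) → r) (λ z → zero , conn z)))))
        where
        pos : 1 ≤ c
        pos = family-≤ (orb-isEq π′) cc (λ (_ : Fin 1) → r) (λ _ → tt) (λ { zero zero _ → refl })
        eq : a' + b + c ≡ (N + 2) + c
        eq = cong (_+ c) (trans (cong (_+ b) (κ′-count ca ca')) (trans (cong suc (tree-euler ca cb)) (sym (ℕₚ.+-suc N 1))))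

    π′-conn : ∀ {y z} → Orb (to π′) y z → Conn (to κ′) ω y z
    π′-conn = orb-induct (Conn (to κ′) ω) (λ _ → done) (λ c → via₂ (via₁ c))

    InA InB : Fin N → Set
    InA z = Orb (to π′) z x
    InB z = Orb (to π′) z v

    -- `π` is a single cycle and differs from `π′` by one swap, so every `π′`-walk ends up at `u` or
    -- at `v`; and `π′` sends `u` to `x`.
    side : ∀ z → InA z ⊎ InB z
    side z with swapped-half π′ π swapped (single z u)
    ... | inj₁ o = inj₁ (orb-trans o (1 , trans (cong (to κ′) (to∘from ωP x)) κ′x))
    ... | inj₂ (inj₁ o) = inj₁ (orb-trans o (1 , trans (cong (to κ′) (to∘from ωP x)) κ′x))
    ... | inj₂ (inj₂ o) = inj₂ o

    -- A link between the two sides would make the whole pair connected.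
    separate : ∀ {y z} → Conn (to κ′) ω y z → InA y → ¬ InB z
    separate c a b = not-connected x joined
      where
      joined : ∀ t → Conn (to κ′) ω t x
      joined t with side t
      ... | inj₁ o = π′-conn o
      ... | inj₂ o = conn-trans (π′-conn o) (conn-trans (π′-conn (orb-sym π′ b)) (conn-trans (conn-sym κ′ ωP c) (π′-conn a)))

    closeA : ∀ {y z} → Conn (to κ′) ω y z → InA y → InA z
    closeA {y} {z} c a with side z
    ... | inj₁ o = o
    ... | inj₂ o = ⊥-elim (separate c a o)

    closeB : ∀ {y z} → Conn (to κ′) ω y z → InB y → InB z
    closeB {y} {z} c b with side z
    ... | inj₁ o = ⊥-elim (separate (conn-sym κ′ ωP c) o b)
    ... | inj₂ o = o

    -- `x` is an edge of the root face, so the root stays on the side of `x`.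
    zeroA : InA zero
    zeroA = closeA (conn-sym κ′ ωP (conn-orb₂ (L.length w , sym x≡))) orb-refl

    fB : InB f
    fB = closeB (via₂ (subst (λ z → Conn (to κ′) ω z f) (sym (to∘from ωP f)) done)) orb-refl

    clsA : ∀ {z} → InA z → Orb (to π′) zero z
    clsA a = orb-trans zeroA (orb-sym π′ a)
    clsA⁻ : ∀ {z} → Orb (to π′) zero z → InA z
    clsA⁻ o = orb-trans (orb-sym π′ o) zeroA
    clsB : ∀ {z} → InB z → Orb (to π′) f z
    clsB a = orb-trans fB (orb-sym π′ a)
    clsB⁻ : ∀ {z} → Orb (to π′) f z → InB z
    clsB⁻ o = orb-trans (orb-sym π′ o) fB

    disjoint : ∀ {y z} → Orb (to π′) zero y → Orb (to π′) f z → ¬ Conn (to κ′) ω y z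
    disjoint o o' c = separate c (clsA⁻ o) (clsB⁻ o')

    κ′-label : ∀ z → ℓ (to κ′ z) ≡ ℓ z
    κ′-label z with z Finₚ.≟ x
    ... | yes refl = cong ℓ κ′x
    ... | no a with z Finₚ.≟ f
    ... | yes refl = trans (cong ℓ κ′f) (trans (κ-label x) (trans (cong ℓ (sym κf)) (κ-label f)))
    ... | no b = trans (cong ℓ (κ′-else z a b)) (κ-label z)

    x-fall : ℓ x ≡ suc (ℓ (ω x))
    x-fall = proj₁ todo

    -- Rises are fixed by `κ`, while `κ f = x` differs from `f`.
    f-fall : ℓ f ≡ suc (ℓ (ω f))
    f-fall with ℓ f ℕₚ.≟ suc (ℓ (ω f))
    ... | yes e = e
    ... | no nf = ⊥-elim (x≢f (trans (sym κf) (κ-fixes f nf)))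

    κ′-fixes : ∀ z → ¬ (ℓ z ≡ suc (ℓ (ω z))) → to κ′ z ≡ z
    κ′-fixes z nf = trans (κ′-else z (λ { refl → nf x-fall }) (λ { refl → nf f-fall })) (κ-fixes z nf)

    private
      getper : ∀ r → ∃ λ k → Per (to π′) r (suc k)
      getper r = go (period π′ r)
        where
        go : (∃ λ k → Per (to π′) r k × k ≤ N) → ∃ λ k → Per (to π′) r (suc k)
        go (zero , mkPer () _ _ , _)
        go (suc k , pk , _) = k , pk

    module WithPeriods {M₁ M₂ : ℕ} (perA : Per (to π′) zero (suc M₁)) (perB : Per (to π′) f (suc M₂))
        (κcA : ∀ z → Orb (to π′) zero z → Orb (to π′) zero (to κ′ z)) (ωcA : ∀ z → Orb (to π′) zero z → Orb (to π′) zero (ω z))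
        (κcB : ∀ z → Orb (to π′) f z → Orb (to π′) f (to κ′ z)) (ωcB : ∀ z → Orb (to π′) f z → Orb (to π′) f (ω z)) where
      module PA = Piece κ′ ωP zero perA κcA ωcA
        using (σ; σ-inj; σ⁻¹; σ-σ⁻¹; σ-cls; κ̄; ω̄; κσ; ωσ; orb-up; orb-down; per-up; per-down;
          class-count; class-restrict; κ̄P; ω̄P; piece-≤)
      module PB = Piece κ′ ωP f perB κcB ωcB
        using (σ; σ-inj; σ⁻¹; σ-σ⁻¹; σ-cls; κ̄; ω̄; κσ; ωσ; per-up; per-down; class-count;
          class-restrict; κ̄P; ω̄P; piece-≤)
      N₁ = suc M₁
      N₂ = suc M₂

      ClsA ClsB : Fin N → Set
      ClsA = Orb (to π′) zero
      ClsB = Orb (to π′) f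

      both : ∀ z → ClsA z ⊎ ClsB z
      both z with side z
      ... | inj₁ a = inj₁ (clsA a)
      ... | inj₂ b = inj₂ (clsB b)

      sizes : N₁ + N₂ ≡ N
      sizes = count-unique ≡-isEq (count-≗ (count-⊎ ≡-isEq (orbit-of-size π′ perA) (orbit-of-size π′ perB)
          (λ { o o' refl → disjoint o o' done })) (λ _ _ → tt) (λ z _ → both z) id id) (fin-card N)

      count-both : (φ : Perm (Fin N)) → (∀ {y z} → Orb (to φ) y z → Conn (to κ′) ω y z) → ∀ {a b} →
        Count ClsA (Orb (to φ)) a → Count ClsB (Orb (to φ)) b → Count {Fin N} All⊤ (Orb (to φ)) (a + b)
      count-both φ h ca cb = count-≗ (count-⊎ (orb-isEq φ) ca cb (λ o o' c → disjoint o o' (h c))) (λ _ _ → tt) (λ z _ → both z) id id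

      module _ {a₁ b₁ a₂ b₂ : ℕ} (ca₁ : Count {Fin N₁} All⊤ (Orb (lookup PA.κ̄)) a₁) (cb₁ : Count {Fin N₁} All⊤ (Orb (lookup PA.ω̄)) b₁)
          (ca₂ : Count {Fin N₂} All⊤ (Orb (lookup PB.κ̄)) a₂) (cb₂ : Count {Fin N₂} All⊤ (Orb (lookup PB.ω̄)) b₂) where
        -- Together the pieces reach the sum of the two maxima allowed by `piece-≤`, so each attains
        -- its own and is again a tree.
        total : (a₁ + b₁) + (a₂ + b₂) ≡ (N₁ + 1) + (N₂ + 1)
        total = begin
            (a₁ + b₁) + (a₂ + b₂) ≡⟨ solve 4 (λ a b c d → (a :+ b) :+ (c :+ d) := (a :+ c) :+ (b :+ d)) refl a₁ b₁ a₂ b₂ ⟩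
            (a₁ + a₂) + (b₁ + b₂) ≡⟨ cong (_+ (b₁ + b₂)) (κ′-count (proj₂ (orbits κP)) (count-both κ′ conn-orb₁ (PA.class-count {κ′} PA.κσ ca₁) (PB.class-count {κ′} PB.κσ ca₂))) ⟩
            suc (proj₁ (orbits κP)) + (b₁ + b₂) ≡⟨ cong suc (tree-euler (proj₂ (orbits κP)) (count-both ωP conn-orb₂ (PA.class-count {ωP} PA.ωσ cb₁) (PB.class-count {ωP} PB.ωσ cb₂))) ⟩
            suc (N + 1) ≡⟨ cong (λ k → suc (k + 1)) (sym sizes) ⟩
            suc ((N₁ + N₂) + 1) ≡⟨ solve 2 (λ a b → con 1 :+ ((a :+ b) :+ con 1) := (a :+ con 1) :+ (b :+ con 1)) refl N₁ N₂ ⟩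
            (N₁ + 1) + (N₂ + 1) ∎
          where
          open ≡-Reasoning
          open +-*-Solver

        eulA : a₁ + b₁ ≡ N₁ + 1
        eulA = ℕₚ.≤-antisym (PA.piece-≤ ca₁ cb₁) (ℕₚ.+-cancelʳ-≤ (a₂ + b₂) _ _ (ℕₚ.≤-trans (ℕₚ.+-monoʳ-≤ (N₁ + 1) (PB.piece-≤ ca₂ cb₂)) (ℕₚ.≤-reflexive (sym total))))

        eulB : a₂ + b₂ ≡ N₂ + 1
        eulB = ℕₚ.≤-antisym (PB.piece-≤ ca₂ cb₂) (ℕₚ.+-cancelˡ-≤ (a₁ + b₁) _ _ (ℕₚ.≤-trans (ℕₚ.+-monoˡ-≤ (N₂ + 1) (PA.piece-≤ ca₁ cb₁)) (ℕₚ.≤-reflexive (sym total))))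

      module F₁ = Finite (fin-card N₁) using (orb-sym; orbits)
      module F₂ = Finite (fin-card N₂) using (orbits)

      stA : Std {M₁} (PA.κ̄ , PA.ω̄ , tab (ℓ ∘ PA.σ))
      stA = PieceTree.piece-tree κ′ ωP zero perA κcA ωcA ℓ step κ′-label κ′-fixes
        (λ ca cb → eulA ca cb (proj₂ (F₂.orbits PB.κ̄P)) (proj₂ (F₂.orbits PB.ω̄P)))

      stB : Std {M₂} (PB.κ̄ , PB.ω̄ , tab (ℓ ∘ PB.σ))
      stB = PieceTree.piece-tree κ′ ωP f perB κcB ωcB ℓ step κ′-label κ′-fixes
        (λ ca cb → eulB (proj₂ (F₁.orbits PA.κ̄P)) (proj₂ (F₁.orbits PA.ω̄P)) ca cb)

      ℓA : ∀ j → lookup (tab (ℓ ∘ PA.σ)) j ≡ ℓ (PA.σ j)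
      ℓA = look-tab (ℓ ∘ PA.σ)
      ℓB : ∀ j → lookup (tab (ℓ ∘ PB.σ)) j ≡ ℓ (PB.σ j)
      ℓB = look-tab (ℓ ∘ PB.σ)

      itA : ∀ k → PA.σ (iter (lookup PA.ω̄) k zero) ≡ iter ω k zero
      itA k = iter-map {g = ω} PA.σ PA.ωσ k zero

      itx : PA.σ (iter (lookup PA.ω̄) (suc (L.length w)) zero) ≡ ω x
      itx = trans (itA (suc (L.length w))) (cong ω (sym x≡))

      gA : Fin N₁
      gA = iter (lookup PA.ω̄) (L.length w) zero

      len : L.length (w ++ false ∷ []) ≡ suc (L.length w)
      len = trans (Lₚ.length-++ w) (ℕₚ.+-comm (L.length w) 1)

      faceA : ∀ i → ∃ λ c → Count (λ z → ClsA z × (Per ω z (suc (toℕ {K} i) * p) × ¬ Orb ω zero z)) (Orb ω) c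
      faceA i = orbits-in ωP (λ z → orb? π′ zero z ×-dec (per? ωP z (suc (toℕ i) * p) ×-dec ¬? (orb? ωP zero z)))

      faceB : ∀ i → ∃ λ c → Count (λ z → ClsB z × (Per ω z (suc (toℕ {K} i) * p) × ¬ ⊥)) (Orb ω) c
      faceB i = orbits-in ωP (λ z → orb? π′ f z ×-dec (per? ωP z (suc (toℕ i) * p) ×-dec yes (λ ())))

      a b : Vec ℕ K
      a = tab (λ i → proj₁ (faceA i))
      b = tab (λ i → proj₁ (faceB i))

      -- No white face meets both sides. The root face lies on side `A`, so on side `B` every face
      -- counts.
      mab : ∀ i → lookup m i ≡ lookup a i + lookup b i
      mab i = trans (count-unique (orb-isEq ωP) (prof i) (count-≗ (count-⊎ (orb-isEq ωP) (proj₂ (faceA i)) (proj₂ (faceB i))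
            (λ (o , _) (o' , _) c → disjoint o o' (conn-orb₂ c)))
          (λ { z (inj₁ (_ , r)) → r ; z (inj₂ (o , r , _)) → r , λ o' → disjoint orb-refl o (conn-orb₂ o') })
          (λ z (r , nz) → dist z r nz (both z)) id id))
        (cong₂ _+_ (sym (look-tab _ i)) (sym (look-tab _ i)))
        where
        dist : ∀ z → Per ω z (suc (toℕ i) * p) → ¬ Orb ω zero z → ClsA z ⊎ ClsB z →
          (ClsA z × (Per ω z (suc (toℕ i) * p) × ¬ Orb ω zero z)) ⊎ (ClsB z × (Per ω z (suc (toℕ i) * p) × ¬ ⊥))
        dist z r nz (inj₁ o) = inj₁ (o , r , nz)
        dist z r nz (inj₂ o) = inj₂ (o , r , λ ())

      profA : WProf p (lookup PA.ω̄) (Orb (lookup PA.ω̄) zero) a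
      profA i = subst (Count _ _) (sym (look-tab _ i)) (PA.class-restrict {ωP} PA.ωσ
        {P = λ z → Per ω z (suc (toℕ i) * p) × ¬ Orb ω zero z} {λ j → Per (lookup PA.ω̄) j (suc (toℕ i) * p) × ¬ Orb (lookup PA.ω̄) zero j}
        (λ j (r , nz) → PA.per-down {ωP} PA.ωσ r , λ o → nz (PA.orb-up {ωP} PA.ωσ o))
        (λ j (r , nz) → PA.per-up {ωP} PA.ωσ r , λ o → nz (PA.orb-down {ωP} PA.ωσ o)) (proj₂ (faceA i)))

      profB : WProf p (lookup PB.ω̄) (λ _ → ⊥) b
      profB i = subst (Count _ _) (sym (look-tab _ i)) (PB.class-restrict {ωP} PB.ωσ
        {P = λ z → Per ω z (suc (toℕ i) * p) × ¬ ⊥} {λ j → Per (lookup PB.ω̄) j (suc (toℕ i) * p) × ¬ ⊥}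
        (λ j (r , nz) → PB.per-down {ωP} PB.ωσ r , λ ())
        (λ j (r , nz) → PB.per-up {ωP} PB.ωσ r , λ ()) (proj₂ (faceB i)))

      rootedA : Per (lookup PA.ω̄) zero (suc n * p)
      rootedA = PA.per-down {ωP} PA.ωσ rooted

      fixedA : ∀ i → i < L.length (w ++ false ∷ []) → lookup PA.κ̄ (iter (lookup PA.ω̄) i zero) ≡ iter (lookup PA.ω̄) i zero
      fixedA i l = PA.σ-inj (trans (PA.κσ _) (trans (cong (to κ′) (itA i)) (trans (fx (ℕₚ.m≤n⇒m<n∨m≡n (ℕ.s≤s⁻¹ (subst (i <_) len l)))) (sym (itA i)))))
        where
        fx : i < L.length w ⊎ i ≡ L.length w → to κ′ (iter ω i zero) ≡ iter ω i zero
        fx (inj₂ refl) = subst (λ z → to κ′ z ≡ z) x≡ κ′x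
        fx (inj₁ l) = trans (κ′-else _ n₁ n₂) (fixed i l)
          where
          -- A corner fixed by `κ` can be neither `x` nor `f`, as `κ` moves both.
          n₁ : iter ω i zero ≢ x
          n₁ e = ne (subst (λ z → κ z ≡ z) e (fixed i l))
          n₂ : iter ω i zero ≢ f
          n₂ e = x≢f (trans (sym κf) (subst (λ z → κ z ≡ z) e (fixed i l)))

      WA : TreeW (suc n) (w ++ false ∷ []) h s a (PA.κ̄ , PA.ω̄ , tab (ℓ ∘ PA.σ))
      WA = record
        { std = stA ; root = trans (ℓA zero) root ; rooted = rootedA ; prof = profA ; fixed = fixedA
        ; height = trans (cong (λ k → lookup (tab (ℓ ∘ PA.σ)) (iter (lookup PA.ω̄) k zero)) len)
            (trans (ℓA _) (trans (cong ℓ itx) (ℕₚ.suc-injective (trans (sym x-fall) height))))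
        ; did = follow-pull PA.σ PA.ωσ ℓA (w ++ false ∷ []) (follow-snoc w did (subst (λ z → Follow ω ℓ z (false ∷ [])) x≡ (x-fall , tt)))
        ; todo = subst (λ k → Follow (lookup PA.ω̄) (lookup (tab (ℓ ∘ PA.σ))) (iter (lookup PA.ω̄) k zero) s) (sym len)
            (follow-pull PA.σ PA.ωσ ℓA s (subst (λ z → Follow ω ℓ z s) (sym itx) (proj₂ todo))) }

      VB : TreeV (suc h) b (PB.κ̄ , PB.ω̄ , tab (ℓ ∘ PB.σ))
      VB = record
        { std = stB ; root = trans (ℓB zero) (trans (sym (κ-label f)) (trans (cong ℓ κf) height))
        ; fall = trans (ℓB zero) (trans f-fall (cong suc (sym (trans (ℓB _) (cong ℓ (PB.ωσ zero))))))
        ; prof = profB }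

      module S = SumOf {M₁} {M₂} (PA.κ̄ , PA.ω̄ , tab (ℓ ∘ PA.σ)) (PB.κ̄ , PB.ω̄ , tab (ℓ ∘ PB.σ)) gA
        using (X; plus; swap-g; swap-else; κX)

      glue : Glue τ (PA.κ̄ , PA.ω̄ , tab (ℓ ∘ PA.σ)) (PB.κ̄ , PB.ω̄ , tab (ℓ ∘ PB.σ)) gA
      glue = record { σ = σ ; σ⁻¹ = λ z → unσ (both z) ; σσ⁻¹ = λ z → σinv (both z) ; σ-inj = λ {y} {y'} → σ-inj {y} {y'} ; σ-root = refl
          ; κσ = λ y → trans (κσ y) (hκ _) ; ωσ = λ { (inj₁ j) → trans (PA.ωσ j) (hω _) ; (inj₂ j) → trans (PB.ωσ j) (hω _) }
          ; ℓσ = λ { (inj₁ j) → trans (ℓA j) (hℓ _) ; (inj₂ j) → trans (ℓB j) (hℓ _) } }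
        where
        σ : S.X → Fin N
        σ (inj₁ j) = PA.σ j
        σ (inj₂ j) = PB.σ j
        unσ : ∀ {z} → ClsA z ⊎ ClsB z → S.X
        unσ (inj₁ o) = inj₁ (PA.σ⁻¹ o)
        unσ (inj₂ o) = inj₂ (PB.σ⁻¹ o)
        σinv : ∀ {z} (c : ClsA z ⊎ ClsB z) → σ (unσ c) ≡ z
        σinv (inj₁ o) = PA.σ-σ⁻¹ o
        σinv (inj₂ o) = PB.σ-σ⁻¹ o
        apart : ∀ {i j} → PA.σ i ≢ PB.σ j
        apart {i} {j} e = disjoint (PA.σ-cls i) (PB.σ-cls j) (subst (Conn (to κ′) ω _) e done)
        σ-inj : ∀ {y y'} → σ y ≡ σ y' → y ≡ y'
        σ-inj {inj₁ i} {inj₁ j} e = cong inj₁ (PA.σ-inj e)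
        σ-inj {inj₁ i} {inj₂ j} e = ⊥-elim (apart {i} {j} e)
        σ-inj {inj₂ i} {inj₁ j} e = ⊥-elim (apart {j} {i} (sym e))
        σ-inj {inj₂ i} {inj₂ j} e = cong inj₂ (PB.σ-inj e)
        gx : PA.σ gA ≡ x
        gx = trans (itA (L.length w)) (sym x≡)
        κσ : ∀ y → σ (S.κX y) ≡ κ (σ y)
        κσ (inj₁ i) = go (i Finₚ.≟ gA)
          where
          go : Dec (i ≡ gA) → σ (S.κX (inj₁ i)) ≡ κ (PA.σ i)
          go (yes refl) = trans (cong (λ y → σ (S.plus _ _ y)) S.swap-g) (trans (PB.κσ zero) (trans κ′f (cong κ (sym gx))))
          go (no n) = trans (cong (λ y → σ (S.plus _ _ y)) (S.swap-else n)) (trans (PA.κσ i)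
            (κ′-else (PA.σ i) (λ e → n (PA.σ-inj (trans e (sym gx)))) (λ e → apart {i} {zero} e)))
        κσ (inj₂ zero) = trans (PA.κσ gA) (trans (cong (to κ′) gx) (trans κ′x (sym κf)))
        κσ (inj₂ (suc j)) = trans (PB.κσ (suc j)) (κ′-else _ (λ e → apart {gA} {suc j} (trans gx (sym e))) (λ e → case (PB.σ-inj {suc j} {zero} e)))
          where
          case : suc j ≡ zero → ⊥
          case ()

      result : SplitOf (suc n) w h s m τ
      result = record
        { WA = WA ; VB = VB ; mab = mab ; sizes = sizes
        ; boundA = profile-bound (fin-card N₁) PA.ω̄P a (orbit-of-size PA.ω̄P rootedA) (λ o o' → orb-trans o' (F₁.orb-sym PA.ω̄P o)) profA
        ; boundB = profile-bound (fin-card N₂) PB.ω̄P {e = 0} b (record { rep = λ () ; repP = λ () ; sep = λ () ; cover = λ _ () }) (λ _ ()) profB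
        ; glue = glue }

    split : SplitOf (suc n) w h s m τ
    split = WithPeriods.result (proj₂ (getper zero)) (proj₂ (getper f))
      (λ _ o → clsA (closeA (via₁ done) (clsA⁻ o))) (λ _ o → clsA (closeA (via₂ done) (clsA⁻ o)))
      (λ _ o → clsB (closeB (via₁ done) (clsB⁻ o))) (λ _ o → clsB (closeB (via₂ done) (clsB⁻ o)))

  split : ∀ {n K M : ℕ} {w : List Bool} {h : ℕ} {s : List Bool} {m : Vec ℕ K} {τ : T M}
    (W : TreeW (suc n) w (suc h) (false ∷ s) m τ) → TreeW.κ W (TreeW.x W) ≢ TreeW.x W → SplitOf (suc n) w h s m τ
  split {n} {K} {M} {w} {h} {s} {m} {τ} W ne = SplitPerm.split {n} {w = w} {τ = τ} (record
      { κP = κP ; ωP = ωP ; κ′ = κP ∙ transposition x f ; ℓ = ℓ ; hκ = λ _ → refl ; hω = λ _ → refl ; hℓ = λ _ → refl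
      ; x = x ; f = f ; x≡ = refl ; κf = to∘from κP x ; ne = ne
      ; κ′x = trans (cong κ (transp-x x f)) (to∘from κP x) ; κ′f = cong κ (transp-y x f)
      ; κ′-else = λ z a b → cong κ (transp-else x f z a b)
      ; step = step ; κ-label = κ-label ; κ-fixes = κ-fixes ; single = single ; tree-euler = tree-euler
      ; root = root ; rooted = rooted ; prof = prof ; fixed = fixed ; height = height ; did = did ; todo = todo })
    where
    open TreeW W using (κ; ω; ℓ; x; std; root; rooted; prof; fixed; height; did; todo)
    open FinitePerm (fin-card (suc M)) using (transp-x; transp-y; transp-else; transposition)
    open IsTree (proj₁ std) using (κ-inj; ω-inj; step; tree)
    open Labels.Tree tree using (κ-label; κ-fixes; single; tree-euler)
    κP = fin-perm κ κ-inj
    ωP = fin-perm ω ω-inj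
    f : Fin (suc M)
    f = from κP x

-- Exponent vectors and series with natural coefficients

isZero-lookup : ∀ {K} (m : Vec ℕ K) → isZero m ≡ true → ∀ i → lookup m i ≡ 0
isZero-lookup (x ∷ m) e zero = ≡ᵇ-elim (proj₁ (∧-true e))
isZero-lookup (x ∷ m) e (suc i) = isZero-lookup m (proj₂ (∧-true {x ℕ.≡ᵇ 0} e)) i

lookup-isZero : ∀ {K} (m : Vec ℕ K) → (∀ i → lookup m i ≡ 0) → isZero m ≡ true
lookup-isZero [] h = refl
lookup-isZero (x ∷ m) h = ∧-intro (≡ᵇ-intro {x} (h zero)) (lookup-isZero m (h ∘ suc))

sum-zero : ∀ {A : Set} (f : A → ℕ) (xs : List A) → sum (L.map f xs) ≡ 0 → ∀ {x} → x ∈ xs → f x ≡ 0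
sum-zero f (y ∷ xs) e (here refl) = ℕₚ.m+n≡0⇒m≡0 (f y) e
sum-zero f (y ∷ xs) e (there i) = sum-zero f xs (ℕₚ.m+n≡0⇒n≡0 (f y) e) i

wsum-zero : ∀ {K} (m : Vec ℕ K) → wsum m ≡ 0 → isZero m ≡ true
wsum-zero {K} m e = lookup-isZero m (λ i → ℕₚ.m+n≡0⇒m≡0 (lookup m i) (sum-zero (λ i → suc (toℕ i) * lookup m i) (L.allFin K) e (Memₚ.∈-allFin i)))

isZero-wsum : ∀ {K} (m : Vec ℕ K) → isZero m ≡ true → wsum m ≡ 0
isZero-wsum {K} m e = go (L.allFin K)
  where
  go : ∀ xs → sum (L.map (λ i → suc (toℕ i) * lookup m i) xs) ≡ 0
  go [] = refl
  go (i ∷ xs) = cong₂ _+_ (trans (cong (suc (toℕ i) *_) (isZero-lookup m e i)) (ℕₚ.*-zeroʳ (suc (toℕ i)))) (go xs)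

_⊖_ : ∀ {K} → Vec ℕ K → Vec ℕ K → Vec ℕ K
_⊖_ = V.zipWith _∸_

lookup-⊖ : ∀ {K} (m a : Vec ℕ K) i → lookup (m ⊖ a) i ≡ lookup m i ∸ lookup a i
lookup-⊖ m a i = Vₚ.lookup-zipWith _∸_ i m a

below-unique : ∀ {K} (m : Vec ℕ K) → Unique (below m)
below-unique [] = [] ∷ []
below-unique (x ∷ m) = subst Unique (sym (concatMap-product _∷_ (L.upTo (suc x)) (below m)))
  (Uniqueₚ.cartesianProductWith⁺ _∷_ Vₚ.∷-injective (Uniqueₚ.upTo⁺ (suc x)) (below-unique m))

below-elim : ∀ {K} (m a : Vec ℕ K) → a ∈ below m → ∀ i → lookup a i ≤ lookup m i
below-elim (x ∷ m) a h i with Memₚ.∈-cartesianProductWith⁻ _∷_ (L.upTo (suc x)) (below m) (subst (a ∈_) (concatMap-product _∷_ (L.upTo (suc x)) (below m)) h)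
below-elim (x ∷ m) _ h zero | y , b , iy , ib , refl = ℕ.s≤s⁻¹ (Memₚ.∈-upTo⁻ iy)
below-elim (x ∷ m) _ h (suc i) | y , b , iy , ib , refl = below-elim m b ib i

below-intro : ∀ {K} (m a : Vec ℕ K) → (∀ i → lookup a i ≤ lookup m i) → a ∈ below m
below-intro [] [] h = here refl
below-intro (x ∷ m) (y ∷ a) h = subst (y ∷ a ∈_) (sym (concatMap-product _∷_ (L.upTo (suc x)) (below m)))
  (Memₚ.∈-cartesianProductWith⁺ _∷_ (Memₚ.∈-upTo⁺ (s≤s (h zero))) (below-intro m a (h ∘ suc)))

-- This and the next two are `oneS`, `mulS` and `prodS` over natural numbers, where coefficients can
-- be sizes of sets.
oneN : ∀ {K} → Vec ℕ K → ℕ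
oneN m = if isZero m then 1 else 0

mulN : ∀ {K} → (Vec ℕ K → ℕ) → (Vec ℕ K → ℕ) → Vec ℕ K → ℕ
mulN A B m = sum (L.map (λ a → A a * B (m ⊖ a)) (below m))

prodN : ∀ {K} → List (Vec ℕ K → ℕ) → Vec ℕ K → ℕ
prodN = L.foldr mulN oneN

-- Words read along the root face

module Words (q : ℕ) (1≤q : 1 ≤ q) {K : ℕ} where
  open Trees q 1≤q using (IsTree)
  open Gluing q 1≤q using (p; T; Follow; follow-snoc; follow-unsnoc; TreeW; TreeV; mkV)

  -- The first argument is the number of edges; the value at 0 matches that of `classesV`.
  treesV : ℕ → ℕ → Vec ℕ K → ℕ
  treesV zero    i m = 0
  treesV (suc M) i m = proj₁ (LabelledCounts.countV-trees q 1≤q {M} m i)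

  treesV-size : ∀ {E M} i m → suc M ≡ E → Size (TreeV {K} {M} i m) (treesV E i m)
  treesV-size {M = M} i m refl = count-≗ (proj₁ (proj₂ (LabelledCounts.countV-trees q 1≤q {M} m i)))
    (λ _ (a , b , c , d) → mkV a b c d) (λ _ (mkV a b c d) → a , b , c , d) id id

  vN : ℕ → Vec ℕ K → ℕ
  vN i m = if isZero m then 1 else treesV (p * wsum m) i m

  coef′ : Maybe (List ℕ) → Vec ℕ K → ℕ
  coef′ nothing   m = 0
  coef′ (just hs) m = prodN (L.map vN hs) m

  coef : ℕ → List Bool → Vec ℕ K → ℕ
  coef h s = coef′ (fallHeights p h s)

  coef-rise : ∀ h s m → coef h (true ∷ s) m ≡ coef (h + q) s m
  coef-rise zero s m = refl
  coef-rise (suc h) s m = refl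

  coef-fall : ∀ h s m → coef (suc h) (false ∷ s) m ≡ mulN (vN (suc h)) (coef h s) m
  coef-fall h s m with fallHeights p h s
  ... | just hs = refl
  ... | nothing = sym (go (below m))
    where
    go : ∀ xs → sum (L.map (λ a → vN (suc h) a * 0) xs) ≡ 0
    go [] = refl
    go (a ∷ xs) = cong₂ _+_ (ℕₚ.*-zeroʳ (vN (suc h) a)) (go xs)

  Valid : ℕ → List Bool → ℕ → Set
  Valid h [] h' = h ≡ h'
  Valid h (true ∷ w) h' = Valid (h + q) w h'
  Valid zero (false ∷ w) h' = ⊥
  Valid (suc h) (false ∷ w) h' = Valid h w h'

  valid-rise : ∀ h w {h'} → Valid h w h' → Valid h (w ++ true ∷ []) (h' + q)
  valid-rise h [] refl = refl
  valid-rise h (true ∷ w) v = valid-rise (h + q) w v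
  valid-rise (suc h) (false ∷ w) v = valid-rise h w v

  valid-fall : ∀ h w {h'} → Valid h w (suc h') → Valid h (w ++ false ∷ []) h'
  valid-fall h [] refl = refl
  valid-fall h (true ∷ w) v = valid-fall (h + q) w v
  valid-fall (suc h) (false ∷ w) v = valid-fall h w v

  -- The truncated `h ∸ 1` and the value past the end are fillers: the heights matter only for valid
  -- words, up to their length.
  hgt : ℕ → List Bool → ℕ → ℕ
  hgt h w zero = h
  hgt h [] (suc i) = h
  hgt h (true ∷ w) (suc i) = hgt (h + q) w i
  hgt h (false ∷ w) (suc i) = hgt (h ∸ 1) w i

  hgt-end : ∀ h w {h'} → Valid h w h' → hgt h w (L.length w) ≡ h'
  hgt-end h [] v = v
  hgt-end h (true ∷ w) v = hgt-end (h + q) w v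
  hgt-end (suc h) (false ∷ w) v = hgt-end h w v

  hgt-follow : ∀ {X : Set} (f : X → X) (ℓ : X → ℕ) h w {h' x} → Valid h w h' →
    (∀ j → j ≤ L.length w → ℓ (iter f j x) ≡ hgt h w j) → Follow f ℓ x w
  hgt-follow f ℓ h [] v e = tt
  hgt-follow f ℓ h (true ∷ w) {x = x} v e = trans (e 1 (s≤s z≤n)) (cong (_+ q) (sym (e 0 z≤n))) ,
    hgt-follow f ℓ (h + q) w v (λ j l → trans (cong ℓ (iter-comm f j x)) (e (suc j) (s≤s l)))
  hgt-follow f ℓ (suc h) (false ∷ w) {x = x} v e = trans (e 0 z≤n) (cong suc (sym (e 1 (s≤s z≤n)))) ,
    hgt-follow f ℓ h w v (λ j l → trans (cong ℓ (iter-comm f j x)) (e (suc j) (s≤s l)))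

  follow-step : ∀ {X : Set} {f : X → X} {ℓ : X → ℕ} w {x} → Follow f ℓ x w → ∀ i → i < L.length w →
    ℓ (iter f i x) ≡ suc (ℓ (f (iter f i x))) ⊎ ℓ (f (iter f i x)) ≡ ℓ (iter f i x) + q
  follow-step (true ∷ w) (e , _) zero _ = inj₂ e
  follow-step (false ∷ w) (e , _) zero _ = inj₁ e
  follow-step {f = f} {ℓ} (true ∷ w) {x} (_ , g) (suc i) (s≤s l) =
    subst (λ z → ℓ z ≡ suc (ℓ (f z)) ⊎ ℓ (f z) ≡ ℓ z + q) (iter-comm f i x) (follow-step w g i l)
  follow-step {f = f} {ℓ} (false ∷ w) {x} (_ , g) (suc i) (s≤s l) =
    subst (λ z → ℓ z ≡ suc (ℓ (f z)) ⊎ ℓ (f z) ≡ ℓ z + q) (iter-comm f i x) (follow-step w g i l)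

  follow-labels : ∀ {X Y : Set} {f : X → X} {ℓ : X → ℕ} {g : Y → Y} {ℓ' : Y → ℕ} w {x y} → Follow f ℓ x w → Follow g ℓ' y w →
    ℓ x ≡ ℓ' y → ∀ i → i ≤ L.length w → ℓ (iter f i x) ≡ ℓ' (iter g i y)
  follow-labels w a b e zero _ = e
  follow-labels {f = f} {ℓ} {g} {ℓ'} (true ∷ w) {x} {y} (a , a') (b , b') e (suc i) (s≤s l) = subst₂ (λ u v → ℓ u ≡ ℓ' v) (iter-comm f i x) (iter-comm g i y)
    (follow-labels w a' b' (trans a (trans (cong (_+ q) e) (sym b))) i l)
  follow-labels {f = f} {ℓ} {g} {ℓ'} (false ∷ w) {x} {y} (a , a') (b , b') e (suc i) (s≤s l) = subst₂ (λ u v → ℓ u ≡ ℓ' v) (iter-comm f i x) (iter-comm g i y)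
    (follow-labels w a' b' (ℕₚ.suc-injective (trans (sym a) (trans e b))) i l)

  follow-unique : ∀ {X : Set} {f : X → X} {ℓ : X → ℕ} w w' {x} → L.length w ≡ L.length w' → Follow f ℓ x w → Follow f ℓ x w' → w ≡ w'
  follow-unique [] [] _ _ _ = refl
  follow-unique (true ∷ w) (true ∷ w') e (_ , a) (_ , b) = cong (true ∷_) (follow-unique w w' (ℕₚ.suc-injective e) a b)
  follow-unique (false ∷ w) (false ∷ w') e (_ , a) (_ , b) = cong (false ∷_) (follow-unique w w' (ℕₚ.suc-injective e) a b)
  follow-unique {f = f} {ℓ} (true ∷ w) (false ∷ w') {x} e (a , _) (b , _) = ⊥-elim (ℕₚ.m≢1+m+n (ℓ x) (trans b (cong suc a)))
  follow-unique {f = f} {ℓ} (false ∷ w) (true ∷ w') {x} e (a , _) (b , _) = ⊥-elim (ℕₚ.m≢1+m+n (ℓ x) (trans a (cong suc b)))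

  read : ∀ {X : Set} (f : X → X) (ℓ : X → ℕ) → (∀ x → ℓ x ≡ suc (ℓ (f x)) ⊎ ℓ (f x) ≡ ℓ x + q) → ∀ k x →
    ∃ λ w → L.length w ≡ k × Follow f ℓ x w
  read f ℓ st zero x = [] , refl , tt
  read f ℓ st (suc k) x with st x | read f ℓ st k (f x)
  ... | inj₁ e | w , l , g = false ∷ w , cong suc l , e , g
  ... | inj₂ e | w , l , g = true ∷ w , cong suc l , e , g

  length-snoc : ∀ (w : List Bool) b → L.length (w ++ b ∷ []) ≡ suc (L.length w)
  length-snoc w b = trans (Lₚ.length-++ w) (ℕₚ.+-comm (L.length w) 1)

  module _ {n : ℕ} {M : ℕ} {m : Vec ℕ K} where

    -- A tree has `κ` fixing all rises, so a rise that is passed adds a bare corner by itself.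
    rise-forward : ∀ {w h s} {τ : T M} → TreeW n w h (true ∷ s) m τ → TreeW n (w ++ true ∷ []) (h + q) s m τ
    rise-forward {w} {h} {s} {τ} W = record
      { std = std ; root = root ; rooted = rooted ; prof = prof ; fixed = λ i l → fx i (ℕₚ.m≤n⇒m<n∨m≡n (ℕ.s≤s⁻¹ (subst (i <_) (length-snoc w true) l)))
      ; height = trans (cong (λ k → ℓ (iter ω k zero)) (length-snoc w true)) (trans (proj₁ todo) (cong (_+ q) height))
      ; did = follow-snoc w did (proj₁ todo , tt)
      ; todo = subst (λ k → Follow ω ℓ (iter ω k zero) s) (sym (length-snoc w true)) (proj₂ todo) }
      where
      open TreeW W using (κ; ω; ℓ; x; std; root; rooted; prof; fixed; height; did; todo)
      fx : ∀ i → i < L.length w ⊎ i ≡ L.length w → κ (iter ω i zero) ≡ iter ω i zero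
      fx i (inj₁ l) = fixed i l
      fx i (inj₂ refl) = Labels.Tree.κ-fixes (IsTree.tree (proj₁ std)) x (λ e → ℕₚ.m≢1+m+n (ℓ x) (trans e (cong suc (proj₁ todo))))

    back : ∀ {w h h' b s} {τ : T M} → (W : TreeW n (w ++ b ∷ []) h s m τ) →
      lookup (proj₂ (proj₂ τ)) (iter (lookup (proj₁ (proj₂ τ))) (L.length w) zero) ≡ h' → TreeW n w h' (b ∷ s) m τ
    back {w} {h} {h'} {b} {s} {τ} W hh = record
      { std = std ; root = root ; rooted = rooted ; prof = prof
      ; fixed = λ i l → fixed i (ℕₚ.<-trans l (ℕₚ.≤-reflexive (sym (length-snoc w b)))) ; height = hh
      ; did = proj₁ fd ; todo = join b (proj₂ fd) (subst (λ k → Follow ω ℓ (iter ω k zero) s) (length-snoc w b) todo) }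
      where
      open TreeW W using (ω; ℓ; x; std; root; rooted; prof; fixed; height; did; todo)
      fd = follow-unsnoc w did
      join : ∀ b {x} → Follow ω ℓ x (b ∷ []) → Follow ω ℓ (ω x) s → Follow ω ℓ x (b ∷ s)
      join true (e , _) f = e , f
      join false (e , _) f = e , f

    rise-back : ∀ {w h s} {τ : T M} → TreeW n (w ++ true ∷ []) (h + q) s m τ → TreeW n w h (true ∷ s) m τ
    rise-back {w} {h} W = back {w} W (ℕₚ.+-cancelʳ-≡ q _ _ (trans (sym (proj₁ (proj₂ (follow-unsnoc w did)))) (trans (cong (λ k → ℓ (iter ω k zero)) (sym (length-snoc w true))) height)))
      where open TreeW W using (ω; ℓ; height; did)

    fall-back : ∀ {w h s} {τ : T M} → TreeW n (w ++ false ∷ []) h s m τ → TreeW n w (suc h) (false ∷ s) m τ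
    fall-back {w} {h} W = back {w} W (trans (proj₁ (proj₂ (follow-unsnoc w did))) (cong suc (trans (cong (λ k → ℓ (iter ω k zero)) (sym (length-snoc w false))) height)))
      where open TreeW W using (ω; ℓ; height; did)

    fall-forward : ∀ {w h s} {τ : T M} (W : TreeW n w (suc h) (false ∷ s) m τ) → TreeW.κ W (TreeW.x W) ≡ TreeW.x W → TreeW n (w ++ false ∷ []) h s m τ
    fall-forward {w} {h} {s} {τ} W e = record
      { std = std ; root = root ; rooted = rooted ; prof = prof ; fixed = λ i l → fx i (ℕₚ.m≤n⇒m<n∨m≡n (ℕ.s≤s⁻¹ (subst (i <_) (length-snoc w false) l)))
      ; height = trans (cong (λ k → ℓ (iter ω k zero)) (length-snoc w false)) (ℕₚ.suc-injective (trans (sym (proj₁ todo)) height))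
      ; did = follow-snoc w did (proj₁ todo , tt)
      ; todo = subst (λ k → Follow ω ℓ (iter ω k zero) s) (sym (length-snoc w false)) (proj₂ todo) }
      where
      open TreeW W using (κ; ω; ℓ; std; root; rooted; prof; fixed; height; did; todo)
      fx : ∀ i → i < L.length w ⊎ i ≡ L.length w → κ (iter ω i zero) ≡ iter ω i zero
      fx i (inj₁ l) = fixed i l
      fx i (inj₂ refl) = e

-- Counting trees with a given root word

module Claim (q : ℕ) (1≤q : 1 ≤ q) {K : ℕ} (n : ℕ) where
  open Trees q 1≤q using (IsTree)
  open Gluing q 1≤q using (p; T; TreeW; TreeV)
  open Glues q 1≤q using (Glue; glue-unique; module GlueFacts; pieces-unique; module Merge)
  open Splits q 1≤q using (SplitOf; split)
  open Words q 1≤q {K}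
    using (treesV; treesV-size; vN; coef; coef-rise; coef-fall; Valid; valid-rise; valid-fall; hgt;
      hgt-end; hgt-follow; follow-step; follow-labels; length-snoc; rise-forward; rise-back; fall-back;
      fall-forward)

  size-empty : ∀ {X : Set} {P : X → Set} → (∀ x → ¬ P x) → Size P 0
  size-empty h = record { rep = λ () ; repP = λ () ; sep = λ () ; cover = λ x p → ⊥-elim (h x p) }

  -- Each edge borders exactly one white face, so the white degrees, root face included, add up to
  -- the number of edges.
  edges : Vec ℕ K → ℕ
  edges m = p * (suc n + wsum m)

  -- Trees all of whose root corners are bare: the root face is everything.

  module Bare {M : ℕ} {m : Vec ℕ K} {w : List Bool} (len : L.length w ≡ suc n * p) {h : ℕ} {τ : T M}
      (W : TreeW (suc n) w h [] m τ) where
    open TreeW W using (κ; ω; ℓ; std; root; rooted; fixed; height)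
    ωP = fin-perm ω (IsTree.ω-inj (proj₁ std))

    fixed-orb : ∀ k → κ (iter ω k zero) ≡ iter ω k zero
    fixed-orb k = subst (λ z → κ z ≡ z) (sym (iter-% ω zero (q + n * p) (per-closes rooted) k))
      (fixed (k % suc (q + n * p)) (ℕₚ.<-≤-trans (m%n<n k (suc (q + n * p))) (ℕₚ.≤-reflexive (sym len))))

    rot≡ω : ∀ k → iter rot k zero ≡ iter ω k zero
    rot≡ω zero = refl
    rot≡ω (suc k) = trans (cong rot (rot≡ω k)) (trans (sym (proj₂ std _)) (fixed-orb (suc k)))

    at : ∀ z → z ≡ iter ω (toℕ z) zero
    at z = trans (sym (iter-rot-zero z)) (rot≡ω (toℕ z))

    κ-id : ∀ z → κ z ≡ z
    κ-id z = subst (λ v → κ v ≡ v) (sym (at z)) (fixed-orb (toℕ z))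

    ω-rot : ∀ z → ω z ≡ rot z
    ω-rot z = trans (sym (κ-id (ω z))) (proj₂ std z)

    full : suc M ≡ suc n * p
    full = per-unique (rot-per rot id id (λ _ → refl)) (mkPer (per-pos rooted) (trans (rot≡ω (suc n * p)) (per-closes rooted))
      (λ j e → per-div rooted j (trans (sym (rot≡ω j)) e)))

    -- The root face uses up all edges, so none is left for another face.
    profile-zero : suc M ≡ edges m → isZero m ≡ true
    profile-zero e = wsum-zero m (ℕₚ.m+n≡0⇒m≡0 (wsum m) (ℕₚ.+-cancelˡ-≡ (p * suc n) _ _
        (trans (sym (ℕₚ.*-distribˡ-+ p (suc n) (wsum m))) (trans (sym e) (trans full (trans (ℕₚ.*-comm (suc n) p) (sym (ℕₚ.+-identityʳ _))))))))

    -- A full turn around the root face comes back to the root, which has label 0.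
    height-zero : h ≡ 0
    height-zero = trans (sym height) (trans (cong ℓ (trans (cong (λ k → iter ω k zero) len) (per-closes rooted))) root)

  bare-unique : ∀ {M m w h} → L.length w ≡ suc n * p → {τ τ' : T M} → TreeW (suc n) w h [] m τ → TreeW (suc n) w h [] m τ' → τ ≡ τ'
  bare-unique {w = w} len W W' = cong₂ _,_ (vec-ext (λ z → trans (B.κ-id z) (sym (B'.κ-id z))))
    (cong₂ _,_ (vec-ext (λ z → trans (B.ω-rot z) (sym (B'.ω-rot z))))
      (vec-ext (λ z → subst₂ (λ u v → TreeW.ℓ W u ≡ TreeW.ℓ W' v) (sym (B.at z)) (sym (B'.at z))
        (follow-labels w (TreeW.did W) (TreeW.did W') (trans (TreeW.root W) (sym (TreeW.root W'))) (toℕ z)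
          (ℕₚ.<⇒≤ (ℕₚ.<-≤-trans (Finₚ.toℕ<n z) (ℕₚ.≤-reflexive (trans B.full (sym len)))))))))
    where
    module B = Bare len W using (at; κ-id; ω-rot; full)
    module B' = Bare len W' using (at; κ-id; ω-rot)

  bare-exists : ∀ {M m w} → L.length w ≡ suc n * p → suc M ≡ suc n * p → isZero m ≡ true → Valid 0 w 0 → ∃ λ τ → TreeW (suc n) {K} {M} w 0 [] m τ
  bare-exists {M} {m} {w} len e z v = (κv , ωv , ℓv) , record
      { std = record { κ-inj = λ {x} {y} q → trans (sym (κ-id x)) (trans q (κ-id y)) ; ω-inj = ω-inj ; step = step
          ; tree = record { ω-follows = λ _ → refl ; κ-label = λ x → cong (lookup ℓv) (κ-id x) ; κ-fixes = λ x _ → κ-id x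
            ; single = λ x y → orb-cong (λ z → sym (rt z)) (rot-orb x y)
            ; tree-euler = λ ca cb → cong₂ _+_
                (count-unique (record { rfl = orb-refl ; sm = λ o → orb-reflexive (sym (orb-fixed (κ-id _) o)) ; tr = orb-trans }) ca
                  (count-≗ (fin-card (suc M)) (λ _ t → t) (λ _ t → t) orb-reflexive (orb-fixed (κ-id _))))
                (count-unique (Finite.orb-isEq (fin-card (suc M)) (fin-perm (lookup ωv) ω-inj)) cb (count-one zero tt (λ y _ → orb-cong (λ z → sym (ω-rot z)) (rot-orb y zero)))) } } , rt
      ; root = ℓ-look zero
      ; rooted = subst (Per (lookup ωv) zero) e (mkPer (s≤s z≤n) (trans (it (suc M)) (per-closes rper)) (λ j q → per-div rper j (trans (sym (it j)) q)))
      ; prof = λ i → subst (Count _ _) (sym (isZero-lookup m z i)) (record { rep = λ () ; repP = λ () ; sep = λ () ; cover = λ x (_ , nx) → ⊥-elim (nx (orb-cong (λ z → sym (ω-rot z)) (rot-orb zero x))) })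
      ; fixed = λ i _ → κ-id _
      ; height = trans (heights (L.length w) ℕₚ.≤-refl) (hgt-end 0 w v)
      ; did = hgt-follow (lookup ωv) (lookup ℓv) 0 w v heights
      ; todo = tt }
    where
    κv ωv : Vec (Fin (suc M)) (suc M)
    κv = tab id
    ωv = tab rot
    ℓv : Vec ℕ (suc M)
    ℓv = tab (λ z → hgt 0 w (toℕ z))
    κ-id : ∀ x → lookup κv x ≡ x
    κ-id = look-tab id
    ω-rot : ∀ x → lookup ωv x ≡ rot x
    ω-rot = look-tab rot
    ℓ-look : ∀ x → lookup ℓv x ≡ hgt 0 w (toℕ x)
    ℓ-look = look-tab _
    rt : ∀ x → lookup κv (lookup ωv x) ≡ rot x
    rt x = trans (κ-id _) (ω-rot x)
    ω-inj : ∀ {x y} → lookup ωv x ≡ lookup ωv y → x ≡ y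
    ω-inj {x} {y} q = Perm.injective (rotation M) (trans (sym (ω-rot x)) (trans q (ω-rot y)))
    rot-orb : ∀ (x y : Fin (suc M)) → Orb rot x y
    rot-orb x y = orb-trans (Finite.orb-sym (fin-card (suc M)) (rotation M) (toℕ x , iter-rot-zero x)) (toℕ y , iter-rot-zero y)
    rper : Per rot (zero {M}) (suc M)
    rper = rot-per rot id id (λ _ → refl)
    it : ∀ k → iter (lookup ωv) k zero ≡ iter rot k zero
    it k = iter-cong ω-rot k zero
    lenM : L.length w ≡ suc M
    lenM = trans len (sym e)
    heights : ∀ j → j ≤ L.length w → lookup ℓv (iter (lookup ωv) j zero) ≡ hgt 0 w j
    heights j l = trans (cong (lookup ℓv) (it j)) (trans (ℓ-look _) (go (ℕₚ.m≤n⇒m<n∨m≡n l)))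
      where
      go : j < L.length w ⊎ j ≡ L.length w → hgt 0 w (toℕ (iter rot j zero)) ≡ hgt 0 w j
      go (inj₁ lt) = cong (hgt 0 w) (trans (toℕ-iter-rot j zero) (trans (cong (_% suc M) (ℕₚ.+-identityʳ j)) (DM.m<n⇒m%n≡m (subst (j <_) lenM lt))))
      go (inj₂ refl) = trans (cong (λ k → hgt 0 w (toℕ k)) (trans (cong (λ k → iter rot k zero) lenM) (iter-rot-full zero))) (sym (hgt-end 0 w v))
    step : ∀ x → lookup ℓv x ≡ suc (lookup ℓv (lookup ωv x)) ⊎ lookup ℓv (lookup ωv x) ≡ lookup ℓv x + q
    step x = subst (λ z → lookup ℓv z ≡ suc (lookup ℓv (lookup ωv z)) ⊎ lookup ℓv (lookup ωv z) ≡ lookup ℓv z + q) (trans (it (toℕ x)) (iter-rot-zero x))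
      (follow-step w (hgt-follow (lookup ωv) (lookup ℓv) 0 w v heights) (toℕ x) (ℕₚ.<-≤-trans (Finₚ.toℕ<n x) (ℕₚ.≤-reflexive (sym lenM))))

  -- With all corners bare the tree is a single white face, which exists exactly for a closed word
  -- and the zero exponent.
  base : ∀ w h → L.length w ≡ suc n * p → Valid 0 w h → ∀ m {M} → suc M ≡ edges m → Size (TreeW (suc n) {K} {M} w h [] m) (coef h [] m)
  base w (suc h) len v m e = size-empty (λ τ W → case (Bare.height-zero len W))
    where
    case : suc h ≡ 0 → ⊥
    case ()
  base w zero len v m {M} e with isZero m in z
  ... | true = let (τ , W) = bare-exists {M} {m} {w} len (trans e (trans (cong (λ k → p * (suc n + k)) (isZero-wsum m z)) (trans (cong (p *_) (ℕₚ.+-identityʳ (suc n))) (ℕₚ.*-comm p (suc n))))) z v in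
        count-one τ W (λ τ' W' → bare-unique len W' W)
  ... | false = size-empty (λ τ W → case (trans (sym z) (Bare.profile-zero len W e)))
    where
    case : false ≡ true → ⊥
    case ()

  -- The corner at the next fall is bare, or carries a tree.

  module FallStep (w : List Bool) (h : ℕ) (s : List Bool) (lt : L.length w < suc n * p) (m : Vec ℕ K) {M : ℕ} (eM : suc M ≡ edges m)
      (IH : ∀ m {M} → suc M ≡ edges m → Size (TreeW (suc n) {K} {M} (w ++ false ∷ []) h s m) (coef h s m)) where

    Y : Set
    Y = Σ ℕ T × Maybe (Σ ℕ T)

    -- `a` is the share of the exponent that goes to the tree at the corner. `nothing` is the term 1
    -- of `V_i`, with `a` zero; `just` is an attached tree, which has at least one white face.
    Q : Vec ℕ K → Y → Set
    Q a ((M₁ , τA) , nothing) = isZero a ≡ true × suc M₁ ≡ edges (m ⊖ a) × TreeW (suc n) (w ++ false ∷ []) h s (m ⊖ a) τA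
    Q a ((M₁ , τA) , just (M₂ , τB)) = isZero a ≡ false × (suc M₁ ≡ edges (m ⊖ a) × TreeW (suc n) (w ++ false ∷ []) h s (m ⊖ a) τA) ×
      (suc M₂ ≡ p * wsum a × TreeV (suc h) a τB)

    sizeA : ∀ a → Size {Σ ℕ T} (λ (M₁ , τA) → suc M₁ ≡ edges (m ⊖ a) × TreeW (suc n) (w ++ false ∷ []) h s (m ⊖ a) τA) (coef h s (m ⊖ a))
    sizeA a = count-map (IH (m ⊖ a) {n + wsum (m ⊖ a) + q * suc (n + wsum (m ⊖ a))} refl) (_ ,_) (λ _ W → refl , W) (λ { _ _ refl → refl })
      (λ { (M₁ , τA) (e , W) → go M₁ τA (ℕₚ.suc-injective e) W })
      where
      go : ∀ M₁ (τA : T M₁) → M₁ ≡ n + wsum (m ⊖ a) + q * suc (n + wsum (m ⊖ a)) → TreeW (suc n) (w ++ false ∷ []) h s (m ⊖ a) τA →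
        ∃ λ τ → TreeW (suc n) (w ++ false ∷ []) h s (m ⊖ a) τ × (∀ {τ'} → _ → τ ≡ τ' → (M₁ , τA) ≡ (_ , τ'))
      go _ τA refl W = τA , W , λ { _ refl → refl }

    sizeB : ∀ a → isZero a ≡ false → Size {Σ ℕ T} (λ (M₂ , τB) → suc M₂ ≡ p * wsum a × TreeV (suc h) a τB) (treesV (p * wsum a) (suc h) a)
    sizeB a z = go (p * wsum a) refl
      where
      go : ∀ E → E ≡ p * wsum a → Size {Σ ℕ T} (λ (M₂ , τB) → suc M₂ ≡ E × TreeV (suc h) a τB) (treesV E (suc h) a)
      go zero e = ⊥-elim (case (trans (sym z) (wsum-zero a (ℕₚ.m+n≡0⇒m≡0 (wsum a) (sym e)))))
        where
        case : false ≡ true → ⊥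
        case ()
      go (suc E) _ = count-map (treesV-size {suc E} {E} (suc h) a refl) (E ,_) (λ _ V → refl , V) (λ { _ _ refl → refl })
        (λ { (_ , τB) (refl , V) → τB , V , λ { _ refl → refl } })

    sizeQ : ∀ a → Size (Q a) (vN (suc h) a * coef h s (m ⊖ a))
    sizeQ a = go (isZero a) refl
      where
      absurd : ∀ {A : Set} {b} → b ≡ true → b ≡ false → A
      absurd refl ()
      go : ∀ b → isZero a ≡ b → Size (Q a) ((if b then 1 else treesV (p * wsum a) (suc h) a) * coef h s (m ⊖ a))
      go true z = subst (Size _) (sym (ℕₚ.*-identityˡ _)) (count-map (sizeA a) (_, nothing) (λ _ (e , W) → z , e , W) (λ { _ _ refl → refl })
          (λ { (A , nothing) (_ , e , W) → A , (e , W) , λ { _ refl → refl } ; (A , just B) (z' , _) → absurd z z' }))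
      go false z = count-map (size-× (sizeB a z) (sizeA a)) (λ (B , A) → A , just B) (λ _ (V , W) → z , W , V) (λ { _ _ refl → refl })
          (λ { (A , nothing) (z' , _) → absurd z' z ; (A , just B) (_ , W , V) → (B , A) , (V , W) , λ { _ refl → refl } })

    -- For a bare corner the tree stays the same and only the reading position moves; otherwise it
    -- is the gluing of the two.
    Rel : Vec ℕ K × Y → T M → Set
    Rel (a , ((M₁ , τA) , nothing)) τ = (M₁ , τA) ≡ (M , τ)
    Rel (a , ((M₁ , τA) , just (M₂ , τB))) τ = Glue τ τA τB (iter (lookup (proj₁ (proj₂ τA))) (L.length w) zero)

    Good′ : T M → Set
    Good′ = TreeW (suc n) w (suc h) (false ∷ s) m

    P : Vec ℕ K × Y → Set
    P (a , y) = a ∈ below m × Q a y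

    minus-zero : ∀ a → isZero a ≡ true → m ⊖ a ≡ m
    minus-zero a z = vec-ext (λ i → trans (lookup-⊖ m a i) (cong (lookup m i ∸_) (isZero-lookup a z i)))

    parts : ∀ a → a ∈ below m → ∀ i → lookup m i ≡ lookup (m ⊖ a) i + lookup a i
    parts a b i = trans (sym (ℕₚ.m∸n+n≡m (below-elim m a b i))) (cong (_+ lookup a i) (sym (lookup-⊖ m a i)))

    forth : ∀ x → P x → ∃ λ τ → Good′ τ × Rel x τ
    forth (a , ((M₁ , τA) , nothing)) (_ , z , e , W) = go τA (ℕₚ.suc-injective (trans e (trans (cong edges (minus-zero a z)) (sym eM)))) (subst (λ v → TreeW (suc n) (w ++ false ∷ []) h s v τA) (minus-zero a z) W)
      where
      go : ∀ {M₁} (τA : T M₁) → M₁ ≡ M → TreeW (suc n) (w ++ false ∷ []) h s m τA → ∃ λ τ → Good′ τ × (M₁ , τA) ≡ (M , τ)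
      go τA refl W = τA , fall-back {w = w} W , refl
    forth (a , ((M₁ , τA) , just (M₂ , τB))) (b , z , (e , W) , (e' , V)) = subst (λ k → ∃ λ (τ : T k) → TreeW (suc n) w (suc h) (false ∷ s) m τ × Glue τ τA τB (iter (lookup (proj₁ (proj₂ τA))) (L.length w) zero)) sz
        (Merge.result {w = w} {a = m ⊖ a} {b = a} {m = m} W V lt (parts a b))
      where
      sz : M₁ + suc M₂ ≡ M
      sz = ℕₚ.suc-injective (trans (cong₂ _+_ e e') (trans (sym (ℕₚ.*-distribˡ-+ p (suc n + wsum (m ⊖ a)) (wsum a)))
        (trans (cong (p *_) (trans (ℕₚ.+-assoc (suc n) (wsum (m ⊖ a)) (wsum a)) (cong (suc n +_) (sym (wsum-+ m (m ⊖ a) a (parts a b)))))) (sym eM))))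

    backw : ∀ τ → Good′ τ → ∃ λ x → P x × Rel x τ
    backw τ W = go (TreeW.κ W (TreeW.x W) Finₚ.≟ TreeW.x W)
      where
      zeroV : Vec ℕ K
      zeroV = V.replicate K 0
      zeroV-lookup : ∀ i → lookup zeroV i ≡ 0
      zeroV-lookup i = Vₚ.lookup-replicate i 0
      go : Dec (TreeW.κ W (TreeW.x W) ≡ TreeW.x W) → ∃ λ x → P x × Rel x τ
      go (yes e) = (zeroV , (M , τ) , nothing) , (below-intro m zeroV (λ i → subst (_≤ lookup m i) (sym (zeroV-lookup i)) z≤n) ,
            z , trans eM (cong edges (sym (minus-zero zeroV z))) , subst (λ v → TreeW (suc n) (w ++ false ∷ []) h s v τ) (sym (minus-zero zeroV z)) (fall-forward W e)) , refl
        where z = lookup-isZero zeroV zeroV-lookup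
      go (no ne) = found (split {w = w} W ne)
        where
        found : SplitOf (suc n) w h s m τ → ∃ λ x → P x × Rel x τ
        found S = (b , (M₁ , τA) , just (M₂ , τB)) , (below-intro m b (λ i → subst (lookup b i ≤_) (sym (mab i)) (ℕₚ.m≤n+m _ _)) ,
              nz , (trans eA (cong edges (sym m⊖b)) , subst (λ v → TreeW (suc n) (w ++ false ∷ []) h s v τA) (sym m⊖b) WA) , (eB , VB)) , glue
          where
          open SplitOf S using (M₁; M₂; τA; τB; a; b; WA; VB; mab; sizes; boundA; boundB; glue)
          m⊖b : m ⊖ b ≡ a
          m⊖b = vec-ext (λ i → trans (lookup-⊖ m b i) (trans (cong (_∸ lookup b i) (mab i)) (ℕₚ.m+n∸n≡m (lookup a i) (lookup b i))))
          edgesA : edges a ≡ suc n * p + p * wsum a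
          edgesA = trans (ℕₚ.*-distribˡ-+ p (suc n) (wsum a)) (cong (_+ p * wsum a) (ℕₚ.*-comm p (suc n)))
          tot : suc M₁ + suc M₂ ≡ edges a + p * wsum b
          tot = trans sizes (trans eM (trans (cong (λ k → p * (suc n + k)) (wsum-+ m a b mab))
            (trans (cong (p *_) (sym (ℕₚ.+-assoc (suc n) (wsum a) (wsum b)))) (ℕₚ.*-distribˡ-+ p (suc n + wsum a) (wsum b)))))
          leA : edges a ≤ suc M₁
          leA = ℕₚ.≤-trans (ℕₚ.≤-reflexive edgesA) boundA
          -- The two lower bounds add up to the exact total, so both are attained: neither piece
          -- hides a face outside its exponent vector.
          eA : suc M₁ ≡ edges a
          eA = ℕₚ.≤-antisym (ℕₚ.+-cancelʳ-≤ (suc M₂) _ _ (ℕₚ.≤-trans (ℕₚ.≤-reflexive tot) (ℕₚ.+-monoʳ-≤ (edges a) boundB))) leA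
          eB : suc M₂ ≡ p * wsum b
          eB = ℕₚ.+-cancelˡ-≡ (edges a) _ _ (trans (cong (_+ suc M₂) (sym eA)) tot)
          -- The attached piece contains at least its root, so it cannot be confused with the term
          -- 1.
          nz : isZero b ≡ false
          nz = ≢true (λ z → case (trans eB (trans (cong (p *_) (isZero-wsum b z)) (ℕₚ.*-zeroʳ p))))
            where
            case : suc M₂ ≡ 0 → ⊥
            case ()

    root-fixed : ∀ {M₁} {v : Vec ℕ K} {τA : T M₁} → TreeW (suc n) (w ++ false ∷ []) h s v τA →
      lookup (proj₁ τA) (iter (lookup (proj₁ (proj₂ τA))) (L.length w) zero) ≡ iter (lookup (proj₁ (proj₂ τA))) (L.length w) zero
    root-fixed W = TreeW.fixed W (L.length w) (ℕₚ.≤-reflexive (sym (length-snoc w false)))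

    -- The corner at the current fall is fixed by `κ` in the bare case and moved by it in the glued
    -- case.
    not-both : ∀ {v v' u : Vec ℕ K} {M₁ M₂} {τ : T M} {τA : T M₁} {τB : T M₂} → TreeW (suc n) (w ++ false ∷ []) h s v τ →
      TreeW (suc n) (w ++ false ∷ []) h s v' τA → TreeV (suc h) u τB → Glue τ τA τB (iter (lookup (proj₁ (proj₂ τA))) (L.length w) zero) → ⊥
    not-both {τ = τ} {τA} {τB} W WA VB G = F.κx≢x (subst (λ z → lookup (proj₁ τ) z ≡ z) (sym x≡) (root-fixed W))
      where
      module F = GlueFacts (TreeW.std WA) (TreeV.std VB) (root-fixed WA) G using (σ; σ-root; ωσ; x; κx≢x)
      x≡ : F.x ≡ iter (lookup (proj₁ (proj₂ τ))) (L.length w) zero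
      x≡ = trans (iter-map {f = lookup (proj₁ (proj₂ τA))} {g = lookup (proj₁ (proj₂ τ))} (F.σ ∘ inj₁) (λ a → F.ωσ (inj₁ a)) (L.length w) zero) (cong (iter _ (L.length w)) F.σ-root)

    zero-unique : ∀ (a a' : Vec ℕ K) → isZero a ≡ true → isZero a' ≡ true → a ≡ a'
    zero-unique a a' z z' = vec-ext (λ i → trans (isZero-lookup a z i) (sym (isZero-lookup a' z' i)))

    prof-unique : ∀ {a a' : Vec ℕ K} {i M₂} {τB : T M₂} → TreeV i a τB → TreeV i a' τB → a ≡ a'
    prof-unique {M₂ = M₂} V V' = vec-ext (λ i → count-unique (Finite.orb-isEq (fin-card (suc M₂)) (fin-perm (TreeV.ω V) (IsTree.ω-inj (proj₁ (TreeV.std V))))) (TreeV.prof V i) (TreeV.prof V' i))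

    inj : ∀ {x x' τ} → P x → P x' → Rel x τ → Rel x' τ → x ≡ x'
    inj {a , (_ , nothing)} {a' , (_ , nothing)} (_ , z , _) (_ , z' , _) refl refl = cong (_, ((_ , _) , nothing)) (zero-unique a a' z z')
    inj {a , (_ , nothing)} {a' , (_ , just _)} (_ , _ , _ , W) (_ , _ , (_ , W') , (_ , V')) refl G = ⊥-elim (not-both W W' V' G)
    inj {a , (_ , just _)} {a' , (_ , nothing)} (_ , _ , (_ , W') , (_ , V')) (_ , _ , _ , W) G refl = ⊥-elim (not-both W W' V' G)
    inj {a , ((M₁ , τA) , just (M₂ , τB))} {a' , ((M₁' , τA') , just (M₂' , τB'))} {τ} (bm , z , (e , W) , (_ , V)) (bm' , _ , (_ , W') , (_ , V')) G G' =
        fin (pieces-unique {τ = τ} {τA} {τB} {τA'} {τB'} (L.length w) refl refl κ-inj (TreeW.std W) (TreeV.std V) (TreeW.std W') (TreeV.std V') (root-fixed W) (root-fixed W') G G') V V'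
      where
      κ-inj : ∀ {x y} → lookup (proj₁ τ) x ≡ lookup (proj₁ τ) y → x ≡ y
      κ-inj = glue-κ-inj
        where
        module F = GlueFacts (TreeW.std W) (TreeV.std V) (root-fixed W) G using (σ; σσ⁻¹; σ-inj; κσ; module S)
        module TA = IsTree (proj₁ (TreeW.std W)) using (κ-inj)
        module TB = IsTree (proj₁ (TreeV.std V)) using (κ-inj)
        κX-inj : ∀ {y y'} → F.S.κX y ≡ F.S.κX y' → y ≡ y'
        κX-inj {y} {y'} e = trans (sym (F.S.swap² y)) (trans (cong F.S.swap (plus-inj (F.S.swap y) (F.S.swap y') e)) (F.S.swap² y'))
          where
          plus-inj : ∀ u v → F.S.plus (lookup (proj₁ τA)) (lookup (proj₁ τB)) u ≡ F.S.plus (lookup (proj₁ τA)) (lookup (proj₁ τB)) v → u ≡ v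
          plus-inj (inj₁ a) (inj₁ b) e = cong inj₁ (TA.κ-inj (inj₁-injective e))
          plus-inj (inj₂ a) (inj₂ b) e = cong inj₂ (TB.κ-inj (inj₂-injective e))
          plus-inj (inj₁ a) (inj₂ b) ()
          plus-inj (inj₂ a) (inj₁ b) ()
        glue-κ-inj : ∀ {x y} → lookup (proj₁ τ) x ≡ lookup (proj₁ τ) y → x ≡ y
        glue-κ-inj {x} {y} e = trans (sym (F.σσ⁻¹ x)) (trans (cong F.σ (κX-inj (F.σ-inj (trans (F.κσ _) (trans (cong (lookup (proj₁ τ)) (F.σσ⁻¹ x)) (trans e (trans (cong (lookup (proj₁ τ)) (sym (F.σσ⁻¹ y))) (sym (F.κσ _))))))))) (F.σσ⁻¹ y))
      fin : (M₁ , τA) ≡ (M₁' , τA') × (M₂ , τB) ≡ (M₂' , τB') → TreeV (suc h) a τB → TreeV (suc h) a' τB' →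
        (a , ((M₁ , τA) , just (M₂ , τB))) ≡ (a' , ((M₁' , τA') , just (M₂' , τB')))
      fin (refl , refl) V V' = cong (_, _) (prof-unique V V')

    inj' : ∀ {x} {τ τ' : T M} → Good′ τ → Good′ τ' → Rel x τ → Rel x τ' → τ ≡ τ'
    inj' {a , (_ , nothing)} _ _ refl refl = refl
    inj' {a , (_ , just _)} W W' G G' = glue-unique (TreeW.std W) (TreeW.std W') G G'

    fall-size : Size Good′ (mulN (vN (suc h)) (coef h s) m)
    fall-size = size-transport (size-sum {Q = Q} (below m) (below-unique m) (λ a _ → sizeQ a)) Rel forth backw (λ {x} {x'} {τ} → inj {x} {x'} {τ}) (λ {x} → inj' {x})

  -- Induction on the part of the root word still to be read: a rise passes with a bare corner, a
  -- fall from height `h` contributes a factor `V_h`.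
  claim : ∀ s w h → L.length w + L.length s ≡ suc n * p → Valid 0 w h → ∀ m {M} → suc M ≡ edges m →
    Size (TreeW (suc n) {K} {M} w h s m) (coef h s m)
  claim [] w h len v m e = base w h (trans (sym (ℕₚ.+-identityʳ _)) len) v m e
  claim (true ∷ s) w h len v m e = subst (Size _) (sym (coef-rise h s m))
    (count-≗ (claim s (w ++ true ∷ []) (h + q) (trans (cong (_+ L.length s) (length-snoc w true)) (trans (sym (ℕₚ.+-suc _ _)) len)) (valid-rise 0 w v) m e)
      (λ _ → rise-back {w = w}) (λ _ → rise-forward {w = w}) id id)
  -- A fall from label 0 is impossible; this is how the paths that leave the half plane drop out.
  claim (false ∷ s) w zero len v m e = size-empty (λ τ W → case (trans (sym (TreeW.height W)) (proj₁ (TreeW.todo W))))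
    where
    case : ∀ {k} → 0 ≡ suc k → ⊥
    case ()
  claim (false ∷ s) w (suc h) len v m e = subst (Size _) (sym (coef-fall h s m))
    (FallStep.fall-size w h s (subst (L.length w <_) len (subst (L.length w <_) (sym (ℕₚ.+-suc _ (L.length s))) (s≤s (ℕₚ.m≤m+n _ _)))) m e
      (λ m {M} → claim s (w ++ false ∷ []) h (trans (cong (_+ L.length s) (length-snoc w false)) (trans (sym (ℕₚ.+-suc _ _)) len)) (valid-fall 0 w v) m {M}))

-- Summation over all root words

allBools-unique : ∀ n → Unique (allBools n)
allBools-unique zero = [] ∷ []
allBools-unique (suc n) = subst Unique (sym (concatMap-product _∷_ (true ∷ false ∷ []) (allBools n)))
  (Uniqueₚ.cartesianProductWith⁺ _∷_ Lₚ.∷-injective (((λ ()) ∷ []) ∷ [] ∷ []) (allBools-unique n))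

allBools-complete : ∀ s → s ∈ allBools (L.length s)
allBools-complete [] = here refl
allBools-complete (b ∷ s) = subst (b ∷ s ∈_) (sym (concatMap-product _∷_ (true ∷ false ∷ []) (allBools (L.length s))))
  (Memₚ.∈-cartesianProductWith⁺ _∷_ (both b) (allBools-complete s))
  where
  both : ∀ b → b ∈ true ∷ false ∷ []
  both true = here refl
  both false = there (here refl)

allBools-length : ∀ n {s} → s ∈ allBools n → L.length s ≡ n
allBools-length zero (here refl) = refl
allBools-length (suc n) {s} i with Memₚ.∈-cartesianProductWith⁻ _∷_ (true ∷ false ∷ []) (allBools n) (subst (s ∈_) (concatMap-product _∷_ (true ∷ false ∷ []) (allBools n)) i)
... | b , s' , _ , i' , refl = cong suc (allBools-length n i')

module RootWords (q : ℕ) (1≤q : 1 ≤ q) {K : ℕ} where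
  open Gluing q 1≤q using (p; TreeW; mkW)
  open Words q 1≤q {K} using (coef; follow-unique; read)

  -- Every tree has exactly one root word, read along the root face from `zero`; sorting the trees
  -- by this word gives the sum.
  treeF-size : ∀ n (m : Vec ℕ K) {M} → suc M ≡ p * (suc n + wsum m) →
    Size (LabelledCounts.TreeF q 1≤q {M} m (suc n)) (sum (L.map (λ s → coef 0 s m) (allBools (suc n * p))))
  treeF-size n m {M} e = size-transport (size-sum {Q = λ s τ → TreeW (suc n) {K} {M} [] 0 s m τ} (allBools (suc n * p)) (allBools-unique (suc n * p))
      (λ s i → Claim.claim q 1≤q n s [] 0 (allBools-length (suc n * p) i) refl m e))
    (λ (s , τ) τ' → τ ≡ τ')
    (λ (s , τ) (_ , W) → τ , (TreeW.std W , TreeW.root W , TreeW.rooted W , TreeW.prof W) , refl)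
    (λ τ (std , root , rooted , prof) → let (s , l , f) = read _ _ (Trees.IsTree.step (proj₁ std)) (suc n * p) zero in
      (s , τ) , (subst (λ k → s ∈ allBools k) l (allBools-complete s) , mkW std root rooted prof (λ _ ()) root tt f) , refl)
    (λ { {s , τ} {s' , _} (i , W) (i' , W') refl refl → cong (_, τ) (follow-unique s s' (trans (allBools-length (suc n * p) i) (sym (allBools-length (suc n * p) i'))) (TreeW.todo W) (TreeW.todo W')) })
    (λ { _ _ refl refl → refl })

-- Passage to rational coefficients

ι : ℕ → ℚ
ι n = (ℤ.+ n) ℚ./ 1

ι-ᵘ : ∀ n → toℚᵘ (ι n) ℚᵘ.≃ mkℚᵘ (ℤ.+ n) 0
ι-ᵘ n = ℚₚ.toℚᵘ-fromℚᵘ (mkℚᵘ (ℤ.+ n) 0)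

ι-+ : ∀ a b → ι (a + b) ≡ ι a ℚ.+ ι b
ι-+ a b = ℚₚ.toℚᵘ-injective (begin
    toℚᵘ (ι (a + b)) ≈⟨ ι-ᵘ (a + b) ⟩
    mkℚᵘ (ℤ.+ (a + b)) 0 ≈⟨ *≡* (cong (ℤ._* (ℤ.+ 1)) (sym (trans (cong₂ ℤ._+_ (ℤₚ.*-identityʳ (ℤ.+ a)) (ℤₚ.*-identityʳ (ℤ.+ b))) refl))) ⟩
    mkℚᵘ (ℤ.+ a) 0 ℚᵘ.+ mkℚᵘ (ℤ.+ b) 0 ≈⟨ ℚᵘₚ.+-cong (ℚᵘₚ.≃-sym (ι-ᵘ a)) (ℚᵘₚ.≃-sym (ι-ᵘ b)) ⟩
    toℚᵘ (ι a) ℚᵘ.+ toℚᵘ (ι b) ≈⟨ ℚᵘₚ.≃-sym (ℚₚ.toℚᵘ-homo-+ (ι a) (ι b)) ⟩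
    toℚᵘ (ι a ℚ.+ ι b) ∎)
  where open ℚᵘₚ.≃-Reasoning

ι-* : ∀ a b → ι (a * b) ≡ ι a ℚ.* ι b
ι-* a b = ℚₚ.toℚᵘ-injective (begin
    toℚᵘ (ι (a * b)) ≈⟨ ι-ᵘ (a * b) ⟩
    mkℚᵘ (ℤ.+ (a * b)) 0 ≈⟨ *≡* (cong (ℤ._* (ℤ.+ 1)) (ℤₚ.pos-* a b)) ⟩
    mkℚᵘ (ℤ.+ a) 0 ℚᵘ.* mkℚᵘ (ℤ.+ b) 0 ≈⟨ ℚᵘₚ.*-cong (ℚᵘₚ.≃-sym (ι-ᵘ a)) (ℚᵘₚ.≃-sym (ι-ᵘ b)) ⟩
    toℚᵘ (ι a) ℚᵘ.* toℚᵘ (ι b) ≈⟨ ℚᵘₚ.≃-sym (ℚₚ.toℚᵘ-homo-* (ι a) (ι b)) ⟩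
    toℚᵘ (ι a ℚ.* ι b) ∎)
  where open ℚᵘₚ.≃-Reasoning

-- With `d = M !` this removes the labelling factor from the counts.
ι-/ : ∀ d t .{{_ : NonZero d}} → (ℤ.+ (d * t)) ℚ./ d ≡ ι t
ι-/ (suc d) t = ℚₚ.toℚᵘ-injective (ℚᵘₚ.≃-trans (ℚₚ.toℚᵘ-fromℚᵘ (mkℚᵘ (ℤ.+ (suc d * t)) d))
  (ℚᵘₚ.≃-trans (*≡* (trans (ℤₚ.*-identityʳ _) (trans (ℤₚ.pos-* (suc d) t) (ℤₚ.*-comm (ℤ.+ suc d) (ℤ.+ t))))) (ℚᵘₚ.≃-sym (ι-ᵘ t))))

sumℚ-cong : ∀ {A : Set} {f g : A → ℚ} (xs : List A) → (∀ x → f x ≡ g x) → sumℚ (L.map f xs) ≡ sumℚ (L.map g xs)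
sumℚ-cong [] h = refl
sumℚ-cong (x ∷ xs) h = cong₂ ℚ._+_ (h x) (sumℚ-cong xs h)

sumℚ-ι : ∀ {A : Set} (f : A → ℕ) (xs : List A) → sumℚ (L.map (ι ∘ f) xs) ≡ ι (sum (L.map f xs))
sumℚ-ι f [] = refl
sumℚ-ι f (x ∷ xs) = trans (cong (ι (f x) ℚ.+_) (sumℚ-ι f xs)) (sym (ι-+ (f x) _))

oneS-ι : ∀ {K} (m : Vec ℕ K) → oneS m ≡ ι (oneN m)
oneS-ι m with isZero m
... | true = refl
... | false = refl

mulS-ι : ∀ {K} {A B : Series K} {a b : Vec ℕ K → ℕ} → (∀ m → A m ≡ ι (a m)) → (∀ m → B m ≡ ι (b m)) → ∀ m → mulS A B m ≡ ι (mulN a b m)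
mulS-ι {A = A} {B} {a} {b} hA hB m = trans (sumℚ-cong (below m) (λ x → trans (cong₂ ℚ._*_ (hA x) (hB (m ⊖ x))) (sym (ι-* (a x) (b (m ⊖ x))))))
  (sumℚ-ι (λ x → a x * b (m ⊖ x)) (below m))

prodS-ι : ∀ {K} {V : ℕ → Series K} {v : ℕ → Vec ℕ K → ℕ} → (∀ i m → V i m ≡ ι (v i m)) → ∀ hs m → prodS (L.map V hs) m ≡ ι (prodN (L.map v hs) m)
prodS-ι h [] m = oneS-ι m
prodS-ι {V = V} {v} h (x ∷ hs) m = mulS-ι {A = V x} {prodS (L.map V hs)} {v x} {prodN (L.map v hs)} (h x) (prodS-ι {V = V} {v} h hs) m

module Coefficients (q : ℕ) (1≤q : 1 ≤ q) {K : ℕ} where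
  open Words q 1≤q {K} using (treesV; vN; coef)
  open Gluing q 1≤q using (p)

  Vcoef-ι : ∀ i (m : Vec ℕ K) → Vcoef p i m ≡ ι (vN i m)
  Vcoef-ι i m with isZero m
  ... | true = refl
  ... | false = go (p * wsum m)
    where
    -- The number of edges is generalised to split off the edge-free case, where both sides are 0.
    go : ∀ E → classesV p i m E ≡ ι (treesV E i m)
    go zero = refl
    go (suc M) = trans (cong (λ c → ((ℤ.+ c) ℚ./ (M !)) {{M ℕₚ.!≢0}}) (proj₂ (proj₂ (LabelledCounts.countV-trees q 1≤q {M} m i))))
      (ι-/ (M !) _ {{M ℕₚ.!≢0}})

  Fcoef-ι : ∀ n (m : Vec ℕ K) → Fcoef p (suc n) m ≡ ι (sum (L.map (λ s → coef 0 s m) (allBools (suc n * p))))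
  Fcoef-ι n m = go (p * (suc n + wsum m)) refl
    where
    -- The left side of the equation is `p * (suc n + wsum m)` unfolded to a successor, so the
    -- edge-free case does not arise.
    go : ∀ E → suc (n + wsum m + q * suc (n + wsum m)) ≡ E → classesF p (suc n) m E ≡ ι (sum (L.map (λ s → coef 0 s m) (allBools (suc n * p))))
    go (suc M) e = fin (LabelledCounts.countF-trees q 1≤q {M} m (suc n))
      where
      fin : (∃ λ t → Size (LabelledCounts.TreeF q 1≤q {M} m (suc n)) t × countF p (suc n) m M ≡ M ! * t) → _
      fin (t , sz , c) = trans (cong (λ c → ((ℤ.+ c) ℚ./ (M !)) {{M ℕₚ.!≢0}}) c) (trans (ι-/ (M !) t {{M ℕₚ.!≢0}})
        (cong ι (count-unique ≡-isEq sz (RootWords.treeF-size q 1≤q n m {M} (sym e)))))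

  -- The summand of `excursionSum` is local to that definition; stating both facts together lets it
  -- be inferred from its use.
  mutual
    excursionSum-ι : ∀ n (m : Vec ℕ K) → excursionSum p n m ≡ ι (sum (L.map (λ s → coef 0 s m) (allBools (n * p))))
    excursionSum-ι n m = trans (sumℚ-cong (allBools (n * p)) (term-ι n m)) (sumℚ-ι (λ s → coef 0 s m) (allBools (n * p)))

    term-ι : ∀ n (m : Vec ℕ K) s → _ ≡ ι (coef 0 s m)
    term-ι n m s with fallHeights p 0 s
    ... | nothing = refl
    ... | just hs = prodS-ι {V = λ i → Vcoef p i} {vN} Vcoef-ι hs m

  theorem : ∀ n (m : Vec ℕ K) → Fcoef p n m ≡ excursionSum p n m
  -- The only excursion of length 0 is the empty one, with weight 1, which agrees with `F_0 = 1`.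
  theorem zero m = trans (oneS-ι m) (trans (cong ι (sym (ℕₚ.+-identityʳ (oneN m)))) (sym (excursionSum-ι 0 m)))
  theorem (suc n) m = trans (Fcoef-ι n m) (sym (excursionSum-ι (suc n) m))

theorem2 : (p : ℕ) → 2 ≤ p → (n K : ℕ) → (m : Vec ℕ K) →
    Fcoef p n m ≡ excursionSum p n m
-- A rise climbs by `p - 1`, here `suc q`; the hypothesis `2 ≤ p` makes this positive, so that rises
-- strictly increase the label.
theorem2 (suc (suc q)) (s≤s (s≤s z≤n)) n K m = Coefficients.theorem (suc q) (s≤s z≤n) n m
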